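{- Among nonzero integers whose absolute value is a power of two (including $2^0=1$), the members of the three determinant sets are exactly: - for $S(C_{24})$: $\{ -1,1\}\cup\{\pm2^j:j\ge8\}$; - for $S(C_2\times C_{12})$: $\{1,2^8,2^{12}\}\cup\{(-2)^j:13\le j\le19\}\cup\{\pm2^j:j\ge20\}$; - for $S(C_2\times C_2\times C_6)$: $\{1,2^8,2^{12}\}\cup\{(-2)^j:14\le j\le31\}\cup\{\pm2^j:j\ge32\}$.
   Context: For a finite group $G$, $S(G)=\{\det(a_{gh^{ -1}})_{g,h\in G}:a_g\in\mathbb Z\}$ is its integer group determinant set. $C_n$ is the cyclic group of order $n$. -}

module Defs where

open import Algebra.Bundles using (Group)
import Algebra.Construct.DirectProduct as DirectProduct
open import Algebra.Definitions.RawMonoid using (sum)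
open import Data.Fin using (Fin; zero; suc; toℕ)
open import Data.Fin.Properties using (toℕ-injective; toℕ-fromℕ<; toℕ<n; toℕ≤n; *↔×)
open import Data.Integer as ℤ using (ℤ; 0ℤ; 1ℤ; -1ℤ; ∣_∣)
import Data.Integer.Properties as ℤ
open import Data.Nat as ℕ using (ℕ; zero; suc; _%_; _∸_; NonZero)
open import Data.Nat.DivMod using (_mod_; m%n<n; m<n⇒m%n≡m; m%n%n≡m%n; n%n≡0; %-distribˡ-+)
import Data.Nat.Properties as ℕ
open import Data.Product using (_×_; _,_; ∃-syntax)
open import Data.Product.Function.NonDependent.Setoid using (_×-inverse_)
open import Data.Product.Relation.Binary.Pointwise.NonDependent using (Pointwise-≡↔≡)
open import Data.Vec.Functional using (Vector; removeAt)
open import Function.Bundles using (Func; Inverse; _⟨$⟩_)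
import Function.Construct.Composition as Composition
import Function.Construct.Identity as Identity
import Function.Construct.Symmetry as Symmetry
open import Level using (0ℓ)
open import Relation.Binary.PropositionalEquality as ≡ hiding (setoid)
open import Relation.Unary using (Pred)

record FiniteGroup : Set₁ where
  field
    group       : Group 0ℓ 0ℓ
    order       : ℕ
    enumeration : Inverse (≡.setoid (Fin order)) (Group.setoid group)

  open Group group public

  element : Fin order → Carrier
  element = Inverse.to enumeration

-- Cofactor expansion along the first row.
det : ∀ {n} → Vector (Vector ℤ n) n → ℤ
det {zero}  M = 1ℤ
det {suc n} M = sum ℤ.+-0-rawMonoid λ j →
  -1ℤ ℤ.^ toℕ j ℤ.* M zero j ℤ.* det (λ i → removeAt (M (suc i)) j)

-- Rows and columns are both listed in the order of the chosen enumeration,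
-- so the determinant does not depend on that choice.
groupMatrix : (G : FiniteGroup) → let open FiniteGroup G in
              Func setoid (≡.setoid ℤ) → Vector (Vector ℤ order) order
groupMatrix G a g h = a ⟨$⟩ (element g ∙ element h ⁻¹)
  where open FiniteGroup G

S : FiniteGroup → Pred ℤ 0ℓ
S G m = ∃[ a ] det (groupMatrix G a) ≡ m

PowerOfTwo : Pred ℤ 0ℓ
PowerOfTwo m = m ≢ 0ℤ × ∃[ k ] ∣ m ∣ ≡ 2 ℕ.^ k

module _ (n : ℕ) .{{_ : NonZero n}} where

  private
    infixl 6 _⊕_
    _⊕_ : Fin n → Fin n → Fin n
    i ⊕ j = (toℕ i ℕ.+ toℕ j) mod n

    ⊖_ : Fin n → Fin n
    ⊖ i = (n ∸ toℕ i) mod n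

    toℕ-mod : ∀ k → toℕ (k mod n) ≡ k % n
    toℕ-mod k = toℕ-fromℕ< (m%n<n k n)

    toℕ-% : ∀ (i : Fin n) → toℕ i % n ≡ toℕ i
    toℕ-% i = m<n⇒m%n≡m (toℕ<n i)

    mod-≡ : ∀ k (i : Fin n) → k % n ≡ toℕ i → k mod n ≡ i
    mod-≡ k i eq = toℕ-injective (trans (toℕ-mod k) eq)

    %-+ˡ : ∀ k l → (k % n ℕ.+ l) % n ≡ (k ℕ.+ l) % n
    %-+ˡ k l = begin
      (k % n ℕ.+ l) % n             ≡⟨ %-distribˡ-+ (k % n) l n ⟩
      (k % n % n ℕ.+ l % n) % n     ≡⟨ cong (λ r → (r ℕ.+ l % n) % n) (m%n%n≡m%n k n) ⟩
      (k % n ℕ.+ l % n) % n         ≡⟨ %-distribˡ-+ k l n ⟨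
      (k ℕ.+ l) % n                 ∎
      where open ≡-Reasoning

    ⊕-comm : ∀ i j → i ⊕ j ≡ j ⊕ i
    ⊕-comm i j = cong (_mod n) (ℕ.+-comm (toℕ i) (toℕ j))

    toℕ-⊕-⊕ : ∀ i j k → toℕ (i ⊕ j ⊕ k) ≡ (toℕ i ℕ.+ toℕ j ℕ.+ toℕ k) % n
    toℕ-⊕-⊕ i j k = begin
      toℕ (i ⊕ j ⊕ k)                          ≡⟨ toℕ-mod _ ⟩
      (toℕ (i ⊕ j) ℕ.+ toℕ k) % n              ≡⟨ cong (λ r → (r ℕ.+ toℕ k) % n) (toℕ-mod _) ⟩
      ((toℕ i ℕ.+ toℕ j) % n ℕ.+ toℕ k) % n    ≡⟨ %-+ˡ (toℕ i ℕ.+ toℕ j) (toℕ k) ⟩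
      (toℕ i ℕ.+ toℕ j ℕ.+ toℕ k) % n          ∎
      where open ≡-Reasoning

    ⊕-assoc : ∀ i j k → i ⊕ j ⊕ k ≡ i ⊕ (j ⊕ k)
    ⊕-assoc i j k = trans (toℕ-injective eq) (⊕-comm (j ⊕ k) i)
      where
      open ≡-Reasoning
      eq : toℕ (i ⊕ j ⊕ k) ≡ toℕ (j ⊕ k ⊕ i)
      eq = begin
        toℕ (i ⊕ j ⊕ k)                      ≡⟨ toℕ-⊕-⊕ i j k ⟩
        (toℕ i ℕ.+ toℕ j ℕ.+ toℕ k) % n      ≡⟨ cong (_% n) (ℕ.+-assoc (toℕ i) _ _) ⟩
        (toℕ i ℕ.+ (toℕ j ℕ.+ toℕ k)) % n    ≡⟨ cong (_% n) (ℕ.+-comm (toℕ i) _) ⟩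
        (toℕ j ℕ.+ toℕ k ℕ.+ toℕ i) % n      ≡⟨ toℕ-⊕-⊕ j k i ⟨
        toℕ (j ⊕ k ⊕ i)                      ∎

    ⊕-identityˡ : ∀ i → (0 mod n) ⊕ i ≡ i
    ⊕-identityˡ i = mod-≡ _ i (begin
      (toℕ (0 mod n) ℕ.+ toℕ i) % n    ≡⟨ cong (λ r → (r ℕ.+ toℕ i) % n) (toℕ-mod 0) ⟩
      (0 % n ℕ.+ toℕ i) % n            ≡⟨ %-+ˡ 0 (toℕ i) ⟩
      toℕ i % n                        ≡⟨ toℕ-% i ⟩
      toℕ i                            ∎)
      where open ≡-Reasoning

    ⊕-inverseˡ : ∀ i → (⊖ i) ⊕ i ≡ 0 mod n
    ⊕-inverseˡ i = mod-≡ _ (0 mod n) (begin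
      (toℕ (⊖ i) ℕ.+ toℕ i) % n            ≡⟨ cong (λ r → (r ℕ.+ toℕ i) % n) (toℕ-mod _) ⟩
      ((n ∸ toℕ i) % n ℕ.+ toℕ i) % n      ≡⟨ %-+ˡ (n ∸ toℕ i) (toℕ i) ⟩
      (n ∸ toℕ i ℕ.+ toℕ i) % n            ≡⟨ cong (_% n) (ℕ.m∸n+n≡m (toℕ≤n i)) ⟩
      n % n                                ≡⟨ n%n≡0 n ⟩
      0                                    ≡⟨ m<n⇒m%n≡m (ℕ.>-nonZero⁻¹ n) ⟨
      0 % n                                ≡⟨ toℕ-mod 0 ⟨
      toℕ (0 mod n)                        ∎)
      where open ≡-Reasoning

  cyclicGroup : Group 0ℓ 0ℓ
  cyclicGroup = record
    { Carrier = Fin n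
    ; _≈_     = _≡_
    ; _∙_     = _⊕_
    ; ε       = 0 mod n
    ; _⁻¹     = ⊖_
    ; isGroup = record
      { isMonoid = record
        { isSemigroup = record
          { isMagma = record { isEquivalence = isEquivalence ; ∙-cong = cong₂ _⊕_ }
          ; assoc   = ⊕-assoc
          }
        ; identity = ⊕-identityˡ , λ i → trans (⊕-comm i _) (⊕-identityˡ i)
        }
      ; inverse = ⊕-inverseˡ , λ i → trans (⊕-comm i _) (⊕-inverseˡ i)
      ; ⁻¹-cong = cong ⊖_
      }
    }

  C : FiniteGroup
  C = record
    { group       = cyclicGroup
    ; order       = n
    ; enumeration = Identity.inverse (≡.setoid (Fin n))
    }

infixr 7 _×ᴳ_
_×ᴳ_ : FiniteGroup → FiniteGroup → FiniteGroup
G ×ᴳ H = record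
  { group       = DirectProduct.group G.group H.group
  ; order       = G.order ℕ.* H.order
  ; enumeration =
      Composition.inverse (*↔× {G.order} {H.order})
        (Composition.inverse (Symmetry.inverse Pointwise-≡↔≡)
          (G.enumeration ×-inverse H.enumeration))
  }
  where
  module G = FiniteGroup G
  module H = FiniteGroup H

{-# OPTIONS --safe #-}

-- Over ℤ[ζ₂₄] the characters diagonalise the group matrix of P × C₃, where P has order 8.
-- Its determinant is therefore D N(E), where D is the integral determinant form of P at
-- integers and E is the same form at elements of ℤ[ω], coordinatewise congruent modulo √-3,
-- and N is the norm of ℤ[ω]. If D N(E) is ± a power of two, so is each factor nⱼ of D, and
-- the norm of each factor wⱼ of E. A norm that is a power of two is a power of four, and
-- wⱼ ≡ nⱼ modulo √-3 then makes the signs depend only on the exponents and units.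
-- The factors also agree modulo 2 with one another: either all are odd and D N(E) = ±1, or
-- all are even. In the even case the halves of the factors are sums and differences of
-- integers whose parities are linked, which forces the lower bounds on the exponent; weights
-- (-2)^e added up over the factors, compared modulo 8, exclude the wrong signs below the
-- stated thresholds. Conversely, adding a constant m to all coefficients changes only the
-- factor at the trivial character, so one matrix yields all larger exponents.

module Submission where

open import Algebra.Bundles using (CommutativeMonoid; CommutativeRing)
import Algebra.Properties.Ring
import Algebra.Properties.Semiring.Mult.TCOptimised
import Algebra.Properties.Semiring.Sum
import Algebra.Solver.CommutativeMonoid as CMSolver
import Algebra.Solver.Ring
open import Algebra.Solver.Ring.AlmostCommutativeRing using (_-Raw-AlmostCommutative⟶_; fromCommutativeRing)
open import Algebra.Structures using (IsCommutativeRing)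
open import Data.Fin using (#_; Fin; _↑ʳ_; _↑ˡ_; combine; remQuot; suc; toℕ; zero)
open import Data.Fin.Permutation using (Permutation; permutation)
open import Data.Fin.Properties using (_≟_; all?; combine-remQuot; pigeonhole; remQuot-combine)
open import Data.Integer as ℤ using (-1ℤ; 0ℤ; 1ℤ; ℤ; ∣_∣)
import Data.Integer.DivMod as ℤ
import Data.Integer.Properties as ℤ
open import Data.Maybe as Maybe using (Maybe)
open import Data.Nat as ℕ using (suc; s≤s; zero; z≤n; ℕ)
open import Data.Nat.DivMod using (_%_; _/_; _mod_)
import Data.Nat.Divisibility as ℕ
open import Data.Nat.Primality using (euclidsLemma; prime?)
import Data.Nat.Properties as ℕ
open import Data.Product using (_,_; _×_; proj₁; proj₂; uncurry; ∃-syntax)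
open import Data.Product.Properties using (≡-dec)
open import Data.Sum using ([_,_]; _⊎_; inj₁; inj₂)
open import Data.Unit using (tt; ⊤)
open import Data.Vec as Vec using (Vec; []; _∷_; insertAt; lookup; map; removeAt; replicate; tabulate; zipWith)
import Data.Vec.Functional as F
open import Data.Vec.Properties using (lookup-map; lookup-replicate; lookup-zipWith; lookup∘tabulate; map-cong; map-∘; tabulate-cong; tabulate-∘; tabulate∘lookup)
open import Function using (_∘_; case_of_)
open import Function.Bundles using (Func; Inverse; _⟨$⟩_)
open import Level using (0ℓ)
open import Relation.Binary using (DecidableEquality)
open import Relation.Binary.Consequences using (dec⇒weaklyDec)
open import Relation.Binary.PropositionalEquality hiding ([_])
open import Relation.Nullary using (contradiction; no; yes; ¬_)
open import Relation.Nullary.Decidable using (_→-dec_; from-no; from-yes; ¬?)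
import Defs
open import Defs using (FiniteGroup; C; _×ᴳ_; PowerOfTwo; groupMatrix)

-- Signs are rigid because -2 is 1 modulo 3: a value `±2^e` that is a square modulo 3 must be
-- `(-2)^e`. Agreement of the factors modulo 2 improves to agreement modulo 4 for suitable products,
-- and units of ℤ[ω] that agree modulo 4 are equal (modulo 2: equal up to sign); this turns E, when
-- it is a unit, into a square for the two noncyclic groups. There the sign is open only if D and E
-- are both even, and the thresholds 20 = 8 + 12 and 32 = 12 + 20 add the least exponents of D and
-- N(E) at which the argument no longer fixes it. For C₂₄ a generator of C₈ already has determinant
-- -1, so only exponents are bounded. The weights modulo 8 come from Parseval: the sum of nⱼwⱼ over
-- the eight characters is divisible by 8, and if all wⱼ are units, the summands are one fixed unit
-- times powers of -2. Since ℤ[ζ₂₄] has no division, the group matrix is diagonalised with a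
-- character table that is invertible only up to the factor 24, which is not a zero divisor. That
-- needs multiplicativity of the determinant over an arbitrary commutative ring.

-- Commutative rings, the ring solver, quadratic extensions

module Rings where
  -- Equality is propositional, so that the laws of a quadratic extension can be proved
  -- componentwise with `cong₂ _,_`, and any context can be rewritten with `cong`.
  record PropRing : Set₁ where
    infix  8 -_
    infixl 7 _*_
    infixl 6 _+_
    field
      Carrier           : Set
      _+_ _*_           : Carrier → Carrier → Carrier
      -_                : Carrier → Carrier
      0# 1#             : Carrier
      isCommutativeRing : IsCommutativeRing _≡_ _+_ _*_ -_ 0# 1#

    commutativeRing : CommutativeRing 0ℓ 0ℓ
    commutativeRing = record { isCommutativeRing = isCommutativeRing }

    open CommutativeRing commutativeRing public
      using ( semiring; +-commutativeMonoid; *-commutativeMonoid; _-_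
            ; +-assoc; +-comm; +-identityˡ; +-identityʳ; -‿inverseˡ; -‿inverseʳ
            ; *-assoc; *-comm; *-identityˡ; *-identityʳ; distribˡ; distribʳ; zeroˡ; zeroʳ )

  module RingKit (R : PropRing) where
    open PropRing R public
    open Algebra.Properties.Ring (CommutativeRing.ring commutativeRing) public using (-‿distribˡ-*; -‿distribʳ-*; -‿involutive; -0#≈0#; -‿+-comm)
    open Algebra.Properties.Semiring.Sum semiring public
      using (sum; sum-cong-≗; ∑-distrib-+; *-distribˡ-sum; *-distribʳ-sum; sum-permute; sum-replicate-zero)
    open Algebra.Properties.Semiring.Mult.TCOptimised semiring using (×1-homo-*; ×-homo-+; 1+×)
      renaming (_×_ to _·_)

    private
      -- Integer coefficients for the ring solver: constants are normalised in ℤ, where equality is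
      -- decidable, even when the ring itself is abstract.
      ⟦_⟧ : ℤ → Carrier
      ⟦ ℤ.+ n ⟧      = n · 1#
      ⟦ ℤ.-[1+ n ] ⟧ = - (suc n · 1#)

      cancel : ∀ x a b → (x + a) + - (x + b) ≡ a + - b
      cancel x a b = begin
        (x + a) + - (x + b)      ≡⟨ cong ((x + a) +_) (sym (-‿+-comm x b)) ⟩
        (x + a) + (- x + - b)    ≡⟨ cong (_+ (- x + - b)) (+-comm x a) ⟩
        (a + x) + (- x + - b)    ≡⟨ +-assoc a x _ ⟩
        a + (x + (- x + - b))    ≡⟨ cong (a +_) (sym (+-assoc x (- x) (- b))) ⟩
        a + ((x + - x) + - b)    ≡⟨ cong (λ y → a + (y + - b)) (-‿inverseʳ x) ⟩
        a + (0# + - b)           ≡⟨ cong (a +_) (+-identityˡ _) ⟩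
        a + - b                  ∎
        where open ≡-Reasoning

      ⊖-homo : ∀ m n → ⟦ m ℤ.⊖ n ⟧ ≡ m · 1# + - (n · 1#)
      ⊖-homo m       zero    = sym (trans (cong (m · 1# +_) -0#≈0#) (+-identityʳ _))
      ⊖-homo zero    (suc n) = sym (+-identityˡ _)
      ⊖-homo (suc m) (suc n) = begin
        ⟦ suc m ℤ.⊖ suc n ⟧                     ≡⟨ cong ⟦_⟧ (ℤ.[1+m]⊖[1+n]≡m⊖n m n) ⟩
        ⟦ m ℤ.⊖ n ⟧                             ≡⟨ ⊖-homo m n ⟩
        m · 1# + - (n · 1#)                     ≡⟨ cancel 1# _ _ ⟨
        (1# + m · 1#) + - (1# + n · 1#)         ≡⟨ cong₂ (λ a b → a + - b) (1+× m 1#) (1+× n 1#) ⟨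
        suc m · 1# + - (suc n · 1#)             ∎
        where open ≡-Reasoning

      -‿homo : ∀ x → ⟦ ℤ.- x ⟧ ≡ - ⟦ x ⟧
      -‿homo (ℤ.+ zero)   = sym -0#≈0#
      -‿homo (ℤ.+ suc n)  = refl
      -‿homo ℤ.-[1+ n ]   = sym (-‿involutive _)

      +-homo : ∀ x y → ⟦ x ℤ.+ y ⟧ ≡ ⟦ x ⟧ + ⟦ y ⟧
      +-homo (ℤ.+ m)      (ℤ.+ n)      = ×-homo-+ 1# m n
      +-homo (ℤ.+ m)      (ℤ.-[1+ n ]) = ⊖-homo m (suc n)
      +-homo (ℤ.-[1+ m ]) (ℤ.+ n)      = trans (⊖-homo n (suc m)) (+-comm _ _)
      +-homo (ℤ.-[1+ m ]) (ℤ.-[1+ n ]) = begin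
        - (suc (suc (m ℕ.+ n)) · 1#)       ≡⟨ cong (λ k → - (suc k · 1#)) (+-suc m n) ⟨
        - ((suc m ℕ.+ suc n) · 1#)         ≡⟨ cong -_ (×-homo-+ 1# (suc m) (suc n)) ⟩
        - (suc m · 1# + suc n · 1#)        ≡⟨ -‿+-comm _ _ ⟨
        - (suc m · 1#) + - (suc n · 1#)    ∎
        where
        open ≡-Reasoning
        open import Data.Nat.Properties using (+-suc)

      *-homo⁺ : ∀ m y → ⟦ ℤ.+ m ℤ.* y ⟧ ≡ ⟦ ℤ.+ m ⟧ * ⟦ y ⟧
      *-homo⁺ m (ℤ.+ n) = trans (cong ⟦_⟧ (sym (ℤ.pos-* m n))) (×1-homo-* m n)
      *-homo⁺ m (ℤ.-[1+ n ]) = begin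
        ⟦ ℤ.+ m ℤ.* ℤ.- (ℤ.+ suc n) ⟧      ≡⟨ cong ⟦_⟧ (ℤ.neg-distribʳ-* (ℤ.+ m) (ℤ.+ suc n)) ⟨
        ⟦ ℤ.- (ℤ.+ m ℤ.* ℤ.+ suc n) ⟧      ≡⟨ -‿homo (ℤ.+ m ℤ.* ℤ.+ suc n) ⟩
        - ⟦ ℤ.+ m ℤ.* ℤ.+ suc n ⟧          ≡⟨ cong -_ (*-homo⁺ m (ℤ.+ suc n)) ⟩
        - (⟦ ℤ.+ m ⟧ * ⟦ ℤ.+ suc n ⟧)      ≡⟨ -‿distribʳ-* _ _ ⟩
        ⟦ ℤ.+ m ⟧ * - ⟦ ℤ.+ suc n ⟧        ∎
        where open ≡-Reasoning

      *-homo : ∀ x y → ⟦ x ℤ.* y ⟧ ≡ ⟦ x ⟧ * ⟦ y ⟧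
      *-homo (ℤ.+ m)      y = *-homo⁺ m y
      *-homo (ℤ.-[1+ m ]) y = begin
        ⟦ ℤ.- (ℤ.+ suc m) ℤ.* y ⟧        ≡⟨ cong ⟦_⟧ (ℤ.neg-distribˡ-* (ℤ.+ suc m) y) ⟨
        ⟦ ℤ.- (ℤ.+ suc m ℤ.* y) ⟧        ≡⟨ -‿homo (ℤ.+ suc m ℤ.* y) ⟩
        - ⟦ ℤ.+ suc m ℤ.* y ⟧            ≡⟨ cong -_ (*-homo⁺ (suc m) y) ⟩
        - (⟦ ℤ.+ suc m ⟧ * ⟦ y ⟧)        ≡⟨ -‿distribˡ-* _ _ ⟩
        - ⟦ ℤ.+ suc m ⟧ * ⟦ y ⟧          ∎
        where open ≡-Reasoning

      morphism : CommutativeRing.rawRing ℤ.+-*-commutativeRing -Raw-AlmostCommutative⟶ fromCommutativeRing commutativeRing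
      morphism = record
        { ⟦_⟧    = ⟦_⟧
        ; +-homo = +-homo
        ; *-homo = *-homo
        ; -‿homo = -‿homo
        ; 0-homo = refl
        ; 1-homo = refl
        }

    open Algebra.Solver.Ring _ _ morphism (λ x y → Maybe.map (cong ⟦_⟧) (dec⇒weaklyDec ℤ._≟_ x y)) public
      using (solve; con; _:+_; _:*_; :-_; _:-_; _:=_; Polynomial)

  ℤ-ring : PropRing
  ℤ-ring = record { isCommutativeRing = ℤ.+-*-isCommutativeRing }

  -- The ring R[θ]/(θ² - pθ - q), with (a , b) standing for a + bθ.
  module Quadratic (R : PropRing) (p q : PropRing.Carrier R) where
    open RingKit R

    private
      A : Set
      A = Carrier × Carrier

      add mul : A → A → A
      add (a , b) (c , d) = a + c , b + d
      mul (a , b) (c , d) = a * c + q * (b * d) , a * d + b * c + p * (b * d)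

      neg : A → A
      neg (a , b) = - a , - b

      mul-comm : ∀ x y → mul x y ≡ mul y x
      mul-comm (a , b) (c , d) = cong₂ _,_
        (solve 5 (λ a b c d q → a :* c :+ q :* (b :* d) := c :* a :+ q :* (d :* b)) refl a b c d q)
        (solve 5 (λ a b c d p → a :* d :+ b :* c :+ p :* (b :* d) := c :* b :+ d :* a :+ p :* (d :* b)) refl a b c d p)

      mul-assoc : ∀ x y z → mul (mul x y) z ≡ mul x (mul y z)
      mul-assoc (a , b) (c , d) (e , f) = cong₂ _,_
        (solve 8 (λ a b c d e f p q →
            (a :* c :+ q :* (b :* d)) :* e :+ q :* ((a :* d :+ b :* c :+ p :* (b :* d)) :* f)
         := a :* (c :* e :+ q :* (d :* f)) :+ q :* (b :* (c :* f :+ d :* e :+ p :* (d :* f)))) refl a b c d e f p q)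
        (solve 8 (λ a b c d e f p q →
            (a :* c :+ q :* (b :* d)) :* f :+ (a :* d :+ b :* c :+ p :* (b :* d)) :* e
              :+ p :* ((a :* d :+ b :* c :+ p :* (b :* d)) :* f)
         := a :* (c :* f :+ d :* e :+ p :* (d :* f)) :+ b :* (c :* e :+ q :* (d :* f))
              :+ p :* (b :* (c :* f :+ d :* e :+ p :* (d :* f)))) refl a b c d e f p q)

      mul-identityˡ : ∀ x → mul (1# , 0#) x ≡ x
      mul-identityˡ (a , b) = cong₂ _,_
        (solve 3 (λ a b q → con 1ℤ :* a :+ q :* (con 0ℤ :* b) := a) refl a b q)
        (solve 3 (λ a b p → con 1ℤ :* b :+ con 0ℤ :* a :+ p :* (con 0ℤ :* b) := b) refl a b p)

      mul-distribˡ : ∀ x y z → mul x (add y z) ≡ add (mul x y) (mul x z)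
      mul-distribˡ (a , b) (c , d) (e , f) = cong₂ _,_
        (solve 7 (λ a b c d e f q → a :* (c :+ e) :+ q :* (b :* (d :+ f))
          := a :* c :+ q :* (b :* d) :+ (a :* e :+ q :* (b :* f))) refl a b c d e f q)
        (solve 7 (λ a b c d e f p → a :* (d :+ f) :+ b :* (c :+ e) :+ p :* (b :* (d :+ f))
          := a :* d :+ b :* c :+ p :* (b :* d) :+ (a :* f :+ b :* e :+ p :* (b :* f))) refl a b c d e f p)

    extension : PropRing
    extension = record
      { Carrier = A ; _+_ = add ; _*_ = mul ; -_ = neg ; 0# = 0# , 0# ; 1# = 1# , 0#
      ; isCommutativeRing = record
        { isRing = record
          { +-isAbelianGroup = record
            { isGroup = record
              { isMonoid = record
                { isSemigroup = record
                  { isMagma = record { isEquivalence = isEquivalence ; ∙-cong = cong₂ add }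
                  ; assoc = λ (a , b) (c , d) (e , f) → cong₂ _,_ (+-assoc a c e) (+-assoc b d f)
                  }
                ; identity = (λ (a , b) → cong₂ _,_ (+-identityˡ a) (+-identityˡ b))
                           , (λ (a , b) → cong₂ _,_ (+-identityʳ a) (+-identityʳ b))
                }
              ; inverse = (λ (a , b) → cong₂ _,_ (-‿inverseˡ a) (-‿inverseˡ b))
                        , (λ (a , b) → cong₂ _,_ (-‿inverseʳ a) (-‿inverseʳ b))
              ; ⁻¹-cong = cong neg
              }
            ; comm = λ (a , b) (c , d) → cong₂ _,_ (+-comm a c) (+-comm b d)
            }
          ; *-cong = cong₂ mul
          ; *-assoc = mul-assoc
          ; *-identity = mul-identityˡ , λ x → trans (mul-comm x _) (mul-identityˡ x)
          ; distrib = mul-distribˡ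
                    , λ x y z → trans (mul-comm (add y z) x)
                        (trans (mul-distribˡ x y z) (cong₂ add (mul-comm x y) (mul-comm x z)))
          }
        ; *-comm = mul-comm
        }
      }

open Rings

-- Determinants as alternating multilinear forms

module Determinants where
  module Determinant (R : PropRing) where
    open RingKit R
    open ≡-Reasoning

    Row : ℕ → Set
    Row = Vec Carrier

    Matrix : ℕ → ℕ → Set
    Matrix m n = Vec (Row n) m

    infixl 6 _⊹_
    infixr 7 _⊙_

    _⊹_ : ∀ {n} → Row n → Row n → Row n
    _⊹_ = zipWith _+_

    _⊙_ : ∀ {n} → Carrier → Row n → Row n
    c ⊙ v = map (c *_) v

    𝟎 : ∀ {n} → Row n
    𝟎 = replicate _ 0#

    unit : ∀ {n} → Fin n → Row n
    unit zero    = 1# ∷ 𝟎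
    unit (suc j) = 0# ∷ unit j

    unit-diagonal : ∀ {n} (j : Fin n) → lookup (unit j) j ≡ 1#
    unit-diagonal zero    = refl
    unit-diagonal (suc j) = unit-diagonal j

    unit-off-diagonal : ∀ {n} (j k : Fin n) → j ≢ k → lookup (unit j) k ≡ 0#
    unit-off-diagonal zero    zero    j≢k = contradiction refl j≢k
    unit-off-diagonal zero    (suc k) j≢k = lookup-replicate k 0#
    unit-off-diagonal (suc j) zero    j≢k = refl
    unit-off-diagonal (suc j) (suc k) j≢k = unit-off-diagonal j k (j≢k ∘ cong suc)

    I : ∀ n → Matrix n n
    I n = tabulate unit

    sgn : ∀ {n} → Fin n → Carrier
    sgn zero    = 1#
    sgn (suc j) = - sgn j

    minor : ∀ {m n} → Fin (suc n) → Matrix m (suc n) → Matrix m n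
    minor j = map (λ r → removeAt r j)

    det : ∀ {n} → Matrix n n → Carrier
    det {zero}  []      = 1#
    det {suc n} (r ∷ M) = sum λ j → sgn j * lookup r j * det (minor j M)

    𝟎-⊹ : ∀ {n} c (v : Row n) → 𝟎 ⊹ c ⊙ v ≡ c ⊙ v
    𝟎-⊹ c []      = refl
    𝟎-⊹ c (x ∷ v) = cong₂ _∷_ (+-identityˡ _) (𝟎-⊹ c v)

    ⊹-𝟎 : ∀ {n} c (v : Row n) → v ⊹ c ⊙ 𝟎 ≡ v
    ⊹-𝟎 c []      = refl
    ⊹-𝟎 c (x ∷ v) = cong₂ _∷_ (solve 2 (λ x c → x :+ c :* con 0ℤ := x) refl x c) (⊹-𝟎 c v)

    -- Every functional used here is affine-linear in this sense, which includes L 𝟎 ≡ 0#.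
    Linear : ∀ {n} → (Row n → Carrier) → Set
    Linear L = ∀ u c v → L (u ⊹ c ⊙ v) ≡ L u + c * L v

    Linear⇒𝟎 : ∀ {n} {L : Row n → Carrier} → Linear L → L 𝟎 ≡ 0#
    Linear⇒𝟎 {L = L} lin = begin
      L 𝟎                              ≡⟨ solve 1 (λ x → x := (x :+ con 1ℤ :* x) :- x) refl (L 𝟎) ⟩
      (L 𝟎 + 1# * L 𝟎) + - L 𝟎         ≡⟨ cong (λ y → y + - L 𝟎) (lin 𝟎 1# 𝟎) ⟨
      L (𝟎 ⊹ 1# ⊙ 𝟎) + - L 𝟎           ≡⟨ cong (λ y → L y + - L 𝟎) (⊹-𝟎 1# 𝟎) ⟩
      L 𝟎 + - L 𝟎                      ≡⟨ -‿inverseʳ _ ⟩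
      0#                               ∎

    Linear-⊙ : ∀ {n} {L : Row n → Carrier} → Linear L → ∀ c v → L (c ⊙ v) ≡ c * L v
    Linear-⊙ {L = L} lin c v = begin
      L (c ⊙ v)          ≡⟨ cong L (𝟎-⊹ c v) ⟨
      L (𝟎 ⊹ c ⊙ v)      ≡⟨ lin 𝟎 c v ⟩
      L 𝟎 + c * L v      ≡⟨ cong (λ y → y + c * L v) (Linear⇒𝟎 lin) ⟩
      0# + c * L v       ≡⟨ +-identityˡ _ ⟩
      c * L v            ∎

    Linear-expand : ∀ {n} {L : Row n → Carrier} → Linear L →
                    ∀ v → L v ≡ sum λ j → lookup v j * L (unit j)
    Linear-expand lin []      = Linear⇒𝟎 lin
    Linear-expand {L = L} lin (x ∷ v) = begin
      L (x ∷ v)                                    ≡⟨ cong L (cong₂ _∷_ (solve 1 (λ x → con 0ℤ :+ x :* con 1ℤ := x) refl x) (⊹-𝟎 x v)) ⟨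
      L ((0# ∷ v) ⊹ x ⊙ unit zero)                 ≡⟨ lin _ x _ ⟩
      L (0# ∷ v) + x * L (unit zero)               ≡⟨ +-comm _ _ ⟩
      x * L (unit zero) + L (0# ∷ v)               ≡⟨ cong (λ y → x * L (unit zero) + y) (Linear-expand tail-linear v) ⟩
      x * L (unit zero) + sum (λ j → lookup v j * L (0# ∷ unit j)) ∎
      where
      tail-linear : Linear (λ w → L (0# ∷ w))
      tail-linear u c w = trans
        (cong (λ y → L (y ∷ (u ⊹ c ⊙ w))) (solve 1 (λ c → con 0ℤ := con 0ℤ :+ c :* con 0ℤ) refl c))
        (lin (0# ∷ u) c (0# ∷ w))

    Multilinear : ∀ m {n} → (Matrix m n → Carrier) → Set
    Multilinear zero    F = ⊤
    Multilinear (suc m) F = (∀ M → Linear (λ u → F (u ∷ M))) × (∀ u → Multilinear m (λ M → F (u ∷ M)))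

    -- Only adjacent equal rows are asked to annihilate the form, which suits recursion on the rows;
    -- `swap-rows` and `repeated-row` extend this to rows at any distance.
    Alternating : ∀ m {n} → (Matrix m n → Carrier) → Set
    Alternating zero          F = ⊤
    Alternating (suc zero)    F = ⊤
    Alternating (suc (suc m)) F = (∀ u M → F (u ∷ u ∷ M) ≡ 0#) × (∀ u → Alternating (suc m) (λ M → F (u ∷ M)))

    Alternating-tail : ∀ m {n} {F : Matrix (suc m) n → Carrier} → Alternating (suc m) F →
                       ∀ u → Alternating m (λ M → F (u ∷ M))
    Alternating-tail zero    alt u = tt
    Alternating-tail (suc m) alt u = proj₂ alt u

    RowLinear : ∀ {n n′} → (Row n → Row n′) → Set
    RowLinear φ = ∀ u c v → φ (u ⊹ c ⊙ v) ≡ φ u ⊹ c ⊙ φ v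

    Multilinear-map : ∀ m {n n′} {F : Matrix m n′ → Carrier} {φ : Row n → Row n′} → RowLinear φ →
                      Multilinear m F → Multilinear m (F ∘ map φ)
    Multilinear-map zero    lin ml = tt
    Multilinear-map (suc m) {F = F} {φ} lin ml =
        (λ M u c v → trans (cong (λ r → F (r ∷ map φ M)) (lin u c v)) (proj₁ ml (map φ M) (φ u) c (φ v)))
      , (λ u → Multilinear-map m lin (proj₂ ml (φ u)))

    Alternating-map : ∀ m {n n′} {F : Matrix m n′ → Carrier} (φ : Row n → Row n′) →
                      Alternating m F → Alternating m (F ∘ map φ)
    Alternating-map zero          φ alt = tt
    Alternating-map (suc zero)    φ alt = tt
    Alternating-map (suc (suc m)) φ alt =
      (λ u M → proj₁ alt (φ u) (map φ M)) , (λ u → Alternating-map (suc m) φ (proj₂ alt (φ u)))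

    Multilinear-sum : ∀ m {n k} {F : Fin k → Matrix m n → Carrier} (c : Fin k → Carrier) →
                      (∀ j → Multilinear m (F j)) → Multilinear m (λ M → sum λ j → c j * F j M)
    Multilinear-sum zero    c ml = tt
    Multilinear-sum (suc m) {F = F} c ml = lin , λ u → Multilinear-sum m c (λ j → proj₂ (ml j) u)
      where
      lin : ∀ M → Linear (λ u → sum λ j → c j * F j (u ∷ M))
      lin M u x v = begin
        sum (λ j → c j * F j ((u ⊹ x ⊙ v) ∷ M))
          ≡⟨ sum-cong-≗ (λ j → trans (cong (λ y → c j * y) (proj₁ (ml j) M u x v))
               (solve 4 (λ c a x b → c :* (a :+ x :* b) := c :* a :+ x :* (c :* b)) refl (c j) (F j (u ∷ M)) x (F j (v ∷ M)))) ⟩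
        sum (λ j → c j * F j (u ∷ M) + x * (c j * F j (v ∷ M)))
          ≡⟨ ∑-distrib-+ (λ j → c j * F j (u ∷ M)) (λ j → x * (c j * F j (v ∷ M))) ⟩
        sum (λ j → c j * F j (u ∷ M)) + sum (λ j → x * (c j * F j (v ∷ M)))
          ≡⟨ cong (λ y → sum (λ j → c j * F j (u ∷ M)) + y) (sym (*-distribˡ-sum x (λ j → c j * F j (v ∷ M)))) ⟩
        sum (λ j → c j * F j (u ∷ M)) + x * sum (λ j → c j * F j (v ∷ M))
          ∎

    sum-0 : ∀ {k} {f : Fin k → Carrier} → (∀ j → f j ≡ 0#) → sum f ≡ 0#
    sum-0 {k} f≡0 = trans (sum-cong-≗ f≡0) (sum-replicate-zero k)

    Alternating-sum : ∀ m {n k} {F : Fin k → Matrix m n → Carrier} (c : Fin k → Carrier) →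
                      (∀ j → Alternating m (F j)) → Alternating m (λ M → sum λ j → c j * F j M)
    Alternating-sum zero          c alt = tt
    Alternating-sum (suc zero)    c alt = tt
    Alternating-sum (suc (suc m)) c alt =
        (λ u M → sum-0 (λ j → trans (cong (λ y → c j * y) (proj₁ (alt j) u M)) (zeroʳ _)))
      , (λ u → Alternating-sum (suc m) c (λ j → proj₂ (alt j) u))

    removeAt-linear : ∀ {n} (j : Fin (suc n)) → RowLinear (λ r → removeAt r j)
    removeAt-linear zero    (x ∷ u)     c (y ∷ v)     = refl
    removeAt-linear (suc j) (x ∷ u@(_ ∷ _)) c (y ∷ v@(_ ∷ _)) = cong (_ ∷_) (removeAt-linear j u c v)

    det-multilinear : ∀ n → Multilinear n (det {n})
    det-multilinear zero    = tt
    det-multilinear (suc n) = first , λ u → Multilinear-sum n (λ j → sgn j * lookup u j)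
                                              (λ j → Multilinear-map n (removeAt-linear j) (det-multilinear n))
      where
      first : ∀ M → Linear (λ u → det (u ∷ M))
      first M u c v = begin
        sum (λ j → sgn j * lookup (u ⊹ c ⊙ v) j * det (minor j M))
          ≡⟨ sum-cong-≗ (λ j → trans
               (cong (λ y → sgn j * y * det (minor j M)) (trans (lookup-zipWith _+_ j u (c ⊙ v)) (cong (λ y → lookup u j + y) (lookup-map j (c *_) v))))
               (solve 5 (λ s a c b d → s :* (a :+ c :* b) :* d := s :* a :* d :+ c :* (s :* b :* d)) refl
                 (sgn j) (lookup u j) c (lookup v j) (det (minor j M)))) ⟩
        sum (λ j → sgn j * lookup u j * det (minor j M) + c * (sgn j * lookup v j * det (minor j M)))
          ≡⟨ ∑-distrib-+ (λ j → sgn j * lookup u j * det (minor j M)) (λ j → c * (sgn j * lookup v j * det (minor j M))) ⟩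
        det (u ∷ M) + sum (λ j → c * (sgn j * lookup v j * det (minor j M)))
          ≡⟨ cong (λ y → det (u ∷ M) + y) (sym (*-distribˡ-sum c (λ j → sgn j * lookup v j * det (minor j M)))) ⟩
        det (u ∷ M) + c * det (v ∷ M)
          ∎

    -- Deleting column j and then column k deletes the same two columns as deleting
    -- column (swap₁ j k) and then column (swap₂ j k), in the other order.
    swap₁ : ∀ {n} → Fin (suc n) → Fin n → Fin (suc n)
    swap₁ zero    k       = suc k
    swap₁ (suc j) zero    = zero
    swap₁ (suc j) (suc k) = suc (swap₁ j k)

    swap₂ : ∀ {n} → Fin (suc n) → Fin n → Fin n
    swap₂ {suc n} zero    k       = zero
    swap₂ (suc j) zero    = j
    swap₂ (suc j) (suc k) = suc (swap₂ j k)

    module _ {A : Set} where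
      removeAt-∷ : ∀ {n} x (v : Vec A (suc n)) k → removeAt (x ∷ v) (suc k) ≡ x ∷ removeAt v k
      removeAt-∷ x (_ ∷ _) k = refl

      removeAt-swap : ∀ {n} (v : Vec A (suc (suc n))) j k →
                      removeAt (removeAt v j) k ≡ removeAt (removeAt v (swap₁ j k)) (swap₂ j k)
      removeAt-swap (x ∷ y ∷ v)     zero    k       = refl
      removeAt-swap (x ∷ y ∷ v)     (suc j) zero    = refl
      removeAt-swap (x ∷ y ∷ z ∷ v) (suc j) (suc k) =
        trans (removeAt-∷ x (removeAt (y ∷ z ∷ v) j) k)
          (trans (cong (x ∷_) (removeAt-swap (y ∷ z ∷ v) j k))
            (sym (removeAt-∷ x (removeAt (y ∷ z ∷ v) (swap₁ j k)) (swap₂ j k))))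

      lookup-swap₁ : ∀ {n} (v : Vec A (suc n)) j k → lookup v (swap₁ j k) ≡ lookup (removeAt v j) k
      lookup-swap₁ (x ∷ y ∷ v) zero    k       = refl
      lookup-swap₁ (x ∷ y ∷ v) (suc j) zero    = refl
      lookup-swap₁ (x ∷ y ∷ v) (suc j) (suc k) = lookup-swap₁ (y ∷ v) j k

      lookup-swap₂ : ∀ {n} (v : Vec A (suc n)) j k → lookup (removeAt v (swap₁ j k)) (swap₂ j k) ≡ lookup v j
      lookup-swap₂ (x ∷ y ∷ v) zero    k       = refl
      lookup-swap₂ (x ∷ y ∷ v) (suc j) zero    = refl
      lookup-swap₂ (x ∷ y ∷ v) (suc j) (suc k) = lookup-swap₂ (y ∷ v) j k

    -- The terms run over ordered pairs of distinct columns; exchanging the two deletions flips the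
    -- sign and keeps `G`. The induction peels off column zero: the terms that delete it first
    -- cancel those that delete it second, and the other pairs form the same sum one size smaller.
    sum-swap-0 : ∀ n (G : Fin (suc n) → Fin n → Carrier) → (∀ j k → G j k ≡ G (swap₁ j k) (swap₂ j k)) →
                 sum (λ j → sgn j * sum λ k → sgn k * G j k) ≡ 0#
    sum-swap-0 zero    G sym-G = trans (+-identityʳ _) (zeroʳ 1#)
    sum-swap-0 (suc n) G sym-G = begin
      1# * sum G₀ + sum (λ j → - sgn j * (1# * G (suc j) zero + sum λ k → - sgn k * G (suc j) (suc k)))
        ≡⟨ cong (λ y → 1# * sum G₀ + y) (trans (sum-cong-≗ step)
             (∑-distrib-+ (λ j → - 1# * G₀ j) (λ j → sgn j * sum λ k → sgn k * G (suc j) (suc k)))) ⟩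
      1# * sum G₀ + (sum (λ j → - 1# * G₀ j) + sum (λ j → sgn j * sum λ k → sgn k * G (suc j) (suc k)))
        ≡⟨ cong₂ (λ y z → 1# * sum G₀ + (y + z)) (sym (*-distribˡ-sum (- 1#) G₀))
             (sum-swap-0 n (λ j k → G (suc j) (suc k)) (λ j k → sym-G (suc j) (suc k))) ⟩
      1# * sum G₀ + (- 1# * sum G₀ + 0#)
        ≡⟨ solve 1 (λ x → con 1ℤ :* x :+ (:- con 1ℤ :* x :+ con 0ℤ) := con 0ℤ) refl (sum G₀) ⟩
      0# ∎
      where
      G₀ : Fin (suc n) → Carrier
      G₀ k = sgn k * G zero k

      step : ∀ j → - sgn j * (1# * G (suc j) zero + sum (λ k → - sgn k * G (suc j) (suc k)))
                   ≡ - 1# * G₀ j + sgn j * sum (λ k → sgn k * G (suc j) (suc k))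
      step j = begin
        - sgn j * (1# * G (suc j) zero + sum (λ k → - sgn k * G (suc j) (suc k)))
          ≡⟨ cong₂ (λ y z → - sgn j * (1# * y + z)) (sym (sym-G zero j)) neg-sum ⟩
        - sgn j * (1# * G zero j + - 1# * sum (λ k → sgn k * G (suc j) (suc k)))
          ≡⟨ solve 3 (λ s g t → :- s :* (con 1ℤ :* g :+ :- con 1ℤ :* t) := :- con 1ℤ :* (s :* g) :+ s :* t) refl
               (sgn j) (G zero j) (sum (λ k → sgn k * G (suc j) (suc k))) ⟩
        - 1# * G₀ j + sgn j * sum (λ k → sgn k * G (suc j) (suc k)) ∎
        where
        neg-sum : sum (λ k → - sgn k * G (suc j) (suc k)) ≡ - 1# * sum (λ k → sgn k * G (suc j) (suc k))
        neg-sum = trans (sum-cong-≗ (λ k → solve 2 (λ s g → :- s :* g := :- con 1ℤ :* (s :* g)) refl (sgn k) (G (suc j) (suc k))))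
                        (sym (*-distribˡ-sum (- 1#) (λ k → sgn k * G (suc j) (suc k))))

    -- Expansion along both equal rows gives a weight that is symmetric in the two deleted columns,
    -- so `sum-swap-0` applies.
    det-equal-rows : ∀ {n} (u : Row (suc (suc n))) M → det (u ∷ u ∷ M) ≡ 0#
    det-equal-rows {n} u M = begin
      sum (λ j → sgn j * lookup u j * sum (λ k → sgn k * lookup (removeAt u j) k * D j k))
        ≡⟨ sum-cong-≗ (λ j → trans (*-assoc _ _ _) (cong (λ y → sgn j * y) (trans
             (*-distribˡ-sum (lookup u j) (λ k → sgn k * lookup (removeAt u j) k * D j k))
             (sum-cong-≗ (λ k → solve 4 (λ a s b d → a :* (s :* b :* d) := s :* (a :* b :* d)) refl
               (lookup u j) (sgn k) (lookup (removeAt u j) k) (D j k)))))) ⟩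
      sum (λ j → sgn j * sum (λ k → sgn k * G j k))
        ≡⟨ sum-swap-0 (suc n) G sym-G ⟩
      0# ∎
      where
      D : Fin (suc (suc n)) → Fin (suc n) → Carrier
      D j k = det (minor k (minor j M))

      G : Fin (suc (suc n)) → Fin (suc n) → Carrier
      G j k = lookup u j * lookup (removeAt u j) k * D j k

      sym-G : ∀ j k → G j k ≡ G (swap₁ j k) (swap₂ j k)
      sym-G j k = cong₂ _*_
        (trans (*-comm _ _) (cong₂ _*_ (sym (lookup-swap₁ u j k)) (sym (lookup-swap₂ u j k))))
        (cong det (trans (sym (map-∘ _ _ M)) (trans (map-cong (λ r → removeAt-swap r j k) M) (map-∘ _ _ M))))

    det-alternating : ∀ n → Alternating n (det {n})
    det-alternating zero          = tt
    det-alternating (suc zero)    = tt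
    det-alternating (suc (suc n)) = det-equal-rows , λ u →
      Alternating-sum (suc n) (λ j → sgn j * lookup u j)
        (λ j → Alternating-map (suc n) (λ r → removeAt r j) (det-alternating (suc n)))

    -- Polarisation with `w = u + v`: expand `F (w ∷ w ∷ M)`, which vanishes together with
    -- `F (u ∷ u ∷ M)` and `F (v ∷ v ∷ M)`.
    swap-rows : ∀ m {n} {F : Matrix (suc (suc m)) n → Carrier} → Multilinear _ F → Alternating _ F →
                ∀ u v M → F (u ∷ v ∷ M) ≡ - F (v ∷ u ∷ M)
    swap-rows m {F = F} ml alt u v M = begin
      F (u ∷ v ∷ M)
        ≡⟨ solve 4 (λ uu uv vu vv → uv := uu :+ con 1ℤ :* uv :+ con 1ℤ :* (vu :+ con 1ℤ :* vv) :- uu :- vv :- vu) refl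
             (F (u ∷ u ∷ M)) (F (u ∷ v ∷ M)) (F (v ∷ u ∷ M)) (F (v ∷ v ∷ M)) ⟩
      F (u ∷ u ∷ M) + 1# * F (u ∷ v ∷ M) + 1# * (F (v ∷ u ∷ M) + 1# * F (v ∷ v ∷ M)) - F (u ∷ u ∷ M) - F (v ∷ v ∷ M) - F (v ∷ u ∷ M)
        ≡⟨ cong₂ (λ y z → y - F (u ∷ u ∷ M) - z - F (v ∷ u ∷ M)) (sym both) (proj₁ alt v M) ⟩
      F (w ∷ w ∷ M) - F (u ∷ u ∷ M) - 0# - F (v ∷ u ∷ M)
        ≡⟨ cong₂ (λ y z → y - z - 0# - F (v ∷ u ∷ M)) (proj₁ alt w M) (proj₁ alt u M) ⟩
      0# - 0# - 0# - F (v ∷ u ∷ M)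
        ≡⟨ solve 1 (λ x → con 0ℤ :- con 0ℤ :- con 0ℤ :- x := :- x) refl (F (v ∷ u ∷ M)) ⟩
      - F (v ∷ u ∷ M) ∎
      where
      w = u ⊹ 1# ⊙ v
      both : F (w ∷ w ∷ M) ≡ F (u ∷ u ∷ M) + 1# * F (u ∷ v ∷ M) + 1# * (F (v ∷ u ∷ M) + 1# * F (v ∷ v ∷ M))
      both = trans (proj₁ ml (w ∷ M) u 1# v)
                   (cong₂ (λ y z → y + 1# * z) (proj₁ (proj₂ ml u) M u 1# v) (proj₁ (proj₂ ml v) M u 1# v))

    repeated-row : ∀ m {n} {F : Matrix (suc m) n → Carrier} → Multilinear _ F → Alternating _ F →
                   ∀ M (i : Fin m) → F (lookup M i ∷ M) ≡ 0#
    repeated-row (suc m) ml alt (v ∷ M) zero = proj₁ alt v M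
    repeated-row (suc m) {F = F} ml alt (v ∷ M) (suc i) = begin
      F (lookup M i ∷ v ∷ M)      ≡⟨ swap-rows m {F = F} ml alt _ v M ⟩
      - F (v ∷ lookup M i ∷ M)    ≡⟨ cong -_ (repeated-row m {F = λ N → F (v ∷ N)} (proj₂ ml v) (Alternating-tail (suc m) {F = F} alt v) M i) ⟩
      - 0#                        ≡⟨ -0#≈0# ⟩
      0#                          ∎

    -- Row operations whose pivot `e` is not itself an argument of `G`: a fixed row outside `G`
    -- makes it vanish as soon as `e` occurs among its rows.
    add-multiples : ∀ m {n} {G : Matrix m n → Carrier} → Multilinear m G → (e : Row n) →
                    (∀ M i → lookup M i ≡ e → G M ≡ 0#) →
                    (c : Row n → Carrier) → ∀ M → G (map (λ r → r ⊹ c r ⊙ e) M) ≡ G M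
    add-multiples zero    ml e van c []      = refl
    add-multiples (suc m) {G = G} ml e van c (r ∷ M) = begin
      G ((r ⊹ c r ⊙ e) ∷ M′)             ≡⟨ proj₁ ml M′ r (c r) e ⟩
      G (r ∷ M′) + c r * G (e ∷ M′)      ≡⟨ cong (λ y → G (r ∷ M′) + c r * y) (van (e ∷ M′) zero refl) ⟩
      G (r ∷ M′) + c r * 0#              ≡⟨ solve 2 (λ a c → a :+ c :* con 0ℤ := a) refl _ (c r) ⟩
      G (r ∷ M′)                         ≡⟨ add-multiples m (proj₂ ml r) e (λ M i eq → van (r ∷ M) (suc i) eq) c M ⟩
      G (r ∷ M)                          ∎
      where M′ = map (λ r → r ⊹ c r ⊙ e) M

    row-to-top : ∀ m {n} {F : Matrix (suc m) n → Carrier} → Multilinear _ F → Alternating _ F →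
                 ∀ M (j : Fin (suc m)) → F (lookup M j ∷ removeAt M j) ≡ sgn j * F M
    row-to-top m ml alt (r ∷ M) zero = sym (*-identityˡ _)
    row-to-top (suc m) {F = F} ml alt (r ∷ M@(_ ∷ _)) (suc j) = begin
      F (lookup M j ∷ r ∷ removeAt M j)       ≡⟨ swap-rows m {F = F} ml alt _ r _ ⟩
      - F (r ∷ lookup M j ∷ removeAt M j)     ≡⟨ cong -_ (row-to-top m {F = λ N → F (r ∷ N)} (proj₂ ml r) (Alternating-tail (suc m) {F = F} alt r) M j) ⟩
      - (sgn j * F (r ∷ M))                   ≡⟨ -‿distribˡ-* _ _ ⟩
      - sgn j * F (r ∷ M)                     ∎

    insert : ∀ {n} → Fin (suc n) → Row n → Row (suc n)
    insert j r = insertAt r j 0#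

    insert-linear : ∀ {n} (j : Fin (suc n)) → RowLinear (insert j)
    insert-linear zero    u       c v       = cong (_∷ (u ⊹ c ⊙ v)) (solve 1 (λ c → con 0ℤ := con 0ℤ :+ c :* con 0ℤ) refl c)
    insert-linear (suc j) (x ∷ u) c (y ∷ v) = cong (_ ∷_) (insert-linear j u c v)

    -- Deleting column `j` and reinserting a zero there is a row operation with pivot `unit j`; this
    -- is how minors enter `alternating-unique`.
    clear-entry : ∀ {n} (j : Fin (suc n)) r → insert j (removeAt r j) ≡ r ⊹ (- lookup r j) ⊙ unit j
    clear-entry zero (x ∷ r) = cong₂ _∷_ (solve 1 (λ x → con 0ℤ := x :+ :- x :* con 1ℤ) refl x) (sym (⊹-𝟎 (- x) r))
    clear-entry (suc j) (x ∷ r@(_ ∷ _)) = cong₂ _∷_ (solve 2 (λ x y → x := x :+ y :* con 0ℤ) refl x _) (clear-entry j r)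

    insert-unit : ∀ {n} (j : Fin (suc n)) → map (insert j) (I n) ≡ removeAt (I (suc n)) j
    insert-unit {n} zero = sym (tabulate-∘ (0# ∷_) unit)
      where open import Data.Vec.Properties using (tabulate-∘)
    insert-unit {suc n} (suc j) = cong₂ _∷_ (cong (1# ∷_) (insert-𝟎 j)) (begin
      map (insert (suc j)) (tabulate (λ k → 0# ∷ unit k))   ≡⟨ cong (map _) (tabulate-∘ (0# ∷_) unit) ⟩
      map (insert (suc j)) (map (0# ∷_) (I n))              ≡⟨ map-∘ _ _ (I n) ⟨
      map (λ r → 0# ∷ insert j r) (I n)                     ≡⟨ map-∘ (0# ∷_) (insert j) (I n) ⟩
      map (0# ∷_) (map (insert j) (I n))                    ≡⟨ cong (map _) (insert-unit j) ⟩
      map (0# ∷_) (removeAt (I (suc n)) j)                  ≡⟨ map-removeAt (0# ∷_) (I (suc n)) j ⟩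
      removeAt (map (0# ∷_) (I (suc n))) j                  ≡⟨ cong (λ M → removeAt M j) (tabulate-∘ (0# ∷_) unit) ⟨
      removeAt (tabulate (λ k → 0# ∷ unit k)) j             ∎)
      where
      open import Data.Vec.Properties using (tabulate-∘)
      insert-𝟎 : ∀ {n} (j : Fin (suc n)) → insert j 𝟎 ≡ 𝟎
      insert-𝟎 zero = refl
      insert-𝟎 {suc n} (suc j) = cong (0# ∷_) (insert-𝟎 j)

      map-removeAt : ∀ {A B : Set} {n} (f : A → B) (v : Vec A (suc n)) j → map f (removeAt v j) ≡ removeAt (map f v) j
      map-removeAt f (x ∷ v)         zero    = refl
      map-removeAt f (x ∷ v@(_ ∷ _)) (suc j) = cong (f x ∷_) (map-removeAt f v j)

    lookup-I : ∀ {n} (j : Fin n) → lookup (I n) j ≡ unit j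
    lookup-I = lookup∘tabulate unit
      where open import Data.Vec.Properties using (lookup∘tabulate)

    -- Expand the first row into unit vectors. With `unit j` on top, row operations clear column `j`
    -- below it, so the form depends only on the minor and the induction hypothesis applies; moving
    -- `unit j` to its place in the identity costs `sgn j`. What results is the cofactor expansion.
    alternating-unique : ∀ n {F : Matrix n n → Carrier} → Multilinear n F → Alternating n F →
                         ∀ M → F M ≡ det M * F (I n)
    alternating-unique zero    ml alt []      = sym (*-identityˡ _)
    alternating-unique (suc n) {F} ml alt (r ∷ M) = begin
      F (r ∷ M)
        ≡⟨ Linear-expand (proj₁ ml M) r ⟩
      sum (λ j → lookup r j * F (unit j ∷ M))
        ≡⟨ sum-cong-≗ (λ j → trans (cong (λ y → lookup r j * y) (expand j))
             (solve 4 (λ a d s f → a :* (d :* (s :* f)) := s :* a :* d :* f) refl (lookup r j) (det (minor j M)) (sgn j) (F (I (suc n))))) ⟩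
      sum (λ j → sgn j * lookup r j * det (minor j M) * F (I (suc n)))
        ≡⟨ *-distribʳ-sum (F (I (suc n))) (λ j → sgn j * lookup r j * det (minor j M)) ⟨
      det (r ∷ M) * F (I (suc n)) ∎
      where
      G : Fin (suc n) → Matrix n n → Carrier
      G j N = F (unit j ∷ map (insert j) N)

      van : ∀ j N i → lookup N i ≡ unit j → F (unit j ∷ N) ≡ 0#
      van j N i eq = trans (cong (λ e → F (e ∷ N)) (sym eq)) (repeated-row n {F = F} ml alt N i)

      expand : ∀ j → F (unit j ∷ M) ≡ det (minor j M) * (sgn j * F (I (suc n)))
      expand j = begin
        F (unit j ∷ M)
          ≡⟨ add-multiples n (proj₂ ml (unit j)) (unit j) (van j) (λ r → - lookup r j) M ⟨
        F (unit j ∷ map (λ r → r ⊹ (- lookup r j) ⊙ unit j) M)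
          ≡⟨ cong (λ N → F (unit j ∷ N)) (trans (map-cong (λ r → sym (clear-entry j r)) M) (map-∘ (insert j) _ M)) ⟩
        G j (minor j M)
          ≡⟨ alternating-unique n (Multilinear-map n (insert-linear j) (proj₂ ml (unit j)))
               (Alternating-map n (insert j) (Alternating-tail n {F = F} alt (unit j))) (minor j M) ⟩
        det (minor j M) * F (unit j ∷ map (insert j) (I n))
          ≡⟨ cong (λ y → det (minor j M) * y) (begin
               F (unit j ∷ map (insert j) (I n))                    ≡⟨ cong₂ (λ e N → F (e ∷ N)) (sym (lookup-I j)) (insert-unit j) ⟩
               F (lookup (I (suc n)) j ∷ removeAt (I (suc n)) j)    ≡⟨ row-to-top n {F = F} ml alt (I (suc n)) j ⟩
               sgn j * F (I (suc n))                                ∎) ⟩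
        det (minor j M) * (sgn j * F (I (suc n))) ∎

open Determinants

-- Multiplicativity, and diagonalisation without division

module DeterminantProducts where
  record Hom (R S : PropRing) : Set where
    private
      module R = PropRing R
      module S = PropRing S
    field
      ⟦_⟧    : R.Carrier → S.Carrier
      +-homo : ∀ x y → ⟦ x R.+ y ⟧ ≡ ⟦ x ⟧ S.+ ⟦ y ⟧
      *-homo : ∀ x y → ⟦ x R.* y ⟧ ≡ ⟦ x ⟧ S.* ⟦ y ⟧
      -‿homo : ∀ x → ⟦ R.- x ⟧ ≡ S.- ⟦ x ⟧
      0-homo : ⟦ R.0# ⟧ ≡ S.0#
      1-homo : ⟦ R.1# ⟧ ≡ S.1#

  module DeterminantProduct (R : PropRing) where
    open RingKit R
    open Determinant R
    open ≡-Reasoning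

    ⊹-interchange : ∀ {n} (a b c d : Row n) x → (a ⊹ x ⊙ b) ⊹ (c ⊹ x ⊙ d) ≡ (a ⊹ c) ⊹ x ⊙ (b ⊹ d)
    ⊹-interchange []      []      []      []      x = refl
    ⊹-interchange (a ∷ u) (b ∷ v) (c ∷ w) (d ∷ t) x = cong₂ _∷_
      (solve 5 (λ a b c d x → (a :+ x :* b) :+ (c :+ x :* d) := (a :+ c) :+ x :* (b :+ d)) refl a b c d x)
      (⊹-interchange u v w t x)

    ⊙-linear : ∀ {n} a b c (r : Row n) → (a + c * b) ⊙ r ≡ a ⊙ r ⊹ c ⊙ (b ⊙ r)
    ⊙-linear a b c []      = refl
    ⊙-linear a b c (x ∷ r) = cong₂ _∷_
      (solve 4 (λ a b c x → (a :+ c :* b) :* x := a :* x :+ c :* (b :* x)) refl a b c x) (⊙-linear a b c r)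

    infixl 7 _⊡_
    _⊡_ : ∀ {m n} → Row m → Matrix m n → Row n
    []      ⊡ []      = 𝟎
    (x ∷ r) ⊡ (b ∷ B) = x ⊙ b ⊹ r ⊡ B

    ⊡-linear : ∀ {m n} (B : Matrix m n) → RowLinear (_⊡ B)
    ⊡-linear []      []      c []      = sym (⊹-𝟎 c 𝟎)
    ⊡-linear (b ∷ B) (x ∷ u) c (y ∷ v) = trans
      (cong₂ _⊹_ (⊙-linear x y c b) (⊡-linear B u c v)) (⊹-interchange (x ⊙ b) (y ⊙ b) (u ⊡ B) (v ⊡ B) c)

    𝟎-⊡ : ∀ {m n} (B : Matrix m n) → 𝟎 ⊡ B ≡ 𝟎
    𝟎-⊡ []      = refl
    𝟎-⊡ (b ∷ B) = trans (cong (λ r → (0# ⊙ b) ⊹ r) (𝟎-⊡ B)) (zero-row b)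
      where
      zero-row : ∀ {n} (b : Row n) → 0# ⊙ b ⊹ 𝟎 ≡ 𝟎
      zero-row []      = refl
      zero-row (x ∷ b) = cong₂ _∷_ (trans (+-identityʳ _) (zeroˡ x)) (zero-row b)

    unit-⊡ : ∀ {m n} (B : Matrix m n) j → unit j ⊡ B ≡ lookup B j
    unit-⊡ (b ∷ B) zero    = trans (cong (λ r → (1# ⊙ b) ⊹ r) (𝟎-⊡ B)) (one-row b)
      where
      one-row : ∀ {n} (b : Row n) → 1# ⊙ b ⊹ 𝟎 ≡ b
      one-row []      = refl
      one-row (x ∷ b) = cong₂ _∷_ (trans (+-identityʳ _) (*-identityˡ x)) (one-row b)
    unit-⊡ (b ∷ B) (suc j) = trans (cong (λ r → (0# ⊙ b) ⊹ r) (unit-⊡ B j)) (drop-row b (lookup B j))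
      where
      drop-row : ∀ {n} (b r : Row n) → 0# ⊙ b ⊹ r ≡ r
      drop-row []      []      = refl
      drop-row (x ∷ b) (y ∷ r) = cong₂ _∷_ (solve 2 (λ x y → con 0ℤ :* x :+ y := y) refl x y) (drop-row b r)

    -- For fixed `B` the left side is alternating and multilinear in the rows of `A`, so by
    -- uniqueness only its value at the identity matters, and that is `det B`.
    det-⊡ : ∀ {n} (A B : Matrix n n) → det (map (_⊡ B) A) ≡ det A * det B
    det-⊡ {n} A B = trans
      (alternating-unique n (Multilinear-map n (⊡-linear B) (det-multilinear n)) (Alternating-map n (_⊡ B) (det-alternating n)) A)
      (cong (λ M → det A * det M) (begin
        map (_⊡ B) (I n)               ≡⟨ tabulate-∘ (_⊡ B) unit ⟨
        tabulate (λ j → unit j ⊡ B)    ≡⟨ tabulate-cong (unit-⊡ B) ⟩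
        tabulate (lookup B)            ≡⟨ tabulate∘lookup B ⟩
        B                              ∎))

    det-I : ∀ n → det (I n) ≡ 1#
    det-I zero    = refl
    det-I (suc n) = begin
      1# * 1# * det (minor zero (tabulate (λ j → 0# ∷ unit {n} j)))
        + sum (λ j → - sgn j * lookup 𝟎 j * det (minor (suc j) (tabulate (λ j → 0# ∷ unit {n} j))))
        ≡⟨ cong₂ _+_ (cong (λ M → 1# * 1# * det M) (sym (tabulate-∘ (λ r → removeAt r zero) (λ j → 0# ∷ unit {n} j))))
             (sum-0 (λ j → trans (cong (λ y → - sgn j * y * det (minor (suc j) (tabulate (λ j → 0# ∷ unit {n} j)))) (lookup-replicate j 0#))
               (solve 2 (λ s d → :- s :* con 0ℤ :* d := con 0ℤ) refl (sgn j) (det (minor (suc j) (tabulate (λ j → 0# ∷ unit {n} j))))))) ⟩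
      1# * 1# * det (I n) + 0#
        ≡⟨ cong (λ y → 1# * 1# * y + 0#) (det-I n) ⟩
      1# * 1# * 1# + 0#
        ≡⟨ solve 0 (con 1ℤ :* con 1ℤ :* con 1ℤ :+ con 0ℤ := con 1ℤ) refl ⟩
      1# ∎

    prod : ∀ {n} → (Fin n → Carrier) → Carrier
    prod = F.foldr _*_ 1#

    scale-rows : ∀ m {n} {F : Matrix m n → Carrier} → Multilinear m F → (d : Fin m → Carrier) → ∀ M →
                 F (tabulate λ i → d i ⊙ lookup M i) ≡ prod d * F M
    scale-rows zero    ml d []      = sym (*-identityˡ _)
    scale-rows (suc m) {F = F} ml d (r ∷ M) = begin
      F (d zero ⊙ r ∷ M′)                      ≡⟨ Linear-⊙ (proj₁ ml M′) (d zero) r ⟩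
      d zero * F (r ∷ M′)                      ≡⟨ cong (λ y → d zero * y) (scale-rows m (proj₂ ml r) (d ∘ suc) M) ⟩
      d zero * (prod (d ∘ suc) * F (r ∷ M))    ≡⟨ *-assoc _ _ _ ⟨
      prod d * F (r ∷ M)                       ∎
      where M′ = tabulate (λ i → d (suc i) ⊙ lookup M i)

    FMatrix : ℕ → Set
    FMatrix n = Fin n → Fin n → Carrier

    toMatrix : ∀ {n} → FMatrix n → Matrix n n
    toMatrix f = tabulate (λ i → tabulate (f i))

    detF : ∀ {n} → FMatrix n → Carrier
    detF f = det (toMatrix f)

    detF-cong : ∀ {n} {f g : FMatrix n} → (∀ i j → f i j ≡ g i j) → detF f ≡ detF g
    detF-cong eq = cong det (tabulate-cong (λ i → tabulate-cong (eq i)))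

    tabulate-⊡ : ∀ {m n} (r : Fin m → Carrier) (g : Fin m → Fin n → Carrier) →
                 tabulate r ⊡ tabulate (λ k → tabulate (g k)) ≡ tabulate (λ j → sum λ k → r k * g k j)
    tabulate-⊡ {zero}  r g = 𝟎≡tabulate
      where
      𝟎≡tabulate : ∀ {n} → 𝟎 {n} ≡ tabulate (λ _ → 0#)
      𝟎≡tabulate {zero}  = refl
      𝟎≡tabulate {suc n} = cong (0# ∷_) 𝟎≡tabulate
    tabulate-⊡ {suc m} r g = trans
      (cong₂ _⊹_ (sym (tabulate-∘ (r zero *_) (g zero))) (tabulate-⊡ (r ∘ suc) (g ∘ suc)))
      (zipWith-tabulate (λ j → r zero * g zero j) (λ j → sum λ k → r (suc k) * g (suc k) j))
      where
      zipWith-tabulate : ∀ {n} (a b : Fin n → Carrier) → tabulate a ⊹ tabulate b ≡ tabulate (λ j → a j + b j)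
      zipWith-tabulate {zero}  a b = refl
      zipWith-tabulate {suc n} a b = cong ((a zero + b zero) ∷_) (zipWith-tabulate (a ∘ suc) (b ∘ suc))

    detF-* : ∀ {n} (f g : FMatrix n) → detF (λ i j → sum λ k → f i k * g k j) ≡ detF f * detF g
    detF-* f g = trans
      (cong det (trans (tabulate-cong (λ i → sym (tabulate-⊡ (f i) g))) (tabulate-∘ (_⊡ toMatrix g) (λ i → tabulate (f i)))))
      (det-⊡ (toMatrix f) (toMatrix g))

    detF-scale : ∀ {n} (d : Fin n → Carrier) (f : FMatrix n) → detF (λ i j → d i * f i j) ≡ prod d * detF f
    detF-scale {n} d f = trans
      (cong det (tabulate-cong (λ i → trans (tabulate-∘ (d i *_) (f i)) (cong (d i ⊙_) (sym (lookup∘tabulate (λ i → tabulate (f i)) i))))))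
      (scale-rows n (det-multilinear n) d (toMatrix f))

    detF-I : ∀ n → detF (λ i j → lookup (unit {n} i) j) ≡ 1#
    detF-I n = trans (cong det (tabulate-cong (λ i → tabulate∘lookup (unit {n} i)))) (det-I n)

    prod-regular : ∀ {n} (c : Carrier) → (∀ x → c * x ≡ 0# → x ≡ 0#) → ∀ x → prod {n} (λ _ → c) * x ≡ 0# → x ≡ 0#
    prod-regular {zero}  c reg x eq = trans (sym (*-identityˡ x)) eq
    prod-regular {suc n} c reg x eq = prod-regular {n} c reg x (reg _ (trans (sym (*-assoc _ _ _)) eq))

    -- No determinant is inverted: `E M = diag(d) E` gives `det E (det M - prod d) = 0`, and
    -- multiplying by `det E′` replaces `det E` by a power of `c`, which is not a zero divisor.
    detF-diagonalised : ∀ {n} (E E′ M : FMatrix n) (d : Fin n → Carrier) (c : Carrier) →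
      (∀ x → c * x ≡ 0# → x ≡ 0#) →
      (∀ i j → sum (λ k → E i k * E′ k j) ≡ c * lookup (unit i) j) →
      (∀ i j → sum (λ k → E i k * M k j) ≡ d i * E i j) →
      detF M ≡ prod d
    detF-diagonalised {n} E E′ M d c reg inv eig = begin
      detF M                             ≡⟨ solve 2 (λ x y → x := (x :- y) :+ y) refl (detF M) (prod d) ⟩
      (detF M - prod d) + prod d         ≡⟨ cong (λ y → y + prod d) (prod-regular {n} c reg _ killed) ⟩
      0# + prod d                        ≡⟨ +-identityˡ _ ⟩
      prod d                             ∎
      where
      eigen : detF E * detF M ≡ prod d * detF E
      eigen = trans (sym (detF-* E M)) (trans (detF-cong eig) (detF-scale d E))

      inverse : detF E * detF E′ ≡ prod {n} (λ _ → c)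
      inverse = trans (sym (detF-* E E′)) (trans (detF-cong inv)
        (trans (detF-scale (λ _ → c) (λ i j → lookup (unit {n} i) j)) (trans (cong (λ y → prod {n} (λ _ → c) * y) (detF-I n)) (*-identityʳ _))))

      killed : prod {n} (λ _ → c) * (detF M - prod d) ≡ 0#
      killed = begin
        prod {n} (λ _ → c) * (detF M - prod d)             ≡⟨ cong (λ y → y * (detF M - prod d)) inverse ⟨
        detF E * detF E′ * (detF M - prod d)               ≡⟨ solve 4 (λ e e′ m p → e :* e′ :* (m :- p) := e′ :* (e :* m) :- e′ :* (p :* e)) refl
                                                                (detF E) (detF E′) (detF M) (prod d) ⟩
        detF E′ * (detF E * detF M) - detF E′ * (prod d * detF E) ≡⟨ cong (λ y → detF E′ * y - detF E′ * (prod d * detF E)) eigen ⟩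
        detF E′ * (prod d * detF E) - detF E′ * (prod d * detF E) ≡⟨ -‿inverseʳ _ ⟩
        0#                                                 ∎

    module _ (h : Hom ℤ-ring R) where
      open Hom h

      sgn-homo : ∀ {n} (j : Fin n) → ⟦ -1ℤ ℤ.^ toℕ j ⟧ ≡ sgn j
      sgn-homo zero    = 1-homo
      sgn-homo (suc j) = begin
        ⟦ -1ℤ ℤ.* -1ℤ ℤ.^ toℕ j ⟧      ≡⟨ cong ⟦_⟧ (ℤ.-1*i≡-i _) ⟩
        ⟦ ℤ.- (-1ℤ ℤ.^ toℕ j) ⟧        ≡⟨ -‿homo _ ⟩
        - ⟦ -1ℤ ℤ.^ toℕ j ⟧            ≡⟨ cong -_ (sgn-homo j) ⟩
        - sgn j                        ∎

      sum-homo : ∀ {n} (f : Fin n → ℤ) → ⟦ F.foldr ℤ._+_ 0ℤ f ⟧ ≡ sum (λ j → ⟦ f j ⟧)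
      sum-homo {zero}  f = 0-homo
      sum-homo {suc n} f = trans (+-homo _ _) (cong (λ y → ⟦ f zero ⟧ + y) (sum-homo (f ∘ suc)))

      removeAt-tabulate : ∀ {n} (f : Fin (suc n) → Carrier) j →
                          removeAt (tabulate f) j ≡ tabulate (F.removeAt f j)
      removeAt-tabulate         f zero    = refl
      removeAt-tabulate {suc n} f (suc j) = cong (f zero ∷_) (removeAt-tabulate (f ∘ suc) j)

      -- Carries the integer determinant of the definition of `S` into the ring where the characters
      -- take their values.
      det-homo : ∀ {n} (M : Fin n → Fin n → ℤ) → ⟦ Defs.det M ⟧ ≡ detF (λ i j → ⟦ M i j ⟧)
      det-homo {zero}  M = 1-homo
      det-homo {suc n} M = trans (sum-homo λ j → -1ℤ ℤ.^ toℕ j ℤ.* M zero j ℤ.* Defs.det (λ i → F.removeAt (M (suc i)) j)) (sum-cong-≗ term)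
        where
        term : ∀ j → ⟦ -1ℤ ℤ.^ toℕ j ℤ.* M zero j ℤ.* Defs.det (λ i → F.removeAt (M (suc i)) j) ⟧
                   ≡ sgn j * lookup (tabulate λ k → ⟦ M zero k ⟧) j * det (minor j (tabulate λ i → tabulate λ k → ⟦ M (suc i) k ⟧))
        term j = trans (*-homo _ _) (cong₂ _*_
          (trans (*-homo _ _) (cong₂ _*_ (sgn-homo j) (sym (lookup∘tabulate (λ k → ⟦ M zero k ⟧) j))))
          (trans (det-homo (λ i → F.removeAt (M (suc i)) j)) (cong det (trans
            (tabulate-cong (λ i → sym (removeAt-tabulate (λ k → ⟦ M (suc i) k ⟧) j)))
            (tabulate-∘ (λ r → removeAt r j) (λ i → tabulate λ k → ⟦ M (suc i) k ⟧))))))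

open DeterminantProducts

-- Characters as eigenvectors of the group matrix

module FourierTransform where
  module Fourier (R : PropRing) (h : Hom ℤ-ring R) (G : FiniteGroup)
                 (a : Func (FiniteGroup.setoid G) (setoid ℤ)) where
    open RingKit R
    open Determinant R using (unit; unit-diagonal; unit-off-diagonal)
    open DeterminantProduct R
    open Hom h
    private module G = FiniteGroup G
    open G using (order; element)

    index : G.Carrier → Fin order
    index = Inverse.from G.enumeration

    element-index : ∀ g → element (index g) G.≈ g
    element-index = Inverse.strictlyInverseˡ G.enumeration

    index-element : ∀ k → index (element k) ≡ k
    index-element = Inverse.strictlyInverseʳ G.enumeration

    infixl 7 _·_
    _·_ : Fin order → Fin order → Fin order
    k · l = index (element k G.∙ element l)

    transform : (Fin order → Fin order → Carrier) → Fin order → Carrier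
    transform X s = sum λ k → X s k * ⟦ a ⟨$⟩ element k ⟧

    private
      cancelʳ : ∀ g k → (g G.∙ k) G.∙ k G.⁻¹ G.≈ g
      cancelʳ g k = G.trans (G.assoc g k (k G.⁻¹)) (G.trans (G.∙-congˡ (G.inverseʳ k)) (G.identityʳ g))

      cancelˡ : ∀ g k → (g G.∙ k G.⁻¹) G.∙ k G.≈ g
      cancelˡ g k = G.trans (G.assoc g (k G.⁻¹) k) (G.trans (G.∙-congˡ (G.inverseˡ k)) (G.identityʳ g))

      translation : Fin order → Permutation order order
      translation l = permutation (_· l) (λ k → index (element k G.∙ element l G.⁻¹))
        (λ k → trans (Inverse.from-cong G.enumeration (G.trans (G.∙-congʳ (element-index _)) (cancelˡ (element k) (element l)))) (index-element k))
        (λ k → trans (Inverse.from-cong G.enumeration (G.trans (G.∙-congʳ (element-index _)) (cancelʳ (element k) (element l)))) (index-element k))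

    -- Right translation by `l` permutes the summation index. After this substitution the matrix
    -- entry at `k l⁻¹` becomes the one at `k`, and `X (k · l)` splits off the factor `X l`.
    eigenvector : (X : Fin order → Carrier) → (∀ k l → X (k · l) ≡ X k * X l) →
      ∀ l → sum (λ k → X k * ⟦ groupMatrix G a k l ⟧) ≡ sum (λ k → X k * ⟦ a ⟨$⟩ element k ⟧) * X l
    eigenvector X X-· l = begin
      sum (λ k → X k * ⟦ groupMatrix G a k l ⟧)
        ≡⟨ sum-permute (λ k → X k * ⟦ groupMatrix G a k l ⟧) (translation l) ⟩
      sum (λ k → X (k · l) * ⟦ groupMatrix G a (k · l) l ⟧)
        ≡⟨ sum-cong-≗ (λ k → cong₂ _*_ (X-· k l) (cong ⟦_⟧ (Func.cong a (G.trans (G.∙-congʳ (element-index _)) (cancelʳ (element k) (element l)))))) ⟩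
      sum (λ k → X k * X l * ⟦ a ⟨$⟩ element k ⟧)
        ≡⟨ sum-cong-≗ (λ k → solve 3 (λ x y z → x :* y :* z := (x :* z) :* y) refl (X k) (X l) ⟦ a ⟨$⟩ element k ⟧) ⟩
      sum (λ k → X k * ⟦ a ⟨$⟩ element k ⟧ * X l)
        ≡⟨ *-distribʳ-sum (X l) (λ k → X k * ⟦ a ⟨$⟩ element k ⟧) ⟨
      sum (λ k → X k * ⟦ a ⟨$⟩ element k ⟧) * X l ∎
      where open ≡-Reasoning

    -- `X′` plays the part of the conjugate character table; orthogonality makes it an inverse of
    -- `X` up to the scalar `c`, in the application the group order.
    groupDeterminant : (X X′ : Fin order → Fin order → Carrier) (c : Carrier) →
      (∀ x → c * x ≡ 0# → x ≡ 0#) →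
      (∀ s k l → X s (k · l) ≡ X s k * X s l) →
      (∀ s → sum (λ k → X s k * X′ k s) ≡ c) →
      (∀ s t → s ≢ t → sum (λ k → X s k * X′ k t) ≡ 0#) →
      ⟦ Defs.det (groupMatrix G a) ⟧ ≡ prod (transform X)
    groupDeterminant X X′ c regular X-· diagonal orthogonal = trans
      (det-homo h (groupMatrix G a))
      (detF-diagonalised X X′ _ (transform X) c regular inverse (λ s → eigenvector (X s) (X-· s)))
      where
      inverse : ∀ s t → sum (λ k → X s k * X′ k t) ≡ c * lookup (unit s) t
      inverse s t with s ≟ t
      ... | yes refl = trans (diagonal s) (sym (trans (cong (λ y → c * y) (unit-diagonal s)) (*-identityʳ c)))
      ... | no s≢t   = trans (orthogonal s t s≢t) (sym (trans (cong (λ y → c * y) (unit-off-diagonal s t s≢t)) (zeroʳ c)))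

open FourierTransform

-- Formal polynomials, Eisenstein integers, determinant forms

module Polynomials where
  infix  8 ⊝_
  infixl 7 _⊗_
  infixl 6 _⊕_ _⊖_

  -- A syntax for forms lets one expression be evaluated in ℤ, in ℤ[ω], in ℤ[ζ₂₄] and in the ring
  -- solver, and the values be compared by induction.
  data Poly (n : ℕ) : Set where
    var     : Fin n → Poly n
    _⊕_ _⊗_ : Poly n → Poly n → Poly n
    ⊝_      : Poly n → Poly n

  _⊖_ : ∀ {n} → Poly n → Poly n → Poly n
  p ⊖ q = p ⊕ ⊝ q

  eval : ∀ (R : PropRing) {n} → Poly n → (Fin n → PropRing.Carrier R) → PropRing.Carrier R
  eval R (var i) ρ = ρ i
  eval R (p ⊕ q) ρ = PropRing._+_ R (eval R p ρ) (eval R q ρ)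
  eval R (p ⊗ q) ρ = PropRing._*_ R (eval R p ρ) (eval R q ρ)
  eval R (⊝ p)   ρ = PropRing.-_ R (eval R p ρ)

  eval-homo : ∀ {R S} (h : Hom R S) {n} (p : Poly n) {ρ σ} → (∀ i → Hom.⟦_⟧ h (ρ i) ≡ σ i) →
              Hom.⟦_⟧ h (eval R p ρ) ≡ eval S p σ
  eval-homo h (var i) eq = eq i
  eval-homo {S = S} h (p ⊕ q) eq = trans (Hom.+-homo h _ _) (cong₂ (PropRing._+_ S) (eval-homo h p eq) (eval-homo h q eq))
  eval-homo {S = S} h (p ⊗ q) eq = trans (Hom.*-homo h _ _) (cong₂ (PropRing._*_ S) (eval-homo h p eq) (eval-homo h q eq))
  eval-homo {S = S} h (⊝ p)   eq = trans (Hom.-‿homo h _) (cong (PropRing.-_ S) (eval-homo h p eq))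

  -- The relation joins two possibly different rings because its main instance is `_∼_`, congruence
  -- modulo √-3 between an integer and an Eisenstein integer.
  eval-related : ∀ {R S : PropRing} (_∼_ : PropRing.Carrier R → PropRing.Carrier S → Set) →
    (∀ {a b c d} → a ∼ b → c ∼ d → PropRing._+_ R a c ∼ PropRing._+_ S b d) →
    (∀ {a b c d} → a ∼ b → c ∼ d → PropRing._*_ R a c ∼ PropRing._*_ S b d) →
    (∀ {a b} → a ∼ b → PropRing.-_ R a ∼ PropRing.-_ S b) →
    ∀ {n} (p : Poly n) {ρ σ} → (∀ i → ρ i ∼ σ i) → eval R p ρ ∼ eval S p σ
  eval-related _∼_ plus times minus (var i) r = r i
  eval-related _∼_ plus times minus (p ⊕ q) r = plus (eval-related _∼_ plus times minus p r) (eval-related _∼_ plus times minus q r)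
  eval-related _∼_ plus times minus (p ⊗ q) r = times (eval-related _∼_ plus times minus p r) (eval-related _∼_ plus times minus q r)
  eval-related _∼_ plus times minus (⊝ p)   r = minus (eval-related _∼_ plus times minus p r)

  _∘ʰ_ : ∀ {R S T} → Hom S T → Hom R S → Hom R T
  g ∘ʰ f = record
    { ⟦_⟧    = g.⟦_⟧ ∘ f.⟦_⟧
    ; +-homo = λ x y → trans (cong g.⟦_⟧ (f.+-homo x y)) (g.+-homo _ _)
    ; *-homo = λ x y → trans (cong g.⟦_⟧ (f.*-homo x y)) (g.*-homo _ _)
    ; -‿homo = λ x → trans (cong g.⟦_⟧ (f.-‿homo x)) (g.-‿homo _)
    ; 0-homo = trans (cong g.⟦_⟧ f.0-homo) g.0-homo
    ; 1-homo = trans (cong g.⟦_⟧ f.1-homo) g.1-homo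
    }
    where
    module f = Hom f
    module g = Hom g

  module QuadraticHom (R : PropRing) (p q : PropRing.Carrier R) where
    open Quadratic R p q
    open RingKit R

    embed : Hom R extension
    embed = record
      { ⟦_⟧    = λ a → a , 0#
      ; +-homo = λ a b → cong (a + b ,_) (sym (+-identityˡ 0#))
      ; *-homo = λ a b → cong₂ _,_
          (solve 3 (λ a b q → a :* b := a :* b :+ q :* (con 0ℤ :* con 0ℤ)) refl a b q)
          (solve 3 (λ a b p → con 0ℤ := a :* con 0ℤ :+ con 0ℤ :* b :+ p :* (con 0ℤ :* con 0ℤ)) refl a b p)
      ; -‿homo = λ a → cong (- a ,_) (sym -0#≈0#)
      ; 0-homo = refl
      ; 1-homo = refl
      }

    θ : PropRing.Carrier extension
    θ = 0# , 1#

    embed-* : ∀ a x y → PropRing._*_ extension (a , 0#) (x , y) ≡ (a * x , a * y)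
    embed-* a x y = cong₂ _,_
      (solve 4 (λ a x y q → a :* x :+ q :* (con 0ℤ :* y) := a :* x) refl a x y q)
      (solve 4 (λ a x y p → a :* y :+ con 0ℤ :* x :+ p :* (con 0ℤ :* y) := a :* y) refl a x y p)

    regular : ∀ a → (∀ x → a * x ≡ 0# → x ≡ 0#) →
              ∀ x → PropRing._*_ extension (a , 0#) x ≡ (0# , 0#) → x ≡ (0# , 0#)
    regular a reg (x , y) eq = cong₂ _,_
      (reg x (cong proj₁ (trans (sym (embed-* a x y)) eq)))
      (reg y (cong proj₂ (trans (sym (embed-* a x y)) eq)))

  -- The Eisenstein integers x + yω with ω² = -1 - ω.
  𝔼 : PropRing
  𝔼 = Quadratic.extension ℤ-ring -1ℤ -1ℤ

  module 𝔼 where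
    open RingKit 𝔼 public
    open QuadraticHom ℤ-ring -1ℤ -1ℤ public renaming (embed to ι; θ to ω)

  module Zk = RingKit ℤ-ring

  norm : 𝔼.Carrier → ℤ
  norm (x , y) = x ℤ.* x ℤ.- x ℤ.* y ℤ.+ y ℤ.* y

  -- Complex conjugation, which sends ω to `ω² = -1 - ω`.
  conj : Hom 𝔼 𝔼
  conj = record
    { ⟦_⟧    = λ (x , y) → x ℤ.- y , ℤ.- y
    ; +-homo = λ (a , b) (c , d) → cong₂ _,_
        (Zk.solve 4 (λ a b c d → (a Zk.:+ c) Zk.:- (b Zk.:+ d) Zk.:= (a Zk.:- b) Zk.:+ (c Zk.:- d)) refl a b c d)
        (Zk.solve 2 (λ b d → Zk.:- (b Zk.:+ d) Zk.:= Zk.:- b Zk.:+ Zk.:- d) refl b d)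
    ; *-homo = λ (a , b) (c , d) → cong₂ _,_
        (solve 4 (λ a b c d → (a :* c :+ con -1ℤ :* (b :* d)) :- (a :* d :+ b :* c :+ con -1ℤ :* (b :* d))
            := (a :- b) :* (c :- d) :+ con -1ℤ :* (:- b :* :- d)) refl a b c d)
        (solve 4 (λ a b c d → :- (a :* d :+ b :* c :+ con -1ℤ :* (b :* d))
            := (a :- b) :* :- d :+ :- b :* (c :- d) :+ con -1ℤ :* (:- b :* :- d)) refl a b c d)
    ; -‿homo = λ (a , b) → cong (_, ℤ.- ℤ.- b) (solve 2 (λ a b → :- a :- :- b := :- (a :- b)) refl a b)
    ; 0-homo = refl
    ; 1-homo = refl
    }
    where open RingKit ℤ-ring

  *-conj : ∀ w → w 𝔼.* Hom.⟦_⟧ conj w ≡ (norm w , 0ℤ)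
  *-conj (a , b) = cong₂ _,_
    (solve 2 (λ a b → a :* (a :- b) :+ con -1ℤ :* (b :* :- b) := a :* a :- a :* b :+ b :* b) refl a b)
    (solve 2 (λ a b → a :* :- b :+ b :* (a :- b) :+ con -1ℤ :* (b :* :- b) := con 0ℤ) refl a b)
    where open RingKit ℤ-ring

  norm-* : ∀ v w → norm (v 𝔼.* w) ≡ norm v ℤ.* norm w
  norm-* (a , b) (c , d) = solve 4 (λ a b c d →
      let x = a :* c :+ con -1ℤ :* (b :* d)
          y = a :* d :+ b :* c :+ con -1ℤ :* (b :* d)
      in x :* x :- x :* y :+ y :* y := (a :* a :- a :* b :+ b :* b) :* (c :* c :- c :* d :+ d :* d)) refl a b c d
    where open RingKit ℤ-ring

  -- The integral determinants of the 2-groups of order 8. Index j stands for x^j in C₈,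
  -- for (x^a , y^b) with j = 4a + b in C₂ × C₄, and for the binary digits of j in C₂³.
  module Forms where
    d e : Fin 4 → Poly 8
    d j = var (j ↑ˡ 4) ⊕ var (4 ↑ʳ j)
    e j = var (j ↑ˡ 4) ⊖ var (4 ↑ʳ j)

    module _ (c : Fin 4 → Poly 8) where
      A⁺ B⁺ A⁻ B⁻ n₁ n₂ n₃ n₄ N₄ N₈ : Poly 8
      A⁺ = c (# 0) ⊕ c (# 2)
      B⁺ = c (# 1) ⊕ c (# 3)
      A⁻ = c (# 0) ⊖ c (# 2)
      B⁻ = c (# 1) ⊖ c (# 3)
      n₁ = A⁺ ⊕ B⁺
      n₂ = A⁺ ⊖ B⁺
      n₃ = A⁻ ⊕ B⁻
      n₄ = A⁻ ⊖ B⁻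
      N₄ = A⁻ ⊗ A⁻ ⊕ B⁻ ⊗ B⁻
      N₈ = X ⊗ X ⊕ Y ⊗ Y
        where
        -- With `i = ζ₈²`, the product of the values of `c₀ + c₁ζ + c₂ζ² + c₃ζ³` at ζ₈ and -ζ₈ is
        -- `X + Y i`; hence `X² + Y²` is the full norm down to ℤ.
        X = c (# 0) ⊗ c (# 0) ⊖ c (# 2) ⊗ c (# 2) ⊕ (c (# 1) ⊗ c (# 3) ⊕ c (# 1) ⊗ c (# 3))
        Y = (c (# 0) ⊗ c (# 2) ⊕ c (# 0) ⊗ c (# 2)) ⊖ c (# 1) ⊗ c (# 1) ⊕ c (# 3) ⊗ c (# 3)

    C8 C2×C4 C2³ : Poly 8
    C8    = (n₁ d ⊗ n₂ d ⊗ N₄ d) ⊗ N₈ e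
    C2×C4 = (n₁ d ⊗ n₂ d ⊗ N₄ d) ⊗ (n₁ e ⊗ n₂ e ⊗ N₄ e)
    C2³   = (n₁ d ⊗ n₂ d ⊗ (n₃ d ⊗ n₄ d)) ⊗ (n₁ e ⊗ n₂ e ⊗ (n₃ e ⊗ n₄ e))

open Polynomials

-- Groups of order 24 as products of their Sylow subgroups

module SylowSubgroups where
  -- Formulated for a commutative monoid because it regroups both sums over the group and products
  -- over its characters.
  module Rearrange (M : CommutativeMonoid 0ℓ 0ℓ) where
    open CommutativeMonoid M using (Carrier; _≈_; _∙_)
    open import Algebra.Properties.CommutativeMonoid.Sum M using (sum; sum-permute)
    open CMSolver M using (Expr; prove) renaming (var to x; id to ∅; _⊕_ to _∙′_)

    private
      fold : ∀ {n} → (Fin n → Expr 24) → Expr 24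
      fold = F.foldr _∙′_ ∅

    nested-sum : ∀ (f : Fin 8 → Fin 3 → Carrier) →
                 sum (λ k → uncurry f (remQuot {8} 3 k)) ≈ sum λ j → sum λ l → f j l
    nested-sum f = prove 24 (fold x) (fold {8} λ j → fold {3} λ l → x (combine j l)) (tabulate λ k → uncurry f (remQuot {8} 3 k))

    nested-sum′ : ∀ (f : Fin 8 → Fin 3 → Carrier) →
                 sum (λ k → uncurry f (remQuot {8} 3 k)) ≈ sum λ l → sum λ j → f j l
    nested-sum′ f = prove 24 (fold x) (fold {3} λ l → fold {8} λ j → x (combine j l)) (tabulate λ k → uncurry f (remQuot {8} 3 k))

  infixl 6 _+₈_ _-₈_ _+₃_ _-₃_
  _+₈_ _-₈_ : Fin 8 → Fin 8 → Fin 8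
  a +₈ b = (toℕ a ℕ.+ toℕ b) mod 8
  a -₈ b = (toℕ a ℕ.+ (8 ℕ.∸ toℕ b)) mod 8

  _+₃_ _-₃_ : Fin 3 → Fin 3 → Fin 3
  a +₃ b = (toℕ a ℕ.+ toℕ b) mod 3
  a -₃ b = (toℕ a ℕ.+ (3 ℕ.∸ toℕ b)) mod 3

  infixl 7 _*₃_
  _*₃_ : Fin 3 → Fin 3 → Fin 3
  a *₃ b = (toℕ a ℕ.* toℕ b) mod 3

  *₃-distribˡ : ∀ s k l → s *₃ (k +₃ l) ≡ s *₃ k +₃ s *₃ l
  *₃-distribˡ = from-yes (all? λ s → all? λ k → all? λ l → (s *₃ (k +₃ l)) ≟ (s *₃ k +₃ s *₃ l))

  -- The powers of a primitive 8th root of unity z in an extension of ℤ[ω]. Keeping the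
  -- ring abstract stops the type checker from unfolding its multiplication.
  module Powers (R : PropRing) (z : PropRing.Carrier R) (κ : Hom 𝔼 R) where
    open RingKit R

    φ : Hom ℤ-ring R
    φ = κ ∘ʰ 𝔼.ι

    ω : Carrier
    ω = Hom.⟦_⟧ κ 𝔼.ω

    z^ : Fin 8 → Carrier
    z^ = lookup (1# Vec.∷ z Vec.∷ z * z Vec.∷ z * z * z Vec.∷ - 1# Vec.∷ - z Vec.∷ - (z * z) Vec.∷ - (z * z * z) Vec.∷ Vec.[])

    ω^ : Fin 3 → Carrier
    ω^ = lookup (1# Vec.∷ ω Vec.∷ - 1# + - ω Vec.∷ Vec.[])

  -- What the Fourier argument needs from ℤ[ζ₂₄]: `24-regular` stands in for division by the group
  -- order, and `φ-injective` brings the final identity back to ℤ.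
  record Cyclotomic : Set₁ where
    field
      ring : PropRing
    open RingKit ring
    field
      z : Carrier
      κ : Hom 𝔼 ring
    open Powers ring z κ public
    field
      z⁴+1            : (z * z) * (z * z) + 1# ≡ 0#
      φ-injective     : ∀ x y → Hom.⟦_⟧ φ x ≡ Hom.⟦_⟧ φ y → x ≡ y
      24-regular      : ∀ x → Hom.⟦_⟧ φ (ℤ.+ 24) * x ≡ 0# → x ≡ 0#
      z^-+            : ∀ a b → z^ (a +₈ b) ≡ z^ a * z^ b
      z^-neg          : ∀ a b → z^ a * z^ (# 0 -₈ b) ≡ z^ (a -₈ b)
      ω^-+            : ∀ a b → ω^ (a +₃ b) ≡ ω^ a * ω^ b
      ω^-orthogonal   : ∀ s t → s ≢ t → sum (λ l → ω^ (s *₃ l) * ω^ (# 0 -₃ t *₃ l)) ≡ 0#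
      ω^-diagonal     : ∀ s → sum (λ l → ω^ (s *₃ l) * ω^ (# 0 -₃ s *₃ l)) ≡ Hom.⟦_⟧ φ (ℤ.+ 3)

  module Sylows (𝕂 : Cyclotomic) where
    open Cyclotomic 𝕂
    open RingKit ring
    open DeterminantProduct ring using (prod)

    -- A group of order 24 as a product of its Sylow subgroups: π₈ and π₃ are the two
    -- projections, and the s-th character of the Sylow 2-subgroup sends j to z^(e s j).
    record Sylow (G : FiniteGroup) : Set where
      private module G = FiniteGroup G
      infixl 6 _⊹₈_
      field
        π₈    : Fin G.order → Fin 8
        π₃    : Fin G.order → Fin 3
        join  : Fin 8 → Fin 3 → Fin G.order
        _⊹₈_  : Fin 8 → Fin 8 → Fin 8
        e     : Fin 8 → Fin 8 → Fin 8
        form  : Poly 8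
      _·_ : Fin G.order → Fin G.order → Fin G.order
      k · l = Inverse.from G.enumeration (G.element k G.∙ G.element l)
      field
        π₈-·         : ∀ k l → π₈ (k · l) ≡ π₈ k ⊹₈ π₈ l
        π₃-·         : ∀ k l → π₃ (k · l) ≡ π₃ k +₃ π₃ l
        e-⊹          : ∀ s j k → e s (j ⊹₈ k) ≡ e s j +₈ e s k
        join-π       : ∀ k → join (π₈ k) (π₃ k) ≡ k
        π₈-join      : ∀ j l → π₈ (join j l) ≡ j
        π₃-join      : ∀ j l → π₃ (join j l) ≡ l
        e-orthogonal : ∀ s t → s ≢ t → sum (λ j → z^ (e s j -₈ e t j)) ≡ 0#
        e-diagonal   : ∀ s → sum (λ j → z^ (e s j -₈ e s j)) ≡ Hom.⟦_⟧ φ (ℤ.+ 8)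
        form-correct : ∀ (c : Fin 8 → Carrier) → prod (λ s → sum λ j → z^ (e s j) * c j) ≡ eval ring form c

    module Norms (G : FiniteGroup) (S : Sylow G) (a : Func (FiniteGroup.setoid G) (setoid ℤ)) where
      private module G = FiniteGroup G
      open Sylow S
      open Fourier ring φ G a using (transform; groupDeterminant)

      private
        π : Permutation G.order 24
        π = permutation (λ k → combine (π₈ k) (π₃ k)) (λ i → uncurry join (remQuot {8} 3 i))
          (λ i → trans (cong₂ combine (π₈-join (proj₁ (remQuot {8} 3 i)) (proj₂ (remQuot {8} 3 i))) (π₃-join (proj₁ (remQuot {8} 3 i)) (proj₂ (remQuot {8} 3 i)))) (combine-remQuot {8} 3 i))
          (λ k → trans (cong (uncurry join) (remQuot-combine (π₈ k) (π₃ k))) (join-π k))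

        module R₊ = Rearrange +-commutativeMonoid
        module R* = Rearrange *-commutativeMonoid
        open import Algebra.Properties.CommutativeMonoid.Sum *-commutativeMonoid using () renaming (sum-permute to prod-permute; sum-cong-≗ to prod-cong)

        split-sum : ∀ (f : Fin 8 → Fin 3 → Carrier) → sum (λ k → f (π₈ k) (π₃ k)) ≡ sum λ j → sum λ l → f j l
        split-sum f = trans
          (sum-cong-≗ (λ k → sym (cong (uncurry f) (remQuot-combine (π₈ k) (π₃ k)))))
          (trans (sym (sum-permute (λ i → uncurry f (remQuot {8} 3 i)) π)) (R₊.nested-sum f))

        split-prod : ∀ (f : Fin 8 → Fin 3 → Carrier) → prod (λ k → f (π₈ k) (π₃ k)) ≡ prod λ l → prod λ j → f j l
        split-prod f = trans
          (prod-cong (λ k → sym (cong (uncurry f) (remQuot-combine (π₈ k) (π₃ k)))))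
          (trans (sym (prod-permute (λ i → uncurry f (remQuot {8} 3 i)) π)) (R*.nested-sum′ f))

        -- The characters are indexed by the group elements themselves, each Sylow subgroup being
        -- isomorphic to its dual. The exponents of `X′` are negated, which makes it the conjugate
        -- table.
        X X′ : Fin G.order → Fin G.order → Carrier
        X  s k = z^ (e (π₈ s) (π₈ k)) * ω^ (π₃ s *₃ π₃ k)
        X′ k s = z^ (# 0 -₈ e (π₈ s) (π₈ k)) * ω^ (# 0 -₃ π₃ s *₃ π₃ k)

        X-· : ∀ s k l → X s (k · l) ≡ X s k * X s l
        X-· s k l = begin
          z^ (e (π₈ s) (π₈ (k · l))) * ω^ (π₃ s *₃ π₃ (k · l))
            ≡⟨ cong₂ (λ p q → z^ p * ω^ q)
                 (trans (cong (e (π₈ s)) (π₈-· k l)) (e-⊹ (π₈ s) (π₈ k) (π₈ l)))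
                 (trans (cong (π₃ s *₃_) (π₃-· k l)) (*₃-distribˡ (π₃ s) (π₃ k) (π₃ l))) ⟩
          z^ (e (π₈ s) (π₈ k) +₈ e (π₈ s) (π₈ l)) * ω^ (π₃ s *₃ π₃ k +₃ π₃ s *₃ π₃ l)
            ≡⟨ cong₂ _*_ (z^-+ (e (π₈ s) (π₈ k)) (e (π₈ s) (π₈ l))) (ω^-+ (π₃ s *₃ π₃ k) (π₃ s *₃ π₃ l)) ⟩
          (z^ (e (π₈ s) (π₈ k)) * z^ (e (π₈ s) (π₈ l))) * (ω^ (π₃ s *₃ π₃ k) * ω^ (π₃ s *₃ π₃ l))
            ≡⟨ solve 4 (λ a b c d → (a :* b) :* (c :* d) := (a :* c) :* (b :* d)) refl
                 (z^ (e (π₈ s) (π₈ k))) (z^ (e (π₈ s) (π₈ l))) (ω^ (π₃ s *₃ π₃ k)) (ω^ (π₃ s *₃ π₃ l)) ⟩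
          X s k * X s l ∎
          where open ≡-Reasoning

        product-sum : ∀ (f : Fin 8 → Carrier) (g : Fin 3 → Carrier) → sum (λ j → sum λ l → f j * g l) ≡ sum f * sum g
        product-sum f g = trans (sum-cong-≗ (λ j → sym (*-distribˡ-sum (f j) g))) (sym (*-distribʳ-sum (sum g) f))

        X-X′ : ∀ s t → sum (λ k → X s k * X′ k t) ≡
               sum (λ j → z^ (e (π₈ s) j -₈ e (π₈ t) j)) * sum (λ l → ω^ (π₃ s *₃ l) * ω^ (# 0 -₃ π₃ t *₃ l))
        X-X′ s t = begin
          sum (λ k → X s k * X′ k t)
            ≡⟨ sum-cong-≗ (λ k → solve 4 (λ a b c d → (a :* b) :* (c :* d) := (a :* c) :* (b :* d)) refl
                 (z^ (e (π₈ s) (π₈ k))) (ω^ (π₃ s *₃ π₃ k)) (z^ (# 0 -₈ e (π₈ t) (π₈ k))) (ω^ (# 0 -₃ π₃ t *₃ π₃ k))) ⟩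
          sum (λ k → (z^ (e (π₈ s) (π₈ k)) * z^ (# 0 -₈ e (π₈ t) (π₈ k))) * (ω^ (π₃ s *₃ π₃ k) * ω^ (# 0 -₃ π₃ t *₃ π₃ k)))
            ≡⟨ sum-cong-≗ (λ k → cong (λ y → y * (ω^ (π₃ s *₃ π₃ k) * ω^ (# 0 -₃ π₃ t *₃ π₃ k))) (z^-neg (e (π₈ s) (π₈ k)) (e (π₈ t) (π₈ k)))) ⟩
          sum (λ k → z^ (e (π₈ s) (π₈ k) -₈ e (π₈ t) (π₈ k)) * (ω^ (π₃ s *₃ π₃ k) * ω^ (# 0 -₃ π₃ t *₃ π₃ k)))
            ≡⟨ split-sum (λ j l → z^ (e (π₈ s) j -₈ e (π₈ t) j) * (ω^ (π₃ s *₃ l) * ω^ (# 0 -₃ π₃ t *₃ l))) ⟩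
          sum (λ j → sum λ l → z^ (e (π₈ s) j -₈ e (π₈ t) j) * (ω^ (π₃ s *₃ l) * ω^ (# 0 -₃ π₃ t *₃ l)))
            ≡⟨ product-sum (λ j → z^ (e (π₈ s) j -₈ e (π₈ t) j)) (λ l → ω^ (π₃ s *₃ l) * ω^ (# 0 -₃ π₃ t *₃ l)) ⟩
          sum (λ j → z^ (e (π₈ s) j -₈ e (π₈ t) j)) * sum (λ l → ω^ (π₃ s *₃ l) * ω^ (# 0 -₃ π₃ t *₃ l)) ∎
          where open ≡-Reasoning

        orthogonal : ∀ s t → s ≢ t → sum (λ k → X s k * X′ k t) ≡ 0#
        orthogonal s t s≢t with π₈ s ≟ π₈ t | π₃ s ≟ π₃ t
        ... | no ne  | _       = trans (X-X′ s t) (trans (cong (λ y → y * sum (λ l → ω^ (π₃ s *₃ l) * ω^ (# 0 -₃ π₃ t *₃ l))) (e-orthogonal (π₈ s) (π₈ t) ne)) (zeroˡ _))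
        ... | yes _  | no ne   = trans (X-X′ s t) (trans (cong (λ y → sum (λ j → z^ (e (π₈ s) j -₈ e (π₈ t) j)) * y) (ω^-orthogonal (π₃ s) (π₃ t) ne)) (zeroʳ _))
        ... | yes p  | yes q   = contradiction (trans (sym (join-π s)) (trans (cong₂ join p q) (join-π t))) s≢t

        diagonal : ∀ s → sum (λ k → X s k * X′ k s) ≡ Hom.⟦_⟧ φ (ℤ.+ 24)
        diagonal s = trans (X-X′ s s) (trans (cong₂ _*_ (e-diagonal (π₈ s)) (ω^-diagonal (π₃ s))) (sym (Hom.*-homo φ (ℤ.+ 8) (ℤ.+ 3))))

      coefficient : Fin 8 → Fin 3 → ℤ
      coefficient j l = a ⟨$⟩ G.element (join j l)

      f : Fin 8 → ℤ
      f j = coefficient j (# 0) ℤ.+ coefficient j (# 1) ℤ.+ coefficient j (# 2)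

      -- This is `c₀ + c₁ω + c₂ω²` in the basis `1 , ω`, by `ω² = -1 - ω`; `f` is the same sum with
      -- ω replaced by 1.
      g : Fin 8 → 𝔼.Carrier
      g j = coefficient j (# 0) ℤ.- coefficient j (# 2) , coefficient j (# 1) ℤ.- coefficient j (# 2)

      private
        component : Fin 3 → Fin 8 → 𝔼.Carrier
        component zero             j = f j , 0ℤ
        component (suc zero)       j = g j
        component (suc (suc zero)) j = Hom.⟦_⟧ conj (g j)

        κ-component : ∀ l j → sum (λ m → ω^ (l *₃ m) * Hom.⟦_⟧ φ (coefficient j m)) ≡ Hom.⟦_⟧ κ (component l j)
        κ-component l j = trans (by-cases l) (sym (basis (component l j)))
          where
          basis : ∀ w → Hom.⟦_⟧ κ w ≡ Hom.⟦_⟧ φ (proj₁ w) + ω * Hom.⟦_⟧ φ (proj₂ w)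
          basis (x , y) = trans (cong (Hom.⟦_⟧ κ) (cong₂ _,_
              (Zk.solve 2 (λ x y → x Zk.:= x Zk.:+ (Zk.con 0ℤ Zk.:* y Zk.:+ Zk.con -1ℤ Zk.:* (Zk.con 1ℤ Zk.:* Zk.con 0ℤ))) refl x y)
              (Zk.solve 1 (λ y → y Zk.:= Zk.con 0ℤ Zk.:+ (Zk.con 0ℤ Zk.:* Zk.con 0ℤ Zk.:+ Zk.con 1ℤ Zk.:* y Zk.:+ Zk.con -1ℤ Zk.:* (Zk.con 1ℤ Zk.:* Zk.con 0ℤ))) refl y)))
            (trans (Hom.+-homo κ (x , 0ℤ) (𝔼.ω 𝔼.* (y , 0ℤ))) (cong (λ t → Hom.⟦_⟧ φ x + t) (Hom.*-homo κ 𝔼.ω (y , 0ℤ))))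

          c₀ = coefficient j (# 0)
          c₁ = coefficient j (# 1)
          c₂ = coefficient j (# 2)

          by-cases : ∀ l → sum (λ m → ω^ (l *₃ m) * Hom.⟦_⟧ φ (coefficient j m)) ≡
                     Hom.⟦_⟧ φ (proj₁ (component l j)) + ω * Hom.⟦_⟧ φ (proj₂ (component l j))
          by-cases zero = trans
            (solve 4 (λ a b c w → con 1ℤ :* a :+ (con 1ℤ :* b :+ (con 1ℤ :* c :+ con 0ℤ)) := a :+ b :+ c :+ w :* con 0ℤ) refl
              (Hom.⟦_⟧ φ c₀) (Hom.⟦_⟧ φ c₁) (Hom.⟦_⟧ φ c₂) ω)
            (cong₂ (λ s t → s + ω * t) (sym (trans (Hom.+-homo φ (c₀ ℤ.+ c₁) c₂) (cong (λ t → t + Hom.⟦_⟧ φ c₂) (Hom.+-homo φ c₀ c₁)))) (sym (Hom.0-homo φ)))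
          by-cases (suc zero) = trans
            (solve 4 (λ a b c w → con 1ℤ :* a :+ (w :* b :+ ((:- con 1ℤ :+ :- w) :* c :+ con 0ℤ)) := (a :+ :- c) :+ w :* (b :+ :- c)) refl
              (Hom.⟦_⟧ φ c₀) (Hom.⟦_⟧ φ c₁) (Hom.⟦_⟧ φ c₂) ω)
            (cong₂ (λ s t → s + ω * t) (sym (φ-minus c₀ c₂)) (sym (φ-minus c₁ c₂)))
            where
            φ-minus : ∀ x y → Hom.⟦_⟧ φ (x ℤ.- y) ≡ Hom.⟦_⟧ φ x + - Hom.⟦_⟧ φ y
            φ-minus x y = trans (Hom.+-homo φ x (ℤ.- y)) (cong (λ t → Hom.⟦_⟧ φ x + t) (Hom.-‿homo φ y))
          by-cases (suc (suc zero)) = trans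
            (solve 4 (λ a b c w → con 1ℤ :* a :+ ((:- con 1ℤ :+ :- w) :* b :+ (w :* c :+ con 0ℤ)) := ((a :+ :- c) :+ :- (b :+ :- c)) :+ w :* :- (b :+ :- c)) refl
              (Hom.⟦_⟧ φ c₀) (Hom.⟦_⟧ φ c₁) (Hom.⟦_⟧ φ c₂) ω)
            (cong₂ (λ s t → s + ω * t)
              (sym (trans (φ-minus (c₀ ℤ.- c₂) (c₁ ℤ.- c₂)) (cong₂ (λ s t → s + - t) (φ-minus c₀ c₂) (φ-minus c₁ c₂))))
              (sym (trans (Hom.-‿homo φ (c₁ ℤ.- c₂)) (cong -_ (φ-minus c₁ c₂)))))
            where
            φ-minus : ∀ x y → Hom.⟦_⟧ φ (x ℤ.- y) ≡ Hom.⟦_⟧ φ x + - Hom.⟦_⟧ φ y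
            φ-minus x y = trans (Hom.+-homo φ x (ℤ.- y)) (cong (λ t → Hom.⟦_⟧ φ x + t) (Hom.-‿homo φ y))

        transform-split : ∀ s → transform X s ≡
                          sum (λ j → z^ (e (π₈ s) j) * Hom.⟦_⟧ κ (component (π₃ s) j))
        transform-split s = begin
          sum (λ k → X s k * Hom.⟦_⟧ φ (a ⟨$⟩ G.element k))
            ≡⟨ sum-cong-≗ (λ k → cong (λ m → X s k * Hom.⟦_⟧ φ (a ⟨$⟩ G.element m)) (sym (join-π k))) ⟩
          sum (λ k → X s k * Hom.⟦_⟧ φ (coefficient (π₈ k) (π₃ k)))
            ≡⟨ split-sum (λ j l → z^ (e (π₈ s) j) * ω^ (π₃ s *₃ l) * Hom.⟦_⟧ φ (coefficient j l)) ⟩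
          sum (λ j → sum λ l → z^ (e (π₈ s) j) * ω^ (π₃ s *₃ l) * Hom.⟦_⟧ φ (coefficient j l))
            ≡⟨ sum-cong-≗ (λ j → trans
                 (sum-cong-≗ (λ l → *-assoc (z^ (e (π₈ s) j)) (ω^ (π₃ s *₃ l)) (Hom.⟦_⟧ φ (coefficient j l))))
                 (trans (sym (*-distribˡ-sum (z^ (e (π₈ s) j)) (λ l → ω^ (π₃ s *₃ l) * Hom.⟦_⟧ φ (coefficient j l))))
                   (cong (λ y → z^ (e (π₈ s) j) * y) (κ-component (π₃ s) j)))) ⟩
          sum (λ j → z^ (e (π₈ s) j) * Hom.⟦_⟧ κ (component (π₃ s) j)) ∎
          where open ≡-Reasoning

      -- The two nontrivial characters of C₃ give conjugate values of the form, whose product is a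
      -- norm. The equation is proved in ℤ[ζ₂₄] and descends because `φ` is injective.
      determinant : Defs.det (groupMatrix G a) ≡ eval ℤ-ring form f ℤ.* norm (eval 𝔼 form g)
      determinant = φ-injective _ _ (begin
        Hom.⟦_⟧ φ (Defs.det (groupMatrix G a))
          ≡⟨ groupDeterminant X X′ (Hom.⟦_⟧ φ (ℤ.+ 24)) 24-regular X-· diagonal orthogonal ⟩
        prod (transform X)
          ≡⟨ prod-cong transform-split ⟩
        prod (λ s → sum (λ j → z^ (e (π₈ s) j) * Hom.⟦_⟧ κ (component (π₃ s) j)))
          ≡⟨ split-prod (λ s l → sum (λ j → z^ (e s j) * Hom.⟦_⟧ κ (component l j))) ⟩
        prod (λ l → prod λ s → sum (λ j → z^ (e s j) * Hom.⟦_⟧ κ (component l j)))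
          ≡⟨ prod-cong (λ l → trans (form-correct (λ j → Hom.⟦_⟧ κ (component l j)))
               (sym (eval-homo κ form (λ _ → refl)))) ⟩
        prod (λ l → Hom.⟦_⟧ κ (eval 𝔼 form (component l)))
          ≡⟨ solve 3 (λ a b c → a :* (b :* (c :* con 1ℤ)) := a :* (b :* c)) refl
               (Hom.⟦_⟧ κ (eval 𝔼 form (component (# 0)))) (Hom.⟦_⟧ κ (eval 𝔼 form g)) (Hom.⟦_⟧ κ (eval 𝔼 form (component (# 2)))) ⟩
        Hom.⟦_⟧ κ (eval 𝔼 form (component (# 0))) * (Hom.⟦_⟧ κ (eval 𝔼 form g) * Hom.⟦_⟧ κ (eval 𝔼 form (component (# 2))))
          ≡⟨ cong₂ (λ p q → Hom.⟦_⟧ κ p * (Hom.⟦_⟧ κ (eval 𝔼 form g) * Hom.⟦_⟧ κ q))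
               (sym (eval-homo 𝔼.ι form (λ _ → refl))) (sym (eval-homo conj form (λ _ → refl))) ⟩
        Hom.⟦_⟧ φ P * (Hom.⟦_⟧ κ Q * Hom.⟦_⟧ κ (Hom.⟦_⟧ conj Q))
          ≡⟨ cong (λ y → Hom.⟦_⟧ φ P * y) (trans (sym (Hom.*-homo κ Q (Hom.⟦_⟧ conj Q))) (cong (Hom.⟦_⟧ κ) (*-conj Q))) ⟩
        Hom.⟦_⟧ φ P * Hom.⟦_⟧ φ (norm Q)
          ≡⟨ Hom.*-homo φ P (norm Q) ⟨
        Hom.⟦_⟧ φ (P ℤ.* norm Q) ∎)
        where
        open ≡-Reasoning
        P = eval ℤ-ring form f
        Q = eval 𝔼 form g

open SylowSubgroups

-- Products over the characters of the groups of order 8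

module CharacterProduct where
  module CharacterProducts (𝕂 : Cyclotomic) where
    open Cyclotomic 𝕂
    open RingKit ring
    open DeterminantProduct ring using (prod)
    open ≡-Reasoning

    private
      -- The ring solver does not know `z⁴ = -1`, so each identity names the cofactor `t` of the
      -- multiple of `z⁴ + 1` by which its sides differ.
      reduce : ∀ {x} y t → x ≡ y + ((z * z) * (z * z) + 1#) * t → x ≡ y
      reduce y t eq = trans eq (trans (cong (λ w → y + w * t) z⁴+1) (solve 2 (λ y t → y :+ con 0ℤ :* t := y) refl y t))

    infixl 9 _⟪_⟫
    _⟪_⟫ : (Fin 4 → Fin 8) → (Fin 4 → Carrier) → Carrier
    k ⟪ u ⟫ = sum λ j → z^ (k j) * u j

    gaussian-pair : ∀ p q → (p + z * z * q) * (p - z * z * q) ≡ p * p + q * q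
    gaussian-pair p q = reduce (p * p + q * q) (- (q * q))
      (solve 3 (λ p q z → (p :+ z :* z :* q) :* (p :- z :* z :* q)
        := (p :* p :+ q :* q) :+ ((z :* z) :* (z :* z) :+ con 1ℤ) :* (:- (q :* q))) refl p q z)

    module _ (u : Fin 4 → Carrier) where
      private
        u₀ = u (# 0)
        u₁ = u (# 1)
        u₂ = u (# 2)
        u₃ = u (# 3)
        X = u₀ * u₀ - u₂ * u₂ + (u₁ * u₃ + u₁ * u₃)
        Y = (u₀ * u₂ + u₀ * u₂) - u₁ * u₁ + u₃ * u₃

      -- The exponents come with an equation so that the statement can use the short name `k`;
      -- matching on `refl` turns every `z^` into a literal power. The values at 1 and -1, and those
      -- at i and -i, are multiplied in pairs.
      C4-product : (k : Fin 4 → Fin 4 → Fin 8) → k ≡ (λ s j → (2 ℕ.* (toℕ s ℕ.* toℕ j)) mod 8) →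
        k (# 0) ⟪ u ⟫ * (k (# 1) ⟪ u ⟫ * (k (# 2) ⟪ u ⟫ * k (# 3) ⟪ u ⟫)) ≡
        (u₀ + u₂ + (u₁ + u₃)) * (u₀ + u₂ - (u₁ + u₃)) * ((u₀ - u₂) * (u₀ - u₂) + (u₁ - u₃) * (u₁ - u₃))
      C4-product k refl = begin
        k (# 0) ⟪ u ⟫ * (k (# 1) ⟪ u ⟫ * (k (# 2) ⟪ u ⟫ * k (# 3) ⟪ u ⟫))
          ≡⟨ solve 4 (λ a b c d → a :* (b :* (c :* d)) := (a :* c) :* (b :* d)) refl (k (# 0) ⟪ u ⟫) (k (# 1) ⟪ u ⟫) (k (# 2) ⟪ u ⟫) (k (# 3) ⟪ u ⟫) ⟩
        (k (# 0) ⟪ u ⟫ * k (# 2) ⟪ u ⟫) * (k (# 1) ⟪ u ⟫ * k (# 3) ⟪ u ⟫)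
          ≡⟨ cong₂ _*_
               (solve 4 (λ a b c d →
                 (con 1ℤ :* a :+ (con 1ℤ :* b :+ (con 1ℤ :* c :+ (con 1ℤ :* d :+ con 0ℤ)))) :*
                 (con 1ℤ :* a :+ (:- con 1ℤ :* b :+ (con 1ℤ :* c :+ (:- con 1ℤ :* d :+ con 0ℤ))))
                 := (a :+ c :+ (b :+ d)) :* (a :+ c :- (b :+ d))) refl u₀ u₁ u₂ u₃)
               (trans (solve 5 (λ a b c d z →
                 (con 1ℤ :* a :+ (z :* z :* b :+ (:- con 1ℤ :* c :+ (:- (z :* z) :* d :+ con 0ℤ)))) :*
                 (con 1ℤ :* a :+ (:- (z :* z) :* b :+ (:- con 1ℤ :* c :+ (z :* z :* d :+ con 0ℤ))))
                 := ((a :- c) :+ z :* z :* (b :- d)) :* ((a :- c) :- z :* z :* (b :- d))) refl u₀ u₁ u₂ u₃ z)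
                 (gaussian-pair (u₀ - u₂) (u₁ - u₃))) ⟩
        (u₀ + u₂ + (u₁ + u₃)) * (u₀ + u₂ - (u₁ + u₃)) * ((u₀ - u₂) * (u₀ - u₂) + (u₁ - u₃) * (u₁ - u₃)) ∎

      C2²-product : (k : Fin 4 → Fin 4 → Fin 8) →
        k ≡ (λ s j → (4 ℕ.* (toℕ s / 2 ℕ.* (toℕ j / 2) ℕ.+ toℕ s % 2 ℕ.* (toℕ j % 2))) mod 8) →
        k (# 0) ⟪ u ⟫ * (k (# 1) ⟪ u ⟫ * (k (# 2) ⟪ u ⟫ * k (# 3) ⟪ u ⟫)) ≡
        (u₀ + u₂ + (u₁ + u₃)) * (u₀ + u₂ - (u₁ + u₃)) * ((u₀ - u₂ + (u₁ - u₃)) * (u₀ - u₂ - (u₁ - u₃)))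
      C2²-product k refl = solve 4 (λ a b c d →
          (con 1ℤ :* a :+ (con 1ℤ :* b :+ (con 1ℤ :* c :+ (con 1ℤ :* d :+ con 0ℤ)))) :*
          ((con 1ℤ :* a :+ (:- con 1ℤ :* b :+ (con 1ℤ :* c :+ (:- con 1ℤ :* d :+ con 0ℤ)))) :*
          ((con 1ℤ :* a :+ (con 1ℤ :* b :+ (:- con 1ℤ :* c :+ (:- con 1ℤ :* d :+ con 0ℤ)))) :*
          (con 1ℤ :* a :+ (:- con 1ℤ :* b :+ (:- con 1ℤ :* c :+ (con 1ℤ :* d :+ con 0ℤ))))))
          := (a :+ c :+ (b :+ d)) :* (a :+ c :- (b :+ d)) :* ((a :- c :+ (b :- d)) :* (a :- c :- (b :- d)))) refl u₀ u₁ u₂ u₃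

      -- The odd numbers `2s + 1` run over the primitive eighth roots: `z` and `z⁵ = -z` together
      -- give `X + i Y`, and `z³` and `z⁷` give `X - i Y`.
      ζ₈-product : (k : Fin 4 → Fin 4 → Fin 8) → k ≡ (λ s j → ((2 ℕ.* toℕ s ℕ.+ 1) ℕ.* toℕ j) mod 8) →
        k (# 0) ⟪ u ⟫ * (k (# 1) ⟪ u ⟫ * (k (# 2) ⟪ u ⟫ * k (# 3) ⟪ u ⟫)) ≡ X * X + Y * Y
      ζ₈-product k refl = begin
        k (# 0) ⟪ u ⟫ * (k (# 1) ⟪ u ⟫ * (k (# 2) ⟪ u ⟫ * k (# 3) ⟪ u ⟫))
          ≡⟨ solve 4 (λ a b c d → a :* (b :* (c :* d)) := (a :* c) :* (b :* d)) refl (k (# 0) ⟪ u ⟫) (k (# 1) ⟪ u ⟫) (k (# 2) ⟪ u ⟫) (k (# 3) ⟪ u ⟫) ⟩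
        (k (# 0) ⟪ u ⟫ * k (# 2) ⟪ u ⟫) * (k (# 1) ⟪ u ⟫ * k (# 3) ⟪ u ⟫)
          ≡⟨ cong₂ _*_
               (reduce (X + z * z * Y) (u₂ * u₂ - (u₁ * u₃ + u₁ * u₃) - z * z * (u₃ * u₃)) (solve 5 (λ a b c d z →
                 (con 1ℤ :* a :+ (z :* b :+ (z :* z :* c :+ (z :* z :* z :* d :+ con 0ℤ)))) :*
                 (con 1ℤ :* a :+ (:- z :* b :+ (z :* z :* c :+ (:- (z :* z :* z) :* d :+ con 0ℤ))))
                 := (a :* a :- c :* c :+ (b :* d :+ b :* d)) :+ z :* z :* ((a :* c :+ a :* c) :- b :* b :+ d :* d)
                    :+ ((z :* z) :* (z :* z) :+ con 1ℤ) :* (c :* c :- (b :* d :+ b :* d) :- z :* z :* (d :* d))) refl u₀ u₁ u₂ u₃ z))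
               (reduce (X - z * z * Y) (u₂ * u₂ - (u₁ * u₃ + u₁ * u₃) - z * z * (u₁ * u₁)) (solve 5 (λ a b c d z →
                 (con 1ℤ :* a :+ (z :* z :* z :* b :+ (:- (z :* z) :* c :+ (z :* d :+ con 0ℤ)))) :*
                 (con 1ℤ :* a :+ (:- (z :* z :* z) :* b :+ (:- (z :* z) :* c :+ (:- z :* d :+ con 0ℤ))))
                 := (a :* a :- c :* c :+ (b :* d :+ b :* d)) :- z :* z :* ((a :* c :+ a :* c) :- b :* b :+ d :* d)
                    :+ ((z :* z) :* (z :* z) :+ con 1ℤ) :* (c :* c :- (b :* d :+ b :* d) :- z :* z :* (b :* b))) refl u₀ u₁ u₂ u₃ z)) ⟩
        (X + z * z * Y) * (X - z * z * Y)
          ≡⟨ gaussian-pair X Y ⟩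
        X * X + Y * Y ∎

    module _ (c : Fin 8 → Carrier) (k : Fin 8 → Fin 8) where
      -- The elements with index `j` and `j + 4` differ by one of order two, where a character is 1
      -- or -1; accordingly it sees only the sums, or in `odd-character` only the differences, of
      -- the two coefficients.
      even-character : (∀ j → z^ (k (4 ↑ʳ j)) ≡ z^ (k (j ↑ˡ 4))) →
        sum (λ j → z^ (k j) * c j) ≡ (λ j → k (j ↑ˡ 4)) ⟪ (λ j → c (j ↑ˡ 4) + c (4 ↑ʳ j)) ⟫
      even-character eq = trans (cong₂ (λ p q → z^ (k (# 0)) * c (# 0) + (z^ (k (# 1)) * c (# 1) + (z^ (k (# 2)) * c (# 2) + (z^ (k (# 3)) * c (# 3) + (p * c (# 4) + (q * c (# 5) + (z^ (k (# 6)) * c (# 6) + (z^ (k (# 7)) * c (# 7) + 0#)))))))) (eq (# 0)) (eq (# 1)))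
        (trans (cong₂ (λ p q → z^ (k (# 0)) * c (# 0) + (z^ (k (# 1)) * c (# 1) + (z^ (k (# 2)) * c (# 2) + (z^ (k (# 3)) * c (# 3) + (z^ (k (# 0)) * c (# 4) + (z^ (k (# 1)) * c (# 5) + (p * c (# 6) + (q * c (# 7) + 0#)))))))) (eq (# 2)) (eq (# 3)))
        (solve 12 (λ s₀ s₁ s₂ s₃ c₀ c₁ c₂ c₃ c₄ c₅ c₆ c₇ →
          s₀ :* c₀ :+ (s₁ :* c₁ :+ (s₂ :* c₂ :+ (s₃ :* c₃ :+ (s₀ :* c₄ :+ (s₁ :* c₅ :+ (s₂ :* c₆ :+ (s₃ :* c₇ :+ con 0ℤ)))))))
          := s₀ :* (c₀ :+ c₄) :+ (s₁ :* (c₁ :+ c₅) :+ (s₂ :* (c₂ :+ c₆) :+ (s₃ :* (c₃ :+ c₇) :+ con 0ℤ)))) refl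
          (z^ (k (# 0))) (z^ (k (# 1))) (z^ (k (# 2))) (z^ (k (# 3))) (c (# 0)) (c (# 1)) (c (# 2)) (c (# 3)) (c (# 4)) (c (# 5)) (c (# 6)) (c (# 7))))

      odd-character : (∀ j → z^ (k (4 ↑ʳ j)) ≡ - z^ (k (j ↑ˡ 4))) →
        sum (λ j → z^ (k j) * c j) ≡ (λ j → k (j ↑ˡ 4)) ⟪ (λ j → c (j ↑ˡ 4) - c (4 ↑ʳ j)) ⟫
      odd-character eq = trans (cong₂ (λ p q → z^ (k (# 0)) * c (# 0) + (z^ (k (# 1)) * c (# 1) + (z^ (k (# 2)) * c (# 2) + (z^ (k (# 3)) * c (# 3) + (p * c (# 4) + (q * c (# 5) + (z^ (k (# 6)) * c (# 6) + (z^ (k (# 7)) * c (# 7) + 0#)))))))) (eq (# 0)) (eq (# 1)))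
        (trans (cong₂ (λ p q → z^ (k (# 0)) * c (# 0) + (z^ (k (# 1)) * c (# 1) + (z^ (k (# 2)) * c (# 2) + (z^ (k (# 3)) * c (# 3) + (- z^ (k (# 0)) * c (# 4) + (- z^ (k (# 1)) * c (# 5) + (p * c (# 6) + (q * c (# 7) + 0#)))))))) (eq (# 2)) (eq (# 3)))
        (solve 12 (λ s₀ s₁ s₂ s₃ c₀ c₁ c₂ c₃ c₄ c₅ c₆ c₇ →
          s₀ :* c₀ :+ (s₁ :* c₁ :+ (s₂ :* c₂ :+ (s₃ :* c₃ :+ (:- s₀ :* c₄ :+ (:- s₁ :* c₅ :+ (:- s₂ :* c₆ :+ (:- s₃ :* c₇ :+ con 0ℤ)))))))
          := s₀ :* (c₀ :- c₄) :+ (s₁ :* (c₁ :- c₅) :+ (s₂ :* (c₂ :- c₆) :+ (s₃ :* (c₃ :- c₇) :+ con 0ℤ)))) refl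
          (z^ (k (# 0))) (z^ (k (# 1))) (z^ (k (# 2))) (z^ (k (# 3))) (c (# 0)) (c (# 1)) (c (# 2)) (c (# 3)) (c (# 4)) (c (# 5)) (c (# 6)) (c (# 7))))

    private
      -- In C₈ the characters that are 1 on the element of order two with index 4 are those of even
      -- index; in the other two groups they are the first four, which is the case of `halve`.
      interleave : ∀ f₀ f₁ f₂ f₃ f₄ f₅ f₆ f₇ →
        f₀ * (f₁ * (f₂ * (f₃ * (f₄ * (f₅ * (f₆ * (f₇ * 1#))))))) ≡ (f₀ * (f₂ * (f₄ * f₆))) * (f₁ * (f₃ * (f₅ * f₇)))
      interleave = solve 8 (λ f₀ f₁ f₂ f₃ f₄ f₅ f₆ f₇ →
        f₀ :* (f₁ :* (f₂ :* (f₃ :* (f₄ :* (f₅ :* (f₆ :* (f₇ :* con 1ℤ))))))) := (f₀ :* (f₂ :* (f₄ :* f₆))) :* (f₁ :* (f₃ :* (f₅ :* f₇)))) refl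

      halve : ∀ f₀ f₁ f₂ f₃ f₄ f₅ f₆ f₇ →
        f₀ * (f₁ * (f₂ * (f₃ * (f₄ * (f₅ * (f₆ * (f₇ * 1#))))))) ≡ (f₀ * (f₁ * (f₂ * f₃))) * (f₄ * (f₅ * (f₆ * f₇)))
      halve = solve 8 (λ f₀ f₁ f₂ f₃ f₄ f₅ f₆ f₇ →
        f₀ :* (f₁ :* (f₂ :* (f₃ :* (f₄ :* (f₅ :* (f₆ :* (f₇ :* con 1ℤ))))))) := (f₀ :* (f₁ :* (f₂ :* f₃))) :* (f₄ :* (f₅ :* (f₆ :* f₇)))) refl

      four : ∀ {a a′ b b′ c c′ d d′} → a ≡ a′ → b ≡ b′ → c ≡ c′ → d ≡ d′ → a * (b * (c * d)) ≡ a′ * (b′ * (c′ * d′))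
      four refl refl refl refl = refl

    module _ (e : Fin 8 → Fin 8 → Fin 8) (c : Fin 8 → Carrier) where
      private
        F : Fin 8 → Carrier
        F s = sum λ j → z^ (e s j) * c j

        c⁺ c⁻ : Fin 4 → Carrier
        c⁺ j = c (j ↑ˡ 4) + c (4 ↑ʳ j)
        c⁻ j = c (j ↑ˡ 4) - c (4 ↑ʳ j)

        even : ∀ s → (∀ j → z^ (e s (4 ↑ʳ j)) ≡ z^ (e s (j ↑ˡ 4))) → F s ≡ (λ j → e s (j ↑ˡ 4)) ⟪ c⁺ ⟫
        even s = even-character c (e s)

        odd : ∀ s → (∀ j → z^ (e s (4 ↑ʳ j)) ≡ - z^ (e s (j ↑ˡ 4))) → F s ≡ (λ j → e s (j ↑ˡ 4)) ⟪ c⁻ ⟫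
        odd s = odd-character c (e s)

        by-four : ∀ {P : Fin 4 → Set} → P (# 0) → P (# 1) → P (# 2) → P (# 3) → ∀ j → P j
        by-four p₀ p₁ p₂ p₃ zero                   = p₀
        by-four p₀ p₁ p₂ p₃ (suc zero)             = p₁
        by-four p₀ p₁ p₂ p₃ (suc (suc zero))       = p₂
        by-four p₀ p₁ p₂ p₃ (suc (suc (suc zero))) = p₃

        neg² : ∀ {x} → x ≡ - - x
        neg² {x} = sym (-‿involutive x)

      C8-form : e ≡ (λ s j → (toℕ s ℕ.* toℕ j) mod 8) → prod F ≡ eval ring Forms.C8 c
      C8-form refl = trans (interleave (F (# 0)) (F (# 1)) (F (# 2)) (F (# 3)) (F (# 4)) (F (# 5)) (F (# 6)) (F (# 7)))
        (cong₂ _*_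
          (trans (four (even (# 0) (by-four refl refl refl refl)) (even (# 2) (by-four refl refl refl refl))
                       (even (# 4) (by-four refl refl refl refl)) (even (# 6) (by-four refl refl refl refl))) (C4-product c⁺ _ refl))
          (trans (four (odd (# 1) (by-four refl refl refl refl)) (odd (# 3) (by-four refl refl neg² refl))
                       (odd (# 5) (by-four refl neg² refl neg²)) (odd (# 7) (by-four refl neg² neg² neg²))) (ζ₈-product c⁻ _ refl)))

      C2×C4-form : e ≡ (λ s j → (4 ℕ.* (toℕ s / 4 ℕ.* (toℕ j / 4)) ℕ.+ 2 ℕ.* (toℕ s % 4 ℕ.* (toℕ j % 4))) mod 8) →
        prod F ≡ eval ring Forms.C2×C4 c
      C2×C4-form refl = trans (halve (F (# 0)) (F (# 1)) (F (# 2)) (F (# 3)) (F (# 4)) (F (# 5)) (F (# 6)) (F (# 7)))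
        (cong₂ _*_
          (trans (four (even (# 0) (by-four refl refl refl refl)) (even (# 1) (by-four refl refl refl refl))
                       (even (# 2) (by-four refl refl refl refl)) (even (# 3) (by-four refl refl refl refl))) (C4-product c⁺ _ refl))
          (trans (four (odd (# 4) (by-four refl refl refl refl)) (odd (# 5) (by-four refl refl neg² neg²))
                       (odd (# 6) (by-four refl neg² refl neg²)) (odd (# 7) (by-four refl neg² neg² refl))) (C4-product c⁻ _ refl)))

      C2³-form : e ≡ (λ s j → (4 ℕ.* (toℕ s / 4 ℕ.* (toℕ j / 4)) ℕ.+ 4 ℕ.* (toℕ s % 4 / 2 ℕ.* (toℕ j % 4 / 2) ℕ.+ toℕ s % 2 ℕ.* (toℕ j % 2))) mod 8) →
        prod F ≡ eval ring Forms.C2³ c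
      C2³-form refl = trans (halve (F (# 0)) (F (# 1)) (F (# 2)) (F (# 3)) (F (# 4)) (F (# 5)) (F (# 6)) (F (# 7)))
        (cong₂ _*_
          (trans (four (even (# 0) (by-four refl refl refl refl)) (even (# 1) (by-four refl refl refl refl))
                       (even (# 2) (by-four refl refl refl refl)) (even (# 3) (by-four refl refl refl refl))) (C2²-product c⁺ _ refl))
          (trans (four (odd (# 4) (by-four refl refl refl refl)) (odd (# 5) (by-four refl neg² refl neg²))
                       (odd (# 6) (by-four refl refl neg² neg²)) (odd (# 7) (by-four refl neg² neg² refl))) (C2²-product c⁻ _ refl)))

open CharacterProduct

-- A model of ℤ[ζ₂₄], verified by computation

module RootsOfUnity where
  module Tower where
    module 𝔼-i = QuadraticHom 𝔼 𝔼.0# (𝔼.- 𝔼.1#)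

    𝔼[i] : PropRing
    𝔼[i] = Quadratic.extension 𝔼 𝔼.0# (𝔼.- 𝔼.1#)

    module 𝔼[i]-z = QuadraticHom 𝔼[i] (PropRing.0# 𝔼[i]) 𝔼-i.θ

    -- ℤ[ζ₂₄] as a tower of quadratic extensions, with ω² = -1 - ω, i² = -1 and z² = i.
    𝕂 : PropRing
    𝕂 = Quadratic.extension 𝔼[i] (PropRing.0# 𝔼[i]) 𝔼-i.θ

    κ : Hom 𝔼 𝕂
    κ = 𝔼[i]-z.embed ∘ʰ 𝔼-i.embed

    open RingKit 𝕂

    z : Carrier
    z = 𝔼[i]-z.θ

    _≟ᴷ_ : DecidableEquality Carrier
    _≟ᴷ_ = ≡-dec ≟ᴱⁱ ≟ᴱⁱ
      where
      ≟ᴱ : DecidableEquality 𝔼.Carrier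
      ≟ᴱ = ≡-dec ℤ._≟_ ℤ._≟_
      ≟ᴱⁱ : DecidableEquality (PropRing.Carrier 𝔼[i])
      ≟ᴱⁱ = ≡-dec ≟ᴱ ≟ᴱ

    24-regular : ∀ x → Hom.⟦_⟧ (Powers.φ 𝕂 z κ) (ℤ.+ 24) * x ≡ 0# → x ≡ 0#
    24-regular = 𝔼[i]-z.regular ((ℤ.+ 24 , 0ℤ) , 𝔼.0#) (𝔼-i.regular (ℤ.+ 24 , 0ℤ) (𝔼.regular (ℤ.+ 24) λ x eq → ℤ.*-cancelˡ-≡ (ℤ.+ 24) x 0ℤ eq))

    open Powers 𝕂 z κ public

  -- A factor C₂ takes its values in powers of `z⁴ = -1` and a factor C₄ in powers of `z² = i`,
  -- whence the coefficients 4 and 2; the digits of `s` and `j` are paired coordinatewise.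
  e-C8 e-C2×C4 e-C2³ : Fin 8 → Fin 8 → Fin 8
  e-C8    s j = (toℕ s ℕ.* toℕ j) mod 8
  e-C2×C4 s j = (4 ℕ.* (toℕ s / 4 ℕ.* (toℕ j / 4)) ℕ.+ 2 ℕ.* (toℕ s % 4 ℕ.* (toℕ j % 4))) mod 8
  e-C2³   s j = (4 ℕ.* (toℕ s / 4 ℕ.* (toℕ j / 4)) ℕ.+ 4 ℕ.* (toℕ s % 4 / 2 ℕ.* (toℕ j % 4 / 2) ℕ.+ toℕ s % 2 ℕ.* (toℕ j % 2))) mod 8

  abstract
    -- The finite identities are settled by deciding equality in the tower; `abstract` then keeps
    -- later type checking from unfolding it.
    ℤ[ζ₂₄] : Cyclotomic
    ℤ[ζ₂₄] = record
      { ring          = 𝕂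
      ; z             = z
      ; κ             = κ
      ; z⁴+1          = refl
      ; φ-injective   = λ x y eq → cong (λ t → proj₁ (proj₁ (proj₁ t))) eq
      ; 24-regular    = 24-regular
      ; z^-+          = from-yes (all? λ a → all? λ b → z^ (a +₈ b) ≟ᴷ (z^ a * z^ b))
      ; z^-neg        = from-yes (all? λ a → all? λ b → (z^ a * z^ (# 0 -₈ b)) ≟ᴷ z^ (a -₈ b))
      ; ω^-+          = from-yes (all? λ a → all? λ b → ω^ (a +₃ b) ≟ᴷ (ω^ a * ω^ b))
      ; ω^-orthogonal = from-yes (all? λ s → all? λ t → ¬? (s ≟ t) →-dec (sum (λ l → ω^ (s *₃ l) * ω^ (# 0 -₃ t *₃ l)) ≟ᴷ 0#))
      ; ω^-diagonal   = from-yes (all? λ s → sum (λ l → ω^ (s *₃ l) * ω^ (# 0 -₃ s *₃ l)) ≟ᴷ Hom.⟦_⟧ φ (ℤ.+ 3))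
      }
      where
      open Tower
      open RingKit 𝕂

  module ζ₂₄ where
    open Cyclotomic ℤ[ζ₂₄] public
    open RingKit ring public

  abstract
    e-C8-orthogonal : ∀ s t → s ≢ t → ζ₂₄.sum (λ j → ζ₂₄.z^ (e-C8 s j -₈ e-C8 t j)) ≡ ζ₂₄.0#
    e-C8-orthogonal = from-yes (all? λ s → all? λ t → ¬? (s ≟ t) →-dec (ζ₂₄.sum (λ j → ζ₂₄.z^ (e-C8 s j -₈ e-C8 t j)) Tower.≟ᴷ ζ₂₄.0#))

    e-C8-diagonal : ∀ s → ζ₂₄.sum (λ j → ζ₂₄.z^ (e-C8 s j -₈ e-C8 s j)) ≡ Hom.⟦_⟧ ζ₂₄.φ (ℤ.+ 8)
    e-C8-diagonal = from-yes (all? λ s → ζ₂₄.sum (λ j → ζ₂₄.z^ (e-C8 s j -₈ e-C8 s j)) Tower.≟ᴷ Hom.⟦_⟧ ζ₂₄.φ (ℤ.+ 8))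

    e-C2×C4-orthogonal : ∀ s t → s ≢ t → ζ₂₄.sum (λ j → ζ₂₄.z^ (e-C2×C4 s j -₈ e-C2×C4 t j)) ≡ ζ₂₄.0#
    e-C2×C4-orthogonal = from-yes (all? λ s → all? λ t → ¬? (s ≟ t) →-dec (ζ₂₄.sum (λ j → ζ₂₄.z^ (e-C2×C4 s j -₈ e-C2×C4 t j)) Tower.≟ᴷ ζ₂₄.0#))

    e-C2×C4-diagonal : ∀ s → ζ₂₄.sum (λ j → ζ₂₄.z^ (e-C2×C4 s j -₈ e-C2×C4 s j)) ≡ Hom.⟦_⟧ ζ₂₄.φ (ℤ.+ 8)
    e-C2×C4-diagonal = from-yes (all? λ s → ζ₂₄.sum (λ j → ζ₂₄.z^ (e-C2×C4 s j -₈ e-C2×C4 s j)) Tower.≟ᴷ Hom.⟦_⟧ ζ₂₄.φ (ℤ.+ 8))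

    e-C2³-orthogonal : ∀ s t → s ≢ t → ζ₂₄.sum (λ j → ζ₂₄.z^ (e-C2³ s j -₈ e-C2³ t j)) ≡ ζ₂₄.0#
    e-C2³-orthogonal = from-yes (all? λ s → all? λ t → ¬? (s ≟ t) →-dec (ζ₂₄.sum (λ j → ζ₂₄.z^ (e-C2³ s j -₈ e-C2³ t j)) Tower.≟ᴷ ζ₂₄.0#))

    e-C2³-diagonal : ∀ s → ζ₂₄.sum (λ j → ζ₂₄.z^ (e-C2³ s j -₈ e-C2³ s j)) ≡ Hom.⟦_⟧ ζ₂₄.φ (ℤ.+ 8)
    e-C2³-diagonal = from-yes (all? λ s → ζ₂₄.sum (λ j → ζ₂₄.z^ (e-C2³ s j -₈ e-C2³ s j)) Tower.≟ᴷ Hom.⟦_⟧ ζ₂₄.φ (ℤ.+ 8))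

open RootsOfUnity

-- Explicit Sylow decompositions of the three groups

module SylowDecompositions where
  open Sylows ℤ[ζ₂₄]
  open CharacterProducts ℤ[ζ₂₄]

  module Times (G : FiniteGroup) where
    private module G = FiniteGroup G

    _·_ : Fin G.order → Fin G.order → Fin G.order
    k · l = Inverse.from G.enumeration (G.element k G.∙ G.element l)

  sylow-C24 : Sylow (C 24)
  sylow-C24 = record
    { π₈ = π₈ ; π₃ = π₃ ; join = join ; _⊹₈_ = _⊹_ ; e = e-C8 ; form = Forms.C8
    ; π₈-·         = from-yes (all? λ k → all? λ l → π₈ (k · l) ≟ (π₈ k ⊹ π₈ l))
    ; π₃-·         = from-yes (all? λ k → all? λ l → π₃ (k · l) ≟ (π₃ k +₃ π₃ l))
    ; e-⊹          = from-yes (all? λ s → all? λ j → all? λ k → e-C8 s (j ⊹ k) ≟ (e-C8 s j +₈ e-C8 s k))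
    ; join-π       = from-yes (all? λ k → join (π₈ k) (π₃ k) ≟ k)
    ; π₈-join      = from-yes (all? λ j → all? λ l → π₈ (join j l) ≟ j)
    ; π₃-join      = from-yes (all? λ j → all? λ l → π₃ (join j l) ≟ l)
    ; e-orthogonal = e-C8-orthogonal
    ; e-diagonal   = e-C8-diagonal
    ; form-correct = λ c → C8-form e-C8 c refl
    }
    where
    open Times (C 24)

    π₈ : Fin 24 → Fin 8
    π₈ k = toℕ k mod 8

    π₃ : Fin 24 → Fin 3
    π₃ k = toℕ k mod 3

    join : Fin 8 → Fin 3 → Fin 24
    -- Chinese remaindering: 9 is 1 modulo 8 and 0 modulo 3, while 16 is 0 modulo 8 and 1 modulo 3.
    join j l = (9 ℕ.* toℕ j ℕ.+ 16 ℕ.* toℕ l) mod 24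

    _⊹_ : Fin 8 → Fin 8 → Fin 8
    j ⊹ k = j +₈ k

  sylow-C2×C12 : Sylow (C 2 ×ᴳ C 12)
  sylow-C2×C12 = record
    { π₈ = π₈ ; π₃ = π₃ ; join = join ; _⊹₈_ = _⊹_ ; e = e-C2×C4 ; form = Forms.C2×C4
    ; π₈-·         = from-yes (all? λ k → all? λ l → π₈ (k · l) ≟ (π₈ k ⊹ π₈ l))
    ; π₃-·         = from-yes (all? λ k → all? λ l → π₃ (k · l) ≟ (π₃ k +₃ π₃ l))
    ; e-⊹          = from-yes (all? λ s → all? λ j → all? λ k → e-C2×C4 s (j ⊹ k) ≟ (e-C2×C4 s j +₈ e-C2×C4 s k))
    ; join-π       = from-yes (all? λ k → join (π₈ k) (π₃ k) ≟ k)
    ; π₈-join      = from-yes (all? λ j → all? λ l → π₈ (join j l) ≟ j)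
    ; π₃-join      = from-yes (all? λ j → all? λ l → π₃ (join j l) ≟ l)
    ; e-orthogonal = e-C2×C4-orthogonal
    ; e-diagonal   = e-C2×C4-diagonal
    ; form-correct = λ c → C2×C4-form e-C2×C4 c refl
    }
    where
    open Times (C 2 ×ᴳ C 12)

    π₈ : Fin 24 → Fin 8
    π₈ k = (4 ℕ.* (toℕ k / 12) ℕ.+ toℕ k % 12 % 4) mod 8

    π₃ : Fin 24 → Fin 3
    π₃ k = (toℕ k % 12) mod 3

    join : Fin 8 → Fin 3 → Fin 24
    -- The pair `(a , b)` of C₂ × C₁₂ has index `12a + b`. Modulo 4 and 3, the number 9 is 1 and 0,
    -- the number 4 is 0 and 1.
    join j l = (12 ℕ.* (toℕ j / 4) ℕ.+ (9 ℕ.* (toℕ j % 4) ℕ.+ 4 ℕ.* toℕ l) % 12) mod 24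

    _⊹_ : Fin 8 → Fin 8 → Fin 8
    j ⊹ k = (4 ℕ.* (toℕ j / 4 ℕ.+ toℕ k / 4) ℕ.+ (toℕ j % 4 ℕ.+ toℕ k % 4) % 4) mod 8

  sylow-C2×C2×C6 : Sylow (C 2 ×ᴳ C 2 ×ᴳ C 6)
  sylow-C2×C2×C6 = record
    { π₈ = π₈ ; π₃ = π₃ ; join = join ; _⊹₈_ = _⊹_ ; e = e-C2³ ; form = Forms.C2³
    ; π₈-·         = from-yes (all? λ k → all? λ l → π₈ (k · l) ≟ (π₈ k ⊹ π₈ l))
    ; π₃-·         = from-yes (all? λ k → all? λ l → π₃ (k · l) ≟ (π₃ k +₃ π₃ l))
    ; e-⊹          = from-yes (all? λ s → all? λ j → all? λ k → e-C2³ s (j ⊹ k) ≟ (e-C2³ s j +₈ e-C2³ s k))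
    ; join-π       = from-yes (all? λ k → join (π₈ k) (π₃ k) ≟ k)
    ; π₈-join      = from-yes (all? λ j → all? λ l → π₈ (join j l) ≟ j)
    ; π₃-join      = from-yes (all? λ j → all? λ l → π₃ (join j l) ≟ l)
    ; e-orthogonal = e-C2³-orthogonal
    ; e-diagonal   = e-C2³-diagonal
    ; form-correct = λ c → C2³-form e-C2³ c refl
    }
    where
    open Times (C 2 ×ᴳ C 2 ×ᴳ C 6)

    π₈ : Fin 24 → Fin 8
    π₈ k = (4 ℕ.* (toℕ k / 12) ℕ.+ 2 ℕ.* (toℕ k % 12 / 6) ℕ.+ toℕ k % 6 % 2) mod 8

    π₃ : Fin 24 → Fin 3
    π₃ k = (toℕ k % 6) mod 3

    join : Fin 8 → Fin 3 → Fin 24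
    -- Inside C₆ the numbers 3 and 4 play this part: 3 is 1 modulo 2 and 0 modulo 3, and 4 is 0
    -- modulo 2 and 1 modulo 3.
    join j l = (12 ℕ.* (toℕ j / 4) ℕ.+ 6 ℕ.* (toℕ j % 4 / 2) ℕ.+ (3 ℕ.* (toℕ j % 2) ℕ.+ 4 ℕ.* toℕ l) % 6) mod 24

    _⊹_ : Fin 8 → Fin 8 → Fin 8
    j ⊹ k = (4 ℕ.* (toℕ j / 4 ℕ.+ toℕ k / 4) ℕ.+ 2 ℕ.* ((toℕ j % 4 / 2 ℕ.+ toℕ k % 4 / 2) % 2) ℕ.+ (toℕ j % 2 ℕ.+ toℕ k % 2) % 2) mod 8

open SylowDecompositions

-- Determinant sets as values of forms on integer tables

module DeterminantSets where
  open Defs using (S)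

  Coefficients : Set
  Coefficients = Fin 8 → Fin 3 → ℤ

  module _ (x : Coefficients) where
    rational : Fin 8 → ℤ
    rational j = x j (# 0) ℤ.+ x j (# 1) ℤ.+ x j (# 2)

    eisenstein : Fin 8 → 𝔼.Carrier
    eisenstein j = x j (# 0) ℤ.- x j (# 2) , x j (# 1) ℤ.- x j (# 2)

    determinant : Poly 8 → ℤ
    determinant form = eval ℤ-ring form rational ℤ.* norm (eval 𝔼 form eisenstein)

  eval-cong : ∀ R {n} (p : Poly n) {ρ σ} → (∀ i → ρ i ≡ σ i) → eval R p ρ ≡ eval R p σ
  eval-cong R = eval-related {R} {R} _≡_ (cong₂ (PropRing._+_ R)) (cong₂ (PropRing._*_ R)) (cong (PropRing.-_ R))

  module GroupDeterminants (G : FiniteGroup) (𝒮 : Sylows.Sylow ℤ[ζ₂₄] G) where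
    open Sylows ℤ[ζ₂₄]
    open Sylow 𝒮
    private module G = FiniteGroup G

    analyse : ∀ {m} → S G m → ∃[ x ] determinant x form ≡ m
    analyse (a , eq) = coefficient , trans (sym determinant′) eq
      where open Norms G 𝒮 a using (coefficient) renaming (determinant to determinant′)

    -- With `analyse` this replaces functions on the group by 8 × 3 tables, so both inclusions of
    -- the theorem become questions about the forms alone.
    synthesise : ∀ x → S G (determinant x form)
    synthesise x = a , trans determinant′ (cong₂ (λ p q → p ℤ.* norm q)
        (eval-cong ℤ-ring form (λ j → cong₂ ℤ._+_ (cong₂ ℤ._+_ (recover j (# 0)) (recover j (# 1))) (recover j (# 2))))
        (eval-cong 𝔼 form (λ j → cong₂ _,_
          (cong₂ ℤ._-_ (recover j (# 0)) (recover j (# 2))) (cong₂ ℤ._-_ (recover j (# 1)) (recover j (# 2))))))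
      where
      index : G.Carrier → Fin G.order
      index = Inverse.from G.enumeration

      a : Func G.setoid (setoid ℤ)
      a = record
        { to   = λ g → x (π₈ (index g)) (π₃ (index g))
        ; cong = λ g≈h → cong (λ k → x (π₈ k) (π₃ k)) (Inverse.from-cong G.enumeration g≈h)
        }

      open Norms G 𝒮 a using (coefficient) renaming (determinant to determinant′)

      recover : ∀ j l → coefficient j l ≡ x j l
      recover j l = trans (cong (λ k → x (π₈ k) (π₃ k)) (Inverse.strictlyInverseʳ G.enumeration (join j l)))
        (cong₂ x (π₈-join j l) (π₃-join j l))

open DeterminantSets

-- Congruences between the factors of the forms

module Divisibility where
  infixr 4 _,_
  -- The quotient is kept as data: for `(-2)^e ≡ 1` modulo 3 it becomes the shift that realises the
  -- larger determinants.
  record Congruent (R : PropRing) (a b m : PropRing.Carrier R) : Set where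
    constructor _,_
    open PropRing R
    field
      quotient : Carrier
      equation : a ≡ b + m * quotient

  module Congruences (R : PropRing) where
    open RingKit R

    infix 4 _≡_[_]
    _≡_[_] : Carrier → Carrier → Carrier → Set
    _≡_[_] = Congruent R

    ≡⇒[] : ∀ {a b m} → a ≡ b → a ≡ b [ m ]
    ≡⇒[] {b = b} {m} refl = 0# , solve 2 (λ b m → b := b :+ m :* con 0ℤ) refl b m

    []-sym : ∀ {a b m} → a ≡ b [ m ] → b ≡ a [ m ]
    []-sym {b = b} {m} (t , refl) = - t , solve 3 (λ b m t → b := (b :+ m :* t) :+ m :* :- t) refl b m t

    []-trans : ∀ {a b c m} → a ≡ b [ m ] → b ≡ c [ m ] → a ≡ c [ m ]
    []-trans {c = c} {m} (s , refl) (t , refl) = t + s , solve 4 (λ c m s t → (c :+ m :* t) :+ m :* s := c :+ m :* (t :+ s)) refl c m s t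

    []-+ : ∀ {m a b c d} → a ≡ b [ m ] → c ≡ d [ m ] → a + c ≡ b + d [ m ]
    []-+ {m} {b = b} {d = d} (s , refl) (t , refl) = s + t ,
      solve 5 (λ b d m s t → (b :+ m :* s) :+ (d :+ m :* t) := (b :+ d) :+ m :* (s :+ t)) refl b d m s t

    []-* : ∀ {m a b c d} → a ≡ b [ m ] → c ≡ d [ m ] → a * c ≡ b * d [ m ]
    []-* {m} {b = b} {d = d} (s , refl) (t , refl) = s * d + b * t + m * (s * t) ,
      solve 5 (λ b d m s t → (b :+ m :* s) :* (d :+ m :* t) := b :* d :+ m :* (s :* d :+ b :* t :+ m :* (s :* t))) refl b d m s t

    []-neg : ∀ {m a b} → a ≡ b [ m ] → - a ≡ - b [ m ]
    []-neg {m} {b = b} (s , refl) = - s , solve 3 (λ b m s → :- (b :+ m :* s) := :- b :+ m :* :- s) refl b m s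

    2# 4# : Carrier
    2# = 1# + 1#
    4# = 2# + 2#

    -- The gain from 2 to 4 matters for units: those of ℤ[ω] that agree modulo 4 are equal, whereas
    -- agreement modulo 2 leaves a sign open.
    []-square : ∀ {a b} → a ≡ b [ 2# ] → a * a ≡ b * b [ 4# ]
    []-square {b = b} (t , refl) = b * t + t * t ,
      solve 2 (λ b t → (b :+ (con 1ℤ :+ con 1ℤ) :* t) :* (b :+ (con 1ℤ :+ con 1ℤ) :* t)
        := b :* b :+ ((con 1ℤ :+ con 1ℤ) :+ (con 1ℤ :+ con 1ℤ)) :* (b :* t :+ t :* t)) refl b t

    []-4⇒2 : ∀ {a b} → a ≡ b [ 4# ] → a ≡ b [ 2# ]
    []-4⇒2 {b = b} (t , refl) = 2# * t , solve 2 (λ b t → b :+ ((con 1ℤ :+ con 1ℤ) :+ (con 1ℤ :+ con 1ℤ)) :* t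
      := b :+ (con 1ℤ :+ con 1ℤ) :* ((con 1ℤ :+ con 1ℤ) :* t)) refl b t

  -- The determinant of the 2-group, evaluated on a quadruple of coefficients modulo
  -- the first coordinate (see Forms).
  module Quadruples (R : PropRing) where
    open RingKit R
    open Congruences R

    record Quadruple : Set where
      constructor ⟨_,_,_,_⟩
      field u₀ u₁ u₂ u₃ : Carrier

      A⁺ B⁺ A⁻ B⁻ n₁ n₂ n₃ n₄ N₄ X Y N₈ : Carrier
      A⁺ = u₀ + u₂
      B⁺ = u₁ + u₃
      A⁻ = u₀ - u₂
      B⁻ = u₁ - u₃
      n₁ = A⁺ + B⁺
      n₂ = A⁺ - B⁺
      n₃ = A⁻ + B⁻
      n₄ = A⁻ - B⁻
      N₄ = A⁻ * A⁻ + B⁻ * B⁻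
      X  = u₀ * u₀ - u₂ * u₂ + (u₁ * u₃ + u₁ * u₃)
      Y  = (u₀ * u₂ + u₀ * u₂) - u₁ * u₁ + u₃ * u₃
      N₈ = X * X + Y * Y

      n₂≡n₁ : n₂ ≡ n₁ [ 2# ]
      n₂≡n₁ = - B⁺ , solve 2 (λ a b → a :- b := (a :+ b) :+ (con 1ℤ :+ con 1ℤ) :* :- b) refl A⁺ B⁺

      n₃≡n₁ : n₃ ≡ n₁ [ 2# ]
      n₃≡n₁ = - u₂ - u₃ , solve 4 (λ a b c d → (a :- c) :+ (b :- d) := (a :+ c) :+ (b :+ d) :+ (con 1ℤ :+ con 1ℤ) :* (:- c :- d)) refl u₀ u₁ u₂ u₃

      n₄≡n₁ : n₄ ≡ n₁ [ 2# ]
      n₄≡n₁ = - u₂ - u₁ , solve 4 (λ a b c d → (a :- c) :- (b :- d) := (a :+ c) :+ (b :+ d) :+ (con 1ℤ :+ con 1ℤ) :* (:- c :- b)) refl u₀ u₁ u₂ u₃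

      N₄≡n₁² : N₄ ≡ n₁ * n₁ [ 2# ]
      N₄≡n₁² = []-trans (- (A⁻ * B⁻) , solve 2 (λ a b → a :* a :+ b :* b := (a :+ b) :* (a :+ b) :+ (con 1ℤ :+ con 1ℤ) :* :- (a :* b)) refl A⁻ B⁻)
                        ([]-* n₃≡n₁ n₃≡n₁)

      -- From `(a - c)² = (a + c)² - 4ac`. It expresses `N₄` modulo 4 by `A⁺` and `B⁺`, which are
      -- determined by `n₁` and `n₂`.
      N₄≡A²+B² : N₄ ≡ A⁺ * A⁺ + B⁺ * B⁺ [ 4# ]
      N₄≡A²+B² = - (u₀ * u₂ + u₁ * u₃) , solve 4 (λ a b c d → (a :- c) :* (a :- c) :+ (b :- d) :* (b :- d)
        := ((a :+ c) :* (a :+ c) :+ (b :+ d) :* (b :+ d)) :+ ((con 1ℤ :+ con 1ℤ) :+ (con 1ℤ :+ con 1ℤ)) :* :- (a :* c :+ b :* d)) refl u₀ u₁ u₂ u₃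

      X≡A² : X ≡ A⁺ * A⁺ [ 2# ]
      X≡A² = u₁ * u₃ - u₂ * u₂ - u₀ * u₂ , solve 4 (λ a b c d → a :* a :- c :* c :+ (b :* d :+ b :* d)
        := (a :+ c) :* (a :+ c) :+ (con 1ℤ :+ con 1ℤ) :* (b :* d :- c :* c :- a :* c)) refl u₀ u₁ u₂ u₃

      Y≡B² : Y ≡ B⁺ * B⁺ [ 2# ]
      Y≡B² = u₀ * u₂ - u₁ * u₁ - u₁ * u₃ , solve 4 (λ a b c d → (a :* c :+ a :* c) :- b :* b :+ d :* d
        := (b :+ d) :* (b :+ d) :+ (con 1ℤ :+ con 1ℤ) :* (a :* c :- b :* b :- b :* d)) refl u₀ u₁ u₂ u₃

      N₈≡A⁴+B⁴ : N₈ ≡ (A⁺ * A⁺) * (A⁺ * A⁺) + (B⁺ * B⁺) * (B⁺ * B⁺) [ 4# ]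
      N₈≡A⁴+B⁴ = []-+ ([]-square X≡A²) ([]-square Y≡B²)

      N₈≡n₁⁴ : N₈ ≡ (n₁ * n₁) * (n₁ * n₁) [ 2# ]
      N₈≡n₁⁴ = []-trans ([]-4⇒2 N₈≡A⁴+B⁴)
        (- ((A⁺ * B⁺) * (A⁺ * A⁺ + A⁺ * A⁺ + (A⁺ * B⁺ + A⁺ * B⁺ + A⁺ * B⁺) + (B⁺ * B⁺ + B⁺ * B⁺))) ,
         solve 2 (λ a b → (a :* a) :* (a :* a) :+ (b :* b) :* (b :* b) := ((a :+ b) :* (a :+ b)) :* ((a :+ b) :* (a :+ b))
           :+ (con 1ℤ :+ con 1ℤ) :* :- ((a :* b) :* (a :* a :+ a :* a :+ (a :* b :+ a :* b :+ a :* b) :+ (b :* b :+ b :* b)))) refl A⁺ B⁺)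

    open Quadruple

    record _≈₂_ (u v : Quadruple) : Set where
      field
        ≈₀ : u₀ u ≡ u₀ v [ 2# ]
        ≈₁ : u₁ u ≡ u₁ v [ 2# ]
        ≈₂ : u₂ u ≡ u₂ v [ 2# ]
        ≈₃ : u₃ u ≡ u₃ v [ 2# ]

    module _ {u v : Quadruple} (u≈v : u ≈₂ v) where
      open _≈₂_ u≈v

      A⁺-≈ : A⁺ u ≡ A⁺ v [ 2# ]
      A⁺-≈ = []-+ ≈₀ ≈₂
      B⁺-≈ : B⁺ u ≡ B⁺ v [ 2# ]
      B⁺-≈ = []-+ ≈₁ ≈₃
      A⁻-≈ : A⁻ u ≡ A⁻ v [ 2# ]
      A⁻-≈ = []-+ ≈₀ ([]-neg ≈₂)
      B⁻-≈ : B⁻ u ≡ B⁻ v [ 2# ]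
      B⁻-≈ = []-+ ≈₁ ([]-neg ≈₃)

      n₁-≈ : n₁ u ≡ n₁ v [ 2# ]
      n₁-≈ = []-+ A⁺-≈ B⁺-≈

      private
        difference-of-squares : ∀ {a b c d} → a ≡ c [ 2# ] → b ≡ d [ 2# ] → (a + b) * (a - b) ≡ (c + d) * (c - d) [ 4# ]
        difference-of-squares {a} {b} {c} {d} p q = []-trans (≡⇒[] (expand a b)) ([]-trans ([]-+ ([]-square p) ([]-neg ([]-square q))) (≡⇒[] (sym (expand c d))))
          where
          expand : ∀ a b → (a + b) * (a - b) ≡ a * a + - (b * b)
          expand = solve 2 (λ a b → (a :+ b) :* (a :- b) := a :* a :+ :- (b :* b)) refl

      -- The product is the difference of squares `A⁺² - B⁺²`, so it agrees modulo 4 although each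
      -- factor alone is only known to agree modulo 2.
      n₁n₂-≈ : n₁ u * n₂ u ≡ n₁ v * n₂ v [ 4# ]
      n₁n₂-≈ = difference-of-squares A⁺-≈ B⁺-≈

      n₃n₄-≈ : n₃ u * n₄ u ≡ n₃ v * n₄ v [ 4# ]
      n₃n₄-≈ = difference-of-squares A⁻-≈ B⁻-≈

      N₄-≈ : N₄ u ≡ N₄ v [ 4# ]
      N₄-≈ = []-+ ([]-square A⁻-≈) ([]-square B⁻-≈)

    C8-product C2×C4-product C2³-product : Quadruple → Quadruple → Carrier
    C8-product    u v = (n₁ u * n₂ u * N₄ u) * N₈ v
    C2×C4-product u v = (n₁ u * n₂ u * N₄ u) * (n₁ v * n₂ v * N₄ v)
    C2³-product   u v = (n₁ u * n₂ u * (n₃ u * n₄ u)) * (n₁ v * n₂ v * (n₃ v * n₄ v))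

    module _ (c : Fin 8 → Carrier) where
      open import Data.Fin using (#_)
      lower upper : Quadruple
      lower = ⟨ c (# 0) + c (# 4) , c (# 1) + c (# 5) , c (# 2) + c (# 6) , c (# 3) + c (# 7) ⟩
      upper = ⟨ c (# 0) - c (# 4) , c (# 1) - c (# 5) , c (# 2) - c (# 6) , c (# 3) - c (# 7) ⟩

      upper≈lower : upper ≈₂ lower
      upper≈lower = record { ≈₀ = step _ _ ; ≈₁ = step _ _ ; ≈₂ = step _ _ ; ≈₃ = step _ _ }
        where
        step : ∀ a b → a - b ≡ a + b [ 2# ]
        step a b = - b , solve 2 (λ a b → a :- b := (a :+ b) :+ (con 1ℤ :+ con 1ℤ) :* :- b) refl a b

      N₄-value : eval R (Forms.N₄ Forms.d) c ≡ N₄ lower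
      N₄-value = refl

      N₄-value′ : eval R (Forms.N₄ Forms.e) c ≡ N₄ upper
      N₄-value′ = refl

      N₈-value : eval R (Forms.N₈ Forms.e) c ≡ N₈ upper
      N₈-value = refl

      C8-value : eval R Forms.C8 c ≡ C8-product lower upper
      C8-value = refl

      C2×C4-value : eval R Forms.C2×C4 c ≡ C2×C4-product lower upper
      C2×C4-value = refl

      C2³-value : eval R Forms.C2³ c ≡ C2³-product lower upper
      C2³-value = refl

open Divisibility

module ≡ℤ = Congruences ℤ-ring
module ≡𝔼 = Congruences 𝔼
module ℤQ = Quadruples ℤ-ring
module 𝔼Q = Quadruples 𝔼

open ≡ℤ using () renaming (_≡_[_] to _≡ᶻ_[_])
open ≡𝔼 using () renaming (_≡_[_] to _≡ᴱ_[_])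

-- Integers that are powers of two up to sign

module PowersOfTwo where
  open ≡ℤ using (≡⇒[]; []-sym; []-trans; []-neg)
  open Zk using (solve; con; _:+_; _:*_; :-_; _:-_; _:=_)

  𝟚 𝟛 : ℤ
  𝟚 = ℤ.+ 2
  𝟛 = ℤ.+ 3

  Even Odd : ℤ → Set
  Even n = ∃[ k ] n ≡ 𝟚 ℤ.* k
  Odd  n = ∃[ k ] n ≡ 1ℤ ℤ.+ 𝟚 ℤ.* k

  parity : ∀ n → Even n ⊎ Odd n
  parity n with n ℤ.%ℕ 2 | ℤ.a≡a%ℕn+[a/ℕn]*n n 2 | ℤ.n%ℕd<d n 2
  ... | zero        | eq | _ = inj₁ (n ℤ./ℕ 2 , trans eq (solve 1 (λ q → con 0ℤ :+ q :* con 𝟚 := con 𝟚 :* q) refl (n ℤ./ℕ 2)))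
  ... | suc zero    | eq | _ = inj₂ (n ℤ./ℕ 2 , trans eq (solve 1 (λ q → con 1ℤ :+ q :* con 𝟚 := con 1ℤ :+ con 𝟚 :* q) refl (n ℤ./ℕ 2)))
  ... | suc (suc _) | _  | s≤s (s≤s ())

  divides-abs : ∀ {c m} k → ℤ.+ c ≡ ℤ.+ m ℤ.* k → m ℕ.∣ c
  divides-abs {c} {m} k eq = ℕ.divides ∣ k ∣ (trans (cong ∣_∣ eq) (trans (ℤ.abs-* (ℤ.+ m) k) (ℕ.*-comm m ∣ k ∣)))

  ¬Even∧Odd : ∀ {n} → Even n → ¬ Odd n
  ¬Even∧Odd {n} (k , refl) (l , eq) = from-no (2 ℕ.∣? 1) (divides-abs (k ℤ.- l) (begin
    1ℤ                                 ≡⟨ solve 1 (λ l → con 1ℤ := (con 1ℤ :+ con 𝟚 :* l) :- con 𝟚 :* l) refl l ⟩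
    (1ℤ ℤ.+ 𝟚 ℤ.* l) ℤ.- 𝟚 ℤ.* l       ≡⟨ cong (λ t → t ℤ.- 𝟚 ℤ.* l) eq ⟨
    𝟚 ℤ.* k ℤ.- 𝟚 ℤ.* l                ≡⟨ solve 2 (λ k l → con 𝟚 :* k :- con 𝟚 :* l := con 𝟚 :* (k :- l)) refl k l ⟩
    𝟚 ℤ.* (k ℤ.- l)                    ∎))
    where open ≡-Reasoning

  Even-resp : ∀ {m n} → m ≡ᶻ n [ 𝟚 ] → Even n → Even m
  Even-resp (t , refl) (k , refl) = k ℤ.+ t , solve 2 (λ k t → con 𝟚 :* k :+ con 𝟚 :* t := con 𝟚 :* (k :+ t)) refl k t

  Odd-resp : ∀ {m n} → m ≡ᶻ n [ 𝟚 ] → Odd n → Odd m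
  Odd-resp (t , refl) (k , refl) = k ℤ.+ t , solve 2 (λ k t → (con 1ℤ :+ con 𝟚 :* k) :+ con 𝟚 :* t := con 1ℤ :+ con 𝟚 :* (k :+ t)) refl k t

  Odd-* : ∀ {m n} → Odd m → Odd n → Odd (m ℤ.* n)
  Odd-* (k , refl) (l , refl) = k ℤ.+ l ℤ.+ 𝟚 ℤ.* (k ℤ.* l) ,
    solve 2 (λ k l → (con 1ℤ :+ con 𝟚 :* k) :* (con 1ℤ :+ con 𝟚 :* l) := con 1ℤ :+ con 𝟚 :* (k :+ l :+ con 𝟚 :* (k :* l))) refl k l

  Even-square⁻ : ∀ {n} → Even (n ℤ.* n) → Even n
  Even-square⁻ {n} ev with parity n
  ... | inj₁ e = e
  ... | inj₂ o = contradiction (Odd-* o o) (¬Even∧Odd ev)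

  ∣∣-cancel : ∀ i j → ∣ i ∣ ≡ ∣ j ∣ → i ≡ j ⊎ i ≡ ℤ.- j
  ∣∣-cancel (ℤ.+ m)       (ℤ.+ n)            refl = inj₁ refl
  ∣∣-cancel (ℤ.+ .(suc n)) (ℤ.-[1+ n ])       refl = inj₂ refl
  ∣∣-cancel (ℤ.-[1+ m ])  (ℤ.+ .(suc m))     refl = inj₂ refl
  ∣∣-cancel (ℤ.-[1+ m ])  (ℤ.-[1+ .m ])      refl = inj₁ refl

  infix 4 _≈2^_
  record _≈2^_ (n : ℤ) (k : ℕ) : Set where
    constructor power
    field abs≡ : ∣ n ∣ ≡ 2 ℕ.^ k

  -- Euclid's lemma for the prime 2 tells which of the two factors to halve; then induct on the
  -- exponent.
  split-power : ∀ k a b → a ℕ.* b ≡ 2 ℕ.^ k → ∃[ i ] ∃[ j ] (a ≡ 2 ℕ.^ i × b ≡ 2 ℕ.^ j × i ℕ.+ j ≡ k)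
  split-power zero    a b eq = 0 , 0 , ℕ.m*n≡1⇒m≡1 a b eq , ℕ.m*n≡1⇒n≡1 a b eq , refl
  split-power (suc k) a b eq with euclidsLemma a b (from-yes (prime? 2)) (ℕ.divides (2 ℕ.^ k) (trans eq (ℕ.*-comm 2 (2 ℕ.^ k))))
  ... | inj₁ (ℕ.divides q refl) with split-power k q b (ℕ.*-cancelˡ-≡ (q ℕ.* b) (2 ℕ.^ k) 2 (trans (sym (ℕ.*-assoc 2 q b)) (trans (cong (ℕ._* b) (ℕ.*-comm 2 q)) eq)))
  ...   | i , j , refl , refl , refl = suc i , j , ℕ.*-comm (2 ℕ.^ i) 2 , refl , refl
  split-power (suc k) a b eq | inj₂ (ℕ.divides q refl) with split-power k a q (ℕ.*-cancelˡ-≡ (a ℕ.* q) (2 ℕ.^ k) 2 (trans (ℕ.*-comm 2 (a ℕ.* q)) (trans (ℕ.*-assoc a q 2) eq)))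
  ...   | i , j , refl , refl , refl = i , suc j , refl , ℕ.*-comm (2 ℕ.^ j) 2 , ℕ.+-suc i j

  ≈2^-* : ∀ {k} a b → a ℤ.* b ≈2^ k → ∃[ i ] ∃[ j ] (a ≈2^ i × b ≈2^ j × i ℕ.+ j ≡ k)
  ≈2^-* {k} a b (power eq) =
    let i , j , a≡ , b≡ , total = split-power k ∣ a ∣ ∣ b ∣ (trans (sym (ℤ.abs-* a b)) eq)
    in i , j , power a≡ , power b≡ , total

  2^-injective : ∀ i j → 2 ℕ.^ i ≡ 2 ℕ.^ j → i ≡ j
  2^-injective zero    zero    eq = refl
  2^-injective zero    (suc j) eq = contradiction (ℕ.divides (2 ℕ.^ j) (trans eq (ℕ.*-comm 2 (2 ℕ.^ j)))) (from-no (2 ℕ.∣? 1))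
  2^-injective (suc i) zero    eq = contradiction (ℕ.divides (2 ℕ.^ i) (trans (sym eq) (ℕ.*-comm 2 (2 ℕ.^ i)))) (from-no (2 ℕ.∣? 1))
  2^-injective (suc i) (suc j) eq = cong suc (2^-injective i j (ℕ.*-cancelˡ-≡ (2 ℕ.^ i) (2 ℕ.^ j) 2 eq))

  ≈2^-suc⇒Even : ∀ {n k} → n ≈2^ suc k → Even n
  ≈2^-suc⇒Even {n} {k} (power eq) with parity n
  ... | inj₁ e = e
  ... | inj₂ (l , refl) = contradiction (ℕ.divides (2 ℕ.^ k) (trans eq (ℕ.*-comm 2 (2 ℕ.^ k)))) odd-abs
    where
    odd-abs : ¬ 2 ℕ.∣ ∣ 1ℤ ℤ.+ 𝟚 ℤ.* l ∣
    odd-abs (ℕ.divides q eq′) with ∣∣-cancel (1ℤ ℤ.+ 𝟚 ℤ.* l) (𝟚 ℤ.* ℤ.+ q) (trans eq′ (trans (ℕ.*-comm q 2) (sym (ℤ.abs-* 𝟚 (ℤ.+ q)))))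
    ... | inj₁ e = ¬Even∧Odd (ℤ.+ q , e) (l , refl)
    ... | inj₂ e = ¬Even∧Odd (ℤ.- (ℤ.+ q) , trans e (ℤ.neg-distribʳ-* 𝟚 (ℤ.+ q))) (l , refl)

  ≈2^-half : ∀ {m k} → 𝟚 ℤ.* m ≈2^ k → ∃[ j ] (k ≡ suc j × m ≈2^ j)
  ≈2^-half {m} {zero}  (power eq) = contradiction (trans (sym (ℤ.abs-* 𝟚 m)) eq) λ e → from-no (2 ℕ.∣? 1) (ℕ.divides ∣ m ∣ (trans (sym e) (ℕ.*-comm 2 ∣ m ∣)))
  ≈2^-half {m} {suc k} (power eq) = k , refl , power (ℕ.*-cancelˡ-≡ ∣ m ∣ (2 ℕ.^ k) 2 (trans (sym (ℤ.abs-* 𝟚 m)) eq))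

  ≈2^-Odd : ∀ {n k} → n ≈2^ k → Odd n → k ≡ 0
  ≈2^-Odd {k = zero}  eq o = refl
  ≈2^-Odd {n} {suc k} eq o = contradiction o (¬Even∧Odd (≈2^-suc⇒Even {n} {k} eq))

  -- Squares modulo 3 fix the sign of a power of two, since -2 ≡ 1.
  -2^≡1 : ∀ e → (ℤ.- 𝟚) ℤ.^ e ≡ᶻ 1ℤ [ 𝟛 ]
  -2^≡1 zero    = 0ℤ , refl
  -2^≡1 (suc e) with -2^≡1 e
  ... | t , eq = -1ℤ ℤ.- 𝟚 ℤ.* t , trans (cong (λ y → ℤ.- 𝟚 ℤ.* y) eq)
    (solve 1 (λ t → con (ℤ.- 𝟚) :* (con 1ℤ :+ con 𝟛 :* t) := con 1ℤ :+ con 𝟛 :* (con -1ℤ :- con 𝟚 :* t)) refl t)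

  ∣-2^∣ : ∀ e → ∣ (ℤ.- 𝟚) ℤ.^ e ∣ ≡ 2 ℕ.^ e
  ∣-2^∣ zero    = refl
  ∣-2^∣ (suc e) = trans (ℤ.abs-* (ℤ.- 𝟚) ((ℤ.- 𝟚) ℤ.^ e)) (cong (2 ℕ.*_) (∣-2^∣ e))

  ¬square≡-1 : ∀ s → ¬ (s ℤ.* s ≡ᶻ -1ℤ [ 𝟛 ])
  ¬square≡-1 s (t , eq) with s ℤ.%ℕ 3 | ℤ.a≡a%ℕn+[a/ℕn]*n s 3 | ℤ.n%ℕd<d s 3
  ... | r | s≡ | r<3 = absurd r r<3 (divides-abs (t ℤ.- ℤ.+ r ℤ.* q ℤ.- ℤ.+ r ℤ.* q ℤ.- 𝟛 ℤ.* (q ℤ.* q)) (begin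
      ℤ.+ (r ℕ.* r ℕ.+ 1)
        ≡⟨ trans (ℤ.pos-+ (r ℕ.* r) 1) (cong (λ y → y ℤ.+ 1ℤ) (ℤ.pos-* r r)) ⟩
      ℤ.+ r ℤ.* ℤ.+ r ℤ.+ 1ℤ
        ≡⟨ solve 2 (λ r q → r :* r :+ con 1ℤ := ((r :+ q :* con 𝟛) :* (r :+ q :* con 𝟛)) :+ con 1ℤ :- con 𝟛 :* (r :* q :+ r :* q :+ con 𝟛 :* (q :* q))) refl (ℤ.+ r) q ⟩
      (ℤ.+ r ℤ.+ q ℤ.* 𝟛) ℤ.* (ℤ.+ r ℤ.+ q ℤ.* 𝟛) ℤ.+ 1ℤ ℤ.- 𝟛 ℤ.* (ℤ.+ r ℤ.* q ℤ.+ ℤ.+ r ℤ.* q ℤ.+ 𝟛 ℤ.* (q ℤ.* q))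
        ≡⟨ cong (λ y → y ℤ.+ 1ℤ ℤ.- 𝟛 ℤ.* (ℤ.+ r ℤ.* q ℤ.+ ℤ.+ r ℤ.* q ℤ.+ 𝟛 ℤ.* (q ℤ.* q))) (trans (cong (λ y → y ℤ.* y) (sym s≡)) eq) ⟩
      (-1ℤ ℤ.+ 𝟛 ℤ.* t) ℤ.+ 1ℤ ℤ.- 𝟛 ℤ.* (ℤ.+ r ℤ.* q ℤ.+ ℤ.+ r ℤ.* q ℤ.+ 𝟛 ℤ.* (q ℤ.* q))
        ≡⟨ solve 3 (λ t r q → (con -1ℤ :+ con 𝟛 :* t) :+ con 1ℤ :- con 𝟛 :* (r :* q :+ r :* q :+ con 𝟛 :* (q :* q))
             := con 𝟛 :* (t :- r :* q :- r :* q :- con 𝟛 :* (q :* q))) refl t (ℤ.+ r) q ⟩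
      𝟛 ℤ.* (t ℤ.- ℤ.+ r ℤ.* q ℤ.- ℤ.+ r ℤ.* q ℤ.- 𝟛 ℤ.* (q ℤ.* q)) ∎))
    where
    open ≡-Reasoning
    q = s ℤ./ℕ 3
    absurd : ∀ r → r ℕ.< 3 → ¬ 3 ℕ.∣ (r ℕ.* r ℕ.+ 1)
    absurd 0 _ = from-no (3 ℕ.∣? 1)
    absurd 1 _ = from-no (3 ℕ.∣? 2)
    absurd 2 _ = from-no (3 ℕ.∣? 5)
    absurd (suc (suc (suc _))) (s≤s (s≤s (s≤s ())))

  -- `n` is `(-2)^e` or its negative. Since `(-2)^e ≡ 1` modulo 3, the negative would make -1 a
  -- square modulo 3.
  square⇒-2^ : ∀ {n e} s → n ≈2^ e → n ≡ᶻ s ℤ.* s [ 𝟛 ] → n ≡ (ℤ.- 𝟚) ℤ.^ e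
  square⇒-2^ {n} {e} s (power abs) n≡s² with ∣∣-cancel n ((ℤ.- 𝟚) ℤ.^ e) (trans abs (sym (∣-2^∣ e)))
  ... | inj₁ eq = eq
  ... | inj₂ eq = contradiction ([]-trans ([]-sym n≡s²) ([]-trans (≡⇒[] eq) ([]-neg (-2^≡1 e)))) (¬square≡-1 s)

open PowersOfTwo

-- Norms and units of the Eisenstein integers

module Norms where
  open ≡𝔼 using (2#; 4#)
  open Zk using (solve; con; _:+_; _:*_; :-_; _:-_; _:=_)

  2#-* : ∀ w → 2# 𝔼.* w ≡ (𝟚 ℤ.* proj₁ w , 𝟚 ℤ.* proj₂ w)
  2#-* (x , y) = 𝔼.embed-* 𝟚 x y

  2#-cancel : ∀ v w → 2# 𝔼.* v ≡ 2# 𝔼.* w → v ≡ w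
  2#-cancel v@(a , b) w@(c , d) eq = cong₂ _,_
    (ℤ.*-cancelˡ-≡ 𝟚 a c (cong proj₁ (trans (sym (2#-* v)) (trans eq (2#-* w)))))
    (ℤ.*-cancelˡ-≡ 𝟚 b d (cong proj₂ (trans (sym (2#-* v)) (trans eq (2#-* w)))))

  square-abs : ∀ i → i ℤ.* i ≡ ℤ.+ (∣ i ∣ ℕ.* ∣ i ∣)
  square-abs (ℤ.+ n)      = sym (ℤ.pos-* n n)
  square-abs (ℤ.-[1+ n ]) = refl

  -- Completing the square. As the right side is a sum of natural numbers, norms are nonnegative and
  -- vanish only at zero.
  4*norm : ∀ x y → ℤ.+ 4 ℤ.* norm (x , y) ≡ ℤ.+ (∣ 𝟚 ℤ.* x ℤ.- y ∣ ℕ.* ∣ 𝟚 ℤ.* x ℤ.- y ∣ ℕ.+ 3 ℕ.* (∣ y ∣ ℕ.* ∣ y ∣))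
  4*norm x y = begin
    ℤ.+ 4 ℤ.* norm (x , y)
      ≡⟨ solve 2 (λ x y → con (ℤ.+ 4) :* (x :* x :- x :* y :+ y :* y)
           := (con 𝟚 :* x :- y) :* (con 𝟚 :* x :- y) :+ con 𝟛 :* (y :* y)) refl x y ⟩
    (𝟚 ℤ.* x ℤ.- y) ℤ.* (𝟚 ℤ.* x ℤ.- y) ℤ.+ 𝟛 ℤ.* (y ℤ.* y)
      ≡⟨ cong₂ (λ p q → p ℤ.+ 𝟛 ℤ.* q) (square-abs (𝟚 ℤ.* x ℤ.- y)) (square-abs y) ⟩
    ℤ.+ (p ℕ.* p) ℤ.+ 𝟛 ℤ.* ℤ.+ (∣ y ∣ ℕ.* ∣ y ∣)
      ≡⟨ cong (λ t → ℤ.+ (p ℕ.* p) ℤ.+ t) (ℤ.pos-* 3 (∣ y ∣ ℕ.* ∣ y ∣)) ⟨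
    ℤ.+ (p ℕ.* p ℕ.+ 3 ℕ.* (∣ y ∣ ℕ.* ∣ y ∣)) ∎
    where
    open ≡-Reasoning
    p = ∣ 𝟚 ℤ.* x ℤ.- y ∣

  norm-abs : ∀ w → norm w ≡ ℤ.+ ∣ norm w ∣
  norm-abs (x , y) = nonnegative (norm (x , y)) (4*norm x y)
    where
    nonnegative : ∀ n {m} → ℤ.+ 4 ℤ.* n ≡ ℤ.+ m → n ≡ ℤ.+ ∣ n ∣
    nonnegative (ℤ.+ n) eq = refl

  norm≡0 : ∀ w → ∣ norm w ∣ ≡ 0 → w ≡ 𝔼.0#
  norm≡0 (x , y) eq = cong₂ _,_ x≡0 y≡0
    where
    total : ∣ 𝟚 ℤ.* x ℤ.- y ∣ ℕ.* ∣ 𝟚 ℤ.* x ℤ.- y ∣ ℕ.+ 3 ℕ.* (∣ y ∣ ℕ.* ∣ y ∣) ≡ 0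
    total = ℤ.+-injective (trans (sym (4*norm x y)) (cong (λ t → ℤ.+ 4 ℤ.* t) (ℤ.∣i∣≡0⇒i≡0 {norm (x , y)} eq)))

    square-0 : ∀ n → n ℕ.* n ≡ 0 → n ≡ 0
    square-0 zero eq = refl

    y≡0 : y ≡ 0ℤ
    y≡0 = ℤ.∣i∣≡0⇒i≡0 (square-0 ∣ y ∣ (ℕ.*-cancelˡ-≡ _ 0 3 (ℕ.m+n≡0⇒n≡0 (∣ 𝟚 ℤ.* x ℤ.- y ∣ ℕ.* ∣ 𝟚 ℤ.* x ℤ.- y ∣) total)))

    x≡0 : x ≡ 0ℤ
    x≡0 = ℤ.*-cancelˡ-≡ 𝟚 x 0ℤ (begin
      𝟚 ℤ.* x              ≡⟨ solve 2 (λ x y → con 𝟚 :* x := (con 𝟚 :* x :- y) :+ y) refl x y ⟩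
      𝟚 ℤ.* x ℤ.- y ℤ.+ y  ≡⟨ cong₂ ℤ._+_ (ℤ.∣i∣≡0⇒i≡0 {𝟚 ℤ.* x ℤ.- y} (square-0 _ (ℕ.m+n≡0⇒m≡0 _ total))) y≡0 ⟩
      0ℤ                   ∎)
      where open ≡-Reasoning

  norm-2* : ∀ w → norm (2# 𝔼.* w) ≡ 𝟚 ℤ.* (𝟚 ℤ.* norm w)
  norm-2* w = trans (norm-* 2# w) (ℤ.*-assoc 𝟚 𝟚 (norm w))

  norm-4* : ∀ w → norm (4# 𝔼.* w) ≡ ℤ.+ 16 ℤ.* norm w
  norm-4* w = norm-* 4# w

  parallelogram : ∀ v w → norm (v 𝔼.- w) ℤ.+ norm (v 𝔼.+ w) ≡ 𝟚 ℤ.* (norm v ℤ.+ norm w)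
  parallelogram (a , b) (c , d) = solve 4 (λ a b c d →
      let x = a :+ :- c ; y = b :+ :- d ; x′ = a :+ c ; y′ = b :+ d in
      (x :* x :- x :* y :+ y :* y) :+ (x′ :* x′ :- x′ :* y′ :+ y′ :* y′)
      := con 𝟚 :* ((a :* a :- a :* b :+ b :* b) :+ (c :* c :- c :* d :+ d :* d))) refl a b c d

  Unit : 𝔼.Carrier → Set
  Unit w = norm w ≡ 1ℤ

  Unit-* : ∀ {v w} → Unit v → Unit w → Unit (v 𝔼.* w)
  Unit-* {v} {w} p q = trans (norm-* v w) (cong₂ ℤ._*_ p q)

  module _ {v w : 𝔼.Carrier} (v-unit : Unit v) (w-unit : Unit w) where
    private
      total : ∣ norm (v 𝔼.- w) ∣ ℕ.+ ∣ norm (v 𝔼.+ w) ∣ ≡ 4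
      total = ℤ.+-injective (trans (sym (cong₂ ℤ._+_ (norm-abs (v 𝔼.- w)) (norm-abs (v 𝔼.+ w))))
        (trans (parallelogram v w) (cong₂ (λ p q → 𝟚 ℤ.* (p ℤ.+ q)) v-unit w-unit)))

      difference : ∀ m t → v ≡ w 𝔼.+ m 𝔼.* t → v 𝔼.- w ≡ m 𝔼.* t
      difference m t refl = 𝔼.solve 3 (λ w m t → (w 𝔼.:+ m 𝔼.:* t) 𝔼.:- w 𝔼.:= m 𝔼.:* t) refl w m t

      difference-0 : ∀ m t → v ≡ w 𝔼.+ m 𝔼.* t → ∣ norm t ∣ ≡ 0 → v ≡ w
      difference-0 m t eq t≡0 = trans eq (trans (cong (λ t → w 𝔼.+ m 𝔼.* t) (norm≡0 t t≡0))
        (𝔼.solve 2 (λ w m → w 𝔼.:+ m 𝔼.:* 𝔼.con 0ℤ 𝔼.:= w) refl w m))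

    -- For units the parallelogram law reads `norm (v - w) + norm (v + w) = 4`. A difference `4t`
    -- has norm `16 norm t`, so `t = 0`.
    units-mod-4 : v ≡ᴱ w [ 4# ] → v ≡ w
    units-mod-4 (t , eq) = difference-0 4# t eq (small ∣ norm t ∣ (trans (cong (ℕ._+ ∣ norm (v 𝔼.+ w) ∣) scaled) total))
      where
      scaled : 16 ℕ.* ∣ norm t ∣ ≡ ∣ norm (v 𝔼.- w) ∣
      scaled = sym (trans (cong (λ u → ∣ norm u ∣) (difference 4# t eq)) (trans (cong ∣_∣ (norm-4* t)) (ℤ.abs-* (ℤ.+ 16) (norm t))))
      small : ∀ a {b} → 16 ℕ.* a ℕ.+ b ≡ 4 → a ≡ 0
      small zero eq = refl
      small (suc a) {b} eq = contradiction
        (ℕ.≤-trans (ℕ.m≤m*n 16 (suc a)) (ℕ.≤-trans (ℕ.m≤m+n (16 ℕ.* suc a) b) (ℕ.≤-reflexive eq)))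
        λ { (s≤s (s≤s (s≤s (s≤s ())))) }

    -- Now `norm (v - w) = 4 norm t`, so `norm t` is 0 or 1, and in the second case nothing is left
    -- for `norm (v + w)`.
    units-mod-2 : v ≡ᴱ w [ 2# ] → v ≡ w ⊎ v ≡ 𝔼.- w
    units-mod-2 (t , eq) = by-size ∣ norm t ∣ ∣ norm (v 𝔼.+ w) ∣ refl refl
        (trans (cong (ℕ._+ ∣ norm (v 𝔼.+ w) ∣) scaled) total)
      where
      scaled : 4 ℕ.* ∣ norm t ∣ ≡ ∣ norm (v 𝔼.- w) ∣
      scaled = sym (trans (cong (λ u → ∣ norm u ∣) (difference 2# t eq)) (trans (cong ∣_∣ (norm-* 2# t)) (ℤ.abs-* (ℤ.+ 4) (norm t))))

      negative : v 𝔼.+ w ≡ 𝔼.0# → v ≡ 𝔼.- w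
      negative v+w≡0 = begin
        v                    ≡⟨ 𝔼.solve 2 (λ v w → v 𝔼.:= (v 𝔼.:+ w) 𝔼.:+ 𝔼.:- w) refl v w ⟩
        (v 𝔼.+ w) 𝔼.+ 𝔼.- w  ≡⟨ cong (λ u → u 𝔼.+ 𝔼.- w) v+w≡0 ⟩
        𝔼.0# 𝔼.+ 𝔼.- w       ≡⟨ 𝔼.+-identityˡ (𝔼.- w) ⟩
        𝔼.- w                ∎
        where open ≡-Reasoning

      by-size : ∀ a b → ∣ norm t ∣ ≡ a → ∣ norm (v 𝔼.+ w) ∣ ≡ b → 4 ℕ.* a ℕ.+ b ≡ 4 → v ≡ w ⊎ v ≡ 𝔼.- w
      by-size zero          b a≡ b≡ eq′ = inj₁ (difference-0 2# t eq a≡)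
      by-size (suc zero)    b a≡ b≡ eq′ = inj₂ (negative (norm≡0 (v 𝔼.+ w) (trans b≡ (ℕ.+-cancelˡ-≡ 4 b 0 eq′))))
      by-size (suc (suc a)) b a≡ b≡ eq′ = contradiction
        (ℕ.≤-trans (ℕ.*-monoʳ-≤ 4 (s≤s (s≤s (z≤n {a})))) (ℕ.≤-trans (ℕ.m≤m+n (4 ℕ.* suc (suc a)) b) (ℕ.≤-reflexive eq′)))
        λ { (s≤s (s≤s (s≤s (s≤s ())))) }

  -- The prime 2 is inert in ℤ[ω]: `x² - xy + y²` is even only if `x` and `y` both are.
  norm-parity : ∀ w → (∃[ v ] w ≡ 2# 𝔼.* v) ⊎ Odd (norm w)
  norm-parity (x , y) with parity x | parity y
  ... | inj₁ (a , refl) | inj₁ (b , refl) = inj₁ ((a , b) , sym (2#-* (a , b)))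
  ... | inj₁ (a , refl) | inj₂ (b , refl) = inj₂ (𝟚 ℤ.* (a ℤ.* a) ℤ.- a ℤ.* (1ℤ ℤ.+ 𝟚 ℤ.* b) ℤ.+ 𝟚 ℤ.* b ℤ.+ 𝟚 ℤ.* (b ℤ.* b) ,
    solve 2 (λ a b → con 𝟚 :* a :* (con 𝟚 :* a) :- con 𝟚 :* a :* (con 1ℤ :+ con 𝟚 :* b) :+ (con 1ℤ :+ con 𝟚 :* b) :* (con 1ℤ :+ con 𝟚 :* b)
      := con 1ℤ :+ con 𝟚 :* (con 𝟚 :* (a :* a) :- a :* (con 1ℤ :+ con 𝟚 :* b) :+ con 𝟚 :* b :+ con 𝟚 :* (b :* b))) refl a b)
  ... | inj₂ (a , refl) | inj₁ (b , refl) = inj₂ (𝟚 ℤ.* (b ℤ.* b) ℤ.- b ℤ.* (1ℤ ℤ.+ 𝟚 ℤ.* a) ℤ.+ 𝟚 ℤ.* a ℤ.+ 𝟚 ℤ.* (a ℤ.* a) ,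
    solve 2 (λ a b → (con 1ℤ :+ con 𝟚 :* a) :* (con 1ℤ :+ con 𝟚 :* a) :- (con 1ℤ :+ con 𝟚 :* a) :* (con 𝟚 :* b) :+ con 𝟚 :* b :* (con 𝟚 :* b)
      := con 1ℤ :+ con 𝟚 :* (con 𝟚 :* (b :* b) :- b :* (con 1ℤ :+ con 𝟚 :* a) :+ con 𝟚 :* a :+ con 𝟚 :* (a :* a))) refl a b)
  ... | inj₂ (a , refl) | inj₂ (b , refl) = inj₂ (𝟚 ℤ.* (a ℤ.* a) ℤ.+ 𝟚 ℤ.* (b ℤ.* b) ℤ.+ a ℤ.+ b ℤ.- 𝟚 ℤ.* (a ℤ.* b) ,
    solve 2 (λ a b → (con 1ℤ :+ con 𝟚 :* a) :* (con 1ℤ :+ con 𝟚 :* a) :- (con 1ℤ :+ con 𝟚 :* a) :* (con 1ℤ :+ con 𝟚 :* b) :+ (con 1ℤ :+ con 𝟚 :* b) :* (con 1ℤ :+ con 𝟚 :* b)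
      := con 1ℤ :+ con 𝟚 :* (con 𝟚 :* (a :* a) :+ con 𝟚 :* (b :* b) :+ a :+ b :- con 𝟚 :* (a :* b))) refl a b)

  norm-power : ∀ {w k} → norm w ≈2^ k →
    (k ≡ 0 × Unit w) ⊎ ∃[ v ] ∃[ j ] (w ≡ 2# 𝔼.* v × k ≡ 2 ℕ.+ j × norm v ≈2^ j)
  norm-power {w} {k} eq = by-parity (norm-parity w)
    where
    by-parity : (∃[ v ] w ≡ 2# 𝔼.* v) ⊎ Odd (norm w) →
      (k ≡ 0 × Unit w) ⊎ ∃[ v ] ∃[ j ] (w ≡ 2# 𝔼.* v × k ≡ 2 ℕ.+ j × norm v ≈2^ j)
    by-parity (inj₂ o) = inj₁ (k≡0 , trans (norm-abs w) (cong ℤ.+_ (trans (_≈2^_.abs≡ eq) (cong (2 ℕ.^_) k≡0))))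
      where k≡0 = ≈2^-Odd {norm w} {k} eq o
    by-parity (inj₁ (v , w≡)) =
      let i , k≡ , eq₁ = ≈2^-half {𝟚 ℤ.* norm v} {k} (subst (_≈2^ k) (trans (cong norm w≡) (norm-2* v)) eq)
          j , i≡ , eq₂ = ≈2^-half {norm v} {i} eq₁
      in inj₂ (v , j , w≡ , trans k≡ (cong suc i≡) , eq₂)

  -- Reduction modulo √-3 sends x + yω to x + y.
  infix 4 _∼_
  record _∼_ (n : ℤ) (w : 𝔼.Carrier) : Set where
    constructor congruent
    field residue : n ≡ᶻ proj₁ w ℤ.+ proj₂ w [ 𝟛 ]

  ∼-+ : ∀ {m n v w} → m ∼ v → n ∼ w → m ℤ.+ n ∼ v 𝔼.+ w
  ∼-+ {v = a , b} {c , d} (congruent (s , refl)) (congruent (t , refl)) = congruent (s ℤ.+ t ,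
    solve 6 (λ a b c d s t → ((a :+ b) :+ con 𝟛 :* s) :+ ((c :+ d) :+ con 𝟛 :* t) := ((a :+ c) :+ (b :+ d)) :+ con 𝟛 :* (s :+ t)) refl a b c d s t)

  -- Reduction is multiplicative because ω goes to 1, which is a root of `t² + t + 1` modulo 3.
  ∼-* : ∀ {m n v w} → m ∼ v → n ∼ w → m ℤ.* n ∼ v 𝔼.* w
  ∼-* {v = a , b} {c , d} (congruent (s , refl)) (congruent (t , refl)) =
    congruent ((a ℤ.+ b) ℤ.* t ℤ.+ (c ℤ.+ d) ℤ.* s ℤ.+ 𝟛 ℤ.* s ℤ.* t ℤ.+ b ℤ.* d ,
    solve 6 (λ a b c d s t → ((a :+ b) :+ con 𝟛 :* s) :* ((c :+ d) :+ con 𝟛 :* t)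
      := ((a :* c :+ con -1ℤ :* (b :* d)) :+ (a :* d :+ b :* c :+ con -1ℤ :* (b :* d)))
         :+ con 𝟛 :* ((a :+ b) :* t :+ (c :+ d) :* s :+ con 𝟛 :* s :* t :+ b :* d)) refl a b c d s t)

  ∼-neg : ∀ {m v} → m ∼ v → ℤ.- m ∼ 𝔼.- v
  ∼-neg {v = a , b} (congruent (s , refl)) = congruent (ℤ.- s ,
    solve 3 (λ a b s → :- ((a :+ b) :+ con 𝟛 :* s) := (:- a :+ :- b) :+ con 𝟛 :* :- s) refl a b s)

  -- The square of `a + bω` reduces to the integer square `(a + b)²` modulo 3, so the sign of `n` is
  -- forced.
  ∼-square : ∀ {n e} w → n ≈2^ e → n ∼ w 𝔼.* w → n ≡ (ℤ.- 𝟚) ℤ.^ e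
  ∼-square {n} {e} (a , b) abs (congruent r) = square⇒-2^ {n} {e} (a ℤ.+ b) abs (≡ᶻ.[]-trans r (b ℤ.* b ℤ.* -1ℤ ,
    solve 2 (λ a b → (a :* a :+ con -1ℤ :* (b :* b)) :+ (a :* b :+ b :* a :+ con -1ℤ :* (b :* b)) := (a :+ b) :* (a :+ b) :+ con 𝟛 :* (b :* b :* con -1ℤ)) refl a b))
    where module ≡ᶻ = Congruences ℤ-ring

open Norms

-- Quadruples whose Eisenstein factors are units

module UnitQuadruples where
  open ≡𝔼 using (2#) renaming (_≡_[_] to _≡ᴱ_[_])
  open Zk using (solve; con; _:+_; _:*_; :-_; _:-_; _:=_)

  Ev : 𝔼.Carrier → Set
  Ev w = ∃[ v ] w ≡ 2# 𝔼.* v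

  Ev⇒Even-norm : ∀ {w} → Ev w → Even (norm w)
  Ev⇒Even-norm (v , eq) = 𝟚 ℤ.* norm v , trans (cong norm eq) (norm-2* v)

  Ev-resp : ∀ {v w} → v ≡ᴱ w [ 2# ] → Ev w → Ev v
  Ev-resp (t , eq) (s , eq′) = s 𝔼.+ t , trans eq (trans (cong (λ x → x 𝔼.+ 2# 𝔼.* t) eq′)
    (𝔼.solve 3 (λ m s t → m 𝔼.:* s 𝔼.:+ m 𝔼.:* t 𝔼.:= m 𝔼.:* (s 𝔼.:+ t)) refl 2# s t))

  Ev-*ʳ : ∀ v {w} → Ev w → Ev (v 𝔼.* w)
  Ev-*ʳ v (s , eq) = v 𝔼.* s , trans (cong (λ x → v 𝔼.* x) eq)
    (𝔼.solve 3 (λ m v s → v 𝔼.:* (m 𝔼.:* s) 𝔼.:= m 𝔼.:* (v 𝔼.:* s)) refl 2# v s)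

  -- 2 is prime in ℤ[ω]; the parity of the norm takes the place of unique factorisation.
  Ev-square⁻ : ∀ w → Ev (w 𝔼.* w) → Ev w
  Ev-square⁻ w ev = by-parity (norm-parity w)
    where
    by-parity : Ev w ⊎ Odd (norm w) → Ev w
    by-parity (inj₁ e) = e
    by-parity (inj₂ o) = contradiction (subst Odd (sym (norm-* w w)) (Odd-* o o)) (¬Even∧Odd (Ev⇒Even-norm ev))

  odd-unit : ∀ {w k} → norm w ≈2^ k → ¬ Ev w → k ≡ 0 × Unit w
  odd-unit {w} {k} p odd = by-power (norm-power {w} {k} p)
    where
    by-power : (k ≡ 0 × Unit w) ⊎ ∃[ v ] ∃[ j ] (w ≡ 2# 𝔼.* v × k ≡ 2 ℕ.+ j × norm v ≈2^ j) → k ≡ 0 × Unit w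
    by-power (inj₁ u)            = u
    by-power (inj₂ (v , _ , e , _)) = contradiction (v , e) odd

  even-power : ∀ {w k} → norm w ≈2^ k → Ev w → 2 ℕ.≤ k
  even-power {w} {k} p ev = by-power (norm-power {w} {k} p)
    where
    by-power : (k ≡ 0 × Unit w) ⊎ ∃[ v ] ∃[ j ] (w ≡ 2# 𝔼.* v × k ≡ 2 ℕ.+ j × norm v ≈2^ j) → 2 ℕ.≤ k
    by-power (inj₁ (_ , u))              = contradiction (0ℤ , u) (¬Even∧Odd (Ev⇒Even-norm ev))
    by-power (inj₂ (_ , _ , _ , k≡ , _)) = ℕ.≤-trans (ℕ.m≤m+n 2 _) (ℕ.≤-reflexive (sym k≡))

  Ev? : ∀ w → Ev w ⊎ ¬ Ev w
  Ev? w = by-parity (norm-parity w)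
    where
    by-parity : Ev w ⊎ Odd (norm w) → Ev w ⊎ ¬ Ev w
    by-parity (inj₁ e) = inj₁ e
    by-parity (inj₂ o) = inj₂ λ e → ¬Even∧Odd (Ev⇒Even-norm e) o

  norm-split : ∀ {k} v w → norm (v 𝔼.* w) ≈2^ k → ∃[ i ] ∃[ j ] (norm v ≈2^ i × norm w ≈2^ j × i ℕ.+ j ≡ k)
  norm-split v w p = ≈2^-* (norm v) (norm w) (subst (_≈2^ _) (norm-* v w) p)

  -- Every factor 2 of `w` accounts for a factor 4 of the norm. The bound `b` makes the recursion
  -- structural.
  norm-exponent-even : ∀ k {w} → norm w ≈2^ k → ∃[ h ] k ≡ h ℕ.+ h
  norm-exponent-even k {w} p = bounded k k {w} ℕ.≤-refl p
    where
    bounded : ∀ b k {w} → k ℕ.≤ b → norm w ≈2^ k → ∃[ h ] k ≡ h ℕ.+ h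
    bounded b k {w} k≤b p = by-power b k≤b (norm-power {w} {k} p)
      where
      by-power : ∀ b → k ℕ.≤ b → (k ≡ 0 × Unit w) ⊎ ∃[ v ] ∃[ j ] (w ≡ 2# 𝔼.* v × k ≡ 2 ℕ.+ j × norm v ≈2^ j) → ∃[ h ] k ≡ h ℕ.+ h
      by-power b       _   (inj₁ (k≡0 , _)) = 0 , k≡0
      by-power zero    k≤b (inj₂ (_ , j , _ , k≡ , _)) = contradiction (subst (ℕ._≤ 0) k≡ k≤b) λ ()
      by-power (suc b) k≤b (inj₂ (v , j , _ , k≡ , q)) =
        let h , j≡ = bounded b j {v} (ℕ.≤-trans (ℕ.n≤1+n j) (ℕ.s≤s⁻¹ (subst (ℕ._≤ suc b) k≡ k≤b))) q
        in suc h , trans k≡ (cong suc (trans (cong suc j≡) (sym (ℕ.+-suc h h))))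

  valuation-≤ : ∀ j {n k} m → n ≡ ℤ.+ (2 ℕ.^ j) ℤ.* m → n ≈2^ k → j ℕ.≤ k
  valuation-≤ j {n} {k} m eq (power p) with split-power k (2 ℕ.^ j) ∣ m ∣ (trans (sym (trans (cong ∣_∣ eq) (ℤ.abs-* (ℤ.+ (2 ℕ.^ j)) m))) p)
  ... | i , l , j≡i , _ , refl = ℕ.≤-trans (ℕ.≤-reflexive (2^-injective j i j≡i)) (ℕ.m≤m+n i l)

  -- Meant for `N₄` and `N₈`: as sums of two squares they are nonnegative, and a nonnegative power
  -- of -2 has even exponent.
  square-exponent : ∀ e {m} → (ℤ.- 𝟚) ℤ.^ e ≡ ℤ.+ m → ∃[ h ] e ≡ h ℕ.+ h
  square-exponent zero          eq = 0 , refl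
  square-exponent (suc zero)    ()
  square-exponent (suc (suc e)) {m} eq = let h , e≡ = square-exponent e (quarter ((ℤ.- 𝟚) ℤ.^ e) (trans (ℤ.*-assoc (ℤ.- 𝟚) (ℤ.- 𝟚) ((ℤ.- 𝟚) ℤ.^ e)) eq))
                                         in suc h , cong suc (trans (cong suc e≡) (sym (ℕ.+-suc h h)))
    where
    quarter : ∀ n {m} → ℤ.+ 4 ℤ.* n ≡ ℤ.+ m → n ≡ ℤ.+ ∣ n ∣
    quarter (ℤ.+ n) eq = refl

  sum-of-squares : ∀ a b → a ℤ.* a ℤ.+ b ℤ.* b ≡ ℤ.+ (∣ a ∣ ℕ.* ∣ a ∣ ℕ.+ ∣ b ∣ ℕ.* ∣ b ∣)
  sum-of-squares a b = cong₂ ℤ._+_ (square-abs a) (square-abs b)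

  module _ {u : 𝔼Q.Quadruple} where
    open 𝔼Q.Quadruple u

    Ev-n₂ : Ev n₂ → Ev n₁
    Ev-n₂ = Ev-resp (≡𝔼.[]-sym n₂≡n₁)

    Ev-n₃ : Ev n₃ → Ev n₁
    Ev-n₃ = Ev-resp (≡𝔼.[]-sym n₃≡n₁)

    Ev-n₄ : Ev n₄ → Ev n₁
    Ev-n₄ = Ev-resp (≡𝔼.[]-sym n₄≡n₁)

    Ev-N₄ : Ev N₄ → Ev n₁
    Ev-N₄ ev = Ev-square⁻ n₁ (Ev-resp (≡𝔼.[]-sym N₄≡n₁²) ev)

    Ev-N₈ : Ev N₈ → Ev n₁
    Ev-N₈ ev = Ev-square⁻ n₁ (Ev-square⁻ (n₁ 𝔼.* n₁) (Ev-resp (≡𝔼.[]-sym N₈≡n₁⁴) ev))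

    Ev-N₄⁻ : Ev n₁ → Ev N₄
    Ev-N₄⁻ ev = Ev-resp N₄≡n₁² (Ev-*ʳ n₁ {n₁} ev)

    Ev-N₈⁻ : Ev n₁ → Ev N₈
    Ev-N₈⁻ ev = Ev-resp N₈≡n₁⁴ (Ev-*ʳ (n₁ 𝔼.* n₁) {n₁ 𝔼.* n₁} (Ev-*ʳ n₁ {n₁} ev))

    module _ (n₁-unit : Unit n₁) (n₂-unit : Unit n₂) where
      private
        -- Units that agree modulo 2 satisfy `n₂ = ± n₁`, so one of `A⁺` and `B⁺` vanishes. The two
        -- cases are recorded symmetrically as `A⁺ B⁺ = 0` and `A⁺² + B⁺² = n₁²`.
        n₂² : n₂ 𝔼.* n₂ ≡ n₁ 𝔼.* n₁
        n₂² = by-sign (units-mod-2 n₂-unit n₁-unit n₂≡n₁)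
          where
          by-sign : n₂ ≡ n₁ ⊎ n₂ ≡ 𝔼.- n₁ → n₂ 𝔼.* n₂ ≡ n₁ 𝔼.* n₁
          by-sign (inj₁ eq) = cong₂ 𝔼._*_ eq eq
          by-sign (inj₂ eq) = trans (cong₂ 𝔼._*_ eq eq) (𝔼.solve 1 (λ n → 𝔼.:- n 𝔼.:* 𝔼.:- n 𝔼.:= n 𝔼.:* n) refl n₁)

        two : ∀ x → x 𝔼.+ x ≡ 2# 𝔼.* x
        two = 𝔼.solve 1 (λ x → x 𝔼.:+ x 𝔼.:= (𝔼.con 1ℤ 𝔼.:+ 𝔼.con 1ℤ) 𝔼.:* x) refl

        A²+B² : A⁺ 𝔼.* A⁺ 𝔼.+ B⁺ 𝔼.* B⁺ ≡ n₁ 𝔼.* n₁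
        A²+B² = 2#-cancel _ _ (trans
          (𝔼.solve 2 (λ a b → (𝔼.con 1ℤ 𝔼.:+ 𝔼.con 1ℤ) 𝔼.:* (a 𝔼.:* a 𝔼.:+ b 𝔼.:* b) 𝔼.:= (a 𝔼.:+ b) 𝔼.:* (a 𝔼.:+ b) 𝔼.:+ (a 𝔼.:- b) 𝔼.:* (a 𝔼.:- b)) refl A⁺ B⁺)
          (trans (cong (λ t → n₁ 𝔼.* n₁ 𝔼.+ t) n₂²) (two (n₁ 𝔼.* n₁))))

        AB : A⁺ 𝔼.* B⁺ ≡ 𝔼.0#
        AB = 2#-cancel _ _ (2#-cancel _ _ (trans
          (𝔼.solve 2 (λ a b → (𝔼.con 1ℤ 𝔼.:+ 𝔼.con 1ℤ) 𝔼.:* ((𝔼.con 1ℤ 𝔼.:+ 𝔼.con 1ℤ) 𝔼.:* (a 𝔼.:* b)) 𝔼.:= (a 𝔼.:+ b) 𝔼.:* (a 𝔼.:+ b) 𝔼.:- (a 𝔼.:- b) 𝔼.:* (a 𝔼.:- b)) refl A⁺ B⁺)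
          (trans (cong (λ t → n₁ 𝔼.* n₁ 𝔼.- t) n₂²) (𝔼.-‿inverseʳ (n₁ 𝔼.* n₁)))))

        A⁴+B⁴ : (A⁺ 𝔼.* A⁺) 𝔼.* (A⁺ 𝔼.* A⁺) 𝔼.+ (B⁺ 𝔼.* B⁺) 𝔼.* (B⁺ 𝔼.* B⁺) ≡ (n₁ 𝔼.* n₁) 𝔼.* (n₁ 𝔼.* n₁)
        A⁴+B⁴ = trans
          (𝔼.solve 2 (λ a b → (a 𝔼.:* a) 𝔼.:* (a 𝔼.:* a) 𝔼.:+ (b 𝔼.:* b) 𝔼.:* (b 𝔼.:* b) 𝔼.:=
            (a 𝔼.:* a 𝔼.:+ b 𝔼.:* b) 𝔼.:* (a 𝔼.:* a 𝔼.:+ b 𝔼.:* b) 𝔼.:- (𝔼.con 1ℤ 𝔼.:+ 𝔼.con 1ℤ) 𝔼.:* (a 𝔼.:* b) 𝔼.:* (a 𝔼.:* b)) refl A⁺ B⁺)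
          (trans (cong₂ (λ s t → s 𝔼.* s 𝔼.- 2# 𝔼.* t 𝔼.* t) A²+B² AB)
            (𝔼.solve 1 (λ s → s 𝔼.:* s 𝔼.:- (𝔼.con 1ℤ 𝔼.:+ 𝔼.con 1ℤ) 𝔼.:* 𝔼.con 0ℤ 𝔼.:* 𝔼.con 0ℤ 𝔼.:= s 𝔼.:* s) refl (n₁ 𝔼.* n₁)))

      -- Modulo 4, `N₄` is `A⁺² + B⁺² = n₁²`, and units that agree modulo 4 are equal. Thus `N₄` is
      -- a square, which determines the sign of its rational counterpart.
      unit-N₄ : Unit N₄ → N₄ ≡ n₁ 𝔼.* n₁
      unit-N₄ N₄-unit = units-mod-4 N₄-unit (Unit-* {n₁} {n₁} n₁-unit n₁-unit)
        (≡𝔼.[]-trans N₄≡A²+B² (≡𝔼.≡⇒[] A²+B²))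

      unit-N₈ : ∀ {v} → v 𝔼Q.≈₂ u → Unit (𝔼Q.Quadruple.N₈ v) → 𝔼Q.Quadruple.N₈ v ≡ (n₁ 𝔼.* n₁) 𝔼.* (n₁ 𝔼.* n₁)
      unit-N₈ {v} v≈u N₈-unit = units-mod-4 N₈-unit
        (Unit-* {n₁ 𝔼.* n₁} {n₁ 𝔼.* n₁} (Unit-* {n₁} {n₁} n₁-unit n₁-unit) (Unit-* {n₁} {n₁} n₁-unit n₁-unit))
        (≡𝔼.[]-trans (𝔼Q.Quadruple.N₈≡A⁴+B⁴ v) (≡𝔼.[]-trans
          (≡𝔼.[]-+ (≡𝔼.[]-* A²-≈ A²-≈) (≡𝔼.[]-* B²-≈ B²-≈)) (≡𝔼.≡⇒[] A⁴+B⁴)))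
        where
        A²-≈ = ≡𝔼.[]-square (𝔼Q.A⁺-≈ v≈u)
        B²-≈ = ≡𝔼.[]-square (𝔼Q.B⁺-≈ v≈u)

open UnitQuadruples

-- Parities of integer quadruples

module RationalQuadruples where
  open Zk using (solve; con; _:+_; _:*_; :-_; _:-_; _:=_)

  ∼-eisenstein : ∀ x j → rational x j ∼ eisenstein x j
  ∼-eisenstein x j = congruent (x j (# 2) , solve 3 (λ a b c → a :+ b :+ c := ((a :- c) :+ (b :- c)) :+ con 𝟛 :* c) refl (x j (# 0)) (x j (# 1)) (x j (# 2)))

  ∼-eval : ∀ x (p : Poly 8) → eval ℤ-ring p (rational x) ∼ eval 𝔼 p (eisenstein x)
  ∼-eval x p = eval-related {ℤ-ring} {𝔼} _∼_ ∼-+ ∼-* ∼-neg p (∼-eisenstein x)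

  Even⇒1≤ : ∀ {n k} → n ≈2^ k → Even n → 1 ℕ.≤ k
  Even⇒1≤ p (m , eq) = valuation-≤ 1 m eq p

  double≥ : ∀ r → 1 ℕ.≤ r ℕ.+ r → 2 ℕ.≤ r ℕ.+ r
  double≥ (suc r) _ = s≤s (ℕ.≤-trans (s≤s z≤n) (ℕ.≤-reflexive (sym (ℕ.+-suc r r))))

  double≥4 : ∀ r → 3 ℕ.≤ r ℕ.+ r → 4 ℕ.≤ r ℕ.+ r
  double≥4 (suc zero)    (s≤s (s≤s ()))
  double≥4 (suc (suc r)) _ = s≤s (s≤s (ℕ.≤-trans (s≤s (s≤s z≤n)) (ℕ.≤-reflexive (sym (trans (ℕ.+-suc r (suc r)) (cong suc (ℕ.+-suc r r)))))))

  -- An odd square is 1 modulo 4, so modulo 4 the sum counts the odd terms.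
  four∣squares : ∀ a b m → a ℤ.* a ℤ.+ b ℤ.* b ≡ ℤ.+ 4 ℤ.* m → Even a × Even b
  four∣squares a b m eq with parity a | parity b
  ... | inj₁ e            | inj₁ e′           = e , e′
  ... | inj₁ (k , refl)   | inj₂ (l , refl)   = contradiction
    (k ℤ.* k ℤ.+ k ℤ.* k ℤ.+ 𝟚 ℤ.* (l ℤ.+ l ℤ.* l) , solve 2 (λ k l → con 𝟚 :* k :* (con 𝟚 :* k) :+ (con 1ℤ :+ con 𝟚 :* l) :* (con 1ℤ :+ con 𝟚 :* l)
      := con 1ℤ :+ con 𝟚 :* (k :* k :+ k :* k :+ con 𝟚 :* (l :+ l :* l))) refl k l)
    (¬Even∧Odd (𝟚 ℤ.* m , trans eq (ℤ.*-assoc 𝟚 𝟚 m)))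
  ... | inj₂ (k , refl)   | inj₁ (l , refl)   = contradiction
    (l ℤ.* l ℤ.+ l ℤ.* l ℤ.+ 𝟚 ℤ.* (k ℤ.+ k ℤ.* k) , solve 2 (λ k l → (con 1ℤ :+ con 𝟚 :* l) :* (con 1ℤ :+ con 𝟚 :* l) :+ con 𝟚 :* k :* (con 𝟚 :* k)
      := con 1ℤ :+ con 𝟚 :* (k :* k :+ k :* k :+ con 𝟚 :* (l :+ l :* l))) refl l k)
    (¬Even∧Odd (𝟚 ℤ.* m , trans eq (ℤ.*-assoc 𝟚 𝟚 m)))
  ... | inj₂ (k , refl)   | inj₂ (l , refl)   = contradiction
    (k ℤ.+ k ℤ.* k ℤ.+ (l ℤ.+ l ℤ.* l) , refl)
    (¬Even∧Odd (m , ℤ.*-cancelˡ-≡ 𝟚 _ (𝟚 ℤ.* m) (trans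
      (solve 2 (λ k l → con 𝟚 :* (con 1ℤ :+ con 𝟚 :* (k :+ k :* k :+ (l :+ l :* l)))
        := (con 1ℤ :+ con 𝟚 :* k) :* (con 1ℤ :+ con 𝟚 :* k) :+ (con 1ℤ :+ con 𝟚 :* l) :* (con 1ℤ :+ con 𝟚 :* l)) refl k l)
      (trans eq (ℤ.*-assoc 𝟚 𝟚 m)))))

  module _ {u : ℤQ.Quadruple} where
    open ℤQ.Quadruple u

    Even-N₄ : Even n₁ → Even N₄
    Even-N₄ (k , eq) = Even-resp N₄≡n₁² (k ℤ.* n₁ , trans (cong (λ t → t ℤ.* n₁) eq) (ℤ.*-assoc 𝟚 k n₁))

    Even-n₁ : Even N₄ → Even n₁
    Even-n₁ ev = Even-square⁻ (Even-resp (≡ℤ.[]-sym N₄≡n₁²) ev)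

    Even-N₈ : ∀ {v} → v ℤQ.≈₂ u → Even n₁ → Even (ℤQ.Quadruple.N₈ v)
    Even-N₈ {v} v≈u ev = Even-resp (ℤQ.Quadruple.N₈≡n₁⁴ v)
      (k ℤ.* n ℤ.* (n ℤ.* n) , trans (cong (λ t → t ℤ.* n ℤ.* (n ℤ.* n)) eq)
        (solve 2 (λ k n → con 𝟚 :* k :* n :* (n :* n) := con 𝟚 :* (k :* n :* (n :* n))) refl k n))
      where
      n = ℤQ.Quadruple.n₁ v
      k = proj₁ (Even-resp (ℤQ.n₁-≈ v≈u) ev)
      eq = proj₂ (Even-resp (ℤQ.n₁-≈ v≈u) ev)

    -- If N₄ is divisible by 4 then all of A⁺, B⁺, A⁻, B⁻ are even, and ℓ = n₁/2 and
    -- ℓ′ = A⁻/2 + B⁻/2 decide how divisible n₁, n₂ and N₄ are.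
    record Halves : Set where
      field
        α β α′ β′ : ℤ
        A⁺≡ : A⁺ ≡ 𝟚 ℤ.* α
        B⁺≡ : B⁺ ≡ 𝟚 ℤ.* β
        A⁻≡ : A⁻ ≡ 𝟚 ℤ.* α′
        B⁻≡ : B⁻ ≡ 𝟚 ℤ.* β′
        u₀≡ : u₀ ≡ α ℤ.+ α′
        u₁≡ : u₁ ≡ β ℤ.+ β′
        u₂≡ : u₂ ≡ α ℤ.- α′
        u₃≡ : u₃ ≡ β ℤ.- β′

      n₁≡ : n₁ ≡ 𝟚 ℤ.* (α ℤ.+ β)
      n₁≡ = trans (cong₂ ℤ._+_ A⁺≡ B⁺≡) (solve 2 (λ a b → con 𝟚 :* a :+ con 𝟚 :* b := con 𝟚 :* (a :+ b)) refl α β)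

      n₂≡ : n₂ ≡ 𝟚 ℤ.* (α ℤ.- β)
      n₂≡ = trans (cong₂ ℤ._-_ A⁺≡ B⁺≡) (solve 2 (λ a b → con 𝟚 :* a :- con 𝟚 :* b := con 𝟚 :* (a :- b)) refl α β)

      N₄≡ : N₄ ≡ ℤ.+ 4 ℤ.* (α′ ℤ.* α′ ℤ.+ β′ ℤ.* β′)
      N₄≡ = trans (cong₂ (λ a b → a ℤ.* a ℤ.+ b ℤ.* b) A⁻≡ B⁻≡)
        (solve 2 (λ a b → con 𝟚 :* a :* (con 𝟚 :* a) :+ con 𝟚 :* b :* (con 𝟚 :* b) := con (ℤ.+ 4) :* (a :* a :+ b :* b)) refl α′ β′)

    halves : Even A⁻ → Even B⁻ → Halves
    halves (a , a≡) (b , b≡) = record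
      { α = a ℤ.+ u₂ ; β = b ℤ.+ u₃ ; α′ = a ; β′ = b ; A⁻≡ = a≡ ; B⁻≡ = b≡
      ; A⁺≡ = plus u₀ u₂ a a≡ ; B⁺≡ = plus u₁ u₃ b b≡
      ; u₀≡ = first u₀ u₂ a a≡ ; u₁≡ = first u₁ u₃ b b≡
      ; u₂≡ = second a u₂ ; u₃≡ = second b u₃
      }
      where
      plus : ∀ x y a → x ℤ.- y ≡ 𝟚 ℤ.* a → x ℤ.+ y ≡ 𝟚 ℤ.* (a ℤ.+ y)
      plus x y a eq = trans (solve 2 (λ x y → x :+ y := (x :- y) :+ con 𝟚 :* y) refl x y)
        (trans (cong (λ t → t ℤ.+ 𝟚 ℤ.* y) eq) (sym (ℤ.*-distribˡ-+ 𝟚 a y)))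
      first : ∀ x y a → x ℤ.- y ≡ 𝟚 ℤ.* a → x ≡ a ℤ.+ y ℤ.+ a
      first x y a eq = trans (solve 2 (λ x y → x := (x :- y) :+ y) refl x y)
        (trans (cong (λ t → t ℤ.+ y) eq) (solve 2 (λ a y → con 𝟚 :* a :+ y := a :+ y :+ a) refl a y))
      second : ∀ a y → y ≡ a ℤ.+ y ℤ.- a
      second = solve 2 (λ a y → y := a :+ y :- a) refl

    halves-from-N₄ : ∀ {r} → N₄ ≈2^ r → 2 ℕ.≤ r → Halves
    halves-from-N₄ {suc (suc r)} p _ =
      let a , b = four∣squares A⁻ B⁻ (proj₁ quarter) (proj₂ quarter) in halves a b
      where
      quarter : ∃[ m ] N₄ ≡ ℤ.+ 4 ℤ.* m
      quarter =
        let m , eq = ≈2^-suc⇒Even {N₄} {suc r} p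
            _ , j≡ , q = ≈2^-half {m} {suc (suc r)} (subst (_≈2^ suc (suc r)) eq p)
            l , eq′ = ≈2^-suc⇒Even {m} {r} (subst (m ≈2^_) (sym (ℕ.suc-injective j≡)) q)
        in l , trans eq (trans (cong (λ t → 𝟚 ℤ.* t) eq′) (sym (ℤ.*-assoc 𝟚 𝟚 l)))
    halves-from-N₄ {suc zero} p (s≤s ())

  -- With all coefficients of one parity, e₀ + 2tⱼ, the norm from ℤ[ζ₈] is divisible by 8.
  N₈-divisible : ∀ p a b c → ∃[ m ] ℤQ.Quadruple.N₈ (ℤQ.⟨ p , p ℤ.+ 𝟚 ℤ.* a , p ℤ.+ 𝟚 ℤ.* b , p ℤ.+ 𝟚 ℤ.* c ⟩) ≡ ℤ.+ 8 ℤ.* m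
  N₈-divisible p a b c = p⁴ ℤ.+ 𝟚 ℤ.* (p ℤ.* p) ℤ.* (x ℤ.+ y) ℤ.+ 𝟚 ℤ.* (x ℤ.* x) ℤ.+ 𝟚 ℤ.* (y ℤ.* y) , (begin
    X ℤ.* X ℤ.+ Y ℤ.* Y
      ≡⟨ cong₂ (λ X Y → X ℤ.* X ℤ.+ Y ℤ.* Y)
           (solve 4 (λ p a b c → let u₁ = p :+ con 𝟚 :* a ; u₂ = p :+ con 𝟚 :* b ; u₃ = p :+ con 𝟚 :* c in
              p :* p :- u₂ :* u₂ :+ (u₁ :* u₃ :+ u₁ :* u₃) := con 𝟚 :* (p :* p :+ con 𝟚 :* (p :* (a :+ c :- b) :- b :* b :+ con 𝟚 :* a :* c))) refl p a b c)
           (solve 4 (λ p a b c → let u₁ = p :+ con 𝟚 :* a ; u₂ = p :+ con 𝟚 :* b ; u₃ = p :+ con 𝟚 :* c in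
              (p :* u₂ :+ p :* u₂) :- u₁ :* u₁ :+ u₃ :* u₃ := con 𝟚 :* (p :* p :+ con 𝟚 :* (p :* (b :- a :+ c) :- a :* a :+ c :* c))) refl p a b c) ⟩
    (𝟚 ℤ.* (p ℤ.* p ℤ.+ 𝟚 ℤ.* x)) ℤ.* (𝟚 ℤ.* (p ℤ.* p ℤ.+ 𝟚 ℤ.* x)) ℤ.+ (𝟚 ℤ.* (p ℤ.* p ℤ.+ 𝟚 ℤ.* y)) ℤ.* (𝟚 ℤ.* (p ℤ.* p ℤ.+ 𝟚 ℤ.* y))
      ≡⟨ solve 3 (λ p x y → let s = con 𝟚 :* (p :* p :+ con 𝟚 :* x) ; t = con 𝟚 :* (p :* p :+ con 𝟚 :* y) in
           s :* s :+ t :* t := con (ℤ.+ 8) :* (p :* p :* (p :* p) :+ con 𝟚 :* (p :* p) :* (x :+ y) :+ con 𝟚 :* (x :* x) :+ con 𝟚 :* (y :* y))) refl p x y ⟩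
    ℤ.+ 8 ℤ.* (p⁴ ℤ.+ 𝟚 ℤ.* (p ℤ.* p) ℤ.* (x ℤ.+ y) ℤ.+ 𝟚 ℤ.* (x ℤ.* x) ℤ.+ 𝟚 ℤ.* (y ℤ.* y)) ∎)
    where
    open ≡-Reasoning
    open ℤQ.Quadruple (ℤQ.⟨ p , p ℤ.+ 𝟚 ℤ.* a , p ℤ.+ 𝟚 ℤ.* b , p ℤ.+ 𝟚 ℤ.* c ⟩) using (X; Y)
    x = p ℤ.* (a ℤ.+ c ℤ.- b) ℤ.- b ℤ.* b ℤ.+ 𝟚 ℤ.* a ℤ.* c
    y = p ℤ.* (b ℤ.- a ℤ.+ c) ℤ.- a ℤ.* a ℤ.+ c ℤ.* c
    p⁴ = p ℤ.* p ℤ.* (p ℤ.* p)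

open RationalQuadruples

-- Exponents for C₂₄

module CyclicExponent where
  open Zk using (solve; con; _:+_; _:*_; :-_; _:-_; _:=_)

  ¬Even⇒0 : ∀ {n k} → n ≈2^ k → ¬ Even n → k ≡ 0
  ¬Even⇒0 {k = zero}      p odd = refl
  ¬Even⇒0 {n} {suc k} p odd = contradiction (≈2^-suc⇒Even {n} {k} p) odd

  Even-N₈⁻ : ∀ {u v} → v ℤQ.≈₂ u → Even (ℤQ.Quadruple.N₈ v) → Even (ℤQ.Quadruple.n₁ u)
  Even-N₈⁻ {u} {v} v≈u ev = Even-resp (≡ℤ.[]-sym (ℤQ.n₁-≈ v≈u))
    (Even-square⁻ (Even-square⁻ (Even-resp (≡ℤ.[]-sym (ℤQ.Quadruple.N₈≡n₁⁴ v)) ev)))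

  -- The exponents are at least `2 + 2 + 2 + 2` if `α + β` is even, since then 4 divides `n₁` and
  -- `n₂`; `1 + 1 + 4 + 2` if only `α′ + β′` is even, since then 8 divides `N₄`; and `1 + 1 + 2 + 4`
  -- if both are odd, since then all coefficients have one parity and 8 divides `N₈`. As the
  -- exponents of `N₄` and `N₈` are even, the bound 3 improves to 4.
  C8-bound : ∀ {u v a b r s} → v ℤQ.≈₂ u → Even (ℤQ.Quadruple.n₁ u) →
    ℤQ.Quadruple.n₁ u ≈2^ a → ℤQ.Quadruple.n₂ u ≈2^ b → ℤQ.Quadruple.N₄ u ≈2^ (r ℕ.+ r) → ℤQ.Quadruple.N₈ v ≈2^ (s ℕ.+ s) →
    8 ℕ.≤ a ℕ.+ b ℕ.+ (r ℕ.+ r) ℕ.+ (s ℕ.+ s)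
  C8-bound {u} {v} {a} {b} {r} {s} v≈u ev pa pb pr ps = by-parity (parity (α ℤ.+ β)) (parity (α′ ℤ.+ β′))
    where
    open ℤQ.Quadruple u
    2≤r : 2 ℕ.≤ r ℕ.+ r
    2≤r = double≥ r (Even⇒1≤ {N₄} pr (Even-N₄ {u} ev))

    1≤s : 1 ℕ.≤ s ℕ.+ s
    1≤s = Even⇒1≤ {ℤQ.Quadruple.N₈ v} ps (Even-N₈ v≈u ev)

    open Halves (halves-from-N₄ {u} {r ℕ.+ r} pr 2≤r)

    1≤a : 1 ℕ.≤ a
    1≤a = valuation-≤ 1 {n₁} (α ℤ.+ β) n₁≡ pa

    1≤b : 1 ℕ.≤ b
    1≤b = valuation-≤ 1 {n₂} (α ℤ.- β) n₂≡ pb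

    four : ∀ {n} t → n ≡ 𝟚 ℤ.* t → Even t → ∃[ m ] n ≡ ℤ.+ 4 ℤ.* m
    four t eq (m , t≡) = m , trans eq (trans (cong (λ t → 𝟚 ℤ.* t) t≡) (sym (ℤ.*-assoc 𝟚 𝟚 m)))

    by-parity : Even (α ℤ.+ β) ⊎ Odd (α ℤ.+ β) → Even (α′ ℤ.+ β′) ⊎ Odd (α′ ℤ.+ β′) → 8 ℕ.≤ a ℕ.+ b ℕ.+ (r ℕ.+ r) ℕ.+ (s ℕ.+ s)
    by-parity (inj₁ e) _ = ℕ.+-mono-≤ (ℕ.+-mono-≤ (ℕ.+-mono-≤
        (let m , eq = four (α ℤ.+ β) n₁≡ e in valuation-≤ 2 {n₁} m eq pa)
        (let m , eq = four (α ℤ.- β) n₂≡ (Even-resp (ℤ.- β , solve 2 (λ a b → a :- b := (a :+ b) :+ con 𝟚 :* :- b) refl α β) e) in valuation-≤ 2 {n₂} m eq pb)) 2≤r)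
        (double≥ s 1≤s)
    by-parity (inj₂ o) (inj₁ (k , eq)) = ℕ.+-mono-≤ (ℕ.+-mono-≤ (ℕ.+-mono-≤ 1≤a 1≤b)
        (double≥4 r (valuation-≤ 3 {N₄} (𝟚 ℤ.* k ℤ.* k ℤ.- α′ ℤ.* β′) eight pr))) (double≥ s 1≤s)
      where
      eight : N₄ ≡ ℤ.+ 8 ℤ.* (𝟚 ℤ.* k ℤ.* k ℤ.- α′ ℤ.* β′)
      eight = begin
        N₄
          ≡⟨ N₄≡ ⟩
        ℤ.+ 4 ℤ.* (α′ ℤ.* α′ ℤ.+ β′ ℤ.* β′)
          ≡⟨ solve 2 (λ a b → con (ℤ.+ 4) :* (a :* a :+ b :* b) := con (ℤ.+ 4) :* ((a :+ b) :* (a :+ b) :- con 𝟚 :* (a :* b))) refl α′ β′ ⟩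
        ℤ.+ 4 ℤ.* ((α′ ℤ.+ β′) ℤ.* (α′ ℤ.+ β′) ℤ.- 𝟚 ℤ.* (α′ ℤ.* β′))
          ≡⟨ cong (λ t → ℤ.+ 4 ℤ.* (t ℤ.* t ℤ.- 𝟚 ℤ.* (α′ ℤ.* β′))) eq ⟩
        ℤ.+ 4 ℤ.* (𝟚 ℤ.* k ℤ.* (𝟚 ℤ.* k) ℤ.- 𝟚 ℤ.* (α′ ℤ.* β′))
          ≡⟨ solve 2 (λ k t → con (ℤ.+ 4) :* (con 𝟚 :* k :* (con 𝟚 :* k) :- con 𝟚 :* t) := con (ℤ.+ 8) :* (con 𝟚 :* k :* k :- t)) refl k (α′ ℤ.* β′) ⟩
        ℤ.+ 8 ℤ.* (𝟚 ℤ.* k ℤ.* k ℤ.- α′ ℤ.* β′) ∎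
        where open ≡-Reasoning
    by-parity (inj₂ (k , eq)) (inj₂ (l , eq′)) = ℕ.+-mono-≤ (ℕ.+-mono-≤ (ℕ.+-mono-≤ 1≤a 1≤b) 2≤r)
        (double≥4 s (valuation-≤ 3 {ℤQ.Quadruple.N₈ v} (proj₁ divisible) (proj₂ divisible) ps))
      where
      open ℤQ._≈₂_ v≈u
      module v = ℤQ.Quadruple v

      -- `u₀ + u₁` is the sum of the two odd numbers `α + β` and `α′ + β′`.
      u₁≡u₀ : u₁ ≡ᶻ u₀ [ 𝟚 ]
      u₁≡u₀ = 1ℤ ℤ.+ k ℤ.+ l ℤ.- u₀ , (begin
        u₁                                   ≡⟨ solve 2 (λ x y → y := (x :+ y) :- x) refl u₀ u₁ ⟩
        u₀ ℤ.+ u₁ ℤ.- u₀                     ≡⟨ cong (λ t → t ℤ.- u₀) sum ⟩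
        𝟚 ℤ.* (1ℤ ℤ.+ k ℤ.+ l) ℤ.- u₀        ≡⟨ solve 2 (λ x t → con 𝟚 :* t :- x := x :+ con 𝟚 :* (t :- x)) refl u₀ (1ℤ ℤ.+ k ℤ.+ l) ⟩
        u₀ ℤ.+ 𝟚 ℤ.* (1ℤ ℤ.+ k ℤ.+ l ℤ.- u₀) ∎)
        where
        open ≡-Reasoning
        sum : u₀ ℤ.+ u₁ ≡ 𝟚 ℤ.* (1ℤ ℤ.+ k ℤ.+ l)
        sum = trans (cong₂ ℤ._+_ u₀≡ u₁≡) (trans
          (solve 4 (λ a b c d → (a :+ c) :+ (b :+ d) := (a :+ b) :+ (c :+ d)) refl α β α′ β′)
          (trans (cong₂ ℤ._+_ eq eq′) (solve 2 (λ k l → (con 1ℤ :+ con 𝟚 :* k) :+ (con 1ℤ :+ con 𝟚 :* l) := con 𝟚 :* (con 1ℤ :+ k :+ l)) refl k l)))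

      u₂≡u₀ : u₂ ≡ᶻ u₀ [ 𝟚 ]
      u₂≡u₀ = ℤ.- α′ , trans u₂≡ (trans (solve 2 (λ a b → a :- b := (a :+ b) :+ con 𝟚 :* :- b) refl α α′) (cong (λ t → t ℤ.+ 𝟚 ℤ.* ℤ.- α′) (sym u₀≡)))

      u₃≡u₁ : u₃ ≡ᶻ u₁ [ 𝟚 ]
      u₃≡u₁ = ℤ.- β′ , trans u₃≡ (trans (solve 2 (λ a b → a :- b := (a :+ b) :+ con 𝟚 :* :- b) refl β β′) (cong (λ t → t ℤ.+ 𝟚 ℤ.* ℤ.- β′) (sym u₁≡)))

      to-v₀ : ∀ {x y} → x ≡ᶻ y [ 𝟚 ] → y ≡ᶻ u₀ [ 𝟚 ] → x ≡ᶻ v.u₀ [ 𝟚 ]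
      to-v₀ p q = ≡ℤ.[]-trans p (≡ℤ.[]-trans q (≡ℤ.[]-sym ≈₀))

      divisible : ∃[ m ] v.N₈ ≡ ℤ.+ 8 ℤ.* m
      divisible = all-equal (to-v₀ ≈₁ u₁≡u₀) (to-v₀ ≈₂ u₂≡u₀) (to-v₀ ≈₃ (≡ℤ.[]-trans u₃≡u₁ u₁≡u₀))
        where
        all-equal : v.u₁ ≡ᶻ v.u₀ [ 𝟚 ] → v.u₂ ≡ᶻ v.u₀ [ 𝟚 ] → v.u₃ ≡ᶻ v.u₀ [ 𝟚 ] → ∃[ m ] v.N₈ ≡ ℤ.+ 8 ℤ.* m
        all-equal (x , e₁) (y , e₂) (z , e₃) =
          let m , eq = N₈-divisible v.u₀ x y z
          in m , trans (cong₃ (λ p q r → ℤQ.Quadruple.N₈ (ℤQ.⟨ v.u₀ , p , q , r ⟩)) e₁ e₂ e₃) eq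
          where
          cong₃ : ∀ {A B : Set} (f : A → A → A → B) {a a′ b b′ c c′} → a ≡ a′ → b ≡ b′ → c ≡ c′ → f a b c ≡ f a′ b′ c′
          cong₃ f refl refl refl = refl

  split₄ : ∀ {k} a b c d → (a ℤ.* b ℤ.* c) ℤ.* d ≈2^ k →
    ∃[ i ] ∃[ j ] ∃[ l ] ∃[ m ] (a ≈2^ i × b ≈2^ j × c ≈2^ l × d ≈2^ m × i ℕ.+ j ℕ.+ l ℕ.+ m ≡ k)
  split₄ a b c d p with ≈2^-* (a ℤ.* b ℤ.* c) d p
  ... | _ , m , p₁ , pd , refl with ≈2^-* (a ℤ.* b) c p₁
  ...   | _ , l , p₂ , pc , refl with ≈2^-* a b p₂
  ...     | i , j , pa , pb , refl = i , j , l , m , pa , pb , pc , pd , refl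

  norm-split₄ : ∀ {k} a b c d → norm ((a 𝔼.* b 𝔼.* c) 𝔼.* d) ≈2^ k →
    ∃[ i ] ∃[ j ] ∃[ l ] ∃[ m ] (norm a ≈2^ i × norm b ≈2^ j × norm c ≈2^ l × norm d ≈2^ m × i ℕ.+ j ℕ.+ l ℕ.+ m ≡ k)
  norm-split₄ a b c d p = split₄ (norm a) (norm b) (norm c) (norm d) (subst (_≈2^ _) (trans (norm-* (a 𝔼.* b 𝔼.* c) d)
    (cong (ℤ._* norm d) (trans (norm-* (a 𝔼.* b) c) (cong (ℤ._* norm c) (norm-* a b))))) p)

  module C8Core {u v : ℤQ.Quadruple} {w z : 𝔼Q.Quadruple} (v≈u : v ℤQ.≈₂ u) (z≈w : z 𝔼Q.≈₂ w)
                (N₄∼ : ℤQ.Quadruple.N₄ u ∼ 𝔼Q.Quadruple.N₄ w) (N₈∼ : ℤQ.Quadruple.N₈ v ∼ 𝔼Q.Quadruple.N₈ z) where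
    private
      module U = ℤQ.Quadruple u
      module V = ℤQ.Quadruple v
      module W = 𝔼Q.Quadruple w
      module Z = 𝔼Q.Quadruple z

    -- All four factors are divisible by 2, whose norm is `2^2`.
    eisenstein-even : ∀ {j} → norm ((W.n₁ 𝔼.* W.n₂ 𝔼.* W.N₄) 𝔼.* Z.N₈) ≈2^ j → Ev W.n₁ → 8 ℕ.≤ j
    eisenstein-even p ev =
      case norm-split₄ W.n₁ W.n₂ W.N₄ Z.N₈ p of λ where
        (_ , _ , _ , _ , q₁ , q₂ , q₄ , q₈ , total) → subst (8 ℕ.≤_) total (ℕ.+-mono-≤ (ℕ.+-mono-≤ (ℕ.+-mono-≤
           (even-power {W.n₁} q₁ ev) (even-power {W.n₂} q₂ (Ev-resp W.n₂≡n₁ ev)))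
           (even-power {W.N₄} q₄ (Ev-N₄⁻ {w} ev))) (even-power {Z.N₈} q₈ (Ev-N₈⁻ {z} (Ev-resp (𝔼Q.n₁-≈ z≈w) ev))))

    eisenstein-odd : ∀ {j} → norm ((W.n₁ 𝔼.* W.n₂ 𝔼.* W.N₄) 𝔼.* Z.N₈) ≈2^ j → ¬ Ev W.n₁ →
      j ≡ 0 × U.N₄ ∼ W.n₁ 𝔼.* W.n₁ × V.N₈ ∼ (W.n₁ 𝔼.* W.n₁) 𝔼.* (W.n₁ 𝔼.* W.n₁)
    eisenstein-odd p odd =
      case norm-split₄ W.n₁ W.n₂ W.N₄ Z.N₈ p of λ where
        (_ , _ , _ , _ , q₁ , q₂ , q₄ , q₈ , total) → let
          z₁ , unit₁ = odd-unit {W.n₁} q₁ odd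
          z₂ , unit₂ = odd-unit {W.n₂} q₂ (λ e → odd (Ev-n₂ {w} e))
          z₄ , unit₄ = odd-unit {W.N₄} q₄ (λ e → odd (Ev-N₄ {w} e))
          z₈ , unit₈ = odd-unit {Z.N₈} q₈ (λ e → odd (Ev-resp (≡𝔼.[]-sym (𝔼Q.n₁-≈ z≈w)) (Ev-N₈ {z} e)))
          in trans (sym total) (cong₂ ℕ._+_ (cong₂ ℕ._+_ (cong₂ ℕ._+_ z₁ z₂) z₄) z₈)
             , subst (U.N₄ ∼_) (unit-N₄ {w} unit₁ unit₂ unit₄) N₄∼
             , subst (V.N₈ ∼_) (unit-N₈ {w} unit₁ unit₂ z≈w unit₈) N₈∼

    -- `N₄` and `N₈` are squares modulo √-3 and sums of two squares, hence powers of -2 with even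
    -- exponent, as `C8-bound` demands.
    rational-even : ∀ {i} → (U.n₁ ℤ.* U.n₂ ℤ.* U.N₄) ℤ.* V.N₈ ≈2^ i → Even U.n₁ →
      U.N₄ ∼ W.n₁ 𝔼.* W.n₁ → V.N₈ ∼ (W.n₁ 𝔼.* W.n₁) 𝔼.* (W.n₁ 𝔼.* W.n₁) → 8 ℕ.≤ i
    rational-even p ev N₄-square N₈-square =
      case split₄ U.n₁ U.n₂ U.N₄ V.N₈ p of λ where
        (a , b , r , s , pa , pb , p₄ , p₈ , total) → let
          h , r≡ = square-exponent r (trans (sym (∼-square {U.N₄} {r} W.n₁ p₄ N₄-square)) (sum-of-squares U.A⁻ U.B⁻))
          l , s≡ = square-exponent s (trans (sym (∼-square {V.N₈} {s} (W.n₁ 𝔼.* W.n₁) p₈ N₈-square)) (sum-of-squares V.X V.Y))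
          in subst (8 ℕ.≤_) (trans (cong₂ (λ s t → a ℕ.+ b ℕ.+ s ℕ.+ t) (sym r≡) (sym s≡)) total)
           (C8-bound {u} {v} {a} {b} {h} {l} v≈u ev pa pb (subst (U.N₄ ≈2^_) r≡ p₄) (subst (V.N₈ ≈2^_) s≡ p₈))

    rational-odd : ∀ {i} → (U.n₁ ℤ.* U.n₂ ℤ.* U.N₄) ℤ.* V.N₈ ≈2^ i → Odd U.n₁ → i ≡ 0
    rational-odd p odd =
      case split₄ U.n₁ U.n₂ U.N₄ V.N₈ p of λ where
        (a , b , r , s , pa , pb , p₄ , p₈ , total) → let
          ¬even = λ e → ¬Even∧Odd e odd
          in trans (sym total) (cong₂ ℕ._+_ (cong₂ ℕ._+_ (cong₂ ℕ._+_
           (¬Even⇒0 {U.n₁} pa ¬even)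
           (¬Even⇒0 {U.n₂} pb (λ e → ¬even (Even-resp (≡ℤ.[]-sym U.n₂≡n₁) e))))
           (¬Even⇒0 {U.N₄} p₄ (λ e → ¬even (Even-n₁ {u} e))))
           (¬Even⇒0 {V.N₈} p₈ (λ e → ¬even (Even-N₈⁻ v≈u e))))

    exponent : ∀ k → ℤQ.C8-product u v ℤ.* norm (𝔼Q.C8-product w z) ≈2^ k →
               k ≡ 0 ⊎ 8 ℕ.≤ k
    exponent k p =
      case ≈2^-* ((U.n₁ ℤ.* U.n₂ ℤ.* U.N₄) ℤ.* V.N₈) (norm ((W.n₁ 𝔼.* W.n₂ 𝔼.* W.N₄) 𝔼.* Z.N₈)) p of λ where
        (i , j , pi , pj , total) → by-evenness i j pi pj total (Ev? W.n₁) (parity U.n₁)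
      where
      by-evenness : ∀ i j → (U.n₁ ℤ.* U.n₂ ℤ.* U.N₄) ℤ.* V.N₈ ≈2^ i → norm ((W.n₁ 𝔼.* W.n₂ 𝔼.* W.N₄) 𝔼.* Z.N₈) ≈2^ j →
        i ℕ.+ j ≡ k → Ev W.n₁ ⊎ ¬ Ev W.n₁ → Even U.n₁ ⊎ Odd U.n₁ → k ≡ 0 ⊎ 8 ℕ.≤ k
      by-evenness i j pi pj total (inj₁ ev) _ =
        inj₂ (ℕ.≤-trans (eisenstein-even {j} pj ev) (ℕ.≤-trans (ℕ.m≤n+m j i) (ℕ.≤-reflexive total)))
      by-evenness i j pi pj total (inj₂ odd) (inj₁ ev) =
        let _ , N₄-square , N₈-square = eisenstein-odd {j} pj odd
        in inj₂ (ℕ.≤-trans (rational-even {i} pi ev N₄-square N₈-square) (ℕ.≤-trans (ℕ.m≤m+n i j) (ℕ.≤-reflexive total)))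
      by-evenness i j pi pj total (inj₂ odd) (inj₂ odd′) =
        inj₁ (trans (sym total) (cong₂ ℕ._+_ (rational-odd {i} pi odd′) (proj₁ (eisenstein-odd {j} pj odd))))

  C8-exponent : ∀ x k → determinant x Forms.C8 ≈2^ k → k ≡ 0 ⊎ 8 ℕ.≤ k
  C8-exponent x k p = C8Core.exponent (ℤQ.upper≈lower f) (𝔼Q.upper≈lower g)
    (subst₂ _∼_ (ℤQ.N₄-value f) (𝔼Q.N₄-value g) (∼-eval x (Forms.N₄ Forms.d)))
    (subst₂ _∼_ (ℤQ.N₈-value f) (𝔼Q.N₈-value g) (∼-eval x (Forms.N₈ Forms.e)))
    k (subst (_≈2^ k) value p)
    where
    f = rational x
    g = eisenstein x
    value = cong₂ (λ s t → s ℤ.* norm t) (ℤQ.C8-value f) (𝔼Q.C8-value g)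

open CyclicExponent

-- Weights modulo 8

module Weights where
  open ≡𝔼 using (4#) renaming (_≡_[_] to _≡ᴱ_[_])
  open Zk using (solve; con; _:+_; _:*_; :-_; _:-_; _:=_)

  𝟜 𝟠 : ℤ
  𝟜 = ℤ.+ 4
  𝟠 = ℤ.+ 8

  ≡±1 : ∀ {n} → n ≈2^ 0 → n ≡ 1ℤ ⊎ n ≡ -1ℤ
  ≡±1 {n} (power eq) = ∣∣-cancel n 1ℤ eq

  odd-square : ∀ {n} → Odd n → n ℤ.* n ≡ᶻ 1ℤ [ 𝟜 ]
  odd-square (k , refl) = k ℤ.+ k ℤ.* k , solve 1 (λ k → (con 1ℤ :+ con 𝟚 :* k) :* (con 1ℤ :+ con 𝟚 :* k) := con 1ℤ :+ con 𝟜 :* (k :+ k :* k)) refl k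

  ¬-1≡1 : ¬ (-1ℤ ≡ᶻ 1ℤ [ 𝟜 ])
  ¬-1≡1 (t , eq) = from-no (4 ℕ.∣? 2) (divides-abs (ℤ.- t) (begin
    𝟚                          ≡⟨⟩
    1ℤ ℤ.- -1ℤ                 ≡⟨ cong (λ s → 1ℤ ℤ.- s) eq ⟩
    1ℤ ℤ.- (1ℤ ℤ.+ 𝟜 ℤ.* t)    ≡⟨ solve 1 (λ t → con 1ℤ :- (con 1ℤ :+ con 𝟜 :* t) := con 𝟜 :* :- t) refl t ⟩
    𝟜 ℤ.* ℤ.- t                ∎))
    where open ≡-Reasoning

  unit-mod-4 : ∀ {n} → n ≈2^ 0 → n ≡ᶻ 1ℤ [ 𝟜 ] → n ≡ 1ℤ
  unit-mod-4 {n} p n≡1 = by-sign (≡±1 p)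
    where
    by-sign : n ≡ 1ℤ ⊎ n ≡ -1ℤ → n ≡ 1ℤ
    by-sign (inj₁ eq) = eq
    by-sign (inj₂ eq) = contradiction (subst (_≡ᶻ 1ℤ [ 𝟜 ]) eq n≡1) ¬-1≡1

  -- `p q ≡ p² ≡ 1` modulo 4, which separates 1 from -1.
  odd-product : ∀ {p q i} → p ℤ.* q ≈2^ i → Odd p → q ≡ᶻ p [ 𝟜 ] → i ≡ 0 × p ℤ.* q ≡ 1ℤ
  odd-product {p} {q} {i} pow odd q≡p = i≡0 , unit-mod-4 (subst (p ℤ.* q ≈2^_) i≡0 pow)
      (≡ℤ.[]-trans (≡ℤ.[]-* {a = p} (≡ℤ.≡⇒[] {p} refl) q≡p) (odd-square odd))
    where i≡0 = ≈2^-Odd {p ℤ.* q} pow (Odd-* odd (Odd-resp (≡ℤ.[]-4⇒2 q≡p) odd))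

  unit-product : ∀ {p q} → Unit p → Unit q → q ≡ᴱ p [ 4# ] → p 𝔼.* q ≡ p 𝔼.* p
  unit-product {p} p-unit q-unit q≡p = cong (λ t → p 𝔼.* t) (units-mod-4 q-unit p-unit q≡p)

  norm-value : ∀ {w h} → norm w ≈2^ (h ℕ.+ h) → norm w ≡ (ℤ.- 𝟚) ℤ.^ (h ℕ.+ h)
  norm-value {w} {h} (power eq) = trans (norm-abs w) (trans (cong ℤ.+_ eq) (doubled h))
    where
    doubled : ∀ h → ℤ.+ (2 ℕ.^ (h ℕ.+ h)) ≡ (ℤ.- 𝟚) ℤ.^ (h ℕ.+ h)
    doubled zero    = refl
    doubled (suc h) = begin
      ℤ.+ (2 ℕ.^ (suc h ℕ.+ suc h))                  ≡⟨ cong (λ n → ℤ.+ (2 ℕ.^ suc n)) (ℕ.+-suc h h) ⟩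
      ℤ.+ (2 ℕ.* (2 ℕ.* 2 ℕ.^ (h ℕ.+ h)))            ≡⟨ trans (ℤ.pos-* 2 (2 ℕ.* 2 ℕ.^ (h ℕ.+ h))) (cong (λ t → 𝟚 ℤ.* t) (ℤ.pos-* 2 (2 ℕ.^ (h ℕ.+ h)))) ⟩
      𝟚 ℤ.* (𝟚 ℤ.* ℤ.+ (2 ℕ.^ (h ℕ.+ h)))            ≡⟨ solve 1 (λ t → con 𝟚 :* (con 𝟚 :* t) := con (ℤ.- 𝟚) :* (con (ℤ.- 𝟚) :* t)) refl (ℤ.+ (2 ℕ.^ (h ℕ.+ h))) ⟩
      ℤ.- 𝟚 ℤ.* (ℤ.- 𝟚 ℤ.* ℤ.+ (2 ℕ.^ (h ℕ.+ h)))    ≡⟨ cong (λ t → ℤ.- 𝟚 ℤ.* (ℤ.- 𝟚 ℤ.* t)) (doubled h) ⟩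
      (ℤ.- 𝟚) ℤ.^ suc (suc (h ℕ.+ h))                ≡⟨ cong (λ n → (ℤ.- 𝟚) ℤ.^ suc n) (ℕ.+-suc h h) ⟨
      (ℤ.- 𝟚) ℤ.^ (suc h ℕ.+ suc h)                  ∎
      where open ≡-Reasoning

  -- A norm that is a power of two is a power of 4, so it may be written with base -2 and the signs
  -- multiply.
  signed-product : ∀ {P w i j k} → P ≡ (ℤ.- 𝟚) ℤ.^ i → norm w ≈2^ j → i ℕ.+ j ≡ k → P ℤ.* norm w ≡ (ℤ.- 𝟚) ℤ.^ k
  signed-product {P} {w} {i} {j} refl q refl =
    let h , j≡ = norm-exponent-even j {w} q
    in trans (cong (λ t → (ℤ.- 𝟚) ℤ.^ i ℤ.* t) (trans (norm-value {w} {h} (subst (norm w ≈2^_) j≡ q)) (cong ((ℤ.- 𝟚) ℤ.^_) (sym j≡))))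
         (sym (ℤ.^-distribˡ-+-* (ℤ.- 𝟚) i j))

  -- S is a sum of exponents e of factors ±2^e, at least b, and W is the sum of the
  -- corresponding (-2)^e; modulo 8 they determine each other as long as S ≤ b + 1.
  record Weighted (S : ℕ) (W : ℤ) (b : ℕ) (c : ℤ) : Set where
    constructor weighted
    field
      excess : ℕ
      S≡     : S ≡ b ℕ.+ excess
      W≡     : excess ℕ.≤ 1 → W ≡ᶻ c ℤ.+ 𝟜 ℤ.* ℤ.+ excess [ 𝟠 ]

  Weighted-+ : ∀ {S S′ W W′ b b′ c c′} → Weighted S W b c → Weighted S′ W′ b′ c′ → Weighted (S ℕ.+ S′) (W ℤ.+ W′) (b ℕ.+ b′) (c ℤ.+ c′)
  Weighted-+ {b = b} {b′} {c} {c′} (weighted t refl W≡) (weighted t′ refl W′≡) = weighted (t ℕ.+ t′)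
    (trans (ℕ.+-assoc b t (b′ ℕ.+ t′)) (trans (cong (b ℕ.+_) (trans (sym (ℕ.+-assoc t b′ t′)) (trans (cong (ℕ._+ t′) (ℕ.+-comm t b′)) (ℕ.+-assoc b′ t t′)))) (sym (ℕ.+-assoc b b′ (t ℕ.+ t′)))))
    (λ t≤1 → ≡ℤ.[]-trans (≡ℤ.[]-+ (W≡ (ℕ.≤-trans (ℕ.m≤m+n t t′) t≤1)) (W′≡ (ℕ.≤-trans (ℕ.m≤n+m t′ t) t≤1)))
      (≡ℤ.≡⇒[] (trans (solve 4 (λ c c′ t t′ → (c :+ con 𝟜 :* t) :+ (c′ :+ con 𝟜 :* t′) := (c :+ c′) :+ con 𝟜 :* (t :+ t′)) refl c c′ (ℤ.+ t) (ℤ.+ t′))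
        (cong (λ s → c ℤ.+ c′ ℤ.+ 𝟜 ℤ.* s) (sym (ℤ.pos-+ t t′))))))

  Weighted-≥ : ∀ {S W b c} → Weighted S W b c → b ℕ.≤ S
  Weighted-≥ {b = b} (weighted t refl _) = ℕ.m≤m+n b t

  pow : ℕ → ℤ
  pow e = (ℤ.- 𝟚) ℤ.^ e

  -- `o` is the half of one factor of a pair. If it is odd, both factors are twice an odd number,
  -- with weight `-2 - 2 ≡ 4` modulo 8; if it is even, both are divisible by 4, and the least
  -- exponents `(2 , 2)` have weight `4 + 4 ≡ 0`.
  data OddEven (o : ℤ) (S : ℕ) (W : ℤ) : Set where
    odd  : Odd o → S ≡ 2 → Weighted S W 2 𝟜 → OddEven o S W
    even : Even o → Weighted S W 4 0ℤ → OddEven o S W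

  both-even-weighted : ∀ {e e′} → 2 ℕ.≤ e → 2 ℕ.≤ e′ → Weighted (e ℕ.+ e′) (pow e ℤ.+ pow e′) 4 0ℤ
  both-even-weighted {suc (suc p)} {suc (suc q)} (s≤s (s≤s z≤n)) (s≤s (s≤s z≤n)) =
    weighted (p ℕ.+ q) (cong (2 ℕ.+_) (trans (ℕ.+-suc p (suc q)) (cong suc (ℕ.+-suc p q)))) (small p q)
    where
    small : ∀ p q → p ℕ.+ q ℕ.≤ 1 → pow (2 ℕ.+ p) ℤ.+ pow (2 ℕ.+ q) ≡ᶻ 0ℤ ℤ.+ 𝟜 ℤ.* ℤ.+ (p ℕ.+ q) [ 𝟠 ]
    small zero       zero       _ = 1ℤ , refl
    small zero       (suc zero) _ = -1ℤ , refl
    small (suc zero) zero       _ = -1ℤ , refl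
    small zero (suc (suc q)) (s≤s ())
    small (suc zero) (suc q) (s≤s ())
    small (suc (suc p)) q (s≤s ())

  -- The exponents `(1 , 2)` have weight `-2 + 4 = 2`, and `(1 , 3)` have `-2 - 8 ≡ 6` modulo 8.
  mixed-weighted : ∀ {e} → 2 ℕ.≤ e → Weighted (1 ℕ.+ e) (pow 1 ℤ.+ pow e) 3 𝟚
  mixed-weighted {suc (suc p)} (s≤s (s≤s z≤n)) = weighted p refl (small p)
    where
    small : ∀ p → p ℕ.≤ 1 → pow 1 ℤ.+ pow (2 ℕ.+ p) ≡ᶻ 𝟚 ℤ.+ 𝟜 ℤ.* ℤ.+ p [ 𝟠 ]
    small zero          _ = 0ℤ , refl
    small (suc zero)    _ = ℤ.- 𝟚 , refl
    small (suc (suc p)) (s≤s ())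

  exponent-1 : ∀ {n x e} → n ≡ 𝟚 ℤ.* x → Odd x → n ≈2^ e → e ≡ 1
  exponent-1 {n} {x} {e} eq o p = case ≈2^-half {x} {e} (subst (_≈2^ e) eq p) of λ where
    (j , e≡ , q) → trans e≡ (cong suc (≈2^-Odd {x} q o))

  exponent-≥2 : ∀ {n x e} → n ≡ 𝟚 ℤ.* x → Even x → n ≈2^ e → 2 ℕ.≤ e
  exponent-≥2 {n} {x} {e} eq (m , x≡) p = valuation-≤ 2 {n} m (trans eq (trans (cong (λ t → 𝟚 ℤ.* t) x≡) (sym (ℤ.*-assoc 𝟚 𝟚 m)))) p

  odd-difference : ∀ {α β} → Odd (α ℤ.+ β) → Odd (α ℤ.- β)
  odd-difference {α} {β} = Odd-resp (ℤ.- β , solve 2 (λ a b → a :- b := (a :+ b) :+ con 𝟚 :* :- b) refl α β)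

  even-difference : ∀ {α β} → Even (α ℤ.+ β) → Even (α ℤ.- β)
  even-difference {α} {β} = Even-resp (ℤ.- β , solve 2 (λ a b → a :- b := (a :+ b) :+ con 𝟚 :* :- b) refl α β)

  pair-view : ∀ {n n′ α β e e′} → n ≡ 𝟚 ℤ.* (α ℤ.+ β) → n′ ≡ 𝟚 ℤ.* (α ℤ.- β) → n ≈2^ e → n′ ≈2^ e′ →
              OddEven (α ℤ.+ β) (e ℕ.+ e′) (pow e ℤ.+ pow e′)
  pair-view {n} {n′} {α} {β} {e} {e′} n≡ n′≡ p p′ = by-parity (parity (α ℤ.+ β))
    where
    by-parity : Even (α ℤ.+ β) ⊎ Odd (α ℤ.+ β) → OddEven (α ℤ.+ β) (e ℕ.+ e′) (pow e ℤ.+ pow e′)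
    by-parity (inj₁ ev) = even ev (both-even-weighted (exponent-≥2 {n} n≡ ev p) (exponent-≥2 {n′} n′≡ (even-difference {α} {β} ev) p′))
    by-parity (inj₂ o) = ones (exponent-1 {n} n≡ o p) (exponent-1 {n′} n′≡ (odd-difference {α} {β} o) p′)
      where
      ones : e ≡ 1 → e′ ≡ 1 → OddEven (α ℤ.+ β) (e ℕ.+ e′) (pow e ℤ.+ pow e′)
      ones refl refl = odd o refl (weighted 0 refl λ _ → -1ℤ , refl)

  -- An even number of the four half-sums is odd. Four odd ones give exponent `2 + 2 + 2 + 2`; two
  -- give at least `2 + 2 + 4 + 4`, with base weight `4 + 4`; none gives at least `4 + 4 + 4 + 4`.
  data Total (o₁ o₂ o₃ o₄ : ℤ) (S : ℕ) (W : ℤ) : Set where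
    minimal : Odd o₁ → Odd o₂ → Odd o₃ → Odd o₄ → S ≡ 8 → Total o₁ o₂ o₃ o₄ S W
    middle  : Weighted S W 12 𝟠 → Total o₁ o₂ o₃ o₄ S W
    large   : 16 ℕ.≤ S → Total o₁ o₂ o₃ o₄ S W

  odd+odd : ∀ {m n} → Odd m → Odd n → Even (m ℤ.+ n)
  odd+odd (k , refl) (l , refl) = 1ℤ ℤ.+ k ℤ.+ l , solve 2 (λ k l → (con 1ℤ :+ con 𝟚 :* k) :+ (con 1ℤ :+ con 𝟚 :* l) := con 𝟚 :* (con 1ℤ :+ k :+ l)) refl k l

  odd+even : ∀ {m n} → Odd m → Even n → Odd (m ℤ.+ n)
  odd+even (k , refl) (l , refl) = k ℤ.+ l , solve 2 (λ k l → (con 1ℤ :+ con 𝟚 :* k) :+ con 𝟚 :* l := con 1ℤ :+ con 𝟚 :* (k :+ l)) refl k l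

  even+even : ∀ {m n} → Even m → Even n → Even (m ℤ.+ n)
  even+even (k , refl) (l , refl) = k ℤ.+ l , solve 2 (λ k l → con 𝟚 :* k :+ con 𝟚 :* l := con 𝟚 :* (k :+ l)) refl k l

  private
    data Two (o₁ o₂ : ℤ) (S : ℕ) (W : ℤ) : Set where
      odds   : Odd o₁ → Odd o₂ → S ≡ 4 → Weighted S W 4 𝟠 → Two o₁ o₂ S W
      differ : Odd (o₁ ℤ.+ o₂) → Weighted S W 6 𝟜 → Two o₁ o₂ S W
      evens  : Even (o₁ ℤ.+ o₂) → Weighted S W 8 0ℤ → Two o₁ o₂ S W

    two : ∀ {o₁ o₂ S₁ S₂ W₁ W₂} → OddEven o₁ S₁ W₁ → OddEven o₂ S₂ W₂ → Two o₁ o₂ (S₁ ℕ.+ S₂) (W₁ ℤ.+ W₂)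
    two (odd o S≡ w)  (odd o′ S′≡ w′) = odds o o′ (cong₂ ℕ._+_ S≡ S′≡) (Weighted-+ w w′)
    two (odd o _ w)   (even e w′)     = differ (odd+even o e) (Weighted-+ w w′)
    two {o₁} {o₂} (even e w) (odd o _ w′) = differ (subst Odd (ℤ.+-comm o₂ o₁) (odd+even o e)) (Weighted-+ w w′)
    two (even e w)    (even e′ w′)    = evens (even+even e e′) (Weighted-+ w w′)

  total : ∀ {o₁ o₂ o₃ o₄ S₁ S₂ S₃ S₄ W₁ W₂ W₃ W₄} → Even ((o₁ ℤ.+ o₂) ℤ.+ (o₃ ℤ.+ o₄)) →
    OddEven o₁ S₁ W₁ → OddEven o₂ S₂ W₂ → OddEven o₃ S₃ W₃ → OddEven o₄ S₄ W₄ →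
    Total o₁ o₂ o₃ o₄ ((S₁ ℕ.+ S₂) ℕ.+ (S₃ ℕ.+ S₄)) ((W₁ ℤ.+ W₂) ℤ.+ (W₃ ℤ.+ W₄))
  total {o₁} {o₂} {o₃} {o₄} ev v₁ v₂ v₃ v₄ = total-of-pairs (two v₁ v₂) (two v₃ v₄)
    where
    total-of-pairs : ∀ {S S′ W W′} → Two o₁ o₂ S W → Two o₃ o₄ S′ W′ → Total o₁ o₂ o₃ o₄ (S ℕ.+ S′) (W ℤ.+ W′)
    total-of-pairs (odds o o′ S≡ w)  (odds o″ o‴ S′≡ w′) = minimal o o′ o″ o‴ (cong₂ ℕ._+_ S≡ S′≡)
    total-of-pairs (odds o o′ _ _)   (differ d _)        = contradiction (subst Odd (ℤ.+-comm (o₃ ℤ.+ o₄) (o₁ ℤ.+ o₂)) (odd+even d (odd+odd o o′))) (¬Even∧Odd ev)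
    total-of-pairs (odds _ _ _ w)    (evens _ w′)        = middle (Weighted-+ w w′)
    total-of-pairs (differ d _)      (odds o o′ _ _)     = contradiction (odd+even d (odd+odd o o′)) (¬Even∧Odd ev)
    total-of-pairs (differ _ w)      (differ _ w′)       = middle (Weighted-+ w w′)
    total-of-pairs (differ d _)      (evens e _)         = contradiction (odd+even d e) (¬Even∧Odd ev)
    total-of-pairs (evens _ w)       (odds _ _ _ w′)     = middle (Weighted-+ w w′)
    total-of-pairs (evens e _)       (differ d _)        = contradiction (subst Odd (ℤ.+-comm (o₃ ℤ.+ o₄) (o₁ ℤ.+ o₂)) (odd+even d e)) (¬Even∧Odd ev)
    total-of-pairs (evens _ w)       (evens _ w′)        = large (ℕ.+-mono-≤ (Weighted-≥ w) (Weighted-≥ w′))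

  -- The parities of the four half-sums cancel because the two quadruples agree modulo 2.
  half-sums-even : ∀ {u v} → v ℤQ.≈₂ u → (h : Halves {u}) (h′ : Halves {v}) →
    Even (((Halves.α h ℤ.+ Halves.β h) ℤ.+ (Halves.α′ h ℤ.+ Halves.β′ h)) ℤ.+ ((Halves.α h′ ℤ.+ Halves.β h′) ℤ.+ (Halves.α′ h′ ℤ.+ Halves.β′ h′)))
  half-sums-even {u} {v} v≈u h h′ = Even-resp (≡ℤ.≡⇒[] rearranged) (agree ≈₀ ≈₁)
    where
    open ℤQ._≈₂_ v≈u
    module U = ℤQ.Quadruple u
    module V = ℤQ.Quadruple v
    module H = Halves h
    module H′ = Halves h′
    rearranged : ((H.α ℤ.+ H.β) ℤ.+ (H.α′ ℤ.+ H.β′)) ℤ.+ ((H′.α ℤ.+ H′.β) ℤ.+ (H′.α′ ℤ.+ H′.β′)) ≡ (U.u₀ ℤ.+ U.u₁) ℤ.+ (V.u₀ ℤ.+ V.u₁)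
    rearranged = trans
      (solve 8 (λ a b c d e f g h → ((a :+ b) :+ (c :+ d)) :+ ((e :+ f) :+ (g :+ h)) := ((a :+ c) :+ (b :+ d)) :+ ((e :+ g) :+ (f :+ h))) refl
        H.α H.β H.α′ H.β′ H′.α H′.β H′.α′ H′.β′)
      (cong₂ ℤ._+_ (cong₂ ℤ._+_ (sym H.u₀≡) (sym H.u₁≡)) (cong₂ ℤ._+_ (sym H′.u₀≡) (sym H′.u₁≡)))
    agree : V.u₀ ≡ᶻ U.u₀ [ 𝟚 ] → V.u₁ ≡ᶻ U.u₁ [ 𝟚 ] → Even ((U.u₀ ℤ.+ U.u₁) ℤ.+ (V.u₀ ℤ.+ V.u₁))
    agree (s , e) (t , e′) = U.u₀ ℤ.+ U.u₁ ℤ.+ s ℤ.+ t , trans (cong₂ (λ x y → (U.u₀ ℤ.+ U.u₁) ℤ.+ (x ℤ.+ y)) e e′)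
      (solve 4 (λ x y s t → (x :+ y) :+ ((x :+ con 𝟚 :* s) :+ (y :+ con 𝟚 :* t)) := con 𝟚 :* (x :+ y :+ s :+ t)) refl U.u₀ U.u₁ s t)

open Weights

-- The spectrum of C₂ × C₁₂

module RankTwoSpectrum where
  open Zk using (solve; con; _:+_; _:*_; :-_; _:-_; _:=_)

  split₃ : ∀ {k} a b c → a ℤ.* b ℤ.* c ≈2^ k →
    ∃[ i ] ∃[ j ] ∃[ l ] (a ≈2^ i × b ≈2^ j × c ≈2^ l × i ℕ.+ j ℕ.+ l ≡ k)
  split₃ {k} a b c p = case ≈2^-* {k} (a ℤ.* b) c p of λ where
    (e , l , q , pc , refl) → case ≈2^-* {e} a b q of λ where
      (i , j , pa , pb , refl) → i , j , l , pa , pb , pc , refl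

  norm-split₃ : ∀ {k} a b c → norm (a 𝔼.* b 𝔼.* c) ≈2^ k →
    ∃[ i ] ∃[ j ] ∃[ l ] (norm a ≈2^ i × norm b ≈2^ j × norm c ≈2^ l × i ℕ.+ j ℕ.+ l ≡ k)
  norm-split₃ {k} a b c p = split₃ (norm a) (norm b) (norm c)
    (subst (_≈2^ k) (trans (norm-* (a 𝔼.* b) c) (cong (ℤ._* norm c) (norm-* a b))) p)

  odd-sum-half : ∀ x y → Odd (x ℤ.+ y) → Even x ⊎ Even y
  odd-sum-half x y o with parity x
  ... | inj₁ e = inj₁ e
  ... | inj₂ o′ = inj₂ (Even-resp (0ℤ , solve 2 (λ x y → y := (x :+ y) :- x :+ con 𝟚 :* con 0ℤ) refl x y) (odd-odd o o′))
    where
    odd-odd : ∀ {m n} → Odd m → Odd n → Even (m ℤ.- n)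
    odd-odd (k , refl) (l , refl) = k ℤ.- l , solve 2 (λ k l → (con 1ℤ :+ con 𝟚 :* k) :- (con 1ℤ :+ con 𝟚 :* l) := con 𝟚 :* (k :- l)) refl k l

  -- If a + b and a - b are even and a is odd, exactly one of them is divisible by 4.
  mixed-halves : ∀ a b → Odd a → Even (a ℤ.+ b) →
    ∃[ x ] ∃[ y ] (a ℤ.+ b ≡ 𝟚 ℤ.* x × a ℤ.- b ≡ 𝟚 ℤ.* y × Odd (x ℤ.+ y))
  mixed-halves a b odd-a (x , eq) = x , x ℤ.- b , eq , minus , subst Odd a≡ odd-a
    where
    minus : a ℤ.- b ≡ 𝟚 ℤ.* (x ℤ.- b)
    minus = trans (solve 2 (λ a b → a :- b := (a :+ b) :- con 𝟚 :* b) refl a b)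
      (trans (cong (λ t → t ℤ.- 𝟚 ℤ.* b) eq) (solve 2 (λ x b → con 𝟚 :* x :- con 𝟚 :* b := con 𝟚 :* (x :- b)) refl x b))
    a≡ : a ≡ x ℤ.+ (x ℤ.- b)
    a≡ = trans (solve 2 (λ a b → a := (a :+ b) :- b) refl a b)
      (trans (cong (λ t → t ℤ.- b) eq) (solve 2 (λ x b → con 𝟚 :* x :- b := x :+ (x :- b)) refl x b))

  mixed-pair : ∀ {a b e e′} → Odd a → Even (a ℤ.+ b) → (a ℤ.+ b) ≈2^ e → (a ℤ.- b) ≈2^ e′ →
               Weighted (e ℕ.+ e′) (pow e ℤ.+ pow e′) 3 𝟚
  mixed-pair {a} {b} {e} {e′} odd-a ev p p′ = case mixed-halves a b odd-a ev of λ where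
        (x , y , eq , eq′ , o) → by-half x y eq eq′ o (odd-sum-half x y o)
    where

    right : ∀ x y → Odd (x ℤ.+ y) → Even x → Odd y
    right x y o ev = subst Odd (solve 2 (λ x y → (x :+ y) :+ :- x := y) refl x y) (odd+even o (negate ev))
      where
      negate : ∀ {x} → Even x → Even (ℤ.- x)
      negate (k , refl) = ℤ.- k , ℤ.neg-distribʳ-* 𝟚 k
    first : e ≡ 1 → 2 ℕ.≤ e′ → Weighted (e ℕ.+ e′) (pow e ℤ.+ pow e′) 3 𝟚
    first refl 2≤e′ = mixed-weighted 2≤e′
    second : 2 ℕ.≤ e → e′ ≡ 1 → Weighted (e ℕ.+ e′) (pow e ℤ.+ pow e′) 3 𝟚
    second 2≤e refl = subst₂ (λ S W → Weighted S W 3 𝟚) (ℕ.+-comm 1 e) (ℤ.+-comm (pow 1) (pow e)) (mixed-weighted 2≤e)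
    by-half : ∀ x y → a ℤ.+ b ≡ 𝟚 ℤ.* x → a ℤ.- b ≡ 𝟚 ℤ.* y → Odd (x ℤ.+ y) → Even x ⊎ Even y → Weighted (e ℕ.+ e′) (pow e ℤ.+ pow e′) 3 𝟚
    by-half x y eq eq′ o (inj₁ ev-x) = second (exponent-≥2 {a ℤ.+ b} eq ev-x p) (exponent-1 {a ℤ.- b} eq′ (right x y o ev-x) p′)
    by-half x y eq eq′ o (inj₂ ev-y) = first (exponent-1 {a ℤ.+ b} eq (right y x (subst Odd (ℤ.+-comm x y) o) ev-y) p) (exponent-≥2 {a ℤ.- b} eq′ ev-y p′)

  module _ {u : ℤQ.Quadruple} where
    open ℤQ.Quadruple u

    A⁺≡A⁻ : A⁺ ≡ᶻ A⁻ [ 𝟚 ]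
    A⁺≡A⁻ = u₂ , solve 2 (λ a b → a :+ b := (a :- b) :+ con 𝟚 :* b) refl u₀ u₂

    -- The bound is `1 + 1 + 2` if `A⁻` is even, so that all halves exist, and `3 + 1` if it is odd.
    -- This cruder bound serves when the Eisenstein part is even, where the exponent of `N₄` is not
    -- known to be even.
    quadruple-≥4 : ∀ {a b r} → Even n₁ → n₁ ≈2^ a → n₂ ≈2^ b → N₄ ≈2^ r → 4 ℕ.≤ a ℕ.+ b ℕ.+ r
    quadruple-≥4 {a} {b} {r} ev pa pb pr = by-parity (parity A⁻)
      where
      by-parity : Even A⁻ ⊎ Odd A⁻ → 4 ℕ.≤ a ℕ.+ b ℕ.+ r
      by-parity (inj₁ ev-A) = ℕ.+-mono-≤ (ℕ.+-mono-≤
          (valuation-≤ 1 {n₁} (H.α ℤ.+ H.β) H.n₁≡ pa) (valuation-≤ 1 {n₂} (H.α ℤ.- H.β) H.n₂≡ pb))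
          (valuation-≤ 2 {N₄} (H.α′ ℤ.* H.α′ ℤ.+ H.β′ ℤ.* H.β′) H.N₄≡ pr)
        where
        even-summand : ∀ {m n} → Even m → Even (m ℤ.+ n) → Even n
        even-summand {m} {n} (k , eq) (l , eq′) = l ℤ.- k , trans (solve 2 (λ m n → n := (m :+ n) :- m) refl m n)
          (trans (cong₂ ℤ._-_ eq′ eq) (solve 2 (λ k l → con 𝟚 :* l :- con 𝟚 :* k := con 𝟚 :* (l :- k)) refl k l))
        module H = Halves (halves {u} ev-A (even-summand ev-A (Even-resp n₃≡n₁ ev)))
      by-parity (inj₂ odd-A) = ℕ.+-mono-≤ (Weighted-≥ (mixed-pair {A⁺} {B⁺} (Odd-resp A⁺≡A⁻ odd-A) ev pa pb))
        (Even⇒1≤ {N₄} pr (Even-N₄ {u} ev))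

  -- The exponent of N₄ = 4(α² + β²), in the shape of the exponents of a pair ±2^e, ±2^e′.
  N₄-view : ∀ {n α β} h → n ≡ 𝟜 ℤ.* (α ℤ.* α ℤ.+ β ℤ.* β) → n ≈2^ (h ℕ.+ h) → 2 ℕ.≤ h ℕ.+ h → ∃[ W ] OddEven (α ℤ.+ β) (h ℕ.+ h) W
  N₄-view {n} {α} {β} h eq p 2≤ = by-parity (parity (α ℤ.+ β))
    where
    eq′ : n ≡ 𝟚 ℤ.* (𝟚 ℤ.* (α ℤ.* α ℤ.+ β ℤ.* β))
    eq′ = trans eq (ℤ.*-assoc 𝟚 𝟚 _)

    squares : α ℤ.* α ℤ.+ β ℤ.* β ≡ᶻ (α ℤ.+ β) ℤ.* (α ℤ.+ β) [ 𝟚 ]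
    squares = ℤ.- (α ℤ.* β) , solve 2 (λ a b → a :* a :+ b :* b := (a :+ b) :* (a :+ b) :+ con 𝟚 :* :- (a :* b)) refl α β

    by-parity : Even (α ℤ.+ β) ⊎ Odd (α ℤ.+ β) → ∃[ W ] OddEven (α ℤ.+ β) (h ℕ.+ h) W
    by-parity (inj₂ o) = _ , odd o h+h≡2 (weighted 0 h+h≡2 λ _ → ≡ℤ.≡⇒[] refl)
      where
      h+h≡2 : h ℕ.+ h ≡ 2
      h+h≡2 = case ≈2^-half {𝟚 ℤ.* (α ℤ.* α ℤ.+ β ℤ.* β)} (subst (_≈2^ (h ℕ.+ h)) eq′ p) of λ where
        (j , e , q) → case ≈2^-half {α ℤ.* α ℤ.+ β ℤ.* β} q of λ where
          (l , e′ , q′) → trans e (cong suc (trans e′ (cong suc (≈2^-Odd q′ (Odd-resp squares (Odd-* o o))))))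
    by-parity (inj₁ ev) = _ , even ev (weighted (h ℕ.+ h ℕ.∸ 4) (sym (ℕ.m+[n∸m]≡n 4≤)) λ _ → ≡ℤ.≡⇒[] refl)
      where
      4≤ : 4 ℕ.≤ h ℕ.+ h
      4≤ = case Even-resp squares (square-even ev) of λ where
          (m , sq≡) → double≥4 h (valuation-≤ 3 {n} m (trans eq (trans (cong (λ t → 𝟜 ℤ.* t) sq≡) (sym (ℤ.*-assoc 𝟜 𝟚 m)))) p)
        where
        square-even : ∀ {t} → Even t → Even (t ℤ.* t)
        square-even {t} (k , e) = k ℤ.* t , trans (cong (λ s → s ℤ.* t) e) (ℤ.*-assoc 𝟚 k t)

  -- 20 is `8 + 12`, the least exponents of the rational and the Eisenstein part when both are even;
  -- beyond it the sign is left open.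
  Spectrum₁ : ℤ → ℕ → Set
  Spectrum₁ D k = (D ≡ pow k × (k ≡ 0 ⊎ k ≡ 8 ⊎ 12 ℕ.≤ k)) ⊎ 20 ℕ.≤ k

  module C2×C4Core {u v : ℤQ.Quadruple} {w z : 𝔼Q.Quadruple} (v≈u : v ℤQ.≈₂ u) (z≈w : z 𝔼Q.≈₂ w)
                (u∼w : ℤQ.Quadruple.N₄ u ∼ 𝔼Q.Quadruple.N₄ w) (v∼z : ℤQ.Quadruple.N₄ v ∼ 𝔼Q.Quadruple.N₄ z) where
    private
      module U = ℤQ.Quadruple u
      module V = ℤQ.Quadruple v
      module W = 𝔼Q.Quadruple w
      module Z = 𝔼Q.Quadruple z
      P₁ = U.n₁ ℤ.* U.n₂ ℤ.* U.N₄
      P₂ = V.n₁ ℤ.* V.n₂ ℤ.* V.N₄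
      Q₁ = W.n₁ 𝔼.* W.n₂ 𝔼.* W.N₄
      Q₂ = Z.n₁ 𝔼.* Z.n₂ 𝔼.* Z.N₄

    Ev-upper : Ev W.n₁ → Ev Z.n₁
    Ev-upper = Ev-resp (𝔼Q.n₁-≈ z≈w)

    even-quadruple : ∀ {j} (q : 𝔼Q.Quadruple) → let open 𝔼Q.Quadruple q in norm (n₁ 𝔼.* n₂ 𝔼.* N₄) ≈2^ j → Ev n₁ → 6 ℕ.≤ j
    even-quadruple q p ev = case norm-split₃ n₁ n₂ N₄ p of λ where
        (_ , _ , _ , q₁ , q₂ , q₄ , refl) → ℕ.+-mono-≤ (ℕ.+-mono-≤
           (even-power {n₁} q₁ ev) (even-power {n₂} q₂ (Ev-resp n₂≡n₁ ev))) (even-power {N₄} q₄ (Ev-N₄⁻ {q} ev))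
      where open 𝔼Q.Quadruple q

    eisenstein-even : ∀ {j} → norm (Q₁ 𝔼.* Q₂) ≈2^ j → Ev W.n₁ → 12 ℕ.≤ j
    eisenstein-even p ev = case norm-split Q₁ Q₂ p of λ where
      (_ , _ , q₁ , q₂ , refl) → ℕ.+-mono-≤ (even-quadruple w q₁ ev) (even-quadruple z q₂ (Ev-upper ev))

    odd-quadruple : ∀ {j} (q : 𝔼Q.Quadruple) → let open 𝔼Q.Quadruple q in norm (n₁ 𝔼.* n₂ 𝔼.* N₄) ≈2^ j → ¬ Ev n₁ →
                    j ≡ 0 × Unit (n₁ 𝔼.* n₂ 𝔼.* N₄) × N₄ ≡ n₁ 𝔼.* n₁
    odd-quadruple q p odd′ = case norm-split₃ n₁ n₂ N₄ p of λ where
        (_ , _ , _ , q₁ , q₂ , q₄ , refl) → let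
          z₁ , unit₁ = odd-unit {n₁} q₁ odd′
          z₂ , unit₂ = odd-unit {n₂} q₂ (λ e → odd′ (Ev-n₂ {q} e))
          z₄ , unit₄ = odd-unit {N₄} q₄ (λ e → odd′ (Ev-N₄ {q} e))
          in cong₂ ℕ._+_ (cong₂ ℕ._+_ z₁ z₂) z₄ , Unit-* {n₁ 𝔼.* n₂} {N₄} (Unit-* {n₁} {n₂} unit₁ unit₂) unit₄ , unit-N₄ {q} unit₁ unit₂ unit₄
      where open 𝔼Q.Quadruple q

    -- `Q₁` and `Q₂` are units that agree modulo 4, hence equal. Their product is therefore a
    -- square, and it fixes the sign of the rational part.
    eisenstein-odd : ∀ {j} → norm (Q₁ 𝔼.* Q₂) ≈2^ j → ¬ Ev W.n₁ →
      j ≡ 0 × Q₁ 𝔼.* Q₂ ≡ Q₁ 𝔼.* Q₁ × U.N₄ ∼ W.n₁ 𝔼.* W.n₁ × V.N₄ ∼ Z.n₁ 𝔼.* Z.n₁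
    eisenstein-odd p odd′ = case norm-split Q₁ Q₂ p of λ where
      (_ , _ , q₁ , q₂ , refl) → case odd-quadruple w q₁ odd′ of λ where
        (z₁ , unit₁ , N₁) → case odd-quadruple z q₂ (λ e → odd′ (Ev-resp (≡𝔼.[]-sym (𝔼Q.n₁-≈ z≈w)) e)) of λ where
          (z₂ , unit₂ , N₂) → cong₂ ℕ._+_ z₁ z₂ , unit-product {Q₁} {Q₂} unit₁ unit₂ (≡𝔼.[]-* (𝔼Q.n₁n₂-≈ z≈w) (𝔼Q.N₄-≈ z≈w))
                            , subst (U.N₄ ∼_) N₁ u∼w , subst (V.N₄ ∼_) N₂ v∼z

    rational-odd : ∀ {i} → P₁ ℤ.* P₂ ≈2^ i → Odd U.n₁ → i ≡ 0 × P₁ ℤ.* P₂ ≡ 1ℤ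
    rational-odd p o = odd-product {P₁} {P₂} p
      (Odd-* (Odd-* o (Odd-resp U.n₂≡n₁ o)) (Odd-resp U.N₄≡n₁² (Odd-* o o)))
      (≡ℤ.[]-* (ℤQ.n₁n₂-≈ v≈u) (ℤQ.N₄-≈ v≈u))

    rational-≥8 : ∀ {i} → P₁ ℤ.* P₂ ≈2^ i → Even U.n₁ → 8 ℕ.≤ i
    rational-≥8 p ev = case ≈2^-* P₁ P₂ p of λ where
      (_ , _ , p₁ , p₂ , refl) → case split₃ U.n₁ U.n₂ U.N₄ p₁ of λ where
        (_ , _ , _ , pa , pb , pr , refl) → case split₃ V.n₁ V.n₂ V.N₄ p₂ of λ where
          (_ , _ , _ , pc , pd , ps , refl) → ℕ.+-mono-≤ (quadruple-≥4 {u} ev pa pb pr)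
            (quadruple-≥4 {v} (Even-resp (ℤQ.n₁-≈ v≈u) ev) pc pd ps)

    -- With its even exponent, `N₄ = 4 (α′² + β′²)` behaves like a pair of linear factors. So there
    -- are four half-sums, an even number of them odd, and the exponents 9, 10 and 11 are skipped.
    rational-even : ∀ {i} → P₁ ℤ.* P₂ ≈2^ i → Even U.n₁ → U.N₄ ∼ W.n₁ 𝔼.* W.n₁ → V.N₄ ∼ Z.n₁ 𝔼.* Z.n₁ → i ≡ 8 ⊎ 12 ℕ.≤ i
    rational-even p ev N₁ N₂ = case ≈2^-* P₁ P₂ p of λ where
          (_ , _ , p₁ , p₂ , refl) → case split₃ U.n₁ U.n₂ U.N₄ p₁ of λ where
            (a , b , r , pa , pb , pr , refl) → case split₃ V.n₁ V.n₂ V.N₄ p₂ of λ where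
              (c , d , s , pc , pd , ps , refl) →
                case square-exponent r (trans (sym (∼-square {U.N₄} {r} W.n₁ pr N₁)) (sum-of-squares U.A⁻ U.B⁻)) of λ where
                  (h , refl) → case square-exponent s (trans (sym (∼-square {V.N₄} {s} Z.n₁ ps N₂)) (sum-of-squares V.A⁻ V.B⁻)) of λ where
                    (l , refl) → finish a b h c d l pa pb pr pc pd ps
      where
      ev′ = Even-resp (ℤQ.n₁-≈ v≈u) ev
      finish : ∀ a b h c d l → U.n₁ ≈2^ a → U.n₂ ≈2^ b → U.N₄ ≈2^ (h ℕ.+ h) → V.n₁ ≈2^ c → V.n₂ ≈2^ d → V.N₄ ≈2^ (l ℕ.+ l) →
               (a ℕ.+ b ℕ.+ (h ℕ.+ h)) ℕ.+ (c ℕ.+ d ℕ.+ (l ℕ.+ l)) ≡ 8 ⊎ 12 ℕ.≤ (a ℕ.+ b ℕ.+ (h ℕ.+ h)) ℕ.+ (c ℕ.+ d ℕ.+ (l ℕ.+ l))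
      finish a b h c d l pa pb pr pc pd ps = conclude
          (total (half-sums-even v≈u H₁ H₂) (pair-view {α = H.α} {H.β} H.n₁≡ H.n₂≡ pa pb) (proj₂ view₁)
                                            (pair-view {α = H′.α} {H′.β} H′.n₁≡ H′.n₂≡ pc pd) (proj₂ view₂))
        where
        2≤h = double≥ h (Even⇒1≤ {U.N₄} pr (Even-N₄ {u} ev))
        2≤l = double≥ l (Even⇒1≤ {V.N₄} ps (Even-N₄ {v} ev′))
        H₁ = halves-from-N₄ {u} pr 2≤h
        H₂ = halves-from-N₄ {v} ps 2≤l
        module H = Halves H₁
        module H′ = Halves H₂
        view₁ = N₄-view {U.N₄} {H.α′} {H.β′} h H.N₄≡ pr 2≤h
        view₂ = N₄-view {V.N₄} {H′.α′} {H′.β′} l H′.N₄≡ ps 2≤l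
        conclude : ∀ {o₁ o₂ o₃ o₄ S W} → Total o₁ o₂ o₃ o₄ S W → S ≡ 8 ⊎ 12 ℕ.≤ S
        conclude (minimal _ _ _ _ eq) = inj₁ eq
        conclude (middle w)           = inj₂ (Weighted-≥ w)
        conclude (large 16≤)          = inj₂ (ℕ.≤-trans (ℕ.m≤m+n 12 4) 16≤)

    spectrum : ∀ k → ℤQ.C2×C4-product u v ∼ 𝔼Q.C2×C4-product w z → ℤQ.C2×C4-product u v ℤ.* norm (𝔼Q.C2×C4-product w z) ≈2^ k →
               Spectrum₁ (ℤQ.C2×C4-product u v ℤ.* norm (𝔼Q.C2×C4-product w z)) k
    spectrum k P∼Q p = case ≈2^-* (P₁ ℤ.* P₂) (norm (Q₁ 𝔼.* Q₂)) p of λ where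
        (i , j , pi , pj , refl) → by-evenness i j pi pj (Ev? W.n₁) (parity U.n₁)
      where
      by-evenness : ∀ i j → P₁ ℤ.* P₂ ≈2^ i → norm (Q₁ 𝔼.* Q₂) ≈2^ j → Ev W.n₁ ⊎ ¬ Ev W.n₁ → Even U.n₁ ⊎ Odd U.n₁ →
                    Spectrum₁ ((P₁ ℤ.* P₂) ℤ.* norm (Q₁ 𝔼.* Q₂)) (i ℕ.+ j)
      by-evenness i j pi pj (inj₁ ev) (inj₁ ev′) = inj₂ (ℕ.+-mono-≤ (rational-≥8 pi ev′) (eisenstein-even pj ev))
      by-evenness i j pi pj (inj₁ ev) (inj₂ o) = case rational-odd pi o of λ where
        (refl , P≡1) → inj₁ (signed-product {w = Q₁ 𝔼.* Q₂} {0} P≡1 pj refl , inj₂ (inj₂ (eisenstein-even pj ev)))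
      by-evenness i j pi pj (inj₂ odd′) par = case eisenstein-odd pj odd′ of λ where
        (refl , square , N₁ , N₂) → inj₁ (signed-product {w = Q₁ 𝔼.* Q₂} {i}
            (∼-square {P₁ ℤ.* P₂} {i} Q₁ pi (subst (P₁ ℤ.* P₂ ∼_) square P∼Q)) pj refl ,
          (case par of λ where
            (inj₂ o)  → inj₁ (cong (ℕ._+ 0) (proj₁ (rational-odd pi o)))
            (inj₁ ev) → case rational-even pi ev N₁ N₂ of λ where
              (inj₁ i≡8)  → inj₂ (inj₁ (cong (ℕ._+ 0) i≡8))
              (inj₂ 12≤i) → inj₂ (inj₂ (ℕ.≤-trans 12≤i (ℕ.m≤m+n i 0)))))

  C2×C4-spectrum : ∀ x k → determinant x Forms.C2×C4 ≈2^ k → Spectrum₁ (determinant x Forms.C2×C4) k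
  C2×C4-spectrum x k p = subst (λ D → Spectrum₁ D k) (sym value)
      (C2×C4Core.spectrum (ℤQ.upper≈lower f) (𝔼Q.upper≈lower g)
        (subst₂ _∼_ (ℤQ.N₄-value f) (𝔼Q.N₄-value g) (∼-eval x (Forms.N₄ Forms.d)))
        (subst₂ _∼_ (ℤQ.N₄-value′ f) (𝔼Q.N₄-value′ g) (∼-eval x (Forms.N₄ Forms.e)))
        k (subst₂ _∼_ (ℤQ.C2×C4-value f) (𝔼Q.C2×C4-value g) (∼-eval x Forms.C2×C4)) (subst (_≈2^ k) value p))
    where
    f = rational x
    g = eisenstein x
    value = cong₂ (λ s t → s ℤ.* norm t) (ℤQ.C2×C4-value f) (𝔼Q.C2×C4-value g)

open RankTwoSpectrum

-- Halves of the four Eisenstein factors over C₂ × C₂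

module HalvedQuadruples where
  open ≡𝔼 using (2#) renaming (_≡_[_] to _≡ᴱ_[_])
  open 𝔼 using (_+_; _*_; -_; _-_; 0#; solve; con; _:+_; _:*_; :-_; _:-_; _:=_)

  -- The nonzero residues modulo 2 are those of 1, ω and 1 + ω.
  residue : Fin 3 → 𝔼.Carrier
  residue zero             = 1ℤ , 0ℤ
  residue (suc zero)       = 0ℤ , 1ℤ
  residue (suc (suc zero)) = 1ℤ , 1ℤ

  unit-residue : ∀ {w} → Unit w → ∃[ c ] w ≡ᴱ residue c [ 2# ]
  unit-residue {x , y} unit with parity x | parity y
  ... | inj₁ (a , refl) | inj₁ (b , refl) = contradiction (0ℤ , unit) (¬Even∧Odd (Ev⇒Even-norm {𝟚 ℤ.* a , 𝟚 ℤ.* b} ((a , b) , sym (2#-* (a , b)))))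
  ... | inj₂ (a , refl) | inj₁ (b , refl) = # 0 , (a , b) , cong₂ _,_ (cong (λ t → 1ℤ ℤ.+ t) (sym (cong proj₁ (2#-* (a , b))))) (sym (trans (ℤ.+-identityˡ _) (cong proj₂ (2#-* (a , b)))))
  ... | inj₁ (a , refl) | inj₂ (b , refl) = # 1 , (a , b) , cong₂ _,_ (sym (trans (ℤ.+-identityˡ _) (cong proj₁ (2#-* (a , b))))) (cong (λ t → 1ℤ ℤ.+ t) (sym (cong proj₂ (2#-* (a , b)))))
  ... | inj₂ (a , refl) | inj₂ (b , refl) = # 2 , (a , b) , cong₂ _,_ (cong (λ t → 1ℤ ℤ.+ t) (sym (cong proj₁ (2#-* (a , b))))) (cong (λ t → 1ℤ ℤ.+ t) (sym (cong proj₂ (2#-* (a , b)))))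

  module _ {x y q q′ : 𝔼.Carrier} where
    sum-congruent : q - q′ ≡ x + y → q ≡ᴱ q′ [ 2# ] → x ≡ᴱ y [ 2# ]
    sum-congruent eq (t , refl) = t - y , trans (solve 2 (λ x y → x := (x :+ y) :- y) refl x y) (trans (cong (λ s → s - y) (sym eq)) (trans
      (solve 4 (λ q t y m → ((q :+ m :* t) :- q) :- y := (m :* t) :- y) refl q′ t y 2#)
      (solve 2 (λ t y → (con 1ℤ :+ con 1ℤ) :* t :- y := y :+ (con 1ℤ :+ con 1ℤ) :* (t :- y)) refl t y)))

    difference-congruent : q - q′ ≡ x - y → q ≡ᴱ q′ [ 2# ] → x ≡ᴱ y [ 2# ]
    difference-congruent eq (t , refl) = t , trans (solve 2 (λ x y → x := y :+ (x :- y)) refl x y) (cong (λ s → y + s)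
      (trans (sym eq) (solve 3 (λ q t m → (q :+ m :* t) :- q := m :* t) refl q′ t 2#)))

    congruent-sum : q - q′ ≡ x + y → x ≡ᴱ y [ 2# ] → q ≡ᴱ q′ [ 2# ]
    congruent-sum eq (t , refl) = y + t , trans (solve 2 (λ q q′ → q := q′ :+ (q :- q′)) refl q q′) (cong (λ s → q′ + s)
      (trans eq (solve 2 (λ y t → (y :+ (con 1ℤ :+ con 1ℤ) :* t) :+ y := (con 1ℤ :+ con 1ℤ) :* (y :+ t)) refl y t)))

    congruent-difference : q - q′ ≡ x - y → x ≡ᴱ y [ 2# ] → q ≡ᴱ q′ [ 2# ]
    congruent-difference eq (t , refl) = t , trans (solve 2 (λ q q′ → q := q′ :+ (q :- q′)) refl q q′) (cong (λ s → q′ + s)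
      (trans eq (solve 3 (λ y t m → (y :+ m :* t) :- y := m :* t) refl y t 2#)))

  ¬Ev-unit : ∀ {w} → Unit w → ¬ Ev w
  ¬Ev-unit unit ev = ¬Even∧Odd (Ev⇒Even-norm ev) (0ℤ , unit)

  Unit-neg : ∀ {w} → Unit w → Unit (- w)
  Unit-neg {x , y} unit = trans (Zk.solve 2 (λ x y → Zk.:- x Zk.:* Zk.:- x Zk.:- Zk.:- x Zk.:* Zk.:- y Zk.:+ Zk.:- y Zk.:* Zk.:- y Zk.:= x Zk.:* x Zk.:- x Zk.:* y Zk.:+ y Zk.:* y) refl x y) unit

  Ev-0 : ∀ {w} → w ≡ 0# → Ev w
  Ev-0 refl = 0# , refl

  record Signed (p x x′ y y′ : 𝔼.Carrier) : Set where
    constructor signed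
    field
      root : 𝔼.Carrier
      sign : (p ≡ root * root × (Ev x ⊎ Ev y)) ⊎ (p ≡ - (root * root) × (¬ Ev x × ¬ Ev x′ × ¬ Ev y × ¬ Ev y′))

  -- Units that agree modulo 2 in pairs are equal up to sign in pairs; the two signs
  -- determine x, x′, y, y′ and hence their parities.
  pairing : ∀ {q q′ r r′ x x′ y y′} → Unit q → Unit q′ → Unit r → Unit r′ →
    q - q′ ≡ x + x′ → r - r′ ≡ x - x′ → q + q′ ≡ y + y′ → r + r′ ≡ y - y′ →
    x ≡ᴱ x′ [ 2# ] → Signed ((q * q′) * (r * r′)) x x′ y y′
  pairing {q} {q′} {r} {r′} {x} {x′} {y} {y′} uq uq′ ur ur′ e₁ e₂ e₃ e₄ x≡x′ =
    by-signs (units-mod-2 uq uq′ (congruent-sum e₁ x≡x′)) (units-mod-2 ur ur′ (congruent-difference e₂ x≡x′))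
    where
    double₁ : 2# * x ≡ (q - q′) + (r - r′)
    double₁ = trans (solve 2 (λ x y → (con 1ℤ :+ con 1ℤ) :* x := (x :+ y) :+ (x :- y)) refl x x′) (cong₂ _+_ (sym e₁) (sym e₂))
    double₂ : 2# * x′ ≡ (q - q′) - (r - r′)
    double₂ = trans (solve 2 (λ x y → (con 1ℤ :+ con 1ℤ) :* y := (x :+ y) :- (x :- y)) refl x x′) (cong₂ _-_ (sym e₁) (sym e₂))
    double₃ : 2# * y ≡ (q + q′) + (r + r′)
    double₃ = trans (solve 2 (λ x y → (con 1ℤ :+ con 1ℤ) :* x := (x :+ y) :+ (x :- y)) refl y y′) (cong₂ _+_ (sym e₃) (sym e₄))
    double₄ : 2# * y′ ≡ (q + q′) - (r + r′)
    double₄ = trans (solve 2 (λ x y → (con 1ℤ :+ con 1ℤ) :* y := (x :+ y) :- (x :- y)) refl y y′) (cong₂ _-_ (sym e₃) (sym e₄))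

    odd-root : ∀ s t → 2# * s ≡ 2# * t → Unit t → ¬ Ev s
    odd-root s t eq unit ev = ¬Ev-unit {t} unit (subst Ev (2#-cancel s t eq) ev)

    zero-root : ∀ s → 2# * s ≡ 2# * 0# → Ev s
    zero-root s eq = Ev-0 (2#-cancel s 0# eq)

    by-signs : q ≡ q′ ⊎ q ≡ - q′ → r ≡ r′ ⊎ r ≡ - r′ → Signed ((q * q′) * (r * r′)) x x′ y y′
    by-signs (inj₁ refl) (inj₁ refl) = signed (q′ * r′) (inj₁
      ( solve 2 (λ q r → (q :* q) :* (r :* r) := (q :* r) :* (q :* r)) refl q′ r′
      , inj₁ (zero-root x (trans double₁ (solve 2 (λ q r → (q :- q) :+ (r :- r) := (con 1ℤ :+ con 1ℤ) :* con 0ℤ) refl q′ r′)))))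
    by-signs (inj₂ refl) (inj₂ refl) = signed (q′ * r′) (inj₁
      ( solve 2 (λ q r → (:- q :* q) :* (:- r :* r) := (q :* r) :* (q :* r)) refl q′ r′
      , inj₂ (zero-root y (trans double₃ (solve 2 (λ q r → (:- q :+ q) :+ (:- r :+ r) := (con 1ℤ :+ con 1ℤ) :* con 0ℤ) refl q′ r′)))))
    by-signs (inj₁ refl) (inj₂ refl) = signed (q′ * r′) (inj₂
      ( solve 2 (λ q r → (q :* q) :* (:- r :* r) := :- ((q :* r) :* (q :* r))) refl q′ r′
      , odd-root x (- r′) (trans double₁ (solve 2 (λ q r → (q :- q) :+ (:- r :- r) := (con 1ℤ :+ con 1ℤ) :* :- r) refl q′ r′)) (Unit-neg {r′} ur′)
      , odd-root x′ r′ (trans double₂ (solve 2 (λ q r → (q :- q) :- (:- r :- r) := (con 1ℤ :+ con 1ℤ) :* r) refl q′ r′)) ur′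
      , odd-root y q′ (trans double₃ (solve 2 (λ q r → (q :+ q) :+ (:- r :+ r) := (con 1ℤ :+ con 1ℤ) :* q) refl q′ r′)) uq′
      , odd-root y′ q′ (trans double₄ (solve 2 (λ q r → (q :+ q) :- (:- r :+ r) := (con 1ℤ :+ con 1ℤ) :* q) refl q′ r′)) uq′))
    by-signs (inj₂ refl) (inj₁ refl) = signed (q′ * r′) (inj₂
      ( solve 2 (λ q r → (:- q :* q) :* (r :* r) := :- ((q :* r) :* (q :* r))) refl q′ r′
      , odd-root x (- q′) (trans double₁ (solve 2 (λ q r → (:- q :- q) :+ (r :- r) := (con 1ℤ :+ con 1ℤ) :* :- q) refl q′ r′)) (Unit-neg {q′} uq′)
      , odd-root x′ (- q′) (trans double₂ (solve 2 (λ q r → (:- q :- q) :- (r :- r) := (con 1ℤ :+ con 1ℤ) :* :- q) refl q′ r′)) (Unit-neg {q′} uq′)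
      , odd-root y r′ (trans double₃ (solve 2 (λ q r → (:- q :+ q) :+ (r :+ r) := (con 1ℤ :+ con 1ℤ) :* r) refl q′ r′)) ur′
      , odd-root y′ (- r′) (trans double₄ (solve 2 (λ q r → (:- q :+ q) :- (r :+ r) := (con 1ℤ :+ con 1ℤ) :* :- r) refl q′ r′)) (Unit-neg {r′} ur′)))

  module HalvedQuadruple {w : 𝔼Q.Quadruple} where
    open 𝔼Q.Quadruple w

    -- Facts about the halved factors are expressed by conditions on the coefficients modulo 2,
    -- because these carry over from one quadruple of a determinant to the other. `Coincide`
    -- corresponds to two halved factors that agree modulo 2.
    Coincide HasEven : Set
    Coincide = (u₁ ≡ᴱ u₃ [ 2# ]) ⊎ (u₂ ≡ᴱ u₃ [ 2# ]) ⊎ (u₂ ≡ᴱ u₁ [ 2# ])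
    HasEven  = Ev u₀ ⊎ Ev u₁ ⊎ Ev u₂ ⊎ Ev u₃

    module _ {q₁ q₂ q₃ q₄} (h₁ : n₁ ≡ 2# * q₁) (h₂ : n₂ ≡ 2# * q₂) (h₃ : n₃ ≡ 2# * q₃) (h₄ : n₄ ≡ 2# * q₄) where
      private
        minus : ∀ q r t {a b} → a ≡ 2# * q → b ≡ 2# * r → a - b ≡ 2# * t → q - r ≡ t
        minus q r t refl refl eq = 2#-cancel (q - r) t (trans (solve 3 (λ m q r → m :* (q :- r) := m :* q :- m :* r) refl 2# q r) eq)
        plus : ∀ q r t {a b} → a ≡ 2# * q → b ≡ 2# * r → a + b ≡ 2# * t → q + r ≡ t
        plus q r t refl refl eq = 2#-cancel (q + r) t (trans (solve 3 (λ m q r → m :* (q :+ r) := m :* q :+ m :* r) refl 2# q r) eq)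

      -- The factors are the Fourier transform of the coefficients over C₂². For each of the three
      -- ways of pairing them off, the sums and differences of the halves are sums and differences
      -- of two coefficients.
      q₁-q₂ : q₁ - q₂ ≡ u₁ + u₃
      q₁-q₂ = minus q₁ q₂ (u₁ + u₃) h₁ h₂ (solve 2 (λ a b → (a :+ b) :- (a :- b) := (con 1ℤ :+ con 1ℤ) :* b) refl A⁺ B⁺)
      q₃-q₄ : q₃ - q₄ ≡ u₁ - u₃
      q₃-q₄ = minus q₃ q₄ (u₁ - u₃) h₃ h₄ (solve 2 (λ a b → (a :+ b) :- (a :- b) := (con 1ℤ :+ con 1ℤ) :* b) refl A⁻ B⁻)
      q₁+q₂ : q₁ + q₂ ≡ u₀ + u₂
      q₁+q₂ = plus q₁ q₂ (u₀ + u₂) h₁ h₂ (solve 2 (λ a b → (a :+ b) :+ (a :- b) := (con 1ℤ :+ con 1ℤ) :* a) refl A⁺ B⁺)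
      q₃+q₄ : q₃ + q₄ ≡ u₀ - u₂
      q₃+q₄ = plus q₃ q₄ (u₀ - u₂) h₃ h₄ (solve 2 (λ a b → (a :+ b) :+ (a :- b) := (con 1ℤ :+ con 1ℤ) :* a) refl A⁻ B⁻)
      q₁-q₃ : q₁ - q₃ ≡ u₂ + u₃
      q₁-q₃ = minus q₁ q₃ (u₂ + u₃) h₁ h₃ (solve 4 (λ a b c d → ((a :+ c) :+ (b :+ d)) :- ((a :- c) :+ (b :- d)) := (con 1ℤ :+ con 1ℤ) :* (c :+ d)) refl u₀ u₁ u₂ u₃)
      q₂-q₄ : q₂ - q₄ ≡ u₂ - u₃
      q₂-q₄ = minus q₂ q₄ (u₂ - u₃) h₂ h₄ (solve 4 (λ a b c d → ((a :+ c) :- (b :+ d)) :- ((a :- c) :- (b :- d)) := (con 1ℤ :+ con 1ℤ) :* (c :- d)) refl u₀ u₁ u₂ u₃)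
      q₁+q₃ : q₁ + q₃ ≡ u₀ + u₁
      q₁+q₃ = plus q₁ q₃ (u₀ + u₁) h₁ h₃ (solve 4 (λ a b c d → ((a :+ c) :+ (b :+ d)) :+ ((a :- c) :+ (b :- d)) := (con 1ℤ :+ con 1ℤ) :* (a :+ b)) refl u₀ u₁ u₂ u₃)
      q₂+q₄ : q₂ + q₄ ≡ u₀ - u₁
      q₂+q₄ = plus q₂ q₄ (u₀ - u₁) h₂ h₄ (solve 4 (λ a b c d → ((a :+ c) :- (b :+ d)) :+ ((a :- c) :- (b :- d)) := (con 1ℤ :+ con 1ℤ) :* (a :- b)) refl u₀ u₁ u₂ u₃)
      q₁-q₄ : q₁ - q₄ ≡ u₂ + u₁
      q₁-q₄ = minus q₁ q₄ (u₂ + u₁) h₁ h₄ (solve 4 (λ a b c d → ((a :+ c) :+ (b :+ d)) :- ((a :- c) :- (b :- d)) := (con 1ℤ :+ con 1ℤ) :* (c :+ b)) refl u₀ u₁ u₂ u₃)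
      q₂-q₃ : q₂ - q₃ ≡ u₂ - u₁
      q₂-q₃ = minus q₂ q₃ (u₂ - u₁) h₂ h₃ (solve 4 (λ a b c d → ((a :+ c) :- (b :+ d)) :- ((a :- c) :+ (b :- d)) := (con 1ℤ :+ con 1ℤ) :* (c :- b)) refl u₀ u₁ u₂ u₃)
      q₁+q₄ : q₁ + q₄ ≡ u₀ + u₃
      q₁+q₄ = plus q₁ q₄ (u₀ + u₃) h₁ h₄ (solve 4 (λ a b c d → ((a :+ c) :+ (b :+ d)) :+ ((a :- c) :- (b :- d)) := (con 1ℤ :+ con 1ℤ) :* (a :+ d)) refl u₀ u₁ u₂ u₃)
      q₂+q₃ : q₂ + q₃ ≡ u₀ - u₃
      q₂+q₃ = plus q₂ q₃ (u₀ - u₃) h₂ h₃ (solve 4 (λ a b c d → ((a :+ c) :- (b :+ d)) :+ ((a :- c) :+ (b :- d)) := (con 1ℤ :+ con 1ℤ) :* (a :- d)) refl u₀ u₁ u₂ u₃)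

      module _ (U₁ : Unit q₁) (U₂ : Unit q₂) (U₃ : Unit q₃) (U₄ : Unit q₄) where
        -- Four units, three nonzero residue classes modulo 2.
        units-coincide : Coincide
        units-coincide = case pigeonhole {3} {4} ℕ.≤-refl class of λ where
            (i , j , i<j , eq) → by-indices i j i<j (≡𝔼.[]-trans (proj₂ (residues i)) (subst (λ c → residue c ≡ᴱ q j [ 2# ]) (sym eq) (≡𝔼.[]-sym (proj₂ (residues j)))))
          where
          q : Fin 4 → 𝔼.Carrier
          q zero                   = q₁
          q (suc zero)             = q₂
          q (suc (suc zero))       = q₃
          q (suc (suc (suc zero))) = q₄

          residues : ∀ i → ∃[ c ] q i ≡ᴱ residue c [ 2# ]
          residues zero                   = unit-residue {q₁} U₁
          residues (suc zero)             = unit-residue {q₂} U₂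
          residues (suc (suc zero))       = unit-residue {q₃} U₃
          residues (suc (suc (suc zero))) = unit-residue {q₄} U₄

          class : Fin 4 → Fin 3
          class i = proj₁ (residues i)

          by-indices : ∀ i j → i Data.Fin.< j → q i ≡ᴱ q j [ 2# ] → Coincide
          by-indices zero (suc zero) _ c                         = inj₁ (sum-congruent q₁-q₂ c)
          by-indices zero (suc (suc zero)) _ c                   = inj₂ (inj₁ (sum-congruent q₁-q₃ c))
          by-indices zero (suc (suc (suc zero))) _ c             = inj₂ (inj₂ (sum-congruent q₁-q₄ c))
          by-indices (suc zero) (suc (suc zero)) _ c             = inj₂ (inj₂ (difference-congruent q₂-q₃ c))
          by-indices (suc zero) (suc (suc (suc zero))) _ c       = inj₂ (inj₁ (difference-congruent q₂-q₄ c))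
          by-indices (suc (suc zero)) (suc (suc (suc zero))) _ c = inj₁ (difference-congruent q₃-q₄ c)
          by-indices (suc zero) (suc zero) (s≤s ()) c
          by-indices (suc (suc zero)) (suc zero) (s≤s ()) c
          by-indices (suc (suc zero)) (suc (suc zero)) (s≤s (s≤s ())) c
          by-indices (suc (suc (suc zero))) (suc zero) (s≤s ()) c
          by-indices (suc (suc (suc zero))) (suc (suc zero)) (s≤s (s≤s ())) c
          by-indices (suc (suc (suc zero))) (suc (suc (suc zero))) (s≤s (s≤s (s≤s ()))) c

        -- Some pairing has units that agree modulo 2, and `pairing` shows that the product is minus
        -- a square just when no coefficient is even. Both quadruples of a determinant share this
        -- condition, so their signs cancel in the end.
        units-signed : ∃[ s ] (((q₁ * q₂) * (q₃ * q₄) ≡ s * s × HasEven) ⊎ ((q₁ * q₂) * (q₃ * q₄) ≡ - (s * s) × ¬ HasEven))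
        units-signed = by-coincidence units-coincide
          where
          by-coincidence : Coincide → ∃[ s ] (((q₁ * q₂) * (q₃ * q₄) ≡ s * s × HasEven) ⊎ ((q₁ * q₂) * (q₃ * q₄) ≡ - (s * s) × ¬ HasEven))
          by-coincidence (inj₁ c) = case pairing {q₁} {q₂} {q₃} {q₄} {u₁} {u₃} {u₀} {u₂} U₁ U₂ U₃ U₄ q₁-q₂ q₃-q₄ q₁+q₂ q₃+q₄ c of λ where
            (signed s (inj₁ (eq , inj₁ e))) → s , inj₁ (eq , inj₂ (inj₁ e))
            (signed s (inj₁ (eq , inj₂ e))) → s , inj₁ (eq , inj₁ e)
            (signed s (inj₂ (eq , o₁ , o₃ , o₀ , o₂))) → s , inj₂ (eq , λ where
              (inj₁ e) → o₀ e
              (inj₂ (inj₁ e)) → o₁ e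
              (inj₂ (inj₂ (inj₁ e))) → o₂ e
              (inj₂ (inj₂ (inj₂ e))) → o₃ e)
          by-coincidence (inj₂ (inj₁ c)) = case pairing {q₁} {q₃} {q₂} {q₄} {u₂} {u₃} {u₀} {u₁} U₁ U₃ U₂ U₄ q₁-q₃ q₂-q₄ q₁+q₃ q₂+q₄ c of λ where
              (signed s (inj₁ (eq , inj₁ e))) → s , inj₁ (trans reorder eq , inj₂ (inj₂ (inj₁ e)))
              (signed s (inj₁ (eq , inj₂ e))) → s , inj₁ (trans reorder eq , inj₁ e)
              (signed s (inj₂ (eq , o₂ , o₃ , o₀ , o₁))) → s , inj₂ (trans reorder eq , λ where
                (inj₁ e) → o₀ e
                (inj₂ (inj₁ e)) → o₁ e
                (inj₂ (inj₂ (inj₁ e))) → o₂ e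
                (inj₂ (inj₂ (inj₂ e))) → o₃ e)
            where
            reorder : (q₁ * q₂) * (q₃ * q₄) ≡ (q₁ * q₃) * (q₂ * q₄)
            reorder = solve 4 (λ a b c d → (a :* b) :* (c :* d) := (a :* c) :* (b :* d)) refl q₁ q₂ q₃ q₄
          by-coincidence (inj₂ (inj₂ c)) = case pairing {q₁} {q₄} {q₂} {q₃} {u₂} {u₁} {u₀} {u₃} U₁ U₄ U₂ U₃ q₁-q₄ q₂-q₃ q₁+q₄ q₂+q₃ c of λ where
              (signed s (inj₁ (eq , inj₁ e))) → s , inj₁ (trans reorder eq , inj₂ (inj₂ (inj₁ e)))
              (signed s (inj₁ (eq , inj₂ e))) → s , inj₁ (trans reorder eq , inj₁ e)
              (signed s (inj₂ (eq , o₂ , o₁ , o₀ , o₃))) → s , inj₂ (trans reorder eq , λ where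
                (inj₁ e) → o₀ e
                (inj₂ (inj₁ e)) → o₁ e
                (inj₂ (inj₂ (inj₁ e))) → o₂ e
                (inj₂ (inj₂ (inj₂ e))) → o₃ e)
            where
            reorder : (q₁ * q₂) * (q₃ * q₄) ≡ (q₁ * q₄) * (q₂ * q₃)
            reorder = solve 4 (λ a b c d → (a :* b) :* (c :* d) := (a :* d) :* (b :* c)) refl q₁ q₂ q₃ q₄

      -- A coincidence pairs off the q's modulo 2, so exactly one of them cannot be even.
      even-paired : Coincide → (Ev q₁ → Ev q₂ ⊎ Ev q₃ ⊎ Ev q₄) × (Ev q₂ → Ev q₁ ⊎ Ev q₃ ⊎ Ev q₄) ×
                               (Ev q₃ → Ev q₁ ⊎ Ev q₂ ⊎ Ev q₄) × (Ev q₄ → Ev q₁ ⊎ Ev q₂ ⊎ Ev q₃)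
      even-paired (inj₁ c) = let p = congruent-sum q₁-q₂ c ; p′ = congruent-difference q₃-q₄ c in
          (λ e → inj₁ (Ev-resp (≡𝔼.[]-sym p) e)) , (λ e → inj₁ (Ev-resp p e))
        , (λ e → inj₂ (inj₂ (Ev-resp (≡𝔼.[]-sym p′) e))) , (λ e → inj₂ (inj₂ (Ev-resp p′ e)))
      even-paired (inj₂ (inj₁ c)) = let p = congruent-sum q₁-q₃ c ; p′ = congruent-difference q₂-q₄ c in
          (λ e → inj₂ (inj₁ (Ev-resp (≡𝔼.[]-sym p) e))) , (λ e → inj₂ (inj₂ (Ev-resp (≡𝔼.[]-sym p′) e)))
        , (λ e → inj₁ (Ev-resp p e)) , (λ e → inj₂ (inj₁ (Ev-resp p′ e)))
      even-paired (inj₂ (inj₂ c)) = let p = congruent-sum q₁-q₄ c ; p′ = congruent-difference q₂-q₃ c in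
          (λ e → inj₂ (inj₂ (Ev-resp (≡𝔼.[]-sym p) e))) , (λ e → inj₂ (inj₁ (Ev-resp (≡𝔼.[]-sym p′) e)))
        , (λ e → inj₂ (inj₁ (Ev-resp p′ e))) , (λ e → inj₁ (Ev-resp p e))

open HalvedQuadruples

-- Norm exponents of even Eisenstein quadruples

module EvenQuadruples where
  open ≡𝔼 using (2#; 4#)
  open Zk using (solve; _:*_; :-_; _:-_; _:=_)

  norm-split₄′ : ∀ {k} a b c d → norm (a 𝔼.* b 𝔼.* (c 𝔼.* d)) ≈2^ k →
    ∃[ i ] ∃[ j ] ∃[ l ] ∃[ m ] (norm a ≈2^ i × norm b ≈2^ j × norm c ≈2^ l × norm d ≈2^ m × (i ℕ.+ j) ℕ.+ (l ℕ.+ m) ≡ k)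
  norm-split₄′ a b c d p = case norm-split (a 𝔼.* b) (c 𝔼.* d) p of λ where
    (_ , _ , p₁ , p₂ , refl) → case norm-split a b p₁ of λ where
      (i , j , pa , pb , refl) → case norm-split c d p₂ of λ where
        (l , m , pc , pd , refl) → i , j , l , m , pa , pb , pc , pd , refl

  split₄′ : ∀ {k} a b c d → a ℤ.* b ℤ.* (c ℤ.* d) ≈2^ k →
    ∃[ i ] ∃[ j ] ∃[ l ] ∃[ m ] (a ≈2^ i × b ≈2^ j × c ≈2^ l × d ≈2^ m × (i ℕ.+ j) ℕ.+ (l ℕ.+ m) ≡ k)
  split₄′ a b c d p = case ≈2^-* (a ℤ.* b) (c ℤ.* d) p of λ where
    (_ , _ , p₁ , p₂ , refl) → case ≈2^-* a b p₁ of λ where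
      (i , j , pa , pb , refl) → case ≈2^-* c d p₂ of λ where
        (l , m , pc , pd , refl) → i , j , l , m , pa , pb , pc , pd , refl

  -- A remaining exponent 1 is impossible since 2 is inert: the half is a unit or again divisible by
  -- 2.
  Half : 𝔼.Carrier → ℕ → Set
  Half n k = ∃[ q ] ∃[ e ] (n ≡ 2# 𝔼.* q × k ≡ 2 ℕ.+ e × ((e ≡ 0 × Unit q) ⊎ (2 ℕ.≤ e × Ev q)))

  half : ∀ {n k} → Ev n → norm n ≈2^ k → Half n k
  half {n} {k} ev p = by-power (norm-power {n} {k} p)
    where
    excess : ∀ q e → norm q ≈2^ e → (e ≡ 0 × Unit q) ⊎ (2 ℕ.≤ e × Ev q)
    excess q e pq = by-power′ (norm-power {q} {e} pq)
      where
      by-power′ : (e ≡ 0 × Unit q) ⊎ ∃[ v ] ∃[ j ] (q ≡ 2# 𝔼.* v × e ≡ 2 ℕ.+ j × norm v ≈2^ j) → (e ≡ 0 × Unit q) ⊎ (2 ℕ.≤ e × Ev q)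
      by-power′ (inj₁ u)                     = inj₁ u
      by-power′ (inj₂ (v , j , q≡ , e≡ , _)) = inj₂ (ℕ.≤-trans (ℕ.m≤m+n 2 j) (ℕ.≤-reflexive (sym e≡)) , v , q≡)
    by-power : (k ≡ 0 × Unit n) ⊎ ∃[ v ] ∃[ j ] (n ≡ 2# 𝔼.* v × k ≡ 2 ℕ.+ j × norm v ≈2^ j) → Half n k
    by-power (inj₁ (_ , unit))            = contradiction ev (¬Ev-unit {n} unit)
    by-power (inj₂ (q , e , n≡ , k≡ , p)) = q , e , n≡ , k≡ , excess q e p

  -- Four factors divisible by 2 contribute 8, and each half that is still even adds at least 2.
  -- Exactly one even half excludes a coincidence, since a coincidence pairs the halves off modulo
  -- 2.
  data EvenQuadruple (w : 𝔼Q.Quadruple) (j : ℕ) : Set where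
    units  : j ≡ 8 → HalvedQuadruple.Coincide {w} →
             (let open 𝔼Q.Quadruple w in ∃[ s ]
               ((n₁ 𝔼.* n₂ 𝔼.* (n₃ 𝔼.* n₄) ≡ (4# 𝔼.* s) 𝔼.* (4# 𝔼.* s) × HalvedQuadruple.HasEven {w}) ⊎
                (n₁ 𝔼.* n₂ 𝔼.* (n₃ 𝔼.* n₄) ≡ 𝔼.- ((4# 𝔼.* s) 𝔼.* (4# 𝔼.* s)) × ¬ HalvedQuadruple.HasEven {w}))) → EvenQuadruple w j
    single : ¬ HalvedQuadruple.Coincide {w} → 10 ℕ.≤ j → EvenQuadruple w j
    many   : 12 ℕ.≤ j → EvenQuadruple w j

  even-quadruple : ∀ (w : 𝔼Q.Quadruple) {j} → let open 𝔼Q.Quadruple w in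
    norm (n₁ 𝔼.* n₂ 𝔼.* (n₃ 𝔼.* n₄)) ≈2^ j → Ev n₁ → EvenQuadruple w j
  even-quadruple w p ev = case norm-split₄′ n₁ n₂ n₃ n₄ p of λ where
      (a , b , c , d , pa , pb , pc , pd , refl) →
        by-halves (half {n₁} ev pa) (half {n₂} (Ev-resp n₂≡n₁ ev) pb) (half {n₃} (Ev-resp n₃≡n₁ ev) pc) (half {n₄} (Ev-resp n₄≡n₁ ev) pd)
    where
    open 𝔼Q.Quadruple w
    open HalvedQuadruple {w}

    quarter : ∀ {q₁ q₂ q₃ q₄} → n₁ ≡ 2# 𝔼.* q₁ → n₂ ≡ 2# 𝔼.* q₂ → n₃ ≡ 2# 𝔼.* q₃ → n₄ ≡ 2# 𝔼.* q₄ →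
              n₁ 𝔼.* n₂ 𝔼.* (n₃ 𝔼.* n₄) ≡ (4# 𝔼.* 4#) 𝔼.* ((q₁ 𝔼.* q₂) 𝔼.* (q₃ 𝔼.* q₄))
    quarter {q₁} {q₂} {q₃} {q₄} h₁ h₂ h₃ h₄ = trans (cong₂ 𝔼._*_ (cong₂ 𝔼._*_ h₁ h₂) (cong₂ 𝔼._*_ h₃ h₄)) (product q₁ q₂ q₃ q₄)
      where
      open 𝔼 using () renaming (solve to solveᴱ; con to conᴱ; _:+_ to _⊞_; _:*_ to _⊠_; _:=_ to _⩵_)
      product : ∀ a b c d → (2# 𝔼.* a) 𝔼.* (2# 𝔼.* b) 𝔼.* ((2# 𝔼.* c) 𝔼.* (2# 𝔼.* d)) ≡ (4# 𝔼.* 4#) 𝔼.* ((a 𝔼.* b) 𝔼.* (c 𝔼.* d))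
      product = solveᴱ 4 (λ a b c d → let two = conᴱ 1ℤ ⊞ conᴱ 1ℤ ; four = two ⊞ two in
        (two ⊠ a) ⊠ (two ⊠ b) ⊠ ((two ⊠ c) ⊠ (two ⊠ d)) ⩵ (four ⊠ four) ⊠ ((a ⊠ b) ⊠ (c ⊠ d))) refl

    scale⁺ : ∀ {p s} → p ≡ s 𝔼.* s → (4# 𝔼.* 4#) 𝔼.* p ≡ (4# 𝔼.* s) 𝔼.* (4# 𝔼.* s)
    scale⁺ {s = s} refl = 𝔼.solve 2 (λ m s → (m 𝔼.:* m) 𝔼.:* (s 𝔼.:* s) 𝔼.:= (m 𝔼.:* s) 𝔼.:* (m 𝔼.:* s)) refl 4# s

    scale⁻ : ∀ {p s} → p ≡ 𝔼.- (s 𝔼.* s) → (4# 𝔼.* 4#) 𝔼.* p ≡ 𝔼.- ((4# 𝔼.* s) 𝔼.* (4# 𝔼.* s))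
    scale⁻ {s = s} refl = 𝔼.solve 2 (λ m s → (m 𝔼.:* m) 𝔼.:* 𝔼.:- (s 𝔼.:* s) 𝔼.:= 𝔼.:- ((m 𝔼.:* s) 𝔼.:* (m 𝔼.:* s))) refl 4# s

    bound : ∀ {a b c d e₁ e₂ e₃ e₄} x y z t → a ≡ 2 ℕ.+ e₁ → b ≡ 2 ℕ.+ e₂ → c ≡ 2 ℕ.+ e₃ → d ≡ 2 ℕ.+ e₄ →
            x ℕ.≤ e₁ → y ℕ.≤ e₂ → z ℕ.≤ e₃ → t ℕ.≤ e₄ → ((2 ℕ.+ x) ℕ.+ (2 ℕ.+ y)) ℕ.+ ((2 ℕ.+ z) ℕ.+ (2 ℕ.+ t)) ℕ.≤ (a ℕ.+ b) ℕ.+ (c ℕ.+ d)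
    bound x y z t refl refl refl refl p q r s = ℕ.+-mono-≤ (ℕ.+-mono-≤ (s≤s (s≤s p)) (s≤s (s≤s q))) (ℕ.+-mono-≤ (s≤s (s≤s r)) (s≤s (s≤s s)))

    units-case : ∀ q₁ q₂ q₃ q₄ → n₁ ≡ 2# 𝔼.* q₁ → n₂ ≡ 2# 𝔼.* q₂ → n₃ ≡ 2# 𝔼.* q₃ → n₄ ≡ 2# 𝔼.* q₄ →
                 Unit q₁ → Unit q₂ → Unit q₃ → Unit q₄ → EvenQuadruple w 8
    units-case q₁ q₂ q₃ q₄ h₁ h₂ h₃ h₄ U₁ U₂ U₃ U₄ =
      units refl (units-coincide {q₁} {q₂} {q₃} {q₄} h₁ h₂ h₃ h₄ U₁ U₂ U₃ U₄)
        (case units-signed {q₁} {q₂} {q₃} {q₄} h₁ h₂ h₃ h₄ U₁ U₂ U₃ U₄ of λ where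
          (s , inj₁ (eq , e)) → s , inj₁ (trans (quarter {q₁} {q₂} {q₃} {q₄} h₁ h₂ h₃ h₄) (scale⁺ {(q₁ 𝔼.* q₂) 𝔼.* (q₃ 𝔼.* q₄)} {s} eq) , e)
          (s , inj₂ (eq , o)) → s , inj₂ (trans (quarter {q₁} {q₂} {q₃} {q₄} h₁ h₂ h₃ h₄) (scale⁻ {(q₁ 𝔼.* q₂) 𝔼.* (q₃ 𝔼.* q₄)} {s} eq) , o))

    by-halves : ∀ {a b c d} → Half n₁ a → Half n₂ b → Half n₃ c → Half n₄ d → EvenQuadruple w ((a ℕ.+ b) ℕ.+ (c ℕ.+ d))
    by-halves (q₁ , _ , h₁ , refl , inj₁ (refl , U₁)) (q₂ , _ , h₂ , refl , inj₁ (refl , U₂)) (q₃ , _ , h₃ , refl , inj₁ (refl , U₃)) (q₄ , _ , h₄ , refl , inj₁ (refl , U₄)) =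
      units-case q₁ q₂ q₃ q₄ h₁ h₂ h₃ h₄ U₁ U₂ U₃ U₄
    by-halves (q₁ , _ , h₁ , a≡ , inj₂ (2≤ , ev₁)) (q₂ , _ , h₂ , b≡ , inj₁ (_ , U₂)) (q₃ , _ , h₃ , c≡ , inj₁ (_ , U₃)) (q₄ , _ , h₄ , d≡ , inj₁ (_ , U₄)) =
      single (λ c → case proj₁ (even-paired {q₁ = q₁} {q₂} {q₃} {q₄} h₁ h₂ h₃ h₄ c) ev₁ of λ where
        (inj₁ e) → ¬Ev-unit {q₂} U₂ e
        (inj₂ (inj₁ e)) → ¬Ev-unit {q₃} U₃ e
        (inj₂ (inj₂ e)) → ¬Ev-unit {q₄} U₄ e) (bound 2 0 0 0 a≡ b≡ c≡ d≡ 2≤ z≤n z≤n z≤n)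
    by-halves (q₁ , _ , h₁ , a≡ , inj₁ (_ , U₁)) (q₂ , _ , h₂ , b≡ , inj₂ (2≤ , ev₂)) (q₃ , _ , h₃ , c≡ , inj₁ (_ , U₃)) (q₄ , _ , h₄ , d≡ , inj₁ (_ , U₄)) =
      single (λ c → case proj₁ (proj₂ (even-paired {q₁ = q₁} {q₂} {q₃} {q₄} h₁ h₂ h₃ h₄ c)) ev₂ of λ where
        (inj₁ e) → ¬Ev-unit {q₁} U₁ e
        (inj₂ (inj₁ e)) → ¬Ev-unit {q₃} U₃ e
        (inj₂ (inj₂ e)) → ¬Ev-unit {q₄} U₄ e) (bound 0 2 0 0 a≡ b≡ c≡ d≡ z≤n 2≤ z≤n z≤n)
    by-halves (q₁ , _ , h₁ , a≡ , inj₁ (_ , U₁)) (q₂ , _ , h₂ , b≡ , inj₁ (_ , U₂)) (q₃ , _ , h₃ , c≡ , inj₂ (2≤ , ev₃)) (q₄ , _ , h₄ , d≡ , inj₁ (_ , U₄)) =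
      single (λ c → case proj₁ (proj₂ (proj₂ (even-paired {q₁ = q₁} {q₂} {q₃} {q₄} h₁ h₂ h₃ h₄ c))) ev₃ of λ where
        (inj₁ e) → ¬Ev-unit {q₁} U₁ e
        (inj₂ (inj₁ e)) → ¬Ev-unit {q₂} U₂ e
        (inj₂ (inj₂ e)) → ¬Ev-unit {q₄} U₄ e) (bound 0 0 2 0 a≡ b≡ c≡ d≡ z≤n z≤n 2≤ z≤n)
    by-halves (q₁ , _ , h₁ , a≡ , inj₁ (_ , U₁)) (q₂ , _ , h₂ , b≡ , inj₁ (_ , U₂)) (q₃ , _ , h₃ , c≡ , inj₁ (_ , U₃)) (q₄ , _ , h₄ , d≡ , inj₂ (2≤ , ev₄)) =
      single (λ c → case proj₂ (proj₂ (proj₂ (even-paired {q₁ = q₁} {q₂} {q₃} {q₄} h₁ h₂ h₃ h₄ c))) ev₄ of λ where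
        (inj₁ e) → ¬Ev-unit {q₁} U₁ e
        (inj₂ (inj₁ e)) → ¬Ev-unit {q₂} U₂ e
        (inj₂ (inj₂ e)) → ¬Ev-unit {q₃} U₃ e) (bound 0 0 0 2 a≡ b≡ c≡ d≡ z≤n z≤n z≤n 2≤)
    by-halves (_ , _ , _ , a≡ , inj₂ (p , _)) (_ , _ , _ , b≡ , inj₂ (q , _)) (_ , _ , _ , c≡ , _) (_ , _ , _ , d≡ , _) =
      many (bound 2 2 0 0 a≡ b≡ c≡ d≡ p q z≤n z≤n)
    by-halves (_ , _ , _ , a≡ , inj₂ (p , _)) (_ , _ , _ , b≡ , inj₁ _) (_ , _ , _ , c≡ , inj₂ (q , _)) (_ , _ , _ , d≡ , _) =
      many (bound 2 0 2 0 a≡ b≡ c≡ d≡ p z≤n q z≤n)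
    by-halves (_ , _ , _ , a≡ , inj₂ (p , _)) (_ , _ , _ , b≡ , inj₁ _) (_ , _ , _ , c≡ , inj₁ _) (_ , _ , _ , d≡ , inj₂ (q , _)) =
      many (bound 2 0 0 2 a≡ b≡ c≡ d≡ p z≤n z≤n q)
    by-halves (_ , _ , _ , a≡ , inj₁ _) (_ , _ , _ , b≡ , inj₂ (p , _)) (_ , _ , _ , c≡ , inj₂ (q , _)) (_ , _ , _ , d≡ , _) =
      many (bound 0 2 2 0 a≡ b≡ c≡ d≡ z≤n p q z≤n)
    by-halves (_ , _ , _ , a≡ , inj₁ _) (_ , _ , _ , b≡ , inj₂ (p , _)) (_ , _ , _ , c≡ , inj₁ _) (_ , _ , _ , d≡ , inj₂ (q , _)) =
      many (bound 0 2 0 2 a≡ b≡ c≡ d≡ z≤n p z≤n q)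
    by-halves (_ , _ , _ , a≡ , inj₁ _) (_ , _ , _ , b≡ , inj₁ _) (_ , _ , _ , c≡ , inj₂ (p , _)) (_ , _ , _ , d≡ , inj₂ (q , _)) =
      many (bound 0 0 2 2 a≡ b≡ c≡ d≡ z≤n z≤n p q)

  -- The totals `8 + 10` and `10 + 8` cannot occur: a coincidence is a condition modulo 2 and holds
  -- for both quadruples or for neither. For `8 + 8` the signs agree by the same kind of reason, so
  -- the product is a square.
  even-pair : ∀ {w z} → z 𝔼Q.≈₂ w → ∀ {i j P Q} →
    (let open 𝔼Q.Quadruple w in P ≡ n₁ 𝔼.* n₂ 𝔼.* (n₃ 𝔼.* n₄)) → (let open 𝔼Q.Quadruple z in Q ≡ n₁ 𝔼.* n₂ 𝔼.* (n₃ 𝔼.* n₄)) →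
    EvenQuadruple w i → EvenQuadruple z j → (i ℕ.+ j ≡ 16 × ∃[ r ] P 𝔼.* Q ≡ r 𝔼.* r) ⊎ 20 ℕ.≤ i ℕ.+ j
  even-pair {w} {z} z≈w {i} {j} {P} {Q} P≡ Q≡ = total-of-pairs
    where
    open 𝔼Q._≈₂_ z≈w
    module CW = HalvedQuadruple {w}
    module CZ = HalvedQuadruple {z}

    coincide : CW.Coincide → CZ.Coincide
    coincide (inj₁ c)        = inj₁ (≡𝔼.[]-trans ≈₁ (≡𝔼.[]-trans c (≡𝔼.[]-sym ≈₃)))
    coincide (inj₂ (inj₁ c)) = inj₂ (inj₁ (≡𝔼.[]-trans ≈₂ (≡𝔼.[]-trans c (≡𝔼.[]-sym ≈₃))))
    coincide (inj₂ (inj₂ c)) = inj₂ (inj₂ (≡𝔼.[]-trans ≈₂ (≡𝔼.[]-trans c (≡𝔼.[]-sym ≈₁))))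

    coincide⁻ : CZ.Coincide → CW.Coincide
    coincide⁻ (inj₁ c)        = inj₁ (≡𝔼.[]-trans (≡𝔼.[]-sym ≈₁) (≡𝔼.[]-trans c ≈₃))
    coincide⁻ (inj₂ (inj₁ c)) = inj₂ (inj₁ (≡𝔼.[]-trans (≡𝔼.[]-sym ≈₂) (≡𝔼.[]-trans c ≈₃)))
    coincide⁻ (inj₂ (inj₂ c)) = inj₂ (inj₂ (≡𝔼.[]-trans (≡𝔼.[]-sym ≈₂) (≡𝔼.[]-trans c ≈₁)))

    has-even : CW.HasEven → CZ.HasEven
    has-even (inj₁ e)               = inj₁ (Ev-resp ≈₀ e)
    has-even (inj₂ (inj₁ e))        = inj₂ (inj₁ (Ev-resp ≈₁ e))
    has-even (inj₂ (inj₂ (inj₁ e))) = inj₂ (inj₂ (inj₁ (Ev-resp ≈₂ e)))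
    has-even (inj₂ (inj₂ (inj₂ e))) = inj₂ (inj₂ (inj₂ (Ev-resp ≈₃ e)))

    has-even⁻ : CZ.HasEven → CW.HasEven
    has-even⁻ (inj₁ e)               = inj₁ (Ev-resp (≡𝔼.[]-sym ≈₀) e)
    has-even⁻ (inj₂ (inj₁ e))        = inj₂ (inj₁ (Ev-resp (≡𝔼.[]-sym ≈₁) e))
    has-even⁻ (inj₂ (inj₂ (inj₁ e))) = inj₂ (inj₂ (inj₁ (Ev-resp (≡𝔼.[]-sym ≈₂) e)))
    has-even⁻ (inj₂ (inj₂ (inj₂ e))) = inj₂ (inj₂ (inj₂ (Ev-resp (≡𝔼.[]-sym ≈₃) e)))

    square : ∀ s t → P ≡ s 𝔼.* s → Q ≡ t 𝔼.* t → ∃[ r ] P 𝔼.* Q ≡ r 𝔼.* r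
    square s t p q = s 𝔼.* t , trans (cong₂ 𝔼._*_ p q) (𝔼.solve 2 (λ s t → (s 𝔼.:* s) 𝔼.:* (t 𝔼.:* t) 𝔼.:= (s 𝔼.:* t) 𝔼.:* (s 𝔼.:* t)) refl s t)

    square⁻ : ∀ s t → P ≡ 𝔼.- (s 𝔼.* s) → Q ≡ 𝔼.- (t 𝔼.* t) → ∃[ r ] P 𝔼.* Q ≡ r 𝔼.* r
    square⁻ s t p q = s 𝔼.* t , trans (cong₂ 𝔼._*_ p q) (𝔼.solve 2 (λ s t → 𝔼.:- (s 𝔼.:* s) 𝔼.:* 𝔼.:- (t 𝔼.:* t) 𝔼.:= (s 𝔼.:* t) 𝔼.:* (s 𝔼.:* t)) refl s t)

    total-of-pairs : EvenQuadruple w i → EvenQuadruple z j → (i ℕ.+ j ≡ 16 × ∃[ r ] P 𝔼.* Q ≡ r 𝔼.* r) ⊎ 20 ℕ.≤ i ℕ.+ j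
    total-of-pairs (units i≡ _ (s , inj₁ (p , e))) (units j≡ _ (t , inj₁ (q , _)))   = inj₁ (cong₂ ℕ._+_ i≡ j≡ , square (4# 𝔼.* s) (4# 𝔼.* t) (trans P≡ p) (trans Q≡ q))
    total-of-pairs (units i≡ _ (s , inj₂ (p , _))) (units j≡ _ (t , inj₂ (q , _)))   = inj₁ (cong₂ ℕ._+_ i≡ j≡ , square⁻ (4# 𝔼.* s) (4# 𝔼.* t) (trans P≡ p) (trans Q≡ q))
    total-of-pairs (units _ _ (_ , inj₁ (_ , e)))  (units _ _ (_ , inj₂ (_ , o)))    = contradiction (has-even e) o
    total-of-pairs (units _ _ (_ , inj₂ (_ , o)))  (units _ _ (_ , inj₁ (_ , e)))    = contradiction (has-even⁻ e) o
    total-of-pairs (units _ c _)   (single d _)    = contradiction (coincide c) d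
    total-of-pairs (single d _)    (units _ c _)   = contradiction (coincide⁻ c) d
    total-of-pairs (units i≡ _ _)  (many j≥)       = inj₂ (ℕ.+-mono-≤ (ℕ.≤-reflexive (sym i≡)) j≥)
    total-of-pairs (many i≥)       (units j≡ _ _)  = inj₂ (ℕ.+-mono-≤ i≥ (ℕ.≤-reflexive (sym j≡)))
    total-of-pairs (single _ i≥)   (single _ j≥)   = inj₂ (ℕ.+-mono-≤ i≥ j≥)
    total-of-pairs (single _ i≥)   (many j≥)       = inj₂ (ℕ.+-mono-≤ i≥ (ℕ.≤-trans (ℕ.m≤m+n 10 2) j≥))
    total-of-pairs (many i≥)       (single _ j≥)   = inj₂ (ℕ.+-mono-≤ (ℕ.≤-trans (ℕ.m≤m+n 10 2) i≥) j≥)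
    total-of-pairs (many i≥)       (many j≥)       = inj₂ (ℕ.+-mono-≤ (ℕ.≤-trans (ℕ.m≤m+n 10 2) i≥) (ℕ.≤-trans (ℕ.m≤m+n 10 2) j≥))

open EvenQuadruples

-- Parseval's identity and the signs of the factors

module SignRules where
  open ≡𝔼 using (2#; 4#)
  open Zk using (solve; con; _:+_; _:*_; :-_; _:-_; _:=_)

  ι : ℤ → 𝔼.Carrier
  ι n = n , 0ℤ

  module Parseval where
    open 𝔼 using (_+_; _*_)
    open 𝔼Q.Quadruple

    dot : 𝔼Q.Quadruple → 𝔼Q.Quadruple → 𝔼.Carrier
    dot a w = (u₀ a * u₀ w + u₁ a * u₁ w) + (u₂ a * u₂ w + u₃ a * u₃ w)

    characters : 𝔼Q.Quadruple → 𝔼Q.Quadruple → 𝔼.Carrier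
    characters a w = (n₁ a * n₁ w + n₂ a * n₂ w) + (n₃ a * n₃ w + n₄ a * n₄ w)

    -- Orthogonality of the four characters of C₂²; the `n₁`, ..., `n₄` are the transforms.
    parseval : ∀ a w → characters a w ≡ 4# * dot a w
    parseval a w = 𝔼.solve 8 (λ a b c d e f g h → let open 𝔼 using () renaming (_:+_ to _⊞_; _:*_ to _⊠_; _:-_ to _⊟_; con to k) in
        ((((a ⊞ c) ⊞ (b ⊞ d)) ⊠ ((e ⊞ g) ⊞ (f ⊞ h)) ⊞ ((a ⊞ c) ⊟ (b ⊞ d)) ⊠ ((e ⊞ g) ⊟ (f ⊞ h)))
          ⊞ (((a ⊟ c) ⊞ (b ⊟ d)) ⊠ ((e ⊟ g) ⊞ (f ⊟ h)) ⊞ ((a ⊟ c) ⊟ (b ⊟ d)) ⊠ ((e ⊟ g) ⊟ (f ⊟ h))))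
        𝔼.:= ((k 1ℤ ⊞ k 1ℤ) ⊞ (k 1ℤ ⊞ k 1ℤ)) ⊠ ((a ⊠ e ⊞ b ⊠ f) ⊞ (c ⊠ g ⊞ d ⊠ h))) refl
        (u₀ a) (u₁ a) (u₂ a) (u₃ a) (u₀ w) (u₁ w) (u₂ w) (u₃ w)

    -- The two `dot` products agree modulo 2, so 4 times their sum is divisible by 8.
    eight : ∀ {a b w z} → b 𝔼Q.≈₂ a → z 𝔼Q.≈₂ w → ∃[ t ] characters a w + characters b z ≡ ι 𝟠 * t
    eight {a} {b} {w} {z} b≈a z≈w = finish (≡𝔼.[]-+ (≡𝔼.[]-+ (≡𝔼.[]-* B.≈₀ Z.≈₀) (≡𝔼.[]-* B.≈₁ Z.≈₁)) (≡𝔼.[]-+ (≡𝔼.[]-* B.≈₂ Z.≈₂) (≡𝔼.[]-* B.≈₃ Z.≈₃)))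
      where
      module B = 𝔼Q._≈₂_ b≈a
      module Z = 𝔼Q._≈₂_ z≈w
      finish : dot b z ≡ᴱ dot a w [ 2# ] → ∃[ t ] characters a w + characters b z ≡ ι 𝟠 * t
      finish (t , eq) = dot a w + t , trans (cong₂ _+_ (parseval a w) (trans (parseval b z) (cong (λ s → 4# * s) eq))) (regroup (dot a w) t)
        where
        regroup : ∀ s t → 4# * s + 4# * (s + 2# * t) ≡ ι 𝟠 * (s + t)
        regroup = 𝔼.solve 2 (λ s t → let two = 𝔼.con 1ℤ 𝔼.:+ 𝔼.con 1ℤ ; four = two 𝔼.:+ two in
          four 𝔼.:* s 𝔼.:+ four 𝔼.:* (s 𝔼.:+ two 𝔼.:* t) 𝔼.:= 𝔼.con 𝟠 𝔼.:* (s 𝔼.:+ t)) refl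

  ι-quadruple : ℤQ.Quadruple → 𝔼Q.Quadruple
  ι-quadruple u = 𝔼Q.⟨ ι u₀ , ι u₁ , ι u₂ , ι u₃ ⟩
    where open ℤQ.Quadruple u

  ι-≈ : ∀ {u v} → v ℤQ.≈₂ u → ι-quadruple v 𝔼Q.≈₂ ι-quadruple u
  ι-≈ v≈u = record { ≈₀ = lift ≈₀ ; ≈₁ = lift ≈₁ ; ≈₂ = lift ≈₂ ; ≈₃ = lift ≈₃ }
    where
    open ℤQ._≈₂_ v≈u
    lift : ∀ {m n} → m ≡ᶻ n [ 𝟚 ] → ι m ≡ᴱ ι n [ 2# ]
    lift {n = n} (t , refl) = ι t , cong (λ w → ι n 𝔼.+ w) (sym (2#-* (ι t)))

  -- A sign δ congruent to the unit y modulo √-3 turns every value ±2^e, congruent to ±y,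
  -- into δ(-2)^e.
  module Signs {δ y} (δ²≡1 : δ ℤ.* δ ≡ 1ℤ) (δ∼y : δ ∼ y) where
    value : ∀ {n e} → n ≈2^ e → n ∼ y → n ≡ δ ℤ.* pow e
    value {n} {e} p n∼y = begin
      n                     ≡⟨ ℤ.*-identityˡ n ⟨
      1ℤ ℤ.* n              ≡⟨ cong (λ t → t ℤ.* n) δ²≡1 ⟨
      δ ℤ.* δ ℤ.* n         ≡⟨ ℤ.*-assoc δ δ n ⟩
      δ ℤ.* (δ ℤ.* n)       ≡⟨ cong (λ t → δ ℤ.* t) (∼-square {δ ℤ.* n} {e} y (power abs) (∼-* δ∼y n∼y)) ⟩
      δ ℤ.* pow e           ∎
      where
      open ≡-Reasoning
      abs : ∣ δ ℤ.* n ∣ ≡ 2 ℕ.^ e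
      abs = trans (ℤ.abs-* δ n) (trans (cong (ℕ._* ∣ n ∣) (ℕ.m*n≡1⇒m≡1 ∣ δ ∣ ∣ δ ∣ (trans (sym (ℤ.abs-* δ δ)) (cong ∣_∣ δ²≡1))))
        (trans (ℕ.*-identityˡ ∣ n ∣) (_≈2^_.abs≡ p)))

    -- If `q = -y`, then `n` is congruent to `-y` as well, and the two signs cancel; the
    -- contribution is the same in both cases.
    contribution : ∀ {n e q} → n ≈2^ e → n ∼ q → q ≡ y ⊎ q ≡ 𝔼.- y → ι n 𝔼.* q ≡ (ι δ 𝔼.* y) 𝔼.* ι (pow e)
    contribution {n} {e} p n∼q (inj₁ refl) = trans (cong (λ t → ι t 𝔼.* y) (value p n∼q)) (trans (cong (𝔼._* y) (Hom.*-homo 𝔼.ι δ (pow e)))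
      (𝔼.solve 3 (λ d p y → (d 𝔼.:* p) 𝔼.:* y 𝔼.:= (d 𝔼.:* y) 𝔼.:* p) refl (ι δ) (ι (pow e)) y))
    contribution {n} {e} p n∼q (inj₂ refl) = begin
      ι n 𝔼.* (𝔼.- y)                      ≡⟨ 𝔼.solve 2 (λ n y → n 𝔼.:* 𝔼.:- y 𝔼.:= 𝔼.:- n 𝔼.:* y) refl (ι n) y ⟩
      ι (ℤ.- n) 𝔼.* y                      ≡⟨ cong (λ t → ι t 𝔼.* y) (value {ℤ.- n} {e} (power (trans (ℤ.∣-i∣≡∣i∣ n) (_≈2^_.abs≡ p))) (subst (ℤ.- n ∼_) (neg-neg y) (∼-neg n∼q))) ⟩
      ι (δ ℤ.* pow e) 𝔼.* y                ≡⟨ cong (𝔼._* y) (Hom.*-homo 𝔼.ι δ (pow e)) ⟩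
      (ι δ 𝔼.* ι (pow e)) 𝔼.* y            ≡⟨ 𝔼.solve 3 (λ d p y → (d 𝔼.:* p) 𝔼.:* y 𝔼.:= (d 𝔼.:* y) 𝔼.:* p) refl (ι δ) (ι (pow e)) y ⟩
      (ι δ 𝔼.* y) 𝔼.* ι (pow e)            ∎
      where
      open ≡-Reasoning
      neg-neg : ∀ w → 𝔼.- (𝔼.- w) ≡ w
      neg-neg = 𝔼.solve 1 (λ w → 𝔼.:- (𝔼.:- w) 𝔼.:= w) refl

  sign-of : ∀ {n e y} → n ≈2^ e → n ∼ y → ∃[ δ ] (δ ℤ.* δ ≡ 1ℤ × δ ∼ y)
  sign-of {n} {e} {y} (power p) (congruent r) = by-sign (∣∣-cancel n (pow e) (trans p (sym (∣-2^∣ e))))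
    where
    by-sign : n ≡ pow e ⊎ n ≡ ℤ.- pow e → ∃[ δ ] (δ ℤ.* δ ≡ 1ℤ × δ ∼ y)
    by-sign (inj₁ eq) = 1ℤ , refl , congruent (≡ℤ.[]-trans (≡ℤ.[]-sym (-2^≡1 e)) (≡ℤ.[]-trans (≡ℤ.≡⇒[] (sym eq)) r))
    by-sign (inj₂ eq) = -1ℤ , refl , congruent (≡ℤ.[]-trans (≡ℤ.[]-neg (≡ℤ.[]-sym (-2^≡1 e))) (≡ℤ.[]-trans (≡ℤ.≡⇒[] (sym eq)) r))

  -- Multiply by the conjugate of `v`, which is its inverse.
  divide-unit : ∀ {v n t} → Unit v → v 𝔼.* ι n ≡ ι 𝟠 𝔼.* t → n ≡ᶻ 0ℤ [ 𝟠 ]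
  divide-unit {v} {n} {t} unit eq = proj₁ s , trans (cong proj₁ (begin
      ι n                                  ≡⟨ 𝔼.*-identityˡ (ι n) ⟨
      ι 1ℤ 𝔼.* ι n                         ≡⟨ cong (λ k → ι k 𝔼.* ι n) unit ⟨
      ι (norm v) 𝔼.* ι n                   ≡⟨ cong (λ w → w 𝔼.* ι n) (*-conj v) ⟨
      (v 𝔼.* v̄) 𝔼.* ι n                    ≡⟨ 𝔼.solve 3 (λ v w n → (v 𝔼.:* w) 𝔼.:* n 𝔼.:= (v 𝔼.:* n) 𝔼.:* w) refl v v̄ (ι n) ⟩
      (v 𝔼.* ι n) 𝔼.* v̄                    ≡⟨ cong (λ w → w 𝔼.* v̄) eq ⟩
      (ι 𝟠 𝔼.* t) 𝔼.* v̄                    ≡⟨ 𝔼.*-assoc (ι 𝟠) t v̄ ⟩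
      ι 𝟠 𝔼.* s                            ≡⟨ 𝔼.embed-* 𝟠 (proj₁ s) (proj₂ s) ⟩
      (𝟠 ℤ.* proj₁ s , 𝟠 ℤ.* proj₂ s)      ∎)) (sym (ℤ.+-identityˡ _))
    where
    open ≡-Reasoning
    v̄ = Hom.⟦_⟧ conj v
    s = t 𝔼.* v̄

  Spectrum₂ : ℤ → ℕ → Set
  Spectrum₂ D k = (D ≡ pow k × (k ≡ 0 ⊎ k ≡ 8 ⊎ k ≡ 12 ⊎ 14 ℕ.≤ k)) ⊎ 32 ℕ.≤ k

  -- A total exponent 13 would have weight `8 + 4`, which is not divisible by 8.
  weighted-12 : ∀ {S W} → Weighted S W 12 𝟠 → W ≡ᶻ 0ℤ [ 𝟠 ] → S ≡ 12 ⊎ 14 ℕ.≤ S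
  weighted-12 (weighted zero          refl _)  _ = inj₁ refl
  weighted-12 (weighted (suc (suc t)) refl _)  _ = inj₂ (ℕ.m≤m+n 14 t)
  weighted-12 (weighted (suc zero)    refl W≡) W≡0 = contradiction (≡ℤ.[]-trans (≡ℤ.[]-sym W≡0) (W≡ ℕ.≤-refl)) impossible
    where
    impossible : ¬ (0ℤ ≡ᶻ 𝟠 ℤ.+ 𝟜 ℤ.* ℤ.+ 1 [ 𝟠 ])
    impossible (t , eq) = from-no (8 ℕ.∣? 12) (divides-abs (ℤ.- t) (trans
      (solve 1 (λ t → con (ℤ.+ 12) := (con (ℤ.+ 12) :+ con 𝟠 :* t) :+ con 𝟠 :* :- t) refl t)
      (trans (cong (λ s → s ℤ.+ 𝟠 ℤ.* ℤ.- t) (sym eq)) (ℤ.+-identityˡ _))))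

  -- For odd α + β one has (α + β)(α - β) ≡ 1 + 2β modulo 4.
  odd-norm-mod-4 : ∀ {α β} → Odd (α ℤ.+ β) → (α ℤ.+ β) ℤ.* (α ℤ.- β) ≡ᶻ 1ℤ ℤ.+ 𝟚 ℤ.* β [ 𝟜 ]
  odd-norm-mod-4 {α} {β} (k , eq) = k ℤ.+ k ℤ.* k ℤ.- β ℤ.- β ℤ.* k , (begin
    (α ℤ.+ β) ℤ.* (α ℤ.- β)
      ≡⟨ solve 2 (λ a b → (a :+ b) :* (a :- b) := (a :+ b) :* ((a :+ b) :- con 𝟚 :* b)) refl α β ⟩
    (α ℤ.+ β) ℤ.* ((α ℤ.+ β) ℤ.- 𝟚 ℤ.* β)
      ≡⟨ cong (λ s → s ℤ.* (s ℤ.- 𝟚 ℤ.* β)) eq ⟩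
    (1ℤ ℤ.+ 𝟚 ℤ.* k) ℤ.* ((1ℤ ℤ.+ 𝟚 ℤ.* k) ℤ.- 𝟚 ℤ.* β)
      ≡⟨ solve 2 (λ k b → (con 1ℤ :+ con 𝟚 :* k) :* ((con 1ℤ :+ con 𝟚 :* k) :- con 𝟚 :* b)
           := (con 1ℤ :+ con 𝟚 :* b) :+ con 𝟜 :* (k :+ k :* k :- b :- b :* k)) refl k β ⟩
    1ℤ ℤ.+ 𝟚 ℤ.* β ℤ.+ 𝟜 ℤ.* (k ℤ.+ k ℤ.* k ℤ.- β ℤ.- β ℤ.* k) ∎)
    where open ≡-Reasoning

  -- Modulo 4 a product of factors `1 + 2b` is 1 plus twice the sum of the `b`, and here that sum is
  -- even.
  four-odd-norms : ∀ {α β α′ β′ γ δ γ′ δ′} → Odd (α ℤ.+ β) → Odd (α′ ℤ.+ β′) → Odd (γ ℤ.+ δ) → Odd (γ′ ℤ.+ δ′) →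
    Even ((β ℤ.+ β′) ℤ.+ (δ ℤ.+ δ′)) →
    ((α ℤ.+ β) ℤ.* (α ℤ.- β) ℤ.* ((α′ ℤ.+ β′) ℤ.* (α′ ℤ.- β′))) ℤ.* ((γ ℤ.+ δ) ℤ.* (γ ℤ.- δ) ℤ.* ((γ′ ℤ.+ δ′) ℤ.* (γ′ ℤ.- δ′))) ≡ᶻ 1ℤ [ 𝟜 ]
  four-odd-norms {α} {β} {α′} {β′} {γ} {δ} {γ′} {δ′} o₁ o₂ o₃ o₄ (m , eq) =
    ≡ℤ.[]-trans (≡ℤ.[]-* (≡ℤ.[]-* (odd-norm-mod-4 {α} {β} o₁) (odd-norm-mod-4 {α′} {β′} o₂)) (≡ℤ.[]-* (odd-norm-mod-4 {γ} {δ} o₃) (odd-norm-mod-4 {γ′} {δ′} o₄)))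
      (m ℤ.+ r , trans (expand β β′ δ δ′) (trans (cong (λ s → 1ℤ ℤ.+ 𝟚 ℤ.* s ℤ.+ 𝟜 ℤ.* r) eq)
        (solve 2 (λ m r → con 1ℤ :+ con 𝟚 :* (con 𝟚 :* m) :+ con 𝟜 :* r := con 1ℤ :+ con 𝟜 :* (m :+ r)) refl m r)))
    where
    quotient : ℤ → ℤ → ℤ → ℤ → ℤ
    quotient a b c d = a ℤ.* b ℤ.+ c ℤ.* d ℤ.+ (a ℤ.+ b ℤ.+ 𝟚 ℤ.* (a ℤ.* b)) ℤ.* (c ℤ.+ d ℤ.+ 𝟚 ℤ.* (c ℤ.* d))
    r = quotient β β′ δ δ′
    expand : ∀ a b c d → ((1ℤ ℤ.+ 𝟚 ℤ.* a) ℤ.* (1ℤ ℤ.+ 𝟚 ℤ.* b)) ℤ.* ((1ℤ ℤ.+ 𝟚 ℤ.* c) ℤ.* (1ℤ ℤ.+ 𝟚 ℤ.* d))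
             ≡ 1ℤ ℤ.+ 𝟚 ℤ.* ((a ℤ.+ b) ℤ.+ (c ℤ.+ d)) ℤ.+ 𝟜 ℤ.* quotient a b c d
    expand = solve 4 (λ a b c d → ((con 1ℤ :+ con 𝟚 :* a) :* (con 1ℤ :+ con 𝟚 :* b)) :* ((con 1ℤ :+ con 𝟚 :* c) :* (con 1ℤ :+ con 𝟚 :* d))
      := con 1ℤ :+ con 𝟚 :* ((a :+ b) :+ (c :+ d)) :+ con 𝟜 :* (a :* b :+ c :* d :+ (a :+ b :+ con 𝟚 :* (a :* b)) :* (c :+ d :+ con 𝟚 :* (c :* d)))) refl

open SignRules

-- The spectrum of C₂ × C₂ × C₆

module RankThreeSpectrum where
  open Zk using (solve; con; _:+_; _:*_; :-_; _:-_; _:=_)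

  record _∼Q_ (u : ℤQ.Quadruple) (w : 𝔼Q.Quadruple) : Set where
    private
      module U = ℤQ.Quadruple u
      module W = 𝔼Q.Quadruple w
    field
      ∼₀ : U.u₀ ∼ W.u₀
      ∼₁ : U.u₁ ∼ W.u₁
      ∼₂ : U.u₂ ∼ W.u₂
      ∼₃ : U.u₃ ∼ W.u₃

    n₁∼ : U.n₁ ∼ W.n₁
    n₁∼ = ∼-+ (∼-+ ∼₀ ∼₂) (∼-+ ∼₁ ∼₃)
    n₂∼ : U.n₂ ∼ W.n₂
    n₂∼ = ∼-+ (∼-+ ∼₀ ∼₂) (∼-neg (∼-+ ∼₁ ∼₃))
    n₃∼ : U.n₃ ∼ W.n₃
    n₃∼ = ∼-+ (∼-+ ∼₀ (∼-neg ∼₂)) (∼-+ ∼₁ (∼-neg ∼₃))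
    n₄∼ : U.n₄ ∼ W.n₄
    n₄∼ = ∼-+ (∼-+ ∼₀ (∼-neg ∼₂)) (∼-neg (∼-+ ∼₁ (∼-neg ∼₃)))

    product∼ : U.n₁ ℤ.* U.n₂ ℤ.* (U.n₃ ℤ.* U.n₄) ∼ W.n₁ 𝔼.* W.n₂ 𝔼.* (W.n₃ 𝔼.* W.n₄)
    product∼ = ∼-* (∼-* n₁∼ n₂∼) (∼-* n₃∼ n₄∼)

  record Powers₄ (u : ℤQ.Quadruple) : Set where
    open ℤQ.Quadruple u
    field
      {a b c d} : ℕ
      pa : n₁ ≈2^ a
      pb : n₂ ≈2^ b
      pc : n₃ ≈2^ c
      pd : n₄ ≈2^ d
    S : ℕ
    S = (a ℕ.+ b) ℕ.+ (c ℕ.+ d)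
    W : ℤ
    W = (pow a ℤ.+ pow b) ℤ.+ (pow c ℤ.+ pow d)

  powers₄ : ∀ {k} u → let open ℤQ.Quadruple u in n₁ ℤ.* n₂ ℤ.* (n₃ ℤ.* n₄) ≈2^ k → ∃[ p ] Powers₄.S {u} p ≡ k
  powers₄ u p = case split₄′ n₁ n₂ n₃ n₄ p of λ where
      (_ , _ , _ , _ , pa , pb , pc , pd , eq) → record { pa = pa ; pb = pb ; pc = pc ; pd = pd } , eq
    where open ℤQ.Quadruple u

  module Contributions {u : ℤQ.Quadruple} {w : 𝔼Q.Quadruple} (u∼w : u ∼Q w) {δ y} (δ²≡1 : δ ℤ.* δ ≡ 1ℤ) (δ∼y : δ ∼ y)
      (p : Powers₄ u) where
    open Signs {δ} {y} δ²≡1 δ∼y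
    open Powers₄ p
    open _∼Q_ u∼w
    private module W′ = 𝔼Q.Quadruple w

    characters-sum : W′.n₁ ≡ y ⊎ W′.n₁ ≡ 𝔼.- y → W′.n₂ ≡ y ⊎ W′.n₂ ≡ 𝔼.- y → W′.n₃ ≡ y ⊎ W′.n₃ ≡ 𝔼.- y → W′.n₄ ≡ y ⊎ W′.n₄ ≡ 𝔼.- y →
      Parseval.characters (ι-quadruple u) w ≡ (ι δ 𝔼.* y) 𝔼.* ι W
    characters-sum s₁ s₂ s₃ s₄ = trans
      (cong₂ 𝔼._+_ (cong₂ 𝔼._+_ (contribution pa n₁∼ s₁) (contribution pb n₂∼ s₂)) (cong₂ 𝔼._+_ (contribution pc n₃∼ s₃) (contribution pd n₄∼ s₄)))
      (collect (ι δ 𝔼.* y) (ι (pow a)) (ι (pow b)) (ι (pow c)) (ι (pow d)))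
      where
      collect : ∀ v p q r s → (v 𝔼.* p 𝔼.+ v 𝔼.* q) 𝔼.+ (v 𝔼.* r 𝔼.+ v 𝔼.* s) ≡ v 𝔼.* ((p 𝔼.+ q) 𝔼.+ (r 𝔼.+ s))
      collect = 𝔼.solve 5 (λ v p q r s → (v 𝔼.:* p 𝔼.:+ v 𝔼.:* q) 𝔼.:+ (v 𝔼.:* r 𝔼.:+ v 𝔼.:* s) 𝔼.:= v 𝔼.:* ((p 𝔼.:+ q) 𝔼.:+ (r 𝔼.:+ s))) refl

  module RationalCube {u v : ℤQ.Quadruple} (v≈u : v ℤQ.≈₂ u) (p : Powers₄ u) (q : Powers₄ v) where
    private
      module U = ℤQ.Quadruple u
      module V = ℤQ.Quadruple v
      module P = Powers₄ p
      module Q = Powers₄ q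
      D = (U.n₁ ℤ.* U.n₂ ℤ.* (U.n₃ ℤ.* U.n₄)) ℤ.* (V.n₁ ℤ.* V.n₂ ℤ.* (V.n₃ ℤ.* V.n₄))

    data Class : Set where
      minimal : P.S ℕ.+ Q.S ≡ 8 → (D ≈2^ (P.S ℕ.+ Q.S) → D ≡ pow 8) → Class
      middle  : Weighted (P.S ℕ.+ Q.S) (P.W ℤ.+ Q.W) 12 𝟠 → Class
      large   : 16 ℕ.≤ P.S ℕ.+ Q.S → Class

    -- If `A⁻` is odd, each of the four pairs has exactly one factor divisible by 4: base exponent
    -- `3 + 3 + 3 + 3` and weight `2 + 2 + 2 + 2`, the same numbers as for two odd half-sums. If
    -- `A⁻` is even, `total` counts the odd half-sums.
    classify : Even U.n₁ → Class
    classify ev = by-parity (parity U.A⁻)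
      where
      ev′ : Even V.n₁
      ev′ = Even-resp (ℤQ.n₁-≈ v≈u) ev

      by-parity : Even U.A⁻ ⊎ Odd U.A⁻ → Class
      by-parity (inj₂ odd-A) = middle (Weighted-+
          (Weighted-+ (mixed-pair {U.A⁺} {U.B⁺} (Odd-resp (A⁺≡A⁻ {u}) odd-A) ev P.pa P.pb) (mixed-pair {U.A⁻} {U.B⁻} odd-A (Even-resp U.n₃≡n₁ ev) P.pc P.pd))
          (Weighted-+ (mixed-pair {V.A⁺} {V.B⁺} (Odd-resp (A⁺≡A⁻ {v}) odd-A′) ev′ Q.pa Q.pb) (mixed-pair {V.A⁻} {V.B⁻} odd-A′ (Even-resp V.n₃≡n₁ ev′) Q.pc Q.pd)))
        where
        odd-A′ = Odd-resp (ℤQ.A⁻-≈ v≈u) odd-A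
      by-parity (inj₁ even-A) = conclude
          (total (half-sums-even v≈u H₁ H₂)
            (pair-view {α = H.α} {H.β} H.n₁≡ H.n₂≡ P.pa P.pb) (pair-view {α = H.α′} {H.β′} n₃≡ n₄≡ P.pc P.pd)
            (pair-view {α = H′.α} {H′.β} H′.n₁≡ H′.n₂≡ Q.pa Q.pb) (pair-view {α = H′.α′} {H′.β′} n₃≡′ n₄≡′ Q.pc Q.pd))
        where
        even-summand : ∀ {m n} → Even m → Even (m ℤ.+ n) → Even n
        even-summand {m} {n} (k , eq) (l , eq′) = l ℤ.- k , trans (solve 2 (λ m n → n := (m :+ n) :- m) refl m n)
          (trans (cong₂ ℤ._-_ eq′ eq) (solve 2 (λ k l → con 𝟚 :* l :- con 𝟚 :* k := con 𝟚 :* (l :- k)) refl k l))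
        even-A′ = Even-resp (ℤQ.A⁻-≈ v≈u) even-A
        H₁ = halves {u} even-A (even-summand even-A (Even-resp U.n₃≡n₁ ev))
        H₂ = halves {v} even-A′ (even-summand even-A′ (Even-resp V.n₃≡n₁ ev′))
        module H = Halves H₁
        module H′ = Halves H₂
        plus : ∀ {a b x y} → a ≡ 𝟚 ℤ.* x → b ≡ 𝟚 ℤ.* y → a ℤ.+ b ≡ 𝟚 ℤ.* (x ℤ.+ y)
        plus {x = x} {y} refl refl = sym (ℤ.*-distribˡ-+ 𝟚 x y)
        minus : ∀ {a b x y} → a ≡ 𝟚 ℤ.* x → b ≡ 𝟚 ℤ.* y → a ℤ.- b ≡ 𝟚 ℤ.* (x ℤ.- y)
        minus {x = x} {y} refl refl = solve 2 (λ x y → con 𝟚 :* x :- con 𝟚 :* y := con 𝟚 :* (x :- y)) refl x y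
        n₃≡ : U.n₃ ≡ 𝟚 ℤ.* (H.α′ ℤ.+ H.β′)
        n₃≡ = plus H.A⁻≡ H.B⁻≡
        n₄≡ : U.n₄ ≡ 𝟚 ℤ.* (H.α′ ℤ.- H.β′)
        n₄≡ = minus H.A⁻≡ H.B⁻≡
        n₃≡′ : V.n₃ ≡ 𝟚 ℤ.* (H′.α′ ℤ.+ H′.β′)
        n₃≡′ = plus H′.A⁻≡ H′.B⁻≡
        n₄≡′ : V.n₄ ≡ 𝟚 ℤ.* (H′.α′ ℤ.- H′.β′)
        n₄≡′ = minus H′.A⁻≡ H′.B⁻≡

        βs-even : Even ((H.β ℤ.+ H.β′) ℤ.+ (H′.β ℤ.+ H′.β′))
        βs-even = agree (ℤQ._≈₂_.≈₁ v≈u)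
          where
          agree : V.u₁ ≡ᶻ U.u₁ [ 𝟚 ] → Even ((H.β ℤ.+ H.β′) ℤ.+ (H′.β ℤ.+ H′.β′))
          agree (t , eq) = U.u₁ ℤ.+ t , trans (cong₂ ℤ._+_ (sym H.u₁≡) (trans (sym H′.u₁≡) eq))
            (solve 2 (λ x t → x :+ (x :+ con 𝟚 :* t) := con 𝟚 :* (x :+ t)) refl U.u₁ t)

        quotient : ℤ
        quotient = ((H.α ℤ.+ H.β) ℤ.* (H.α ℤ.- H.β) ℤ.* ((H.α′ ℤ.+ H.β′) ℤ.* (H.α′ ℤ.- H.β′)))
               ℤ.* ((H′.α ℤ.+ H′.β) ℤ.* (H′.α ℤ.- H′.β) ℤ.* ((H′.α′ ℤ.+ H′.β′) ℤ.* (H′.α′ ℤ.- H′.β′)))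

        D≡ : D ≡ ℤ.+ 256 ℤ.* quotient
        D≡ = trans (cong₂ ℤ._*_ (cong₂ ℤ._*_ (cong₂ ℤ._*_ H.n₁≡ H.n₂≡) (cong₂ ℤ._*_ n₃≡ n₄≡)) (cong₂ ℤ._*_ (cong₂ ℤ._*_ H′.n₁≡ H′.n₂≡) (cong₂ ℤ._*_ n₃≡′ n₄≡′)))
          (extract (H.α ℤ.+ H.β) (H.α ℤ.- H.β) (H.α′ ℤ.+ H.β′) (H.α′ ℤ.- H.β′) (H′.α ℤ.+ H′.β) (H′.α ℤ.- H′.β) (H′.α′ ℤ.+ H′.β′) (H′.α′ ℤ.- H′.β′))
          where
          extract₄ : ∀ a b c d → (𝟚 ℤ.* a) ℤ.* (𝟚 ℤ.* b) ℤ.* ((𝟚 ℤ.* c) ℤ.* (𝟚 ℤ.* d)) ≡ ℤ.+ 16 ℤ.* (a ℤ.* b ℤ.* (c ℤ.* d))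
          extract₄ = solve 4 (λ a b c d → (con 𝟚 :* a) :* (con 𝟚 :* b) :* ((con 𝟚 :* c) :* (con 𝟚 :* d)) := con (ℤ.+ 16) :* (a :* b :* (c :* d))) refl
          extract : ∀ a b c d e f g h → ((𝟚 ℤ.* a) ℤ.* (𝟚 ℤ.* b) ℤ.* ((𝟚 ℤ.* c) ℤ.* (𝟚 ℤ.* d))) ℤ.* ((𝟚 ℤ.* e) ℤ.* (𝟚 ℤ.* f) ℤ.* ((𝟚 ℤ.* g) ℤ.* (𝟚 ℤ.* h)))
                    ≡ ℤ.+ 256 ℤ.* ((a ℤ.* b ℤ.* (c ℤ.* d)) ℤ.* (e ℤ.* f ℤ.* (g ℤ.* h)))
          extract a b c d e f g h = trans (cong₂ ℤ._*_ (extract₄ a b c d) (extract₄ e f g h))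
            (solve 2 (λ x y → (con (ℤ.+ 16) :* x) :* (con (ℤ.+ 16) :* y) := con (ℤ.+ 256) :* (x :* y)) refl (a ℤ.* b ℤ.* (c ℤ.* d)) (e ℤ.* f ℤ.* (g ℤ.* h)))

        -- `D` is 256 times a number that is 1 or -1 and is 1 modulo 4. Thus exponent 8 brings a
        -- positive sign by itself, which is needed when the Eisenstein part is even and not known
        -- to be a square.
        sign : Odd (H.α ℤ.+ H.β) → Odd (H.α′ ℤ.+ H.β′) → Odd (H′.α ℤ.+ H′.β) → Odd (H′.α′ ℤ.+ H′.β′) → P.S ℕ.+ Q.S ≡ 8 →
               D ≈2^ (P.S ℕ.+ Q.S) → D ≡ pow 8
        sign o₁ o₂ o₃ o₄ S≡8 pD = trans D≡ (cong (λ t → ℤ.+ 256 ℤ.* t) (unit-mod-4 quotient-unit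
            (four-odd-norms {H.α} {H.β} {H.α′} {H.β′} {H′.α} {H′.β} {H′.α′} {H′.β′} o₁ o₂ o₃ o₄ βs-even)))
          where
          quotient-unit : quotient ≈2^ 0
          quotient-unit = power (ℕ.*-cancelˡ-≡ ∣ quotient ∣ 1 256 (trans (sym (ℤ.abs-* (ℤ.+ 256) quotient))
            (trans (cong ∣_∣ (sym D≡)) (trans (_≈2^_.abs≡ pD) (cong (2 ℕ.^_) S≡8)))))

        conclude : Total (H.α ℤ.+ H.β) (H.α′ ℤ.+ H.β′) (H′.α ℤ.+ H′.β) (H′.α′ ℤ.+ H′.β′) (P.S ℕ.+ Q.S) (P.W ℤ.+ Q.W) → Class
        conclude (minimal o₁ o₂ o₃ o₄ eq) = minimal eq (sign o₁ o₂ o₃ o₄ eq)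
        conclude (middle w)               = middle w
        conclude (large 16≤)              = large 16≤

  module C2³Core {u v : ℤQ.Quadruple} {w z : 𝔼Q.Quadruple} (v≈u : v ℤQ.≈₂ u) (z≈w : z 𝔼Q.≈₂ w) (u∼w : u ∼Q w) (v∼z : v ∼Q z) where
    private
      module U = ℤQ.Quadruple u
      module V = ℤQ.Quadruple v
      module W = 𝔼Q.Quadruple w
      module Z = 𝔼Q.Quadruple z
      P₁ = U.n₁ ℤ.* U.n₂ ℤ.* (U.n₃ ℤ.* U.n₄)
      P₂ = V.n₁ ℤ.* V.n₂ ℤ.* (V.n₃ ℤ.* V.n₄)
      Q₁ = W.n₁ 𝔼.* W.n₂ 𝔼.* (W.n₃ 𝔼.* W.n₄)
      Q₂ = Z.n₁ 𝔼.* Z.n₂ 𝔼.* (Z.n₃ 𝔼.* Z.n₄)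

    P∼Q : P₁ ℤ.* P₂ ∼ Q₁ 𝔼.* Q₂
    P∼Q = ∼-* (_∼Q_.product∼ u∼w) (_∼Q_.product∼ v∼z)

    eisenstein-even : ∀ {j} → norm (Q₁ 𝔼.* Q₂) ≈2^ j → Ev W.n₁ → (j ≡ 16 × ∃[ r ] Q₁ 𝔼.* Q₂ ≡ r 𝔼.* r) ⊎ 20 ℕ.≤ j
    eisenstein-even p ev = case norm-split Q₁ Q₂ p of λ where
      (_ , _ , p₁ , p₂ , refl) → even-pair {w} {z} z≈w {P = Q₁} {Q₂} refl refl (even-quadruple w p₁ ev) (even-quadruple z p₂ (Ev-resp (𝔼Q.n₁-≈ z≈w) ev))

    AllUnits : 𝔼Q.Quadruple → Set
    AllUnits q = Unit n₁ × Unit n₂ × Unit n₃ × Unit n₄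
      where open 𝔼Q.Quadruple q

    odd-quadruple : ∀ {j} (q : 𝔼Q.Quadruple) → let open 𝔼Q.Quadruple q in norm (n₁ 𝔼.* n₂ 𝔼.* (n₃ 𝔼.* n₄)) ≈2^ j → ¬ Ev n₁ →
                    j ≡ 0 × AllUnits q
    odd-quadruple q p odd′ = case norm-split₄′ n₁ n₂ n₃ n₄ p of λ where
        (_ , _ , _ , _ , q₁ , q₂ , q₃ , q₄ , refl) → let
          z₁ , unit₁ = odd-unit {n₁} q₁ odd′
          z₂ , unit₂ = odd-unit {n₂} q₂ (λ e → odd′ (Ev-n₂ {q} e))
          z₃ , unit₃ = odd-unit {n₃} q₃ (λ e → odd′ (Ev-n₃ {q} e))
          z₄ , unit₄ = odd-unit {n₄} q₄ (λ e → odd′ (Ev-n₄ {q} e))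
          in cong₂ ℕ._+_ (cong₂ ℕ._+_ z₁ z₂) (cong₂ ℕ._+_ z₃ z₄) , unit₁ , unit₂ , unit₃ , unit₄
      where open 𝔼Q.Quadruple q

    eisenstein-odd : ∀ {j} → norm (Q₁ 𝔼.* Q₂) ≈2^ j → ¬ Ev W.n₁ → j ≡ 0 × AllUnits w × AllUnits z
    eisenstein-odd p odd′ = case norm-split Q₁ Q₂ p of λ where
      (_ , _ , q₁ , q₂ , refl) → case odd-quadruple w q₁ odd′ of λ where
        (z₁ , us) → case odd-quadruple z q₂ (λ e → odd′ (Ev-resp (≡𝔼.[]-sym (𝔼Q.n₁-≈ z≈w)) e)) of λ where
          (z₂ , us′) → cong₂ ℕ._+_ z₁ z₂ , us , us′

    product-unit : ∀ q → AllUnits q → let open 𝔼Q.Quadruple q in Unit (n₁ 𝔼.* n₂ 𝔼.* (n₃ 𝔼.* n₄))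
    product-unit q (t₁ , t₂ , t₃ , t₄) = Unit-* {n₁ 𝔼.* n₂} {n₃ 𝔼.* n₄} (Unit-* {n₁} {n₂} t₁ t₂) (Unit-* {n₃} {n₄} t₃ t₄)
      where open 𝔼Q.Quadruple q

    square : AllUnits w → AllUnits z → Q₁ 𝔼.* Q₂ ≡ Q₁ 𝔼.* Q₁
    square us us′ = unit-product {Q₁} {Q₂} (product-unit w us) (product-unit z us′) (≡𝔼.[]-* (𝔼Q.n₁n₂-≈ z≈w) (𝔼Q.n₃n₄-≈ z≈w))

    rational-odd : ∀ {i} → P₁ ℤ.* P₂ ≈2^ i → Odd U.n₁ → i ≡ 0 × P₁ ℤ.* P₂ ≡ 1ℤ
    rational-odd p o = odd-product {P₁} {P₂} p
      (Odd-* (Odd-* o (Odd-resp U.n₂≡n₁ o)) (Odd-* (Odd-resp U.n₃≡n₁ o) (Odd-resp U.n₄≡n₁ o)))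
      (≡ℤ.[]-* (ℤQ.n₁n₂-≈ v≈u) (ℤQ.n₃n₄-≈ v≈u))

    -- By `Parseval.eight` the sum of the products of rational and Eisenstein values over all eight
    -- characters is divisible by 8. The Eisenstein values are units that agree modulo 2, hence all
    -- `y` or `-y`; each summand is then `δ y` times a power of -2, and the unit `δ y` is divided
    -- out.
    W≡0 : AllUnits w → AllUnits z → (p : Powers₄ u) (q : Powers₄ v) → Powers₄.W p ℤ.+ Powers₄.W q ≡ᶻ 0ℤ [ 𝟠 ]
    W≡0 (w₁ , w₂ , w₃ , w₄) (z₁ , z₂ , z₃ , z₄) p q = case sign-of {U.n₁} (Powers₄.pa p) (_∼Q_.n₁∼ u∼w) of λ where
        (δ , δ² , δ∼y) → case Parseval.eight (ι-≈ v≈u) z≈w of λ where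
          (t , eq) → divide-unit {ι δ 𝔼.* y} {Powers₄.W p ℤ.+ Powers₄.W q} {t} (trans (norm-* (ι δ) y) (cong₂ ℤ._*_ (trans (norm-ι δ) δ²) w₁)) (trans
            (trans (𝔼.distribˡ (ι δ 𝔼.* y) (ι (Powers₄.W p)) (ι (Powers₄.W q)))
              (sym (cong₂ 𝔼._+_
                (Contributions.characters-sum u∼w δ² δ∼y p (inj₁ refl) (units-mod-2 w₂ w₁ W.n₂≡n₁) (units-mod-2 w₃ w₁ W.n₃≡n₁) (units-mod-2 w₄ w₁ W.n₄≡n₁))
                (Contributions.characters-sum v∼z δ² δ∼y q (units-mod-2 z₁ w₁ z≡w) (units-mod-2 z₂ w₁ (≡𝔼.[]-trans Z.n₂≡n₁ z≡w))
                  (units-mod-2 z₃ w₁ (≡𝔼.[]-trans Z.n₃≡n₁ z≡w)) (units-mod-2 z₄ w₁ (≡𝔼.[]-trans Z.n₄≡n₁ z≡w)))))) eq)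
      where
      y = W.n₁
      z≡w = 𝔼Q.n₁-≈ z≈w
      norm-ι : ∀ δ → norm (ι δ) ≡ δ ℤ.* δ
      norm-ι = solve 1 (λ d → d :* d :- d :* con 0ℤ :+ con 0ℤ :* con 0ℤ := d :* d) refl

    -- For use when the Eisenstein factors are not units: the weights then exclude no exponent, but
    -- exponent 8 still comes with its sign.
    rational-even : ∀ {i} → P₁ ℤ.* P₂ ≈2^ i → Even U.n₁ → (i ≡ 8 × P₁ ℤ.* P₂ ≡ pow 8) ⊎ 12 ℕ.≤ i
    rational-even pow-D ev = case ≈2^-* P₁ P₂ pow-D of λ where
        (_ , _ , p₁ , p₂ , refl) → case powers₄ u p₁ of λ where
          (p , refl) → case powers₄ v p₂ of λ where
            (q , refl) → conclude p q pow-D (RationalCube.classify v≈u p q ev)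
      where
      conclude : ∀ p q → P₁ ℤ.* P₂ ≈2^ (Powers₄.S p ℕ.+ Powers₄.S q) → RationalCube.Class v≈u p q →
                 (Powers₄.S p ℕ.+ Powers₄.S q ≡ 8 × P₁ ℤ.* P₂ ≡ pow 8) ⊎ 12 ℕ.≤ Powers₄.S p ℕ.+ Powers₄.S q
      conclude p q pD (RationalCube.minimal eq D≡) = inj₁ (eq , D≡ pD)
      conclude p q pD (RationalCube.middle x)      = inj₂ (Weighted-≥ x)
      conclude p q pD (RationalCube.large x)       = inj₂ (ℕ.≤-trans (ℕ.m≤m+n 12 4) x)

    rational-even-odd : ∀ {i} → P₁ ℤ.* P₂ ≈2^ i → Even U.n₁ → AllUnits w → AllUnits z → i ≡ 8 ⊎ i ≡ 12 ⊎ 14 ℕ.≤ i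
    rational-even-odd pow-D ev us us′ = case ≈2^-* P₁ P₂ pow-D of λ where
        (_ , _ , p₁ , p₂ , refl) → case powers₄ u p₁ of λ where
          (p , refl) → case powers₄ v p₂ of λ where
            (q , refl) → conclude p q (RationalCube.classify v≈u p q ev)
      where
      conclude : ∀ p q → RationalCube.Class v≈u p q → let S = Powers₄.S p ℕ.+ Powers₄.S q in S ≡ 8 ⊎ S ≡ 12 ⊎ 14 ℕ.≤ S
      conclude p q (RationalCube.minimal eq _) = inj₁ eq
      conclude p q (RationalCube.middle x)     = inj₂ (weighted-12 x (W≡0 us us′ p q))
      conclude p q (RationalCube.large x)      = inj₂ (inj₂ (ℕ.≤-trans (ℕ.m≤m+n 14 2) x))

    spectrum : ∀ k → ℤQ.C2³-product u v ℤ.* norm (𝔼Q.C2³-product w z) ≈2^ k → Spectrum₂ (ℤQ.C2³-product u v ℤ.* norm (𝔼Q.C2³-product w z)) k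
    spectrum k p = case ≈2^-* (P₁ ℤ.* P₂) (norm (Q₁ 𝔼.* Q₂)) p of λ where
        (i , j , pi , pj , refl) → by-evenness i j pi pj (Ev? W.n₁) (parity U.n₁)
      where
      Result : ℕ → ℕ → Set
      Result i j = Spectrum₂ ((P₁ ℤ.* P₂) ℤ.* norm (Q₁ 𝔼.* Q₂)) (i ℕ.+ j)

      signed-result : ∀ i j → P₁ ℤ.* P₂ ≡ pow i → norm (Q₁ 𝔼.* Q₂) ≈2^ j → (i ℕ.+ j ≡ 0 ⊎ i ℕ.+ j ≡ 8 ⊎ i ℕ.+ j ≡ 12 ⊎ 14 ℕ.≤ i ℕ.+ j) → Result i j
      signed-result i j P≡ pj exps = inj₁ (signed-product {w = Q₁ 𝔼.* Q₂} {i} P≡ pj refl , exps)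

      -- A rational exponent 8 fixes its own sign; an Eisenstein exponent 16 fixes the sign by being
      -- a square. If neither happens, the total is at least `12 + 20`.
      both-even : ∀ i j → norm (Q₁ 𝔼.* Q₂) ≈2^ j → P₁ ℤ.* P₂ ≈2^ i → (j ≡ 16 × ∃[ r ] Q₁ 𝔼.* Q₂ ≡ r 𝔼.* r) ⊎ 20 ℕ.≤ j →
                  (i ≡ 8 × P₁ ℤ.* P₂ ≡ pow 8) ⊎ 12 ℕ.≤ i → Result i j
      both-even i j pj pi alternatives (inj₁ (refl , P≡)) = signed-result 8 j P≡ pj (inj₂ (inj₂ (inj₂ (ℕ.≤-trans (ℕ.m≤m+n 14 10) (ℕ.+-monoʳ-≤ 8 (16≤ alternatives))))))
        where
        16≤ : (j ≡ 16 × ∃[ r ] Q₁ 𝔼.* Q₂ ≡ r 𝔼.* r) ⊎ 20 ℕ.≤ j → 16 ℕ.≤ j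
        16≤ (inj₁ (refl , _)) = ℕ.≤-refl
        16≤ (inj₂ 20≤)        = ℕ.≤-trans (ℕ.m≤m+n 16 4) 20≤
      both-even i j pj pi (inj₁ (refl , r , eq)) (inj₂ 12≤) = signed-result i 16
        (∼-square {P₁ ℤ.* P₂} {i} r pi (subst (P₁ ℤ.* P₂ ∼_) eq P∼Q)) pj (inj₂ (inj₂ (inj₂ (ℕ.≤-trans (ℕ.m≤m+n 14 14) (ℕ.+-monoˡ-≤ 16 12≤)))))
      both-even i j pj pi (inj₂ 20≤) (inj₂ 12≤) = inj₂ (ℕ.+-mono-≤ 12≤ 20≤)

      by-evenness : ∀ i j → P₁ ℤ.* P₂ ≈2^ i → norm (Q₁ 𝔼.* Q₂) ≈2^ j → Ev W.n₁ ⊎ ¬ Ev W.n₁ → Even U.n₁ ⊎ Odd U.n₁ → Result i j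
      by-evenness i j pi pj (inj₁ ev) (inj₁ ev′) = both-even i j pj pi (eisenstein-even pj ev) (rational-even pi ev′)
      by-evenness i j pi pj (inj₁ ev) (inj₂ o) = case rational-odd pi o of λ where
        (refl , P≡1) → case eisenstein-even pj ev of λ where
          (inj₁ (refl , _)) → signed-result 0 16 P≡1 pj (inj₂ (inj₂ (inj₂ (ℕ.m≤m+n 14 2))))
          (inj₂ 20≤)        → signed-result 0 j P≡1 pj (inj₂ (inj₂ (inj₂ (ℕ.≤-trans (ℕ.m≤m+n 14 6) 20≤))))
      by-evenness i j pi pj (inj₂ odd′) par = case eisenstein-odd pj odd′ of λ where
        (refl , us , us′) → signed-result i 0 (∼-square {P₁ ℤ.* P₂} {i} Q₁ pi (subst (P₁ ℤ.* P₂ ∼_) (square us us′) P∼Q)) pj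
          (case par of λ where
            (inj₂ o)  → inj₁ (cong (ℕ._+ 0) (proj₁ (rational-odd pi o)))
            (inj₁ ev) → case rational-even-odd pi ev us us′ of λ where
              (inj₁ i≡8)         → inj₂ (inj₁ (cong (ℕ._+ 0) i≡8))
              (inj₂ (inj₁ i≡12)) → inj₂ (inj₂ (inj₁ (cong (ℕ._+ 0) i≡12)))
              (inj₂ (inj₂ 14≤))  → inj₂ (inj₂ (inj₂ (ℕ.≤-trans 14≤ (ℕ.m≤m+n i 0)))))

  C2³-spectrum : ∀ x k → determinant x Forms.C2³ ≈2^ k → Spectrum₂ (determinant x Forms.C2³) k
  C2³-spectrum x k p = subst (λ D → Spectrum₂ D k) (sym value)
      (C2³Core.spectrum (ℤQ.upper≈lower f) (𝔼Q.upper≈lower g)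
        (record { ∼₀ = ∼-eval x (Forms.d (# 0)) ; ∼₁ = ∼-eval x (Forms.d (# 1)) ; ∼₂ = ∼-eval x (Forms.d (# 2)) ; ∼₃ = ∼-eval x (Forms.d (# 3)) })
        (record { ∼₀ = ∼-eval x (Forms.e (# 0)) ; ∼₁ = ∼-eval x (Forms.e (# 1)) ; ∼₂ = ∼-eval x (Forms.e (# 2)) ; ∼₃ = ∼-eval x (Forms.e (# 3)) })
        k (subst (_≈2^ k) value p))
    where
    f = rational x
    g = eisenstein x
    value = cong₂ (λ s t → s ℤ.* norm t) (ℤQ.C2³-value f) (𝔼Q.C2³-value g)

open RankThreeSpectrum

-- Tables that realise the determinants

module Witnesses where
  open Defs using (S)
  open Zk using (solve; con; _:+_; _:*_; :-_; _:-_; _:=_)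

  Table : Set
  Table = Vec (Vec ℤ 3) 8

  𝟎 𝟏 : Vec ℤ 3
  𝟎 = 0ℤ ∷ 0ℤ ∷ 0ℤ ∷ []
  𝟏 = 1ℤ ∷ 1ℤ ∷ 1ℤ ∷ []

  table : Table → Coefficients
  table t j l = lookup (lookup t j) l

  -- Adding m to every coefficient changes only the value at the trivial character, by 24m;
  -- if that value is 8, it becomes 8(1 + 3m), which is 8(-2)^t for a suitable m.
  shifted : Table → ℤ → Coefficients
  shifted t m j l = table t j l ℤ.+ m

  family : ∀ form t K N → (∀ m → eval ℤ-ring form (rational (shifted t m)) ≡ K ℤ.* (1ℤ ℤ.+ 𝟛 ℤ.* m)) →
           norm (eval 𝔼 form (eisenstein (table t))) ≡ N → ∀ e → ∃[ x ] determinant x form ≡ (K ℤ.* N) ℤ.* pow e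
  family form t K N rational-part eisenstein-part e = shifted t m , (begin
    determinant (shifted t m) form
      ≡⟨ cong₂ ℤ._*_ (rational-part m) (cong norm (eval-cong 𝔼 form (λ j →
           cong₂ _,_ (cancel (table t j (# 0)) (table t j (# 2))) (cancel (table t j (# 1)) (table t j (# 2)))))) ⟩
    K ℤ.* (1ℤ ℤ.+ 𝟛 ℤ.* m) ℤ.* norm (eval 𝔼 form (eisenstein (table t)))
      ≡⟨ cong₂ (λ p n → K ℤ.* p ℤ.* n) (sym m≡) eisenstein-part ⟩
    K ℤ.* pow e ℤ.* N
      ≡⟨ solve 3 (λ k p n → k :* p :* n := (k :* n) :* p) refl K (pow e) N ⟩
    (K ℤ.* N) ℤ.* pow e ∎)
    where
    open ≡-Reasoning
    m = Congruent.quotient (-2^≡1 e)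
    m≡ = Congruent.equation (-2^≡1 e)
    cancel : ∀ a b → (a ℤ.+ m) ℤ.- (b ℤ.+ m) ≡ a ℤ.- b
    cancel a b = solve 3 (λ a b m → (a :+ m) :- (b :+ m) := a :- b) refl a b m

  private
    module Solver = Zk

    -- Repeats a form inside the ring solver with the shift `m` as its only unknown, so that one
    -- normalisation proves a whole family.
    reify : ∀ {n} → Poly n → (Fin n → Solver.Polynomial 1) → Solver.Polynomial 1
    reify (var i) ρ = ρ i
    reify (p ⊕ q) ρ = reify p ρ :+ reify q ρ
    reify (p ⊗ q) ρ = reify p ρ :* reify q ρ
    reify (⊝ p)   ρ = :- reify p ρ

    shifted-rational : Table → Solver.Polynomial 1 → Fin 8 → Solver.Polynomial 1
    shifted-rational t m j = entry (# 0) :+ entry (# 1) :+ entry (# 2)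
      where
      entry : Fin 3 → Solver.Polynomial 1
      entry l = con (table t j l) :+ m

  pow-split : ∀ b {k} → b ℕ.≤ k → pow b ℤ.* pow (k ℕ.∸ b) ≡ pow k
  pow-split b b≤k = trans (sym (ℤ.^-distribˡ-+-* (ℤ.- 𝟚) b _)) (cong pow (ℕ.m+[n∸m]≡n b≤k))

  ∣2^∣ : ∀ k → ∣ 𝟚 ℤ.^ k ∣ ≡ 2 ℕ.^ k
  ∣2^∣ zero    = refl
  ∣2^∣ (suc k) = trans (ℤ.abs-* 𝟚 (𝟚 ℤ.^ k)) (cong (2 ℕ.*_) (∣2^∣ k))

  ±2^-abs : ∀ {m} k → m ≡ 𝟚 ℤ.^ k ⊎ m ≡ ℤ.- (𝟚 ℤ.^ k) → ∣ m ∣ ≡ 2 ℕ.^ k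
  ±2^-abs k (inj₁ refl) = ∣2^∣ k
  ±2^-abs k (inj₂ refl) = trans (ℤ.∣-i∣≡∣i∣ (𝟚 ℤ.^ k)) (∣2^∣ k)

  abs-±2^ : ∀ m k → ∣ m ∣ ≡ 2 ℕ.^ k → m ≡ 𝟚 ℤ.^ k ⊎ m ≡ ℤ.- (𝟚 ℤ.^ k)
  abs-±2^ m k eq = ∣∣-cancel m (𝟚 ℤ.^ k) (trans eq (sym (∣2^∣ k)))

  abs-±pow : ∀ m k → ∣ m ∣ ≡ 2 ℕ.^ k → m ≡ pow k ⊎ m ≡ ℤ.- pow k
  abs-±pow m k eq = ∣∣-cancel m (pow k) (trans eq (sym (∣-2^∣ k)))

  powerOfTwo : ∀ {m} k → ∣ m ∣ ≡ 2 ℕ.^ k → PowerOfTwo m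
  powerOfTwo {m} k eq = (λ { refl → contradiction (trans eq refl) (λ e → ℕ.<⇒≢ (ℕ.m^n>0 2 k) e) }) , k , eq

  ≤-cases : ∀ {a k} → a ℕ.≤ k → k ≡ a ⊎ suc a ℕ.≤ k
  ≤-cases a≤k = case ℕ.m≤n⇒m<n∨m≡n a≤k of λ where
    (inj₁ a<k)  → inj₂ a<k
    (inj₂ refl) → inj₁ refl

  module C24 where
    open GroupDeterminants (C 24) sylow-C24

    realise : ∀ {m} → ∃[ x ] determinant x Forms.C8 ≡ m → S (C 24) m
    realise (x , eq) = subst (S (C 24)) eq (synthesise x)

    one : S (C 24) 1ℤ
    one = realise (table ((1ℤ ∷ 0ℤ ∷ 0ℤ ∷ []) ∷ 𝟎 ∷ 𝟎 ∷ 𝟎 ∷ 𝟎 ∷ 𝟎 ∷ 𝟎 ∷ 𝟎 ∷ []) , refl)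

    minus-one : S (C 24) -1ℤ
    -- A generator of C₈ permutes the 24 elements in three 8-cycles, an odd permutation.
    minus-one = realise (table (𝟎 ∷ (1ℤ ∷ 0ℤ ∷ 0ℤ ∷ []) ∷ 𝟎 ∷ 𝟎 ∷ 𝟎 ∷ 𝟎 ∷ 𝟎 ∷ 𝟎 ∷ []) , refl)

    -- With `t` a generator of C₃, the element `-(t + t²)` is -2 where `t` goes to 1, and 1 where
    -- `t` goes to ω: the determinant is `(-2)^8`. A generator of C₈ as an extra factor changes the
    -- sign.
    eight : S (C 24) (pow 8)
    eight = realise (table ((0ℤ ∷ -1ℤ ∷ -1ℤ ∷ []) ∷ 𝟎 ∷ 𝟎 ∷ 𝟎 ∷ 𝟎 ∷ 𝟎 ∷ 𝟎 ∷ 𝟎 ∷ []) , refl)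

    minus-eight : S (C 24) (ℤ.- pow 8)
    minus-eight = realise (table (𝟎 ∷ (0ℤ ∷ -1ℤ ∷ -1ℤ ∷ []) ∷ 𝟎 ∷ 𝟎 ∷ 𝟎 ∷ 𝟎 ∷ 𝟎 ∷ 𝟎 ∷ []) , refl)

    positive : ∀ {k} → 9 ℕ.≤ k → S (C 24) (pow k)
    positive {k} 9≤k = subst (S (C 24)) (pow-split 9 9≤k) (realise (family Forms.C8 t (ℤ.-[1+ 511 ]) (ℤ.+ 1)
        (solve 1 (λ m → reify Forms.C8 (shifted-rational t m) := con (ℤ.-[1+ 511 ]) :* (con 1ℤ :+ con 𝟛 :* m)) refl) refl (k ℕ.∸ 9)))
      where
      t : Table
      t = ((-1ℤ ∷ 0ℤ ∷ 0ℤ ∷ []) ∷ 𝟎 ∷ 𝟎 ∷ 𝟏 ∷ 𝟏 ∷ 𝟏 ∷ 𝟎 ∷ 𝟎 ∷ [])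

    negative : ∀ {k} → 9 ℕ.≤ k → S (C 24) (ℤ.- pow k)
    negative {k} 9≤k = subst (S (C 24)) (trans (sym (ℤ.neg-distribˡ-* (pow 9) (pow (k ℕ.∸ 9)))) (cong ℤ.-_ (pow-split 9 9≤k)))
        (realise (family Forms.C8 t (ℤ.+ 512) (ℤ.+ 1)
          (solve 1 (λ m → reify Forms.C8 (shifted-rational t m) := con (ℤ.+ 512) :* (con 1ℤ :+ con 𝟛 :* m)) refl) refl (k ℕ.∸ 9)))
      where
      t : Table
      t = (𝟎 ∷ (-1ℤ ∷ 0ℤ ∷ 0ℤ ∷ []) ∷ 𝟎 ∷ 𝟎 ∷ 𝟏 ∷ 𝟏 ∷ 𝟏 ∷ 𝟎 ∷ [])

    realised : ∀ {m} k → 8 ℕ.≤ k → m ≡ pow k ⊎ m ≡ ℤ.- pow k → S (C 24) m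
    realised k 8≤k sign = case ≤-cases 8≤k of λ where
        (inj₁ refl) → by-sign eight minus-eight sign
        (inj₂ 9≤k)  → by-sign (positive 9≤k) (negative 9≤k) sign
      where
      by-sign : ∀ {m n} → S (C 24) n → S (C 24) (ℤ.- n) → m ≡ n ⊎ m ≡ ℤ.- n → S (C 24) m
      by-sign p q (inj₁ refl) = p
      by-sign p q (inj₂ refl) = q

  module C2×C12 where
    open GroupDeterminants (C 2 ×ᴳ C 12) sylow-C2×C12

    realise : ∀ {m} → ∃[ x ] determinant x Forms.C2×C4 ≡ m → S (C 2 ×ᴳ C 12) m
    realise (x , eq) = subst (S (C 2 ×ᴳ C 12)) eq (synthesise x)

    one : S (C 2 ×ᴳ C 12) 1ℤ
    one = realise (table ((1ℤ ∷ 0ℤ ∷ 0ℤ ∷ []) ∷ 𝟎 ∷ 𝟎 ∷ 𝟎 ∷ 𝟎 ∷ 𝟎 ∷ 𝟎 ∷ 𝟎 ∷ []) , refl)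

    2⁸ : S (C 2 ×ᴳ C 12) (𝟚 ℤ.^ 8)
    2⁸ = realise (table ((0ℤ ∷ -1ℤ ∷ -1ℤ ∷ []) ∷ 𝟎 ∷ 𝟎 ∷ 𝟎 ∷ 𝟎 ∷ 𝟎 ∷ 𝟎 ∷ 𝟎 ∷ []) , refl)

    -- For `1 - y² (1 + t + t²)`, with `y` of order 4 and `t` of order 3, the rational values are
    -- `1 - 3` for four characters and `1 + 3` for the other four; all Eisenstein values are 1.
    2¹² : S (C 2 ×ᴳ C 12) (𝟚 ℤ.^ 12)
    2¹² = realise (table ((1ℤ ∷ 0ℤ ∷ 0ℤ ∷ []) ∷ 𝟎 ∷ (-1ℤ ∷ -1ℤ ∷ -1ℤ ∷ []) ∷ 𝟎 ∷ 𝟎 ∷ 𝟎 ∷ 𝟎 ∷ 𝟎 ∷ []) , refl)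

    -- The trivial character takes the value 4 here, and `4 + 24m = 4 (1 + 6m)` is up to sign a
    -- power of two only for `m = 0`, so shifting this table gives no further exponents.
    -2²⁰ : S (C 2 ×ᴳ C 12) (ℤ.- pow 20)
    -2²⁰ = realise (table ((0ℤ ∷ 0ℤ ∷ -1ℤ ∷ []) ∷ (0ℤ ∷ 1ℤ ∷ 0ℤ ∷ []) ∷ 𝟎 ∷ 𝟎 ∷ (0ℤ ∷ 0ℤ ∷ 1ℤ ∷ []) ∷ (1ℤ ∷ 0ℤ ∷ 0ℤ ∷ []) ∷ (1ℤ ∷ 0ℤ ∷ 0ℤ ∷ []) ∷ (0ℤ ∷ 1ℤ ∷ 0ℤ ∷ []) ∷ []) , refl)

    positive : ∀ {k} → 13 ℕ.≤ k → S (C 2 ×ᴳ C 12) (pow k)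
    positive {k} 13≤k = subst (S (C 2 ×ᴳ C 12)) (pow-split 13 13≤k) (realise (family Forms.C2×C4 t (ℤ.-[1+ 8191 ]) (ℤ.+ 1)
        (solve 1 (λ m → reify Forms.C2×C4 (shifted-rational t m) := con (ℤ.-[1+ 8191 ]) :* (con 1ℤ :+ con 𝟛 :* m)) refl) refl (k ℕ.∸ 13)))
      where
      t : Table
      t = ((1ℤ ∷ 0ℤ ∷ 0ℤ ∷ []) ∷ (1ℤ ∷ 0ℤ ∷ 1ℤ ∷ []) ∷ (0ℤ ∷ 0ℤ ∷ 1ℤ ∷ []) ∷ (0ℤ ∷ 1ℤ ∷ 0ℤ ∷ []) ∷ 𝟎 ∷ 𝟎 ∷ 𝟎 ∷ 𝟏 ∷ [])

    -- These signs require both parts to be even. The shifted table has rational part `2^9` before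
    -- shifting and Eisenstein norm `2^12`, so its family starts at 21.
    negative : ∀ {k} → 20 ℕ.≤ k → S (C 2 ×ᴳ C 12) (ℤ.- pow k)
    negative {k} 20≤k = case ≤-cases 20≤k of λ where
        (inj₁ refl) → -2²⁰
        (inj₂ 21≤k) → subst (S (C 2 ×ᴳ C 12)) (trans (sym (ℤ.neg-distribˡ-* (pow 21) (pow (k ℕ.∸ 21)))) (cong ℤ.-_ (pow-split 21 21≤k)))
          (realise (family Forms.C2×C4 t (ℤ.+ 512) (ℤ.+ 4096)
            (solve 1 (λ m → reify Forms.C2×C4 (shifted-rational t m) := con (ℤ.+ 512) :* (con 1ℤ :+ con 𝟛 :* m)) refl) refl (k ℕ.∸ 21)))
      where
      t : Table
      t = (𝟎 ∷ (0ℤ ∷ 0ℤ ∷ 1ℤ ∷ []) ∷ (0ℤ ∷ 1ℤ ∷ 0ℤ ∷ []) ∷ 𝟎 ∷ (1ℤ ∷ 0ℤ ∷ 1ℤ ∷ []) ∷ (0ℤ ∷ 0ℤ ∷ 1ℤ ∷ []) ∷ (0ℤ ∷ 1ℤ ∷ 1ℤ ∷ []) ∷ (1ℤ ∷ 0ℤ ∷ 0ℤ ∷ []) ∷ [])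

  module C2×C2×C6 where
    open GroupDeterminants (C 2 ×ᴳ C 2 ×ᴳ C 6) sylow-C2×C2×C6

    realise : ∀ {m} → ∃[ x ] determinant x Forms.C2³ ≡ m → S (C 2 ×ᴳ C 2 ×ᴳ C 6) m
    realise (x , eq) = subst (S (C 2 ×ᴳ C 2 ×ᴳ C 6)) eq (synthesise x)

    one : S (C 2 ×ᴳ C 2 ×ᴳ C 6) 1ℤ
    one = realise (table ((1ℤ ∷ 0ℤ ∷ 0ℤ ∷ []) ∷ 𝟎 ∷ 𝟎 ∷ 𝟎 ∷ 𝟎 ∷ 𝟎 ∷ 𝟎 ∷ 𝟎 ∷ []) , refl)

    2⁸ : S (C 2 ×ᴳ C 2 ×ᴳ C 6) (𝟚 ℤ.^ 8)
    2⁸ = realise (table ((0ℤ ∷ -1ℤ ∷ -1ℤ ∷ []) ∷ 𝟎 ∷ 𝟎 ∷ 𝟎 ∷ 𝟎 ∷ 𝟎 ∷ 𝟎 ∷ 𝟎 ∷ []) , refl)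

    2¹² : S (C 2 ×ᴳ C 2 ×ᴳ C 6) (𝟚 ℤ.^ 12)
    2¹² = realise (table ((1ℤ ∷ 0ℤ ∷ 0ℤ ∷ []) ∷ (-1ℤ ∷ -1ℤ ∷ -1ℤ ∷ []) ∷ 𝟎 ∷ 𝟎 ∷ 𝟎 ∷ 𝟎 ∷ 𝟎 ∷ 𝟎 ∷ []) , refl)

    -- Again a single value: the trivial character gives -4, from which no shift by `24m` reaches
    -- another power of two.
    -2³² : S (C 2 ×ᴳ C 2 ×ᴳ C 6) (ℤ.- pow 32)
    -2³² = realise (table ((0ℤ ∷ -1ℤ ∷ 0ℤ ∷ []) ∷ (0ℤ ∷ -1ℤ ∷ 0ℤ ∷ []) ∷ (0ℤ ∷ 0ℤ ∷ 1ℤ ∷ []) ∷ (-1ℤ ∷ -1ℤ ∷ 0ℤ ∷ []) ∷ (0ℤ ∷ -1ℤ ∷ 0ℤ ∷ []) ∷ (0ℤ ∷ 0ℤ ∷ -1ℤ ∷ []) ∷ (1ℤ ∷ 0ℤ ∷ 0ℤ ∷ []) ∷ 𝟎 ∷ []) , refl)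

    positive : ∀ {k} → 14 ℕ.≤ k → S (C 2 ×ᴳ C 2 ×ᴳ C 6) (pow k)
    positive {k} 14≤k = subst (S (C 2 ×ᴳ C 2 ×ᴳ C 6)) (pow-split 14 14≤k) (realise (family Forms.C2³ t (ℤ.+ 16384) (ℤ.+ 1)
        (solve 1 (λ m → reify Forms.C2³ (shifted-rational t m) := con (ℤ.+ 16384) :* (con 1ℤ :+ con 𝟛 :* m)) refl) refl (k ℕ.∸ 14)))
      where
      t : Table
      t = ((0ℤ ∷ 1ℤ ∷ 1ℤ ∷ []) ∷ 𝟎 ∷ 𝟎 ∷ 𝟎 ∷ 𝟎 ∷ 𝟎 ∷ 𝟏 ∷ 𝟏 ∷ [])

    -- Rational part `2^13` and Eisenstein norm `2^20`, just above the exponents `12 + 20` where the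
    -- sign becomes free; this family starts at 33.
    negative : ∀ {k} → 32 ℕ.≤ k → S (C 2 ×ᴳ C 2 ×ᴳ C 6) (ℤ.- pow k)
    negative {k} 32≤k = case ≤-cases 32≤k of λ where
        (inj₁ refl) → -2³²
        (inj₂ 33≤k) → subst (S (C 2 ×ᴳ C 2 ×ᴳ C 6)) (trans (sym (ℤ.neg-distribˡ-* (pow 33) (pow (k ℕ.∸ 33)))) (cong ℤ.-_ (pow-split 33 33≤k)))
          (realise (family Forms.C2³ t (ℤ.+ 8192) (ℤ.+ 1048576)
            (solve 1 (λ m → reify Forms.C2³ (shifted-rational t m) := con (ℤ.+ 8192) :* (con 1ℤ :+ con 𝟛 :* m)) refl) refl (k ℕ.∸ 33)))
      where
      t : Table
      t = ((0ℤ ∷ -1ℤ ∷ 0ℤ ∷ []) ∷ (1ℤ ∷ 0ℤ ∷ 1ℤ ∷ []) ∷ (1ℤ ∷ 0ℤ ∷ 1ℤ ∷ []) ∷ (0ℤ ∷ 1ℤ ∷ 1ℤ ∷ []) ∷ (0ℤ ∷ 1ℤ ∷ 0ℤ ∷ []) ∷ (0ℤ ∷ 0ℤ ∷ 1ℤ ∷ []) ∷ (0ℤ ∷ 1ℤ ∷ 0ℤ ∷ []) ∷ 𝟎 ∷ [])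

open Witnesses

-- The three determinant sets

open import Defs
open import Data.Integer using (ℤ; +_; -_; 1ℤ; -1ℤ; _^_)
open import Data.Nat using (_≤_)
open import Data.Product using (_×_; ∃-syntax)
open import Data.Sum using (_⊎_)
open import Relation.Binary.PropositionalEquality using (_≡_)
open import Relation.Unary using (_∩_; _∪_; _≐_; ｛_｝)

corollary6p1 : (S (C 24) ∩ PowerOfTwo ≐
    ｛ -1ℤ ｝ ∪ ｛ 1ℤ ｝
    ∪ (λ m → ∃[ j ] 8 ≤ j × (m ≡ (+ 2) ^ j ⊎ m ≡ - ((+ 2) ^ j))))
    ×
    (S (C 2 ×ᴳ C 12) ∩ PowerOfTwo ≐
    ｛ 1ℤ ｝ ∪ ｛ (+ 2) ^ 8 ｝ ∪ ｛ (+ 2) ^ 12 ｝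
    ∪ (λ m → ∃[ j ] 13 ≤ j × j ≤ 19 × m ≡ (- (+ 2)) ^ j)
    ∪ (λ m → ∃[ j ] 20 ≤ j × (m ≡ (+ 2) ^ j ⊎ m ≡ - ((+ 2) ^ j))))
    ×
    (S (C 2 ×ᴳ C 2 ×ᴳ C 6) ∩ PowerOfTwo ≐
    ｛ 1ℤ ｝ ∪ ｛ (+ 2) ^ 8 ｝ ∪ ｛ (+ 2) ^ 12 ｝
    ∪ (λ m → ∃[ j ] 14 ≤ j × j ≤ 31 × m ≡ (- (+ 2)) ^ j)
    ∪ (λ m → ∃[ j ] 32 ≤ j × (m ≡ (+ 2) ^ j ⊎ m ≡ - ((+ 2) ^ j))))
corollary6p1 =
    ((λ (s , _ , k , eq) → cyclic-⊆ k eq (GroupDeterminants.analyse (C 24) sylow-C24 s)) , cyclic-⊇)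
  , ((λ (s , _ , k , eq) → C2×C12-⊆ k eq (GroupDeterminants.analyse (C 2 ×ᴳ C 12) sylow-C2×C12 s)) , C2×C12-⊇)
  , ((λ (s , _ , k , eq) → C2×C2×C6-⊆ k eq (GroupDeterminants.analyse (C 2 ×ᴳ C 2 ×ᴳ C 6) sylow-C2×C2×C6 s)) , C2×C2×C6-⊇)
  where
  Large : ℕ.ℕ → ℤ → Set
  Large b m = ∃[ j ] b ≤ j × (m ≡ (+ 2) ^ j ⊎ m ≡ - ((+ 2) ^ j))

  as-large : ∀ {b m} k → ℤ.∣ m ∣ ≡ 2 ℕ.^ k → b ≤ k → Large b m
  as-large {m = m} k eq b≤k = k , b≤k , abs-±2^ m k eq

  cyclic-⊆ : ∀ {m} k → ℤ.∣ m ∣ ≡ 2 ℕ.^ k → ∃[ x ] determinant x Forms.C8 ≡ m → (｛ -1ℤ ｝ ∪ ｛ 1ℤ ｝ ∪ Large 8) m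
  cyclic-⊆ {m} k eq (x , d≡m) = by-exponent (C8-exponent x k (power (trans (cong ℤ.∣_∣ d≡m) eq)))
    where
    by-exponent : k ≡ 0 ⊎ 8 ≤ k → (｛ -1ℤ ｝ ∪ ｛ 1ℤ ｝ ∪ Large 8) m
    by-exponent (inj₁ refl) = by-sign (≡±1 (power eq))
      where
      by-sign : m ≡ 1ℤ ⊎ m ≡ -1ℤ → (｛ -1ℤ ｝ ∪ ｛ 1ℤ ｝ ∪ Large 8) m
      by-sign (inj₁ e) = inj₂ (inj₁ (sym e))
      by-sign (inj₂ e) = inj₁ (sym e)
    by-exponent (inj₂ 8≤k) = inj₂ (inj₂ (as-large k eq 8≤k))

  cyclic-⊇ : ∀ {m} → (｛ -1ℤ ｝ ∪ ｛ 1ℤ ｝ ∪ Large 8) m → (S (C 24) ∩ PowerOfTwo) m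
  cyclic-⊇ (inj₁ refl)        = C24.minus-one , powerOfTwo 0 refl
  cyclic-⊇ (inj₂ (inj₁ refl)) = C24.one , powerOfTwo 0 refl
  cyclic-⊇ {m} (inj₂ (inj₂ (j , 8≤j , sign))) =
    C24.realised j 8≤j (abs-±pow m j (±2^-abs j sign)) , powerOfTwo j (±2^-abs j sign)

  Moderate : ℕ.ℕ → ℕ.ℕ → ℤ → Set
  Moderate a b m = ∃[ j ] a ≤ j × j ≤ b × m ≡ (- (+ 2)) ^ j

  -- Above `b` both signs are allowed, so the known sign may be forgotten there.
  moderate-or-large : ∀ {m} a b k → ℤ.∣ m ∣ ≡ 2 ℕ.^ k → m ≡ pow k → a ≤ k → Moderate a b m ⊎ Large (ℕ.suc b) m
  moderate-or-large a b k eq m≡ a≤k = case ℕ.≤-<-connex k b of λ where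
    (inj₁ k≤b) → inj₁ (k , a≤k , k≤b , m≡)
    (inj₂ b<k) → inj₂ (as-large k eq b<k)

  C2×C12-⊆ : ∀ {m} k → ℤ.∣ m ∣ ≡ 2 ℕ.^ k → ∃[ x ] determinant x Forms.C2×C4 ≡ m →
             (｛ 1ℤ ｝ ∪ ｛ (+ 2) ^ 8 ｝ ∪ ｛ (+ 2) ^ 12 ｝ ∪ Moderate 13 19 ∪ Large 20) m
  C2×C12-⊆ {m} k eq (x , d≡m) = by-spectrum (subst (λ D → Spectrum₁ D k) d≡m (C2×C4-spectrum x k (power (trans (cong ℤ.∣_∣ d≡m) eq))))
    where
    by-spectrum : Spectrum₁ m k → (｛ 1ℤ ｝ ∪ ｛ (+ 2) ^ 8 ｝ ∪ ｛ (+ 2) ^ 12 ｝ ∪ Moderate 13 19 ∪ Large 20) m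
    by-spectrum (inj₂ 20≤k)                     = inj₂ (inj₂ (inj₂ (inj₂ (as-large k eq 20≤k))))
    by-spectrum (inj₁ (m≡ , inj₁ refl))         = inj₁ (sym m≡)
    by-spectrum (inj₁ (m≡ , inj₂ (inj₁ refl)))  = inj₂ (inj₁ (sym m≡))
    by-spectrum (inj₁ (m≡ , inj₂ (inj₂ 12≤k)))  = case ≤-cases 12≤k of λ where
      (inj₁ refl) → inj₂ (inj₂ (inj₁ (sym m≡)))
      (inj₂ 13≤k) → inj₂ (inj₂ (inj₂ (moderate-or-large 13 19 k eq m≡ 13≤k)))

  -- `2^j` and `(-2)^j` agree up to sign, so together with their negatives they are the same two
  -- numbers.
  realised : ∀ {G m} j → S G (pow j) → S G (- pow j) → m ≡ (+ 2) ^ j ⊎ m ≡ - ((+ 2) ^ j) → (S G ∩ PowerOfTwo) m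
  realised {G} {m} j p q sign = by-sign (abs-±pow m j (±2^-abs j sign)) , powerOfTwo j (±2^-abs j sign)
    where
    by-sign : m ≡ pow j ⊎ m ≡ - pow j → S G m
    by-sign (inj₁ refl) = p
    by-sign (inj₂ refl) = q

  C2×C12-⊇ : ∀ {m} → (｛ 1ℤ ｝ ∪ ｛ (+ 2) ^ 8 ｝ ∪ ｛ (+ 2) ^ 12 ｝ ∪ Moderate 13 19 ∪ Large 20) m → (S (C 2 ×ᴳ C 12) ∩ PowerOfTwo) m
  C2×C12-⊇ (inj₁ refl)                                         = C2×C12.one , powerOfTwo 0 refl
  C2×C12-⊇ (inj₂ (inj₁ refl))                                  = C2×C12.2⁸ , powerOfTwo 8 refl
  C2×C12-⊇ (inj₂ (inj₂ (inj₁ refl)))                           = C2×C12.2¹² , powerOfTwo 12 refl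
  C2×C12-⊇ (inj₂ (inj₂ (inj₂ (inj₁ (j , 13≤j , _ , refl)))))   = C2×C12.positive 13≤j , powerOfTwo j (∣-2^∣ j)
  C2×C12-⊇ (inj₂ (inj₂ (inj₂ (inj₂ (j , 20≤j , sign)))))       =
    realised {C 2 ×ᴳ C 12} j (C2×C12.positive (ℕ.≤-trans (ℕ.m≤m+n 13 7) 20≤j)) (C2×C12.negative 20≤j) sign

  C2×C2×C6-⊆ : ∀ {m} k → ℤ.∣ m ∣ ≡ 2 ℕ.^ k → ∃[ x ] determinant x Forms.C2³ ≡ m →
             (｛ 1ℤ ｝ ∪ ｛ (+ 2) ^ 8 ｝ ∪ ｛ (+ 2) ^ 12 ｝ ∪ Moderate 14 31 ∪ Large 32) m
  C2×C2×C6-⊆ {m} k eq (x , d≡m) = by-spectrum (subst (λ D → Spectrum₂ D k) d≡m (C2³-spectrum x k (power (trans (cong ℤ.∣_∣ d≡m) eq))))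
    where
    by-spectrum : Spectrum₂ m k → (｛ 1ℤ ｝ ∪ ｛ (+ 2) ^ 8 ｝ ∪ ｛ (+ 2) ^ 12 ｝ ∪ Moderate 14 31 ∪ Large 32) m
    by-spectrum (inj₂ 32≤k)                            = inj₂ (inj₂ (inj₂ (inj₂ (as-large k eq 32≤k))))
    by-spectrum (inj₁ (m≡ , inj₁ refl))                = inj₁ (sym m≡)
    by-spectrum (inj₁ (m≡ , inj₂ (inj₁ refl)))         = inj₂ (inj₁ (sym m≡))
    by-spectrum (inj₁ (m≡ , inj₂ (inj₂ (inj₁ refl))))  = inj₂ (inj₂ (inj₁ (sym m≡)))
    by-spectrum (inj₁ (m≡ , inj₂ (inj₂ (inj₂ 14≤k))))  = inj₂ (inj₂ (inj₂ (moderate-or-large 14 31 k eq m≡ 14≤k)))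

  C2×C2×C6-⊇ : ∀ {m} → (｛ 1ℤ ｝ ∪ ｛ (+ 2) ^ 8 ｝ ∪ ｛ (+ 2) ^ 12 ｝ ∪ Moderate 14 31 ∪ Large 32) m → (S (C 2 ×ᴳ C 2 ×ᴳ C 6) ∩ PowerOfTwo) m
  C2×C2×C6-⊇ (inj₁ refl)                                         = C2×C2×C6.one , powerOfTwo 0 refl
  C2×C2×C6-⊇ (inj₂ (inj₁ refl))                                  = C2×C2×C6.2⁸ , powerOfTwo 8 refl
  C2×C2×C6-⊇ (inj₂ (inj₂ (inj₁ refl)))                           = C2×C2×C6.2¹² , powerOfTwo 12 refl
  C2×C2×C6-⊇ (inj₂ (inj₂ (inj₂ (inj₁ (j , 14≤j , _ , refl)))))   = C2×C2×C6.positive 14≤j , powerOfTwo j (∣-2^∣ j)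
  C2×C2×C6-⊇ (inj₂ (inj₂ (inj₂ (inj₂ (j , 32≤j , sign)))))       =
    realised {C 2 ×ᴳ C 2 ×ᴳ C 6} j (C2×C2×C6.positive (ℕ.≤-trans (ℕ.m≤m+n 14 18) 32≤j)) (C2×C2×C6.negative 32≤j) sign
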